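{- There is an absolute constant $c>0$ such that for every $\epsilon_0 \in (0,1)$, every finite field $\mathbb{F}_q$, every integer $m \ge 1$ and every degree $d$ satisfying $\epsilon_0 > c\,(d/q)^{1/48}$, the following holds for every $\epsilon \ge \epsilon_0$. If a points table $f\colon \mathbb{F}_q^m \to \mathbb{F}_q$ and a degree-$d$ lines oracle $\ell \mapsto P_\ell$ satisfy \[ \Pr_{x,\ \ell \ni x}[f(x) = P_\ell(x)] \geq 5\epsilon, \] then there exists an $m$-variate polynomial $Q$ of total degree at most $d$ such that $\Pr_{x \in \mathbb{F}_q^m}[f(x) = Q(x)] \geq \epsilon^2$.
   Context: A line in $\mathbb{F}_q^m$ is $\{b+tu: t\in\mathbb{F}_q\}$ with $u\neq0$. A degree-$d$ lines oracle assigns to every line $\ell$ a function $P_\ell$ on $\ell$ that is a univariate polynomial of degree at most $d$ in a parametrization of $\ell$. In the probability, $x$ is a uniform point of $\mathbb{F}_q^m$ and $\ell$ a uniform line through $x$. -}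

module Defs where

open import Data.Nat as ℕ using (ℕ; zero; suc)
open import Data.Integer using (+_)
open import Data.Rational as ℚ using (ℚ; 0ℚ; 1ℚ)
open import Data.Vec as V using (Vec; []; _∷_)
import Data.Vec.Properties as VP
open import Data.List as L using (List; length; filter)
open import Data.List.Membership.Propositional using (_∈_)
open import Data.List.Relation.Unary.Unique.Propositional using (Unique)
open import Data.List.Relation.Unary.All using (All)
open import Data.Product using (Σ; _×_; _,_; proj₁; proj₂)
open import Relation.Nullary using (¬_; Dec; yes; no)
open import Relation.Unary using (Decidable)
open import Relation.Binary.PropositionalEquality using (_≡_)
import Algebra.Structures as AS

-- a / n as a rational (n = 0 is mapped to 0; never used with n = 0)
frac : ℕ → ℕ → ℚ
frac a zero    = 0ℚ
frac a (suc n) = (+ a) ℚ./ suc n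

_^ℚ_ : ℚ → ℕ → ℚ
x ^ℚ zero  = 1ℚ
x ^ℚ suc n = x ℚ.* (x ^ℚ n)

count : {A : Set} {P : A → Set} → Decidable P → List A → ℕ
count P? xs = length (filter P? xs)

record FiniteField : Set₁ where
  infixl 6 _+_
  infixl 7 _*_
  field
    Carrier : Set
    _+_ _*_ : Carrier → Carrier → Carrier
    -_      : Carrier → Carrier
    0# 1#   : Carrier
    isCommutativeRing : AS.IsCommutativeRing {A = Carrier} _≡_ _+_ _*_ -_ 0# 1#
    1≢0     : ¬ (1# ≡ 0#)
    _⁻¹     : Carrier → Carrier
    ⁻¹-inverse : ∀ x → ¬ (x ≡ 0#) → (x * (x ⁻¹)) ≡ 1#
    _≟_     : (x y : Carrier) → Dec (x ≡ y)
    elements : List Carrier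
    elements-unique   : Unique elements
    elements-complete : ∀ x → x ∈ elements

  size : ℕ
  size = length elements

module _ (F : FiniteField) where
  open FiniteField F

  Point : ℕ → Set
  Point m = Vec Carrier m

  allPoints : (m : ℕ) → List (Point m)
  allPoints zero    = L.[ [] ]
  allPoints (suc m) = L.concatMap (λ a → L.map (a ∷_) (allPoints m)) elements

  zeroVec : (m : ℕ) → Point m
  zeroVec m = V.replicate m 0#

  _≟ᵥ_ : {m : ℕ} (x y : Point m) → Dec (x ≡ y)
  _≟ᵥ_ = VP.≡-dec _≟_

  linePt : {m : ℕ} → Point m → Point m → Carrier → Point m
  linePt b u t = V.zipWith (λ bi ui → bi + t * ui) b u

  -- univariate polynomials of degree ≤ d: coefficient vectors c₀ … c_d
  UPoly : ℕ → Set
  UPoly d = Vec Carrier (suc d)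

  evalU : {n : ℕ} → Vec Carrier n → Carrier → Carrier
  evalU []       t = 0#
  evalU (c ∷ cs) t = c + t * evalU cs t

  _^F_ : Carrier → ℕ → Carrier
  x ^F zero  = 1#
  x ^F suc k = x * (x ^F k)

  record MPoly (m d : ℕ) : Set where
    field
      terms  : List (Carrier × Vec ℕ m)
      degree : All (λ tm → V.sum (proj₂ tm) ℕ.≤ d) terms

  evalMono : {m : ℕ} → Vec ℕ m → Point m → Carrier
  evalMono []       []       = 1#
  evalMono (e ∷ es) (x ∷ xs) = (x ^F e) * evalMono es xs

  evalM : {m d : ℕ} → MPoly m d → Point m → Carrier
  evalM Q x = L.foldr (λ tm acc → (proj₁ tm * evalMono (proj₂ tm) x) + acc) 0#
                      (MPoly.terms Q)

  SameLine : {m : ℕ} → Point m → Point m → Point m → Point m → Set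
  SameLine b u b' u' =
    (∀ t → Σ Carrier λ t' → linePt b u t ≡ linePt b' u' t') ×
    (∀ t' → Σ Carrier λ t → linePt b' u' t' ≡ linePt b u t)

  -- A degree-d lines oracle: to each parametrized line (b, u), u ≠ 0, a
  -- univariate polynomial of degree ≤ d in the parameter t, such that the
  -- induced function on the line depends only on the line as a set.
  record LinesOracle (m d : ℕ) : Set where
    field
      P : Point m → Point m → UPoly d
      well-defined : ∀ b u b' u' →
        ¬ (u ≡ zeroVec m) → ¬ (u' ≡ zeroVec m) → SameLine b u b' u' →
        ∀ t t' → linePt b u t ≡ linePt b' u' t' →
        evalU (P b u) t ≡ evalU (P b' u') t'

  -- Pr_{x, ℓ ∋ x}[f(x) = P_ℓ(x)]: x uniform in F^m, ℓ uniform line through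
  -- x, i.e. ℓ = {x + t u} with u uniform among nonzero vectors (each line
  -- through x has exactly q - 1 such directions); x corresponds to t = 0.
  pairs : (m : ℕ) → List (Point m × Point m)
  pairs m = L.cartesianProduct (allPoints m)
              (filter (λ u → Relation.Nullary.¬? (u ≟ᵥ zeroVec m)) (allPoints m))
    where import Relation.Nullary

  linesAgreement : {m d : ℕ} → (Point m → Carrier) → LinesOracle m d → ℚ
  linesAgreement {m} f O =
    frac (count (λ p → f (proj₁ p) ≟ evalU (LinesOracle.P O (proj₁ p) (proj₂ p)) 0#)
                (pairs m))
         (length (pairs m))

  polyAgreement : {m d : ℕ} → (Point m → Carrier) → MPoly m d → ℚ
  polyAgreement {m} f Q =
    frac (count (λ x → f x ≟ evalM Q x) (allPoints m)) (length (allPoints m))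

{-# OPTIONS --safe #-}

-- In the plane, pass to a subgraph of the point-line agreement graph with large minimum degree and interpolate
-- a nonzero A(x , y , z) of low weighted degree vanishing on the graph of f over its points; then A(x , P_ℓ(x)) = 0
-- on each of its lines. Replacing A by derivatives and, in characteristic p, p-th roots makes f(x₀) a simple root at some
-- x₀, so the P_ℓ on the lines through x₀ are restrictions of the unique power series branch of A = 0 there,
-- which is therefore a polynomial of degree d.
-- Higher dimensions are reached by induction through random hyperplanes. Pairwise independence of points gives most
-- hyperplanes nearly the average agreement, hence a polynomial on each. Consistency of two such
-- polynomials on the intersection is almost transitive, which yields a large exact clique; its polynomials are glued
-- by interpolation along one direction, and the excess degree is removed because the top homogeneous part vanishes
-- on too many hyperplanes. The losses of successive dimensions form a geometric series.

module Submission where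

open import Defs
open import Data.Bool using (Bool; true; false)
import Data.Bool.Properties as Bool
open import Data.Fin as Fin using (Fin; zero; suc; toℕ)
open import Data.List as List using (List; []; _∷_; _++_; map; foldr; concatMap; length; filter; take; upTo; cartesianProduct; cartesianProductWith)
open import Data.List.Membership.Propositional using (_∈_)
open import Data.List.Membership.Propositional.Properties using (∈-lookup; ∈-map⁻; ∈-upTo⁻; ∈-cartesianProduct⁺; ∈-cartesianProductWith⁺; ∈-cartesianProductWith⁻)
open import Data.List.Properties using (length-++; length-map; length-take; length-upTo)
open import Data.List.Relation.Unary.All as All using (All; []; _∷_)
import Data.List.Relation.Unary.All.Properties as Allₚ
open import Data.List.Relation.Unary.AllPairs as AllPairs using (AllPairs; []; _∷_)
open import Data.List.Relation.Unary.Any using (here; there)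
open import Data.List.Relation.Unary.Unique.Propositional using (Unique)
import Data.List.Relation.Unary.Unique.Propositional.Properties as Unique
open import Data.Maybe using (Maybe; just; nothing)
open import Data.Nat as ℕ using (ℕ; zero; suc; z≤n; s≤s; NonZero)
open import Data.Nat.Divisibility using (_∣_; divides)
open import Data.Nat.Tactic.RingSolver using () renaming (solve-∀ to ringℕ)
open import Data.Product using (Σ; ∃; ∃₂; _×_; _,_; proj₁; proj₂)
import Data.Product.Properties as Product
open import Data.Sum using (_⊎_; inj₁; inj₂)
open import Data.Unit using (⊤; tt)
open import Data.Vec as Vec using (Vec; []; _∷_; lookup; zipWith; replicate; tabulate)
import Data.Vec.Properties as Vecₚ
import Data.Vec.Relation.Unary.All as VAll
import Data.Vec.Relation.Unary.All.Properties as VAllₚ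
open import Function using (_∘_; case_of_)
open import Level using (0ℓ)
open import Relation.Nullary using (¬_; Dec; yes; no; contradiction)
open import Relation.Nullary.Decidable using (¬?; _×-dec_; _→-dec_; toWitness)
open import Relation.Binary.PropositionalEquality

-- All probabilities are counts in `ℕ`, and 1/ε is replaced by an integer `K`. The obstacle to the
-- induction is loss. In the uniform bound a share 1/(33 K) of the hyperplanes carries a polynomial,
-- and the clique among them has density of order K⁻⁶. If the agreement of the glued polynomial were
-- estimated through that density, the losses of the dimensions would multiply. It is measured by
-- sampling instead: every clique hyperplane shows agreement a little above 2/K², and if the global
-- agreement were lower, the whole clique would consist of outliers, of which Chebyshev's inequality
-- allows fewer than the clique contains. So a dimension only moves the thresholds by a small
-- amount, and the density of the clique enters only the size required of `q`. That size is K¹² d up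
-- to a constant: hyperplane polynomials agree with `f` with total density of order K⁻³,
-- Cauchy-Schwarz turns this into edge density K⁻⁶, and extracting an exact clique from a graph of
-- edge density 1/G needs at least G² δ vertices up to a constant, where δ is the transitivity
-- defect.

-- Finite sums of natural numbers, indicators and moment inequalities.

module FiniteSums where
  open import Data.Nat using (_+_; _*_; _≤_; _<_)
  open import Data.Nat.Properties hiding (_≟_)

  private
    variable
      A B : Set
      P Q : Set

  ∑ : List A → (A → ℕ) → ℕ
  ∑ [] g = 0
  ∑ (x ∷ xs) g = g x + ∑ xs g

  ∑-cong : (xs : List A) {g h : A → ℕ} → (∀ x → g x ≡ h x) → ∑ xs g ≡ ∑ xs h
  ∑-cong [] e = refl
  ∑-cong (x ∷ xs) e = cong₂ _+_ (e x) (∑-cong xs e)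

  ∑-mono : (xs : List A) {g h : A → ℕ} → (∀ x → g x ≤ h x) → ∑ xs g ≤ ∑ xs h
  ∑-mono [] e = z≤n
  ∑-mono (x ∷ xs) e = +-mono-≤ (e x) (∑-mono xs e)

  ∑-+ : (xs : List A) (g h : A → ℕ) → ∑ xs (λ x → g x + h x) ≡ ∑ xs g + ∑ xs h
  ∑-+ [] g h = refl
  ∑-+ (x ∷ xs) g h = trans (cong ((g x + h x) +_) (∑-+ xs g h)) (swap₄ (g x) (h x) (∑ xs g) (∑ xs h))
    where
    swap₄ : ∀ a b c d → a + b + (c + d) ≡ a + c + (b + d)
    swap₄ = ringℕ

  ∑-*ˡ : (xs : List A) (k : ℕ) (g : A → ℕ) → ∑ xs (λ x → k * g x) ≡ k * ∑ xs g
  ∑-*ˡ [] k g = sym (*-zeroʳ k)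
  ∑-*ˡ (x ∷ xs) k g = trans (cong (k * g x +_) (∑-*ˡ xs k g)) (sym (*-distribˡ-+ k (g x) (∑ xs g)))

  ∑-*ʳ : (xs : List A) (k : ℕ) (g : A → ℕ) → ∑ xs (λ x → g x * k) ≡ ∑ xs g * k
  ∑-*ʳ xs k g = trans (∑-cong xs (λ x → *-comm (g x) k)) (trans (∑-*ˡ xs k g) (*-comm k _))

  ∑-const : (xs : List A) (k : ℕ) → ∑ xs (λ _ → k) ≡ length xs * k
  ∑-const [] k = refl
  ∑-const (x ∷ xs) k = cong (k +_) (∑-const xs k)

  ∑-zero : (xs : List A) → ∑ xs (λ _ → 0) ≡ 0
  ∑-zero xs = trans (∑-const xs 0) (*-zeroʳ (length xs))

  ∑-≤const : (xs : List A) {k : ℕ} {g : A → ℕ} → (∀ x → g x ≤ k) → ∑ xs g ≤ length xs * k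
  ∑-≤const xs {k} e = ≤-trans (∑-mono xs e) (≤-reflexive (∑-const xs k))

  ∑-swap : (xs : List A) (ys : List B) (g : A → B → ℕ) →
           ∑ xs (λ x → ∑ ys (g x)) ≡ ∑ ys (λ y → ∑ xs (λ x → g x y))
  ∑-swap [] ys g = sym (∑-zero ys)
  ∑-swap (x ∷ xs) ys g = trans (cong (∑ ys (g x) +_) (∑-swap xs ys g))
                               (sym (∑-+ ys (g x) (λ y → ∑ xs (λ x → g x y))))

  ∑-++ : (xs ys : List A) (g : A → ℕ) → ∑ (xs ++ ys) g ≡ ∑ xs g + ∑ ys g
  ∑-++ [] ys g = refl
  ∑-++ (x ∷ xs) ys g = trans (cong (g x +_) (∑-++ xs ys g)) (sym (+-assoc (g x) _ _))

  ∑-map : (φ : A → B) (xs : List A) (g : B → ℕ) → ∑ (map φ xs) g ≡ ∑ xs (g ∘ φ)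
  ∑-map φ [] g = refl
  ∑-map φ (x ∷ xs) g = cong (g (φ x) +_) (∑-map φ xs g)

  ∑-concatMap : (φ : A → List B) (xs : List A) (g : B → ℕ) →
                ∑ (concatMap φ xs) g ≡ ∑ xs (λ x → ∑ (φ x) g)
  ∑-concatMap φ [] g = refl
  ∑-concatMap φ (x ∷ xs) g = trans (∑-++ (φ x) _ g) (cong (∑ (φ x) g +_) (∑-concatMap φ xs g))

  I : Dec P → ℕ
  I (yes _) = 1
  I (no _) = 0

  I-yes : (p? : Dec P) → P → I p? ≡ 1
  I-yes (yes _) p = refl
  I-yes (no ¬p) p = contradiction p ¬p

  I-no : (p? : Dec P) → ¬ P → I p? ≡ 0
  I-no (yes p) ¬p = contradiction p ¬p
  I-no (no _) ¬p = refl

  I≤1 : (p? : Dec P) → I p? ≤ 1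
  I≤1 (yes _) = s≤s z≤n
  I≤1 (no _) = z≤n

  I-pos : (p? : Dec P) → 0 < I p? → P
  I-pos (yes p) _ = p

  I-mono : (p? : Dec P) (q? : Dec Q) → (P → Q) → I p? ≤ I q?
  I-mono (yes p) q? f = ≤-reflexive (sym (I-yes q? (f p)))
  I-mono (no _) q? f = z≤n

  I-cong : (p? : Dec P) (q? : Dec Q) → (P → Q) → (Q → P) → I p? ≡ I q?
  I-cong p? q? f g = ≤-antisym (I-mono p? q? f) (I-mono q? p? g)

  I-× : (p? : Dec P) (q? : Dec Q) → I (p? ×-dec q?) ≡ I p? * I q?
  I-× (yes _) (yes _) = refl
  I-× (yes _) (no _) = refl
  I-× (no _) _ = refl

  I-¬ : (p? : Dec P) → I p? + I (¬? p?) ≡ 1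
  I-¬ (yes _) = refl
  I-¬ (no _) = refl

  I*-≤ : (p? : Dec P) (k : ℕ) → I p? * k ≤ k
  I*-≤ (yes _) k = ≤-reflexive (+-identityʳ k)
  I*-≤ (no _) k = z≤n

  I*-mono : (p? : Dec P) {k l : ℕ} → (P → k ≤ l) → I p? * k ≤ I p? * l
  I*-mono (yes p) f = +-mono-≤ (f p) z≤n
  I*-mono (no _) f = z≤n

  I*-cong : (p? : Dec P) {k l : ℕ} → (P → k ≡ l) → I p? * k ≡ I p? * l
  I*-cong (yes p) f = cong (_+ 0) (f p)
  I*-cong (no _) f = refl

  length-filter≡∑ : {P : A → Set} (P? : ∀ x → Dec (P x)) (xs : List A) →
                    length (filter P? xs) ≡ ∑ xs (λ x → I (P? x))
  length-filter≡∑ P? [] = refl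
  length-filter≡∑ P? (x ∷ xs) with P? x
  ... | yes _ = cong suc (length-filter≡∑ P? xs)
  ... | no _ = length-filter≡∑ P? xs

  ∑-filter : {P : A → Set} (P? : ∀ x → Dec (P x)) (xs : List A) (g : A → ℕ) →
             ∑ (filter P? xs) g ≡ ∑ xs (λ x → I (P? x) * g x)
  ∑-filter P? [] g = refl
  ∑-filter P? (x ∷ xs) g with P? x
  ... | yes _ = cong₂ _+_ (sym (+-identityʳ (g x))) (∑-filter P? xs g)
  ... | no _ = ∑-filter P? xs g

  ∑-<⇒∃ : (xs : List A) {g h : A → ℕ} → ∑ xs g < ∑ xs h → ∃ λ x → x ∈ xs × g x < h x
  ∑-<⇒∃ (x ∷ xs) {g} {h} lt with g x ℕ.<? h x
  ... | yes l = x , here refl , l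
  ... | no ¬l with ∑-<⇒∃ xs {g} {h} (≰⇒> λ le → <⇒≱ lt (+-mono-≤ (≮⇒≥ ¬l) le))
  ... | y , y∈ , l = y , there y∈ , l

  -- The averaging argument. On a nonempty list, raising `h` by one makes the inequality of the sums
  -- strict, which reduces the claim to `∑-<⇒∃`.
  ∑-≤⇒∃ : (xs : List A) {g h : A → ℕ} → 0 < length xs → ∑ xs g ≤ ∑ xs h → ∃ λ x → x ∈ xs × g x ≤ h x
  ∑-≤⇒∃ xs {g} {h} ne le with ∑-<⇒∃ xs {g} {λ x → suc (h x)}
    (subst (∑ xs g <_) (sym (trans (∑-+ xs (λ _ → 1) h) (cong (_+ ∑ xs h) (trans (∑-const xs 1) (*-identityʳ _)))))
      (≤-trans (s≤s le) (+-monoˡ-≤ (∑ xs h) ne)))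
  ... | x , x∈ , s≤s l = x , x∈ , l

  ∑-pos⇒∃ : (xs : List A) {g : A → ℕ} → 0 < ∑ xs g → ∃ λ x → x ∈ xs × 0 < g x
  ∑-pos⇒∃ xs {g} lt = ∑-<⇒∃ xs {λ _ → 0} (subst (_< ∑ xs g) (sym (∑-zero xs)) lt)

  term≤∑ : {xs : List A} (g : A → ℕ) {x : A} → x ∈ xs → g x ≤ ∑ xs g
  term≤∑ g (here refl) = m≤m+n _ _
  term≤∑ g (there {x = y} m) = ≤-trans (term≤∑ g m) (m≤n+m _ (g y))

  2ab≤a²+b² : ∀ a b → 2 * (a * b) ≤ a * a + b * b
  2ab≤a²+b² a b with ≤-total a b
  ... | inj₁ a≤b with c , refl ← m≤n⇒∃[o]m+o≡n a≤b =
    subst (2 * (a * (a + c)) ≤_) (lem a c) (m≤m+n _ (c * c))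
    where lem : ∀ a c → 2 * (a * (a + c)) + c * c ≡ a * a + (a + c) * (a + c)
          lem = ringℕ
  ... | inj₂ b≤a with c , refl ← m≤n⇒∃[o]m+o≡n b≤a =
    subst (2 * ((b + c) * b) ≤_) (lem b c) (m≤m+n _ (c * c))
    where lem : ∀ b c → 2 * ((b + c) * b) + c * c ≡ (b + c) * (b + c) + b * b
          lem = ringℕ

  -- Induction on the list: a new entry `a` creates the cross term `2 a S`, and summing
  -- `2 a g(y) ≤ a² + g(y)²` over the old entries bounds it by `L a² + T`.
  cauchy-schwarz : (xs : List A) (g : A → ℕ) → ∑ xs g * ∑ xs g ≤ length xs * ∑ xs (λ x → g x * g x)
  cauchy-schwarz [] g = z≤n
  cauchy-schwarz (x ∷ xs) g = begin
    (a + S) * (a + S) ≡⟨ e₁ a S ⟩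
    a * a + 2 * (a * S) + S * S ≤⟨ +-mono-≤ (+-monoʳ-≤ (a * a) cross) (cauchy-schwarz xs g) ⟩
    a * a + (L * (a * a) + T) + L * T ≡⟨ e₂ a L T ⟩
    suc L * (a * a + T) ∎
    where
    open ≤-Reasoning
    a = g x
    S = ∑ xs g
    L = length xs
    T = ∑ xs (λ x → g x * g x)
    e₁ : ∀ a S → (a + S) * (a + S) ≡ a * a + 2 * (a * S) + S * S
    e₁ = ringℕ
    e₂ : ∀ a L T → a * a + (L * (a * a) + T) + L * T ≡ suc L * (a * a + T)
    e₂ = ringℕ
    cross : 2 * (a * S) ≤ L * (a * a) + T
    cross = begin
      2 * (a * S) ≡⟨ cong (2 *_) (sym (∑-*ˡ xs a g)) ⟩
      2 * ∑ xs (λ y → a * g y) ≡⟨ sym (∑-*ˡ xs 2 _) ⟩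
      ∑ xs (λ y → 2 * (a * g y)) ≤⟨ ∑-mono xs (λ y → 2ab≤a²+b² a (g y)) ⟩
      ∑ xs (λ y → a * a + g y * g y) ≡⟨ trans (∑-+ xs _ _) (cong (_+ T) (∑-const xs (a * a))) ⟩
      L * (a * a) + T ∎

  -- This is `(x - μ)² ≥ η²` with the negative term moved to the other side, since `ℕ` has no
  -- subtraction.
  sq-gap : ∀ x μ η → x + η ≤ μ ⊎ μ + η ≤ x → 2 * (μ * x) + η * η ≤ x * x + μ * μ
  sq-gap x μ η (inj₁ l) with c , refl ← m≤n⇒∃[o]m+o≡n l =
    subst (2 * ((x + η + c) * x) + η * η ≤_) (lem x η c) (m≤m+n _ (2 * (c * η) + c * c))
    where lem : ∀ x η c → 2 * ((x + η + c) * x) + η * η + (2 * (c * η) + c * c) ≡ x * x + (x + η + c) * (x + η + c)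
          lem = ringℕ
  sq-gap x μ η (inj₂ l) with c , refl ← m≤n⇒∃[o]m+o≡n l =
    subst (2 * (μ * (μ + η + c)) + η * η ≤_) (lem μ η c) (m≤m+n _ (2 * (c * η) + c * c))
    where lem : ∀ x η c → 2 * (x * (x + η + c)) + η * η + (2 * (c * η) + c * c) ≡ (x + η + c) * (x + η + c) + x * x
          lem = ringℕ

  -- Stated for total mass L μ and second moment at most L μ² + V, so that V bounds L times the variance.
  chebyshev : (xs : List A) (g : A → ℕ) (μ η V : ℕ) {Bad : A → Set} (bad? : ∀ x → Dec (Bad x)) →
              (∀ x → Bad x → g x + η ≤ μ ⊎ μ + η ≤ g x) →
              ∑ xs g ≡ length xs * μ →
              ∑ xs (λ x → g x * g x) ≤ length xs * (μ * μ) + V →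
              ∑ xs (λ x → I (bad? x)) * (η * η) ≤ V
  chebyshev xs g μ η V {Bad} bad? far mean second =
    +-cancelˡ-≤ (2 * (L * (μ * μ))) _ _ (begin
      2 * (L * (μ * μ)) + b * (η * η) ≡⟨ cong₂ _+_ lhs (sym (∑-*ʳ xs (η * η) _)) ⟩
      ∑ xs (λ x → 2 * (μ * g x)) + ∑ xs (λ x → I (bad? x) * (η * η)) ≡⟨ sym (∑-+ xs _ _) ⟩
      ∑ xs (λ x → 2 * (μ * g x) + I (bad? x) * (η * η)) ≤⟨ ∑-mono xs pointwise ⟩
      ∑ xs (λ x → g x * g x + μ * μ) ≡⟨ trans (∑-+ xs _ _) (cong (_ +_) (∑-const xs (μ * μ))) ⟩
      ∑ xs (λ x → g x * g x) + L * (μ * μ) ≤⟨ +-monoˡ-≤ (L * (μ * μ)) second ⟩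
      L * (μ * μ) + V + L * (μ * μ) ≡⟨ e L μ V ⟩
      2 * (L * (μ * μ)) + V ∎)
    where
    open ≤-Reasoning
    L = length xs
    b = ∑ xs (λ x → I (bad? x))
    e : ∀ L μ V → L * (μ * μ) + V + L * (μ * μ) ≡ 2 * (L * (μ * μ)) + V
    e = ringℕ
    e′ : ∀ L μ → 2 * (L * (μ * μ)) ≡ 2 * (μ * (L * μ))
    e′ = ringℕ
    lhs : 2 * (L * (μ * μ)) ≡ ∑ xs (λ x → 2 * (μ * g x))
    lhs = trans (e′ L μ) (sym (trans (∑-*ˡ xs 2 _) (cong (2 *_) (trans (∑-*ˡ xs μ g) (cong (μ *_) mean)))))
    -- Every entry has `(g x - μ)² ≥ 0`, and a bad one at least `η²`.
    pointwise : ∀ x → 2 * (μ * g x) + I (bad? x) * (η * η) ≤ g x * g x + μ * μ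
    pointwise x with bad? x
    ... | yes b = subst (λ z → 2 * (μ * g x) + z ≤ g x * g x + μ * μ) (sym (+-identityʳ _)) (sq-gap (g x) μ η (far x b))
    ... | no _ = subst (_≤ g x * g x + μ * μ) (sym (+-identityʳ _))
                    (≤-trans (2ab≤a²+b² μ (g x)) (≤-reflexive (+-comm (μ * μ) _)))

  record Finite (A : Set) : Set where
    field
      elems : List A
      unique : Unique elems
      complete : ∀ x → x ∈ elems
      _≟_ : (x y : A) → Dec (x ≡ y)

    ∑-absent : (xs : List A) {a : A} → All (λ x → ¬ (a ≡ x)) xs → (g : A → ℕ) → ∑ xs (λ x → I (x ≟ a) * g x) ≡ 0
    ∑-absent [] [] g = refl
    ∑-absent (x ∷ xs) {a} (n ∷ ns) g = cong₂ _+_ (cong (_* g x) (I-no (x ≟ a) (n ∘ sym))) (∑-absent xs ns g)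

    ∑-δ-list : {xs : List A} {a : A} → Unique xs → a ∈ xs → (g : A → ℕ) → ∑ xs (λ x → I (x ≟ a) * g x) ≡ g a
    ∑-δ-list {x ∷ xs} {a} (n ∷ _) (here refl) g =
      trans (cong₂ _+_ (cong (_* g x) (I-yes (x ≟ x) refl)) (∑-absent xs n g))
            (trans (+-identityʳ _) (+-identityʳ _))
    ∑-δ-list {x ∷ xs} {a} (n ∷ u) (there m) g =
      cong₂ _+_ (cong (_* g x) (I-no (x ≟ a) (All.lookup n m))) (∑-δ-list u m g)

    ∑-δ : (a : A) (g : A → ℕ) → ∑ elems (λ x → I (x ≟ a) * g x) ≡ g a
    ∑-δ a g = ∑-δ-list unique (complete a) g

    ∑-δ₁ : (a : A) → ∑ elems (λ x → I (x ≟ a)) ≡ 1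
    ∑-δ₁ a = trans (∑-cong elems (λ x → sym (*-identityʳ _))) (∑-δ a (λ _ → 1))

    ∃? : {P : A → Set} → (∀ x → Dec (P x)) → Dec (∃ P)
    ∃? {P} P? = search elems (λ x _ → complete x)
      where
      search : (xs : List A) → (∀ x → P x → x ∈ xs) → Dec (∃ P)
      search [] c = no λ (x , p) → case c x p of λ ()
      search (x ∷ xs) c with P? x
      ... | yes p = yes (x , p)
      ... | no ¬p = search xs λ y py → case c y py of λ
        { (here refl) → contradiction py ¬p ; (there m) → m }

    ∀? : {P : A → Set} → (∀ x → Dec (P x)) → Dec (∀ x → P x)
    ∀? P? with ∃? (λ x → ¬? (P? x))
    ... | yes (x , ¬p) = no λ f → ¬p (f x)
    ... | no ¬e = yes λ x → case P? x of λ { (yes p) → p ; (no ¬p) → contradiction (x , ¬p) ¬e }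

  module _ (FA : Finite A) (FB : Finite B) where
    private
      module FA = Finite FA
      module FB = Finite FB

    -- Grouping by fibres: `h (φ x)` is expanded into a delta sum over `y` and the two sums are
    -- exchanged. Reindexing along bijections and injections is deduced from this form.
    ∑-pushforward : (φ : A → B) (h : B → ℕ) →
      ∑ FA.elems (λ x → h (φ x)) ≡ ∑ FB.elems (λ y → h y * ∑ FA.elems (λ x → I (φ x FB.≟ y)))
    ∑-pushforward φ h = begin
      ∑ FA.elems (λ x → h (φ x)) ≡⟨ ∑-cong FA.elems (λ x → sym (FB.∑-δ (φ x) h)) ⟩
      ∑ FA.elems (λ x → ∑ FB.elems (λ y → I (y FB.≟ φ x) * h y)) ≡⟨ ∑-swap FA.elems FB.elems _ ⟩
      ∑ FB.elems (λ y → ∑ FA.elems (λ x → I (y FB.≟ φ x) * h y))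
        ≡⟨ ∑-cong FB.elems (λ y → trans (∑-cong FA.elems (λ x → trans (*-comm (I (y FB.≟ φ x)) (h y))
              (cong (h y *_) (I-cong (y FB.≟ φ x) (φ x FB.≟ y) sym sym)))) (∑-*ˡ FA.elems (h y) _)) ⟩
      ∑ FB.elems (λ y → h y * ∑ FA.elems (λ x → I (φ x FB.≟ y))) ∎
      where open ≡-Reasoning

    ∑-reindex : (φ : A → B) (ψ : B → A) → (∀ x → ψ (φ x) ≡ x) → (∀ y → φ (ψ y) ≡ y) → (h : B → ℕ) →
      ∑ FA.elems (λ x → h (φ x)) ≡ ∑ FB.elems h
    ∑-reindex φ ψ ψφ φψ h = trans (∑-pushforward φ h)
      (∑-cong FB.elems (λ y → trans (cong (h y *_) (trans
        (∑-cong FA.elems (λ x → I-cong (φ x FB.≟ y) (x FA.≟ ψ y)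
           (λ e → trans (sym (ψφ x)) (cong ψ e)) (λ e → trans (cong φ e) (φψ y))))
        (FA.∑-δ₁ (ψ y)))) (*-identityʳ (h y))))

    ∑-injection≤ : (φ : A → B) → (∀ {x y} → φ x ≡ φ y → x ≡ y) → (h : B → ℕ) →
      ∑ FA.elems (λ x → h (φ x)) ≤ ∑ FB.elems h
    ∑-injection≤ φ inj h = ≤-trans (≤-reflexive (∑-pushforward φ h))
      (∑-mono FB.elems (λ y → ≤-trans (*-monoʳ-≤ (h y) (fibre y)) (≤-reflexive (*-identityʳ _))))
      where
      fibre : ∀ y → ∑ FA.elems (λ x → I (φ x FB.≟ y)) ≤ 1
      fibre y with FA.∃? (λ x → φ x FB.≟ y)
      ... | yes (x₀ , e₀) = ≤-trans (∑-mono FA.elems (λ x → I-mono (φ x FB.≟ y) (x FA.≟ x₀) (λ e → inj (trans e (sym e₀)))))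
                                    (≤-reflexive (FA.∑-δ₁ x₀))
      ... | no ¬e = ≤-trans (≤-reflexive (trans (∑-cong FA.elems (λ x → I-no (φ x FB.≟ y) (λ e → ¬e (x , e)))) (∑-zero FA.elems))) z≤n

-- Algebra of the finite field; points, lines and hyperplanes.

module FieldAlgebra (F : FiniteField) where
  open import Data.Nat using (_+_; _*_; _^_; _≤_; _<_)
  open import Data.Nat.Properties hiding (_≟_)
  open import Algebra.Bundles using (CommutativeRing; RawRing)
  import Algebra.Solver.Ring
  import Algebra.Solver.Ring.NaturalCoefficients.Default
  import Algebra.Solver.Ring.AlmostCommutativeRing as ACR
  import Algebra.Properties.Semiring.Mult
  open FiniteSums

  open FiniteField F public using (elements) renaming
    ( Carrier to 𝔽; _+_ to _+ᶠ_; _*_ to _*ᶠ_; -_ to -ᶠ_; 0# to 0ᶠ; 1# to 1ᶠ; size to q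
    ; _⁻¹ to _⁻¹ᶠ; ⁻¹-inverse to *-inverseʳ; 1≢0 to 1ᶠ≢0ᶠ)

  infix 4 _≟ᶠ_ _≟ᵖ_

  _≟ᶠ_ : (x y : 𝔽) → Dec (x ≡ y)
  _≟ᶠ_ = FiniteField._≟_ F

  commutativeRing : CommutativeRing 0ℓ 0ℓ
  commutativeRing = record { isCommutativeRing = FiniteField.isCommutativeRing F }

  open CommutativeRing commutativeRing public using () renaming
    ( +-assoc to +ᶠ-assoc; +-comm to +ᶠ-comm; +-identityˡ to +ᶠ-identityˡ; +-identityʳ to +ᶠ-identityʳ
    ; *-assoc to *ᶠ-assoc; *-comm to *ᶠ-comm; *-identityˡ to *ᶠ-identityˡ; *-identityʳ to *ᶠ-identityʳ
    ; zeroˡ to *ᶠ-zeroˡ; zeroʳ to *ᶠ-zeroʳ; -‿inverseʳ to +ᶠ-inverseʳ; -‿inverseˡ to +ᶠ-inverseˡ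
    ; distribˡ to *ᶠ-distribˡ)

  private
    module R = CommutativeRing commutativeRing
    almostRing = ACR.fromCommutativeRing commutativeRing
    module S₀ = Algebra.Solver.Ring.NaturalCoefficients.Default R.commutativeSemiring
    module Mult = Algebra.Properties.Semiring.Mult R.semiring

  ⟦_⟧ : ℕ → 𝔽
  ⟦ n ⟧ = n Mult.× 1ᶠ

  ⟦⟧-+ : ∀ m n → ⟦ m + n ⟧ ≡ ⟦ m ⟧ +ᶠ ⟦ n ⟧
  ⟦⟧-+ m n = Mult.×-homo-+ 1ᶠ m n

  ⟦⟧-* : ∀ m n → ⟦ m * n ⟧ ≡ ⟦ m ⟧ *ᶠ ⟦ n ⟧
  ⟦⟧-* = Mult.×1-homo-*

  -- The ring solver needs coefficients with decidable equality in which cancellation computes: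
  -- the pair (a , b) stands for a - b.
  private
    value : ℕ × ℕ → 𝔽
    value (a , b) = ⟦ a ⟧ +ᶠ (-ᶠ ⟦ b ⟧)

    -- Zero and one are singled out so that the solver constants `con (0 , 0)` and `con (1 , 0)`
    -- denote `0ᶠ` and `1ᶠ` by computation; `ι≡value` shows that the general formula takes the same
    -- values.
    ι : ℕ × ℕ → 𝔽
    ι (zero , zero) = 0ᶠ
    ι (suc zero , zero) = 1ᶠ
    ι c = value c

    -0≡0 : -ᶠ 0ᶠ ≡ 0ᶠ
    -0≡0 = trans (sym (+ᶠ-identityˡ _)) (+ᶠ-inverseʳ 0ᶠ)

    ι≡value : ∀ c → ι c ≡ value c
    ι≡value (zero , zero) = sym (trans (+ᶠ-identityˡ _) -0≡0)
    ι≡value (suc zero , zero) = sym (trans (cong₂ _+ᶠ_ (+ᶠ-identityʳ 1ᶠ) -0≡0) (+ᶠ-identityʳ 1ᶠ))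
    ι≡value (zero , suc b) = refl
    ι≡value (suc zero , suc b) = refl
    ι≡value (suc (suc a) , zero) = refl
    ι≡value (suc (suc a) , suc b) = refl

    coeffRing : RawRing 0ℓ 0ℓ
    coeffRing = record
      { Carrier = ℕ × ℕ
      ; _≈_ = _≡_
      ; _+_ = λ (a , b) (c , d) → a + c , b + d
      ; _*_ = λ (a , b) (c , d) → a * c + b * d , a * d + b * c
      ; -_ = λ (a , b) → b , a
      ; 0# = 0 , 0
      ; 1# = 1 , 0
      }

    open RawRing coeffRing using () renaming (_+_ to _+ᶜ_; _*_ to _*ᶜ_; -_ to -ᶜ_)

    value-+ : ∀ x y → value (x +ᶜ y) ≡ value x +ᶠ value y
    value-+ (a , b) (c , d) = trans
      (cong₂ _+ᶠ_ (⟦⟧-+ a c) (trans (cong -ᶠ_ (⟦⟧-+ b d)) (sym (ACR.AlmostCommutativeRing.-‿+-comm almostRing ⟦ b ⟧ ⟦ d ⟧))))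
      (S₀.solve 4 (λ a b c d → (a S₀.:+ c) S₀.:+ (b S₀.:+ d) S₀.:= (a S₀.:+ b) S₀.:+ (c S₀.:+ d))
        refl ⟦ a ⟧ (-ᶠ ⟦ b ⟧) ⟦ c ⟧ (-ᶠ ⟦ d ⟧))

    value-* : ∀ x y → value (x *ᶜ y) ≡ value x *ᶠ value y
    value-* (a , b) (c , d) = begin
      ⟦ a * c + b * d ⟧ +ᶠ (-ᶠ ⟦ a * d + b * c ⟧)
        ≡⟨ cong₂ (λ u v → u +ᶠ (-ᶠ v))
             (trans (⟦⟧-+ (a * c) (b * d)) (cong₂ _+ᶠ_ (⟦⟧-* a c) (⟦⟧-* b d)))
             (trans (⟦⟧-+ (a * d) (b * c)) (cong₂ _+ᶠ_ (⟦⟧-* a d) (⟦⟧-* b c))) ⟩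
      (A *ᶠ C +ᶠ B *ᶠ D) +ᶠ (-ᶠ (A *ᶠ D +ᶠ B *ᶠ C))
        ≡⟨ cong₂ _+ᶠ_ (cong (A *ᶠ C +ᶠ_) (sym neg-neg))
             (trans (sym (ACR.AlmostCommutativeRing.-‿+-comm almostRing (A *ᶠ D) (B *ᶠ C)))
               (cong₂ _+ᶠ_ (-‿distribʳ-* A D) (-‿distribˡ-* B C))) ⟩
      (A *ᶠ C +ᶠ (-ᶠ B) *ᶠ (-ᶠ D)) +ᶠ (A *ᶠ (-ᶠ D) +ᶠ (-ᶠ B) *ᶠ C)
        ≡⟨ S₀.solve 4 (λ a b c d → (a S₀.:* c S₀.:+ b S₀.:* d) S₀.:+ (a S₀.:* d S₀.:+ b S₀.:* c)
             S₀.:= (a S₀.:+ b) S₀.:* (c S₀.:+ d)) refl A (-ᶠ B) C (-ᶠ D) ⟩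
      (A +ᶠ (-ᶠ B)) *ᶠ (C +ᶠ (-ᶠ D)) ∎
      where
      open ≡-Reasoning
      open import Algebra.Properties.Ring R.ring using (-‿distribˡ-*; -‿distribʳ-*; -‿involutive)
      A = ⟦ a ⟧
      B = ⟦ b ⟧
      C = ⟦ c ⟧
      D = ⟦ d ⟧
      neg-neg : (-ᶠ B) *ᶠ (-ᶠ D) ≡ B *ᶠ D
      neg-neg = trans (sym (-‿distribˡ-* B (-ᶠ D))) (trans (cong -ᶠ_ (sym (-‿distribʳ-* B D))) (-‿involutive _))

    value-neg : ∀ x → value (-ᶜ x) ≡ -ᶠ value x
    value-neg (a , b) = trans (+ᶠ-comm ⟦ b ⟧ _) (trans (cong (-ᶠ ⟦ a ⟧ +ᶠ_) (sym (-‿involutive ⟦ b ⟧)))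
      (ACR.AlmostCommutativeRing.-‿+-comm almostRing ⟦ a ⟧ (-ᶠ ⟦ b ⟧)))
      where open import Algebra.Properties.Ring R.ring using (-‿involutive)

    -- Differences coincide as soon as the crosswise sums do. This turns the decidable comparison of
    -- naturals in `coeff≟` into an equation in the field.
    transfer : ∀ {x y z w} → x +ᶠ w ≡ z +ᶠ y → x +ᶠ (-ᶠ y) ≡ z +ᶠ (-ᶠ w)
    transfer {x} {y} {z} {w} e = begin
      x +ᶠ (-ᶠ y) ≡⟨ sym (+ᶠ-identityʳ _) ⟩
      x +ᶠ (-ᶠ y) +ᶠ 0ᶠ ≡⟨ cong (_ +ᶠ_) (sym (+ᶠ-inverseʳ w)) ⟩
      x +ᶠ (-ᶠ y) +ᶠ (w +ᶠ (-ᶠ w)) ≡⟨ S₀.solve 4 (λ x y w v → x S₀.:+ y S₀.:+ (w S₀.:+ v) S₀.:= (x S₀.:+ w) S₀.:+ (y S₀.:+ v)) refl x (-ᶠ y) w (-ᶠ w) ⟩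
      x +ᶠ w +ᶠ ((-ᶠ y) +ᶠ (-ᶠ w)) ≡⟨ cong (_+ᶠ ((-ᶠ y) +ᶠ (-ᶠ w))) e ⟩
      z +ᶠ y +ᶠ ((-ᶠ y) +ᶠ (-ᶠ w)) ≡⟨ S₀.solve 4 (λ z y u v → z S₀.:+ y S₀.:+ (u S₀.:+ v) S₀.:= (z S₀.:+ v) S₀.:+ (y S₀.:+ u)) refl z y (-ᶠ y) (-ᶠ w) ⟩
      z +ᶠ (-ᶠ w) +ᶠ (y +ᶠ (-ᶠ y)) ≡⟨ cong (_ +ᶠ_) (+ᶠ-inverseʳ y) ⟩
      z +ᶠ (-ᶠ w) +ᶠ 0ᶠ ≡⟨ +ᶠ-identityʳ _ ⟩
      z +ᶠ (-ᶠ w) ∎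
      where open ≡-Reasoning

    coeff≟ : ∀ x y → Maybe (ι x ≡ ι y)
    coeff≟ (a , b) (c , d) with (a + d) ℕ.≟ (c + b)
    ... | yes e = just (trans (ι≡value (a , b)) (trans (transfer (trans (sym (⟦⟧-+ a d)) (trans (cong ⟦_⟧ e) (⟦⟧-+ c b)))) (sym (ι≡value (c , d)))))
    ... | no _ = nothing

    morphism : coeffRing ACR.-Raw-AlmostCommutative⟶ almostRing
    morphism = record
      { ⟦_⟧ = ι
      ; +-homo = λ x y → trans (ι≡value (x +ᶜ y)) (trans (value-+ x y) (sym (cong₂ _+ᶠ_ (ι≡value x) (ι≡value y))))
      ; *-homo = λ x y → trans (ι≡value (x *ᶜ y)) (trans (value-* x y) (sym (cong₂ _*ᶠ_ (ι≡value x) (ι≡value y))))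
      ; -‿homo = λ x → trans (ι≡value (-ᶜ x)) (trans (value-neg x) (sym (cong -ᶠ_ (ι≡value x))))
      ; 0-homo = refl
      ; 1-homo = refl
      }

  open Algebra.Solver.Ring coeffRing almostRing morphism coeff≟ public
    using (solve; con; _:+_; _:*_; :-_; _:=_)

  x-y+y≡x : ∀ x y → x +ᶠ (-ᶠ y) +ᶠ y ≡ x
  x-y+y≡x = solve 2 (λ x y → x :+ (:- y) :+ y := x) refl
  x+y-y≡x : ∀ x y → x +ᶠ y +ᶠ (-ᶠ y) ≡ x
  x+y-y≡x = solve 2 (λ x y → x :+ y :+ (:- y) := x) refl

  x-y≡0⇒x≡y : ∀ {x y} → x +ᶠ (-ᶠ y) ≡ 0ᶠ → x ≡ y
  x-y≡0⇒x≡y {x} {y} e = trans (sym (x-y+y≡x x y)) (trans (cong (_+ᶠ y) e) (+ᶠ-identityˡ y))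

  +ᶠ-cancelʳ : ∀ {x y} z → x +ᶠ z ≡ y +ᶠ z → x ≡ y
  +ᶠ-cancelʳ {x} {y} z e = trans (sym (x+y-y≡x x z)) (trans (cong (_+ᶠ (-ᶠ z)) e) (x+y-y≡x y z))

  x≡y⇒x-y≡0 : ∀ {x y} → x ≡ y → x +ᶠ (-ᶠ y) ≡ 0ᶠ
  x≡y⇒x-y≡0 {x} refl = +ᶠ-inverseʳ x

  *-cancel-inverse : ∀ {a} x → ¬ (a ≡ 0ᶠ) → x *ᶠ (a ⁻¹ᶠ) *ᶠ a ≡ x
  *-cancel-inverse {a} x a≢0 = trans (*ᶠ-assoc x (a ⁻¹ᶠ) a)
    (trans (cong (x *ᶠ_) (trans (*ᶠ-comm (a ⁻¹ᶠ) a) (*-inverseʳ a a≢0))) (*ᶠ-identityʳ x))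

  *-cancel-inverse′ : ∀ {a} x → ¬ (a ≡ 0ᶠ) → x *ᶠ a *ᶠ (a ⁻¹ᶠ) ≡ x
  *-cancel-inverse′ {a} x a≢0 = trans (*ᶠ-assoc x a (a ⁻¹ᶠ)) (trans (cong (x *ᶠ_) (*-inverseʳ a a≢0)) (*ᶠ-identityʳ x))

  *-cancelʳ : ∀ {a x y} → ¬ (a ≡ 0ᶠ) → x *ᶠ a ≡ y *ᶠ a → x ≡ y
  *-cancelʳ {a} {x} {y} a≢0 e = trans (sym (*-cancel-inverse′ x a≢0)) (trans (cong (_*ᶠ (a ⁻¹ᶠ)) e) (*-cancel-inverse′ y a≢0))

  no-zero-divisors : ∀ {x y} → ¬ (y ≡ 0ᶠ) → x *ᶠ y ≡ 0ᶠ → x ≡ 0ᶠ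
  no-zero-divisors {x} {y} y≢0 e = *-cancelʳ y≢0 (trans e (sym (*ᶠ-zeroˡ y)))

  *-nonzero : ∀ {x y} → ¬ (x ≡ 0ᶠ) → ¬ (y ≡ 0ᶠ) → ¬ (x *ᶠ y ≡ 0ᶠ)
  *-nonzero x≢0 y≢0 e = x≢0 (no-zero-divisors y≢0 e)

  finite𝔽 : Finite 𝔽
  finite𝔽 = record
    { elems = elements ; unique = FiniteField.elements-unique F
    ; complete = FiniteField.elements-complete F ; _≟_ = _≟ᶠ_ }

  Pt : ℕ → Set
  Pt = Point F

  points : (n : ℕ) → List (Pt n)
  points = allPoints F

  0ᵥ : {n : ℕ} → Pt n
  0ᵥ {n} = zeroVec F n

  _≟ᵖ_ : {n : ℕ} (x y : Pt n) → Dec (x ≡ y)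
  _≟ᵖ_ = _≟ᵥ_ F

  line : {n : ℕ} → Pt n → Pt n → 𝔽 → Pt n
  line = linePt F

  private
    -- Recognising the enumeration of points as a Cartesian product gives access to its uniqueness
    -- and completeness.
    points-suc : ∀ (xs : List 𝔽) {n} (ys : List (Pt n)) →
      concatMap (λ a → map (a ∷_) ys) xs ≡ cartesianProductWith _∷_ xs ys
    points-suc [] ys = refl
    points-suc (x ∷ xs) ys = cong (map (x ∷_) ys ++_) (points-suc xs ys)

    points-unique : ∀ n → Unique (points n)
    points-unique zero = [] ∷ []
    points-unique (suc n) = subst Unique (sym (points-suc elements (points n)))
      (Unique.cartesianProductWith⁺ _∷_ Vecₚ.∷-injective (FiniteField.elements-unique F) (points-unique n))

    points-complete : ∀ {n} (x : Pt n) → x ∈ points n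
    points-complete [] = here refl
    points-complete {suc n} (a ∷ x) = subst ((a ∷ x) ∈_) (sym (points-suc elements (points n)))
      (∈-cartesianProductWith⁺ _∷_ (FiniteField.elements-complete F a) (points-complete x))

  finitePt : (n : ℕ) → Finite (Pt n)
  finitePt n = record { elems = points n ; unique = points-unique n ; complete = points-complete ; _≟_ = _≟ᵖ_ }

  ∑ᶠ : (𝔽 → ℕ) → ℕ
  ∑ᶠ = ∑ elements

  ∑ᵖ : (n : ℕ) → (Pt n → ℕ) → ℕ
  ∑ᵖ n = ∑ (points n)

  ∑ᵖ-suc : ∀ n (g : Pt (suc n) → ℕ) → ∑ᵖ (suc n) g ≡ ∑ᶠ (λ a → ∑ᵖ n (λ y → g (a ∷ y)))
  ∑ᵖ-suc n g = trans (∑-concatMap (λ a → map (a ∷_) (points n)) elements g)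
    (∑-cong elements (λ a → ∑-map (a ∷_) (points n) g))

  length-points : ∀ n → length (points n) ≡ q ^ n
  length-points n = trans (sym (trans (∑-const (points n) 1) (*-identityʳ _))) (go n)
    where
    go : ∀ n → ∑ᵖ n (λ _ → 1) ≡ q ^ n
    go zero = refl
    go (suc n) = trans (∑ᵖ-suc n _) (trans (∑-cong elements (λ _ → go n)) (∑-const elements (q ^ n)))

  ∑ᵖ-const : ∀ n k → ∑ᵖ n (λ _ → k) ≡ q ^ n * k
  ∑ᵖ-const n k = trans (∑-const (points n) k) (cong (_* k) (length-points n))

  ∑ᵖ-one : ∀ n → ∑ᵖ n (λ _ → 1) ≡ q ^ n
  ∑ᵖ-one n = trans (∑ᵖ-const n 1) (*-identityʳ _)

  ∑ᵖ-≤const : ∀ n {k} {g : Pt n → ℕ} → (∀ x → g x ≤ k) → ∑ᵖ n g ≤ q ^ n * k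
  ∑ᵖ-≤const n {k} e = ≤-trans (∑-mono (points n) e) (≤-reflexive (∑ᵖ-const n k))

  dot : {n : ℕ} → Pt n → Pt n → 𝔽
  dot [] [] = 0ᶠ
  dot (a ∷ x) (b ∷ y) = a *ᶠ b +ᶠ dot x y

  dot-comm : ∀ {n} (x y : Pt n) → dot x y ≡ dot y x
  dot-comm [] [] = refl
  dot-comm (a ∷ x) (b ∷ y) = cong₂ _+ᶠ_ (*ᶠ-comm a b) (dot-comm x y)

  dot-zeroʳ : ∀ {n} (x : Pt n) → dot x 0ᵥ ≡ 0ᶠ
  dot-zeroʳ [] = refl
  dot-zeroʳ (a ∷ x) = trans (cong₂ _+ᶠ_ (*ᶠ-zeroʳ a) (dot-zeroʳ x)) (+ᶠ-identityˡ 0ᶠ)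

  dot-line : ∀ {n} (w b u : Pt n) t → dot w (line b u t) ≡ dot w b +ᶠ t *ᶠ dot w u
  dot-line [] [] [] t = sym (trans (+ᶠ-identityˡ _) (*ᶠ-zeroʳ t))
  dot-line (c ∷ w) (b ∷ x) (u ∷ y) t = trans (cong (c *ᶠ (b +ᶠ t *ᶠ u) +ᶠ_) (dot-line w x y t)) (shuffle c b t u (dot w x) (dot w y))
    where
    shuffle : ∀ c b t u r s → c *ᶠ (b +ᶠ t *ᶠ u) +ᶠ (r +ᶠ t *ᶠ s) ≡ c *ᶠ b +ᶠ r +ᶠ t *ᶠ (c *ᶠ u +ᶠ s)
    shuffle = solve 6 (λ c b t u r s → c :* (b :+ t :* u) :+ (r :+ t :* s) := c :* b :+ r :+ t :* (c :* u :+ s)) refl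

  dot-lineˡ : ∀ {n} (b u w : Pt n) t → dot (line b u t) w ≡ dot b w +ᶠ t *ᶠ dot u w
  dot-lineˡ b u w t = trans (dot-comm (line b u t) w) (trans (dot-line w b u t) (cong₂ (λ x y → x +ᶠ t *ᶠ y) (dot-comm w b) (dot-comm w u)))

  line-0 : ∀ {n} (b u : Pt n) → line b u 0ᶠ ≡ b
  line-0 [] [] = refl
  line-0 (b ∷ x) (u ∷ y) = cong₂ _∷_ (trans (cong (b +ᶠ_) (*ᶠ-zeroˡ u)) (+ᶠ-identityʳ b)) (line-0 x y)

  line-line : ∀ {n} (b u : Pt n) s t → line (line b u s) u t ≡ line b u (s +ᶠ t)
  line-line [] [] s t = refl
  line-line (b ∷ x) (u ∷ y) s t = cong₂ _∷_ (merge b s u t) (line-line x y s t)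
    where
    merge : ∀ b s u t → b +ᶠ s *ᶠ u +ᶠ t *ᶠ u ≡ b +ᶠ (s +ᶠ t) *ᶠ u
    merge = solve 4 (λ b s u t → b :+ s :* u :+ t :* u := b :+ (s :+ t) :* u) refl

  line-back : ∀ {n} (b u : Pt n) t → line (line b u t) u (-ᶠ t) ≡ b
  line-back b u t = trans (line-line b u t (-ᶠ t)) (trans (cong (line b u) (+ᶠ-inverseʳ t)) (line-0 b u))

  line-back′ : ∀ {n} (b u : Pt n) t → line (line b u (-ᶠ t)) u t ≡ b
  line-back′ b u t = trans (line-line b u (-ᶠ t) t) (trans (cong (line b u) (+ᶠ-inverseˡ t)) (line-0 b u))

  line-injective : ∀ {n} (b u : Pt n) {s t} → ¬ (u ≡ 0ᵥ) → line b u s ≡ line b u t → s ≡ t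
  line-injective [] [] u≢0 e = contradiction refl u≢0
  line-injective (b ∷ x) (u ∷ y) {s} {t} u≢0 e with u ≟ᶠ 0ᶠ
  ... | no u≢ = *-cancelʳ u≢ (+ᶠ-cancelʳ b (trans (+ᶠ-comm _ b) (trans (Vecₚ.∷-injectiveˡ e) (+ᶠ-comm b _))))
  ... | yes refl = line-injective x y (λ y≡0 → u≢0 (cong (0ᶠ ∷_) y≡0)) (Vecₚ.∷-injectiveʳ e)

  infixl 6 _⊞_ _⊟_
  infixr 7 _⊙_

  -- Sum, difference and scalar multiple are instances of `line`, so that the laws proved for `line`
  -- cover them.
  _⊞_ _⊟_ : {n : ℕ} → Pt n → Pt n → Pt n
  x ⊞ y = line x y 1ᶠ
  x ⊟ y = line x y (-ᶠ 1ᶠ)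

  _⊙_ : {n : ℕ} → 𝔽 → Pt n → Pt n
  s ⊙ u = line 0ᵥ u s

  ⊞-⊟ : ∀ {n} (x y : Pt n) → (x ⊞ y) ⊟ y ≡ x
  ⊞-⊟ x y = line-back x y 1ᶠ

  ⊟-⊞ : ∀ {n} (x y : Pt n) → (x ⊟ y) ⊞ y ≡ x
  ⊟-⊞ x y = line-back′ x y 1ᶠ

  ⊟≡0⇒≡ : ∀ {n} {x y : Pt n} → x ⊟ y ≡ 0ᵥ → x ≡ y
  ⊟≡0⇒≡ {x = x} {y} e = trans (sym (⊟-⊞ x y)) (trans (cong (_⊞ y) e) (0⊞ y))
    where
    0⊞ : ∀ {n} (y : Pt n) → 0ᵥ ⊞ y ≡ y
    0⊞ [] = refl
    0⊞ (a ∷ y) = cong₂ _∷_ (trans (+ᶠ-identityˡ _) (*ᶠ-identityˡ a)) (0⊞ y)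

  dot-⊟ : ∀ {n} (w x y : Pt n) → dot w (x ⊟ y) ≡ dot w x +ᶠ (-ᶠ dot w y)
  dot-⊟ w x y = trans (dot-line w x y (-ᶠ 1ᶠ)) (neg (dot w x) (dot w y))
    where
    neg : ∀ a b → a +ᶠ (-ᶠ 1ᶠ) *ᶠ b ≡ a +ᶠ (-ᶠ b)
    neg = solve 2 (λ a b → a :+ (:- con (1 , 0)) :* b := a :+ (:- b)) refl

  dot-⊟ˡ : ∀ {n} (x y w : Pt n) → dot (x ⊟ y) w ≡ dot x w +ᶠ (-ᶠ dot y w)
  dot-⊟ˡ x y w = trans (dot-comm (x ⊟ y) w) (trans (dot-⊟ w x y) (cong₂ (λ a b → a +ᶠ (-ᶠ b)) (dot-comm w x) (dot-comm w y)))

  -- Every y ≠ z lies on the line through z in direction t⁻¹ (y - z), at parameter t.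
  line-through : ∀ {n} (z y : Pt n) {t} → ¬ (t ≡ 0ᶠ) → line z ((t ⁻¹ᶠ) ⊙ (y ⊟ z)) t ≡ y
  line-through [] [] t≢0 = refl
  line-through (z ∷ zs) (y ∷ ys) {t} t≢0 = cong₂ _∷_
    (trans (expand z y t (t ⁻¹ᶠ)) (trans (cong (λ c → z +ᶠ c *ᶠ (y +ᶠ (-ᶠ z))) (*-inverseʳ t t≢0)) (collapse z y)))
    (line-through zs ys t≢0)
    where
    expand : ∀ z y t i → z +ᶠ t *ᶠ (0ᶠ +ᶠ i *ᶠ (y +ᶠ (-ᶠ 1ᶠ) *ᶠ z)) ≡ z +ᶠ t *ᶠ i *ᶠ (y +ᶠ (-ᶠ z))
    expand = solve 4 (λ z y t i → z :+ t :* (con (0 , 0) :+ i :* (y :+ (:- con (1 , 0)) :* z)) := z :+ t :* i :* (y :+ (:- z))) refl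
    collapse : ∀ z y → z +ᶠ 1ᶠ *ᶠ (y +ᶠ (-ᶠ z)) ≡ y
    collapse = solve 2 (λ z y → z :+ con (1 , 0) :* (y :+ (:- z)) := y) refl

  ∑ᶠ-shift : ∀ s (g : 𝔽 → ℕ) → ∑ᶠ (λ t → g (t +ᶠ s)) ≡ ∑ᶠ g
  ∑ᶠ-shift s g = ∑-reindex finite𝔽 finite𝔽 (_+ᶠ s) (_+ᶠ (-ᶠ s)) (λ x → x+y-y≡x x s) (λ x → x-y+y≡x x s) g

  ∑ᵖ-translate : ∀ {n} (u : Pt n) t (g : Pt n → ℕ) → ∑ᵖ n (λ x → g (line x u t)) ≡ ∑ᵖ n g
  ∑ᵖ-translate {n} u t g = ∑-reindex (finitePt n) (finitePt n) (λ x → line x u t) (λ x → line x u (-ᶠ t))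
    (λ x → line-back x u t) (λ x → line-back′ x u t) g

  ∷-zero : ∀ {n} {a : 𝔽} {v : Pt n} → ¬ (a ∷ v ≡ 0ᵥ) → v ≡ 0ᵥ → ¬ (a ≡ 0ᶠ)
  ∷-zero av≢0 refl refl = av≢0 refl

  -- The factor `q` stands on the left to avoid division. If the tail of `v` is nonzero, each value
  -- of the first coordinate leaves an instance one dimension lower; otherwise the first coordinate
  -- is forced to be `b / a` and the others are free.
  hyperplane-count : ∀ {n} (v : Pt n) → ¬ (v ≡ 0ᵥ) → ∀ b → q * ∑ᵖ n (λ w → I (dot w v ≟ᶠ b)) ≡ q ^ n
  hyperplane-count [] v≢0 b = contradiction refl v≢0
  hyperplane-count {suc n} (a ∷ v) v≢0 b = trans (cong (q *_) (∑ᵖ-suc n _)) (step (v ≟ᵖ 0ᵥ))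
    where
    open ≡-Reasoning
    step : Dec (v ≡ 0ᵥ) → q * ∑ᶠ (λ c → ∑ᵖ n (λ w → I (c *ᶠ a +ᶠ dot w v ≟ᶠ b))) ≡ q * q ^ n
    step (no v≢) = begin
      q * ∑ᶠ (λ c → ∑ᵖ n (λ w → I (c *ᶠ a +ᶠ dot w v ≟ᶠ b)))
        ≡⟨ sym (∑-*ˡ elements q _) ⟩
      ∑ᶠ (λ c → q * ∑ᵖ n (λ w → I (c *ᶠ a +ᶠ dot w v ≟ᶠ b)))
        ≡⟨ ∑-cong elements (λ c → trans (cong (q *_) (∑-cong (points n) (λ w → I-cong (_ ≟ᶠ b) (_ ≟ᶠ _)
             (λ e → trans (sym (cancel (c *ᶠ a) (dot w v))) (cong (_+ᶠ (-ᶠ (c *ᶠ a))) e))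
             (λ e → trans (cong (c *ᶠ a +ᶠ_) e) (back (c *ᶠ a) b)))))
             (hyperplane-count v v≢ (b +ᶠ (-ᶠ (c *ᶠ a))))) ⟩
      ∑ᶠ (λ _ → q ^ n)
        ≡⟨ ∑-const elements (q ^ n) ⟩
      q * q ^ n ∎
      where
      cancel : ∀ x y → x +ᶠ y +ᶠ (-ᶠ x) ≡ y
      cancel = solve 2 (λ x y → x :+ y :+ (:- x) := y) refl
      back : ∀ x y → x +ᶠ (y +ᶠ (-ᶠ x)) ≡ y
      back = solve 2 (λ x y → x :+ (y :+ (:- x)) := y) refl
    step (yes refl) = cong (q *_) (begin
      ∑ᶠ (λ c → ∑ᵖ n (λ w → I (c *ᶠ a +ᶠ dot w 0ᵥ ≟ᶠ b)))
        ≡⟨ ∑-cong elements (λ c → trans (∑-cong (points n) (λ w → I-cong (_ ≟ᶠ b) (c ≟ᶠ b *ᶠ (a ⁻¹ᶠ))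
             (λ e → trans (sym (*-cancel-inverse′ c a≢0)) (cong (_*ᶠ (a ⁻¹ᶠ)) (trans (sym (drop c w)) e)))
             (λ e → trans (drop c w) (trans (cong (_*ᶠ a) e) (*-cancel-inverse b a≢0)))))
             (trans (∑ᵖ-const n _) (*-comm (q ^ n) _))) ⟩
      ∑ᶠ (λ c → I (c ≟ᶠ b *ᶠ (a ⁻¹ᶠ)) * q ^ n)
        ≡⟨ Finite.∑-δ finite𝔽 (b *ᶠ (a ⁻¹ᶠ)) (λ _ → q ^ n) ⟩
      q ^ n ∎)
      where
      a≢0 : ¬ (a ≡ 0ᶠ)
      a≢0 = ∷-zero v≢0 refl
      drop : ∀ c w → c *ᶠ a +ᶠ dot w 0ᵥ ≡ c *ᶠ a
      drop c w = trans (cong (c *ᶠ a +ᶠ_) (dot-zeroʳ w)) (+ᶠ-identityʳ _)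

  q>0 : 0 < q
  q>0 with elements | FiniteField.elements-complete F 0ᶠ
  ... | _ ∷ _ | _ = s≤s z≤n

  q>1 : 1 < q
  q>1 = ≰⇒> λ q≤1 → 1ᶠ≢0ᶠ (at-most-one q≤1 (FiniteField.elements-complete F 1ᶠ) (FiniteField.elements-complete F 0ᶠ))
    where
    at-most-one : {xs : List 𝔽} → length xs ≤ 1 → ∀ {x y} → x ∈ xs → y ∈ xs → x ≡ y
    at-most-one {_ ∷ []} _ (here refl) (here refl) = refl
    at-most-one {_ ∷ _ ∷ _} (s≤s ()) _ _

-- Power series in one variable, truncated evaluation and root counting.

module Series (F : FiniteField) where
  open import Data.Nat using (_+_; _≤_; _<_)
  open import Data.Nat.Properties hiding (_≟_)
  open FiniteSums
  open FieldAlgebra F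

  -- One type serves for polynomials and for power series: a degree bound is a predicate, and every
  -- evaluation states its truncation order. The branch found by Newton iteration comes without an a
  -- priori degree.
  Ser : Set
  Ser = ℕ → 𝔽

  conv : Ser → Ser → Ser
  conv a b zero = a 0 *ᶠ b 0
  conv a b (suc n) = a 0 *ᶠ b (suc n) +ᶠ conv (a ∘ suc) b n

  -- ev n a t is the value at t of the truncation of a to degree < n.
  ev : ℕ → Ser → 𝔽 → 𝔽
  ev zero a t = 0ᶠ
  ev (suc n) a t = a 0 +ᶠ t *ᶠ ev n (a ∘ suc) t

  Deg : ℕ → Ser → Set
  Deg d a = ∀ i → d < i → a i ≡ 0ᶠ

  const : 𝔽 → Ser
  const c zero = c
  const c (suc _) = 0ᶠ

  lin : 𝔽 → 𝔽 → Ser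
  lin b u zero = b
  lin b u (suc zero) = u
  lin b u (suc (suc _)) = 0ᶠ

  ev-cong : ∀ n {a b : Ser} t → (∀ i → i < n → a i ≡ b i) → ev n a t ≡ ev n b t
  ev-cong zero t e = refl
  ev-cong (suc n) t e = cong₂ (λ x y → x +ᶠ t *ᶠ y) (e 0 (s≤s z≤n)) (ev-cong n t (λ i i<n → e (suc i) (s≤s i<n)))

  ev-zero : ∀ n {a : Ser} t → (∀ i → i < n → a i ≡ 0ᶠ) → ev n a t ≡ 0ᶠ
  ev-zero zero t e = refl
  ev-zero (suc n) t e = trans (cong₂ (λ x y → x +ᶠ t *ᶠ y) (e 0 (s≤s z≤n)) (ev-zero n t (λ i i<n → e (suc i) (s≤s i<n))))
    (trans (+ᶠ-identityˡ _) (*ᶠ-zeroʳ t))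

  ev-+ : ∀ n (a b : Ser) t → ev n (λ i → a i +ᶠ b i) t ≡ ev n a t +ᶠ ev n b t
  ev-+ zero a b t = sym (+ᶠ-identityˡ 0ᶠ)
  ev-+ (suc n) a b t = trans (cong (λ z → a 0 +ᶠ b 0 +ᶠ t *ᶠ z) (ev-+ n (a ∘ suc) (b ∘ suc) t)) (shuffle _ _ t _ _)
    where
    shuffle : ∀ x y t u v → x +ᶠ y +ᶠ t *ᶠ (u +ᶠ v) ≡ x +ᶠ t *ᶠ u +ᶠ (y +ᶠ t *ᶠ v)
    shuffle = solve 5 (λ x y t u v → x :+ y :+ t :* (u :+ v) := x :+ t :* u :+ (y :+ t :* v)) refl

  ev-scale : ∀ n c (a : Ser) t → ev n (λ i → c *ᶠ a i) t ≡ c *ᶠ ev n a t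
  ev-scale zero c a t = sym (*ᶠ-zeroʳ c)
  ev-scale (suc n) c a t = trans (cong (λ z → c *ᶠ a 0 +ᶠ t *ᶠ z) (ev-scale n c (a ∘ suc) t)) (shuffle c _ t _)
    where
    shuffle : ∀ c x t u → c *ᶠ x +ᶠ t *ᶠ (c *ᶠ u) ≡ c *ᶠ (x +ᶠ t *ᶠ u)
    shuffle = solve 4 (λ c x t u → c :* x :+ t :* (c :* u) := c :* (x :+ t :* u)) refl

  ev-ext : ∀ d n {a : Ser} t → Deg d a → d ≤ n → ev (suc n) a t ≡ ev (suc d) a t
  ev-ext zero n {a} t deg _ = cong (λ z → a 0 +ᶠ t *ᶠ z) (ev-zero n t (λ i _ → deg (suc i) (s≤s z≤n)))
  ev-ext (suc d) (suc n) {a} t deg (s≤s d≤n) = cong (λ z → a 0 +ᶠ t *ᶠ z) (ev-ext d n t (λ i d<i → deg (suc i) (s≤s d<i)) d≤n)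

  ev-at-0 : ∀ n (a : Ser) → ev (suc n) a 0ᶠ ≡ a 0
  ev-at-0 n a = trans (cong (a 0 +ᶠ_) (*ᶠ-zeroˡ _)) (+ᶠ-identityʳ _)

  conv-cong : ∀ n {a a' b b' : Ser} → (∀ i → i ≤ n → a i ≡ a' i) → (∀ i → i ≤ n → b i ≡ b' i) → conv a b n ≡ conv a' b' n
  conv-cong zero e f = cong₂ _*ᶠ_ (e 0 z≤n) (f 0 z≤n)
  conv-cong (suc n) e f = cong₂ _+ᶠ_ (cong₂ _*ᶠ_ (e 0 z≤n) (f (suc n) ≤-refl))
    (conv-cong n (λ i i≤n → e (suc i) (s≤s i≤n)) (λ i i≤n → f i (m≤n⇒m≤1+n i≤n)))

  conv-zeroˡ : ∀ n {a b : Ser} → (∀ i → a i ≡ 0ᶠ) → conv a b n ≡ 0ᶠ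
  conv-zeroˡ zero {b = b} e = trans (cong (_*ᶠ b 0) (e 0)) (*ᶠ-zeroˡ _)
  conv-zeroˡ (suc n) {b = b} e = trans (cong₂ _+ᶠ_ (trans (cong (_*ᶠ b (suc n)) (e 0)) (*ᶠ-zeroˡ _)) (conv-zeroˡ n (e ∘ suc))) (+ᶠ-identityˡ 0ᶠ)

  conv-constˡ : ∀ n {a b : Ser} → Deg 0 a → conv a b n ≡ a 0 *ᶠ b n
  conv-constˡ zero deg = refl
  conv-constˡ (suc n) deg = trans (cong (_ +ᶠ_) (conv-zeroˡ n (λ i → deg (suc i) (s≤s z≤n)))) (+ᶠ-identityʳ _)

  Deg-conv : ∀ d e {a b : Ser} → Deg d a → Deg e b → Deg (d + e) (conv a b)
  Deg-conv zero e {a} da db i lt = trans (conv-constˡ i da) (trans (cong (a 0 *ᶠ_) (db i lt)) (*ᶠ-zeroʳ _))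
  Deg-conv (suc d) e {a} da db (suc i) (s≤s lt) = trans
    (cong₂ _+ᶠ_ (trans (cong (a 0 *ᶠ_) (db (suc i) (≤-trans (s≤s (m≤n+m e d)) (m≤n⇒m≤1+n lt)))) (*ᶠ-zeroʳ _))
                (Deg-conv d e (λ j d<j → da (suc j) (s≤s d<j)) db i lt))
    (+ᶠ-identityˡ 0ᶠ)

  conv-top : ∀ d e {a b : Ser} → Deg d a → Deg e b → conv a b (d + e) ≡ a d *ᶠ b e
  conv-top zero e da db = conv-constˡ e da
  conv-top (suc d) e {a} da db = trans
    (cong₂ _+ᶠ_ (trans (cong (a 0 *ᶠ_) (db (suc (d + e)) (s≤s (m≤n+m e d)))) (*ᶠ-zeroʳ _))
                (conv-top d e (λ j d<j → da (suc j) (s≤s d<j)) db))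
    (+ᶠ-identityˡ _)

  ev-conv : ∀ d e {a b : Ser} t → Deg d a → Deg e b → ev (suc (d + e)) (conv a b) t ≡ ev (suc d) a t *ᶠ ev (suc e) b t
  ev-conv zero e {a} {b} t da db = trans (ev-cong (suc e) t (λ i _ → conv-constˡ i {a} {b} da))
    (trans (ev-scale (suc e) (a 0) b t) (cong (_*ᶠ ev (suc e) b t) (sym (trans (cong (a 0 +ᶠ_) (*ᶠ-zeroʳ t)) (+ᶠ-identityʳ _)))))
  ev-conv (suc d) e {a} {b} t da db = begin
    a 0 *ᶠ b 0 +ᶠ t *ᶠ ev (suc (d + e)) (λ i → a 0 *ᶠ b (suc i) +ᶠ conv (a ∘ suc) b i) t
      ≡⟨ cong (λ z → a 0 *ᶠ b 0 +ᶠ t *ᶠ z) (trans (ev-+ (suc (d + e)) (λ i → a 0 *ᶠ b (suc i)) (conv (a ∘ suc) b) t)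
           (cong₂ _+ᶠ_ (ev-scale (suc (d + e)) (a 0) (b ∘ suc) t) (ev-conv d e t (λ j d<j → da (suc j) (s≤s d<j)) db))) ⟩
    a 0 *ᶠ b 0 +ᶠ t *ᶠ (a 0 *ᶠ ev (suc (d + e)) (b ∘ suc) t +ᶠ A *ᶠ B)
      ≡⟨ shuffle (a 0) (b 0) t _ A B ⟩
    a 0 *ᶠ ev (suc (suc (d + e))) b t +ᶠ t *ᶠ A *ᶠ B
      ≡⟨ cong (λ z → a 0 *ᶠ z +ᶠ t *ᶠ A *ᶠ B) (ev-ext e (suc (d + e)) t db (m≤n⇒m≤1+n (m≤n+m e d))) ⟩
    a 0 *ᶠ B +ᶠ t *ᶠ A *ᶠ B
      ≡⟨ collect (a 0) B t A ⟩
    (a 0 +ᶠ t *ᶠ A) *ᶠ B ∎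
    where
    open ≡-Reasoning
    A = ev (suc d) (a ∘ suc) t
    B = ev (suc e) b t
    shuffle : ∀ a b t u x y → a *ᶠ b +ᶠ t *ᶠ (a *ᶠ u +ᶠ x *ᶠ y) ≡ a *ᶠ (b +ᶠ t *ᶠ u) +ᶠ t *ᶠ x *ᶠ y
    shuffle = solve 6 (λ a b t u x y → a :* b :+ t :* (a :* u :+ x :* y) := a :* (b :+ t :* u) :+ t :* x :* y) refl
    collect : ∀ a y t x → a *ᶠ y +ᶠ t *ᶠ x *ᶠ y ≡ (a +ᶠ t *ᶠ x) *ᶠ y
    collect = solve 4 (λ a y t x → a :* y :+ t :* x :* y := (a :+ t :* x) :* y) refl

  Pert : ℕ → Ser → Ser → 𝔽 → Set
  Pert M a a' δ = (∀ i → i < M → a i ≡ a' i) × (a M ≡ a' M +ᶠ δ)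

  private
    pert-convˡ : ∀ M {a a' b b' : Ser} {δ} → Pert M a a' δ → (∀ i → i ≤ M → b i ≡ b' i) →
                 conv a b M ≡ conv a' b' M +ᶠ δ *ᶠ b 0
    pert-convˡ zero {a' = a'} {b} {b'} {δ} (_ , e) f = trans (cong (_*ᶠ b 0) e) (trans (expand (a' 0) δ (b 0)) (cong (λ z → a' 0 *ᶠ z +ᶠ δ *ᶠ b 0) (f 0 z≤n)))
      where
      expand : ∀ x y z → (x +ᶠ y) *ᶠ z ≡ x *ᶠ z +ᶠ y *ᶠ z
      expand = solve 3 (λ x y z → (x :+ y) :* z := x :* z :+ y :* z) refl
    pert-convˡ (suc M) (e , e') f = trans
      (cong₂ _+ᶠ_ (cong₂ _*ᶠ_ (e 0 (s≤s z≤n)) (f (suc M) ≤-refl))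
                  (pert-convˡ M ((λ i i<M → e (suc i) (s≤s i<M)) , e') (λ i i≤M → f i (m≤n⇒m≤1+n i≤M))))
      (sym (+ᶠ-assoc _ _ _))

  -- The product rule for a variation that is first visible in degree `suc M`. The degree has to be
  -- positive: in degree 0 the two variations would also contribute their product `δ ε`.
  pert-conv : ∀ M {a a' b b' : Ser} {δ ε} → Pert (suc M) a a' δ → Pert (suc M) b b' ε →
              Pert (suc M) (conv a b) (conv a' b') (δ *ᶠ b 0 +ᶠ a 0 *ᶠ ε)
  pert-conv M {a} {a'} {b} {b'} {δ} {ε} (e , e') (f , f') =
    (λ { i (s≤s i≤M) → conv-cong i (λ j j≤i → e j (s≤s (≤-trans j≤i i≤M))) (λ j j≤i → f j (s≤s (≤-trans j≤i i≤M))) }) ,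
    (begin
      a 0 *ᶠ b (suc M) +ᶠ conv (a ∘ suc) b M
        ≡⟨ cong₂ _+ᶠ_ (cong (a 0 *ᶠ_) f') (pert-convˡ M ((λ i i<M → e (suc i) (s≤s i<M)) , e') (λ i i≤M → f i (s≤s i≤M))) ⟩
      a 0 *ᶠ (b' (suc M) +ᶠ ε) +ᶠ (conv (a' ∘ suc) b' M +ᶠ δ *ᶠ b 0)
        ≡⟨ shuffle (a 0) (b' (suc M)) ε (conv (a' ∘ suc) b' M) (δ *ᶠ b 0) ⟩
      a 0 *ᶠ b' (suc M) +ᶠ conv (a' ∘ suc) b' M +ᶠ (δ *ᶠ b 0 +ᶠ a 0 *ᶠ ε)
        ≡⟨ cong (λ z → z *ᶠ b' (suc M) +ᶠ conv (a' ∘ suc) b' M +ᶠ (δ *ᶠ b 0 +ᶠ a 0 *ᶠ ε)) (e 0 (s≤s z≤n)) ⟩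
      a' 0 *ᶠ b' (suc M) +ᶠ conv (a' ∘ suc) b' M +ᶠ (δ *ᶠ b 0 +ᶠ a 0 *ᶠ ε) ∎)
    where
    open ≡-Reasoning
    shuffle : ∀ a b e c d → a *ᶠ (b +ᶠ e) +ᶠ (c +ᶠ d) ≡ a *ᶠ b +ᶠ c +ᶠ (d +ᶠ a *ᶠ e)
    shuffle = solve 5 (λ a b e c d → a :* (b :+ e) :+ (c :+ d) := a :* b :+ c :+ (d :+ a :* e)) refl

  -- Synthetic division by `t - r`, with remainder the value at `r`; the defining identity is
  -- `ev-quo`.
  quo : ℕ → Ser → 𝔽 → Ser
  quo n a r zero = ev n (a ∘ suc) r
  quo zero a r (suc i) = 0ᶠ
  quo (suc n) a r (suc i) = quo n (a ∘ suc) r i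

  ev-quo : ∀ n a r t → ev (suc n) a t ≡ ev (suc n) a r +ᶠ (t +ᶠ (-ᶠ r)) *ᶠ ev n (quo n a r) t
  ev-quo zero a r t = zero-case (a 0) t r
    where
    zero-case : ∀ a t r → a +ᶠ t *ᶠ 0ᶠ ≡ a +ᶠ r *ᶠ 0ᶠ +ᶠ (t +ᶠ (-ᶠ r)) *ᶠ 0ᶠ
    zero-case = solve 3 (λ a t r → a :+ t :* con (0 , 0) := a :+ r :* con (0 , 0) :+ (t :+ (:- r)) :* con (0 , 0)) refl
  ev-quo (suc n) a r t = trans (cong (λ z → a 0 +ᶠ t *ᶠ z) (ev-quo n (a ∘ suc) r t))
      (shuffle (a 0) t r (ev (suc n) (a ∘ suc) r) (ev n (quo n (a ∘ suc) r) t))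
    where
    shuffle : ∀ a t r X Y → a +ᶠ t *ᶠ (X +ᶠ (t +ᶠ (-ᶠ r)) *ᶠ Y) ≡ a +ᶠ r *ᶠ X +ᶠ (t +ᶠ (-ᶠ r)) *ᶠ (X +ᶠ t *ᶠ Y)
    shuffle = solve 5 (λ a t r X Y → a :+ t :* (X :+ (t :+ (:- r)) :* Y) := a :+ r :* X :+ (t :+ (:- r)) :* (X :+ t :* Y)) refl

  private
    quo-zero : ∀ n a r → ev (suc n) a r ≡ 0ᶠ → (∀ i → i < n → quo n a r i ≡ 0ᶠ) → ∀ i → i < suc n → a i ≡ 0ᶠ
    quo-zero zero a r e z zero _ = trans (sym (trans (cong (a 0 +ᶠ_) (*ᶠ-zeroʳ r)) (+ᶠ-identityʳ _))) e
    quo-zero zero a r e z (suc i) (s≤s ())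
    quo-zero (suc n) a r e z zero _ =
      trans (sym (trans (cong (λ y → a 0 +ᶠ r *ᶠ y) (z 0 (s≤s z≤n))) (trans (cong (a 0 +ᶠ_) (*ᶠ-zeroʳ r)) (+ᶠ-identityʳ _)))) e
    quo-zero (suc n) a r e z (suc i) (s≤s lt) =
      quo-zero n (a ∘ suc) r (z 0 (s≤s z≤n)) (λ j j<n → z (suc j) (s≤s j<n)) i lt

  -- Each root is divided out by `quo`. The other roots remain roots of the quotient because they
  -- differ from the one removed, and the truncation order drops by one.
  roots⇒zero : ∀ n (a : Ser) {rs : List 𝔽} → Unique rs → All (λ r → ev n a r ≡ 0ᶠ) rs → n ≤ length rs →
               ∀ i → i < n → a i ≡ 0ᶠ
  roots⇒zero (suc n) a {r ∷ rs} (r≢ ∷ u) (z ∷ zs) (s≤s le) =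
    quo-zero n a r z (roots⇒zero n (quo n a r) u (rest r≢ zs) le)
    where
    rest : ∀ {xs} → All (λ x → ¬ (r ≡ x)) xs → All (λ x → ev (suc n) a x ≡ 0ᶠ) xs → All (λ x → ev n (quo n a r) x ≡ 0ᶠ) xs
    rest [] [] = []
    rest {x ∷ _} (r≢x ∷ ps) (e ∷ es) = no-zero-divisors (λ x-r≡0 → r≢x (sym (x-y≡0⇒x≡y x-r≡0)))
      (trans (*ᶠ-comm _ _) (trans (sym (trans (ev-quo n a r x) (trans (cong (_+ᶠ ((x +ᶠ (-ᶠ r)) *ᶠ ev n (quo n a r) x)) z) (+ᶠ-identityˡ _)))) e)) ∷ rest ps es

  -- The same with the roots singled out by a decidable predicate, so that agreement counts given as
  -- sums of indicators apply directly.
  many-roots⇒zero : ∀ n (a : Ser) {P : 𝔽 → Set} (P? : ∀ t → Dec (P t)) → (∀ t → P t → ev n a t ≡ 0ᶠ) →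
                    n ≤ ∑ᶠ (λ t → I (P? t)) → ∀ i → i < n → a i ≡ 0ᶠ
  many-roots⇒zero n a P? z le = roots⇒zero n a (Unique.filter⁺ P? (FiniteField.elements-unique F))
    (All.map (λ {t} → z t) (Allₚ.all-filter P? elements)) (subst (n ≤_) (sym (length-filter≡∑ P? elements)) le)

  root-count : ∀ d (a : Ser) t₀ → ¬ (ev (suc d) a t₀ ≡ 0ᶠ) → ∑ᶠ (λ t → I (ev (suc d) a t ≟ᶠ 0ᶠ)) ≤ d
  root-count d a t₀ nz = ≮⇒≥ λ lt → nz (ev-zero (suc d) t₀ (many-roots⇒zero (suc d) a (λ t → ev (suc d) a t ≟ᶠ 0ᶠ) (λ _ e → e) lt))

  ev-injective : ∀ n (a b : Ser) {P : 𝔽 → Set} (P? : ∀ t → Dec (P t)) → (∀ t → P t → ev n a t ≡ ev n b t) →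
                 n ≤ ∑ᶠ (λ t → I (P? t)) → ∀ i → i < n → a i ≡ b i
  ev-injective n a b P? e le i lt = x-y≡0⇒x≡y (many-roots⇒zero n (λ j → a j +ᶠ (-ᶠ b j)) P?
    (λ t p → trans (difference t) (x≡y⇒x-y≡0 (e t p))) le i lt)
    where
    neg1 : ∀ x → -ᶠ x ≡ (-ᶠ 1ᶠ) *ᶠ x
    neg1 = solve 1 (λ x → :- x := (:- con (1 , 0)) :* x) refl
    difference : ∀ t → ev n (λ j → a j +ᶠ (-ᶠ b j)) t ≡ ev n a t +ᶠ (-ᶠ ev n b t)
    difference t = trans (ev-+ n a (λ j → -ᶠ b j) t) (cong (ev n a t +ᶠ_)
      (trans (ev-cong n t (λ j _ → neg1 (b j))) (trans (ev-scale n (-ᶠ 1ᶠ) b t) (sym (neg1 _)))))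

  coeffs : {n : ℕ} → Vec 𝔽 n → Ser
  coeffs [] i = 0ᶠ
  coeffs (c ∷ cs) zero = c
  coeffs (c ∷ cs) (suc i) = coeffs cs i

  evalU≡ev : ∀ {n} (cs : Vec 𝔽 n) t → evalU F cs t ≡ ev n (coeffs cs) t
  evalU≡ev [] t = refl
  evalU≡ev (c ∷ cs) t = cong (λ z → c +ᶠ t *ᶠ z) (evalU≡ev cs t)

  Deg-coeffs : ∀ {d} (cs : Vec 𝔽 (suc d)) → Deg d (coeffs cs)
  Deg-coeffs cs i lt = go cs i lt
    where
    go : ∀ {n} (cs : Vec 𝔽 n) i → n ≤ i → coeffs cs i ≡ 0ᶠ
    go [] i _ = refl
    go (c ∷ cs) (suc i) (s≤s le) = go cs i le

-- Multivariate polynomials, their restriction to lines, and the Schwartz-Zippel bound.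

module Polynomials (F : FiniteField) where
  open import Data.Nat using (_+_; _*_; _^_; _≤_; _<_)
  open import Data.Nat.Properties hiding (_≟_)
  open FiniteSums
  open FieldAlgebra F
  open Series F

  private
    variable
      m n d e : ℕ

  Terms : ℕ → Set
  Terms m = List (𝔽 × Vec ℕ m)

  evalT : Terms m → Pt m → 𝔽
  evalT ts x = foldr (λ tm acc → (proj₁ tm *ᶠ evalMono F (proj₂ tm) x) +ᶠ acc) 0ᶠ ts

  mono : Vec ℕ m → Pt m → 𝔽
  mono = evalMono F

  pow : 𝔽 → ℕ → 𝔽
  pow = _^F_ F

  pow-+ : ∀ x i j → pow x (i + j) ≡ pow x i *ᶠ pow x j
  pow-+ x zero j = sym (*ᶠ-identityˡ _)
  pow-+ x (suc i) j = trans (cong (x *ᶠ_) (pow-+ x i j)) (sym (*ᶠ-assoc x _ _))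

  mono-0 : (x : Pt m) → mono (replicate m 0) x ≡ 1ᶠ
  mono-0 [] = refl
  mono-0 (a ∷ x) = trans (*ᶠ-identityˡ _) (mono-0 x)

  sum-0 : ∀ m → Vec.sum (replicate m 0) ≡ 0
  sum-0 zero = refl
  sum-0 (suc m) = sum-0 m

  mono-+ : (α β : Vec ℕ m) (x : Pt m) → mono (zipWith _+_ α β) x ≡ mono α x *ᶠ mono β x
  mono-+ [] [] [] = sym (*ᶠ-identityˡ 1ᶠ)
  mono-+ (i ∷ α) (j ∷ β) (a ∷ x) = trans (cong₂ _*ᶠ_ (pow-+ a i j) (mono-+ α β x)) (shuffle _ _ _ _)
    where
    shuffle : ∀ a b c d → a *ᶠ b *ᶠ (c *ᶠ d) ≡ a *ᶠ c *ᶠ (b *ᶠ d)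
    shuffle = solve 4 (λ a b c d → a :* b :* (c :* d) := a :* c :* (b :* d)) refl

  sum-+ : (α β : Vec ℕ m) → Vec.sum (zipWith _+_ α β) ≡ Vec.sum α + Vec.sum β
  sum-+ [] [] = refl
  sum-+ (i ∷ α) (j ∷ β) = trans (cong (i + j +_) (sum-+ α β)) (shuffle i j (Vec.sum α) (Vec.sum β))
    where
    shuffle : ∀ a b c d → a + b + (c + d) ≡ a + c + (b + d)
    shuffle = ringℕ

  evalT-++ : (ts us : Terms m) (x : Pt m) → evalT (ts ++ us) x ≡ evalT ts x +ᶠ evalT us x
  evalT-++ [] us x = sym (+ᶠ-identityˡ _)
  evalT-++ (t ∷ ts) us x = trans (cong (_ +ᶠ_) (evalT-++ ts us x)) (sym (+ᶠ-assoc _ _ _))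

  private
    times : 𝔽 × Vec ℕ m → Terms m → Terms m
    times (c , α) us = map (λ (b , β) → c *ᶠ b , zipWith _+_ α β) us

    evalT-times : (t : 𝔽 × Vec ℕ m) (us : Terms m) (x : Pt m) → evalT (times t us) x ≡ proj₁ t *ᶠ mono (proj₂ t) x *ᶠ evalT us x
    evalT-times t [] x = sym (*ᶠ-zeroʳ _)
    evalT-times (c , α) ((b , β) ∷ us) x = trans
      (cong₂ (λ y z → c *ᶠ b *ᶠ y +ᶠ z) (mono-+ α β x) (evalT-times (c , α) us x)) (shuffle c b (mono α x) (mono β x) (evalT us x))
      where
      shuffle : ∀ c b y z u → c *ᶠ b *ᶠ (y *ᶠ z) +ᶠ c *ᶠ y *ᶠ u ≡ c *ᶠ y *ᶠ (b *ᶠ z +ᶠ u)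
      shuffle = solve 5 (λ c b y z u → c :* b :* (y :* z) :+ c :* y :* u := c :* y :* (b :* z :+ u)) refl

    mulT : Terms m → Terms m → Terms m
    mulT [] us = []
    mulT (t ∷ ts) us = times t us ++ mulT ts us

    evalT-mul : (ts us : Terms m) (x : Pt m) → evalT (mulT ts us) x ≡ evalT ts x *ᶠ evalT us x
    evalT-mul [] us x = sym (*ᶠ-zeroˡ _)
    evalT-mul (t ∷ ts) us x = trans (evalT-++ (times t us) _ x)
      (trans (cong₂ _+ᶠ_ (evalT-times t us x) (evalT-mul ts us x)) (shuffle _ _ _))
      where
      shuffle : ∀ a b c → a *ᶠ b +ᶠ c *ᶠ b ≡ (a +ᶠ c) *ᶠ b
      shuffle = solve 3 (λ a b c → a :* b :+ c :* b := (a :+ c) :* b) refl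

    mulT-degree : (ts us : Terms m) → All (λ t → Vec.sum (proj₂ t) ≤ d) ts → All (λ t → Vec.sum (proj₂ t) ≤ e) us →
                  All (λ t → Vec.sum (proj₂ t) ≤ d + e) (mulT ts us)
    mulT-degree [] us [] es = []
    mulT-degree ((c , α) ∷ ts) us (p ∷ ps) es = Allₚ.++⁺
      (Allₚ.map⁺ (All.map (λ {(b , β)} r → ≤-trans (≤-reflexive (sum-+ α β)) (+-mono-≤ p r)) es)) (mulT-degree ts us ps es)

  -- A property of the function, with existence of a representing term list as its content. Over a
  -- finite field a function has many representations, and the closure properties are about
  -- functions.
  IsPoly : (m d : ℕ) → (Pt m → 𝔽) → Set
  IsPoly m d g = Σ (MPoly F m d) λ Q → ∀ x → evalM F Q x ≡ g x

  poly-cong : {g h : Pt m → 𝔽} → (∀ x → g x ≡ h x) → IsPoly m d g → IsPoly m d h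
  poly-cong e (Q , p) = Q , λ x → trans (p x) (e x)

  poly-weaken : {g : Pt m → 𝔽} → d ≤ e → IsPoly m d g → IsPoly m e g
  poly-weaken d≤e (Q , p) = record { terms = MPoly.terms Q ; degree = All.map (λ r → ≤-trans r d≤e) (MPoly.degree Q) } , p

  poly-const : (c : 𝔽) → IsPoly m d (λ _ → c)
  poly-const {m} c = record { terms = (c , replicate m 0) ∷ [] ; degree = ≤-trans (≤-reflexive (sum-0 m)) z≤n ∷ [] } ,
    λ x → trans (+ᶠ-identityʳ _) (trans (cong (c *ᶠ_) (mono-0 x)) (*ᶠ-identityʳ c))

  poly-+ : {g h : Pt m → 𝔽} → IsPoly m d g → IsPoly m d h → IsPoly m d (λ x → g x +ᶠ h x)
  poly-+ (Q , p) (R , r) = record { terms = MPoly.terms Q ++ MPoly.terms R ; degree = Allₚ.++⁺ (MPoly.degree Q) (MPoly.degree R) } ,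
    λ x → trans (evalT-++ (MPoly.terms Q) (MPoly.terms R) x) (cong₂ _+ᶠ_ (p x) (r x))

  poly-* : {g h : Pt m → 𝔽} → IsPoly m d g → IsPoly m e h → IsPoly m (d + e) (λ x → g x *ᶠ h x)
  poly-* (Q , p) (R , r) =
    record { terms = mulT (MPoly.terms Q) (MPoly.terms R) ; degree = mulT-degree _ _ (MPoly.degree Q) (MPoly.degree R) } ,
    λ x → trans (evalT-mul (MPoly.terms Q) (MPoly.terms R) x) (cong₂ _*ᶠ_ (p x) (r x))

  poly-scale : {g : Pt m → 𝔽} (c : 𝔽) → IsPoly m d g → IsPoly m d (λ x → c *ᶠ g x)
  poly-scale c p = poly-* (poly-const {d = 0} c) p

  poly-neg : {g : Pt m → 𝔽} → IsPoly m d g → IsPoly m d (λ x → -ᶠ g x)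
  poly-neg {g = g} p = poly-cong (λ x → neg (g x)) (poly-scale (-ᶠ 1ᶠ) p)
    where
    neg : ∀ x → (-ᶠ 1ᶠ) *ᶠ x ≡ -ᶠ x
    neg = solve 1 (λ x → (:- con (1 , 0)) :* x := :- x) refl

  poly-- : {g h : Pt m → 𝔽} → IsPoly m d g → IsPoly m d h → IsPoly m d (λ x → g x +ᶠ (-ᶠ h x))
  poly-- p r = poly-+ p (poly-neg r)

  private
    unit : Fin m → Vec ℕ m
    unit {suc m} zero = 1 ∷ replicate m 0
    unit {suc m} (suc i) = 0 ∷ unit i

    sum-unit : (i : Fin m) → Vec.sum (unit i) ≡ 1
    sum-unit {suc m} zero = cong suc (sum-0 m)
    sum-unit {suc m} (suc i) = sum-unit i

    mono-unit : (i : Fin m) (x : Pt m) → mono (unit i) x ≡ lookup x i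
    mono-unit zero (a ∷ x) = trans (cong₂ _*ᶠ_ (*ᶠ-identityʳ a) (mono-0 x)) (*ᶠ-identityʳ a)
    mono-unit (suc i) (a ∷ x) = trans (*ᶠ-identityˡ _) (mono-unit i x)

  poly-var : (i : Fin m) → IsPoly m 1 (λ x → lookup x i)
  poly-var i = record { terms = (1ᶠ , unit i) ∷ [] ; degree = ≤-reflexive (sum-unit i) ∷ [] } ,
    λ x → trans (+ᶠ-identityʳ _) (trans (*ᶠ-identityˡ _) (mono-unit i x))

  poly-pow : {g : Pt m → 𝔽} → IsPoly m 1 g → ∀ k → IsPoly m k (λ x → pow (g x) k)
  poly-pow p zero = poly-const 1ᶠ
  poly-pow p (suc k) = poly-* p (poly-pow p k)

  -- Substituting functions of degree one keeps the total degree, because each variable of a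
  -- monomial is replaced by a factor of degree at most one.
  poly-∘ : ∀ {k} {g : Pt m → 𝔽} → IsPoly m d g → (fs : Vec (Pt k → 𝔽) m) → VAll.All (IsPoly k 1) fs →
           IsPoly k d (λ x → g (Vec.map (λ f → f x) fs))
  poly-∘ {m} {d} {k} (Q , p) fs ps = poly-cong (λ x → p _) (go (MPoly.terms Q) (MPoly.degree Q))
    where
    mono-∘ : ∀ {m} (fs : Vec (Pt k → 𝔽) m) → VAll.All (IsPoly k 1) fs → (α : Vec ℕ m) →
             IsPoly k (Vec.sum α) (λ x → mono α (Vec.map (λ f → f x) fs))
    mono-∘ [] VAll.[] [] = poly-const 1ᶠ
    mono-∘ (f ∷ fs) (p VAll.∷ ps) (i ∷ α) = poly-* (poly-pow p i) (mono-∘ fs ps α)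
    go : (ts : Terms m) → All (λ t → Vec.sum (proj₂ t) ≤ d) ts → IsPoly k d (λ x → evalT ts (Vec.map (λ f → f x) fs))
    go [] [] = poly-const 0ᶠ
    go ((c , α) ∷ ts) (r ∷ rs) = poly-+ (poly-scale c (poly-weaken r (mono-∘ fs ps α))) (go ts rs)

  powS : Ser → ℕ → Ser
  powS s zero = const 1ᶠ
  powS s (suc k) = conv s (powS s k)

  monoS : Vec ℕ m → Vec Ser m → Ser
  monoS [] [] = const 1ᶠ
  monoS (i ∷ α) (s ∷ ss) = conv (powS s i) (monoS α ss)

  -- Formal substitution of series for the variables. It gives access to the coefficients of the
  -- composite, on which tangency and Newton iteration are statements.
  evalS : Terms m → Vec Ser m → Ser
  evalS [] ss i = 0ᶠ
  evalS ((c , α) ∷ ts) ss i = c *ᶠ monoS α ss i +ᶠ evalS ts ss i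

  weight : Vec ℕ m → Vec ℕ m → ℕ
  weight [] [] = 0
  weight (w ∷ ws) (i ∷ α) = i * w + weight ws α

  Degs : Vec ℕ m → Vec Ser m → Set
  Degs [] [] = ⊤
  Degs (w ∷ ws) (s ∷ ss) = Deg w s × Degs ws ss

  evs : Vec ℕ m → Vec Ser m → 𝔽 → Pt m
  evs ws ss t = zipWith (λ w s → ev (suc w) s t) ws ss

  Deg-const : ∀ c → Deg 0 (const c)
  Deg-const c (suc i) _ = refl

  Deg-powS : ∀ w (s : Ser) → Deg w s → ∀ k → Deg (k * w) (powS s k)
  Deg-powS w s ds zero = Deg-const 1ᶠ
  Deg-powS w s ds (suc k) = Deg-conv w (k * w) ds (Deg-powS w s ds k)

  Deg-monoS : (ws : Vec ℕ m) (ss : Vec Ser m) → Degs ws ss → (α : Vec ℕ m) → Deg (weight ws α) (monoS α ss)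
  Deg-monoS [] [] _ [] = Deg-const 1ᶠ
  Deg-monoS (w ∷ ws) (s ∷ ss) (ds , dss) (i ∷ α) = Deg-conv (i * w) (weight ws α) (Deg-powS w s ds i) (Deg-monoS ws ss dss α)

  ev-const : ∀ c t → ev 1 (const c) t ≡ c
  ev-const c t = trans (cong (c +ᶠ_) (*ᶠ-zeroʳ t)) (+ᶠ-identityʳ c)

  ev-powS : ∀ w (s : Ser) → Deg w s → ∀ t k → ev (suc (k * w)) (powS s k) t ≡ pow (ev (suc w) s t) k
  ev-powS w s ds t zero = ev-const 1ᶠ t
  ev-powS w s ds t (suc k) = trans (ev-conv w (k * w) t ds (Deg-powS w s ds k)) (cong (ev (suc w) s t *ᶠ_) (ev-powS w s ds t k))

  private
    ev-monoS : (ws : Vec ℕ m) (ss : Vec Ser m) → Degs ws ss → ∀ t (α : Vec ℕ m) →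
               ev (suc (weight ws α)) (monoS α ss) t ≡ mono α (evs ws ss t)
    ev-monoS [] [] _ t [] = ev-const 1ᶠ t
    ev-monoS (w ∷ ws) (s ∷ ss) (ds , dss) t (i ∷ α) =
      trans (ev-conv (i * w) (weight ws α) t (Deg-powS w s ds i) (Deg-monoS ws ss dss α))
            (cong₂ _*ᶠ_ (ev-powS w s ds t i) (ev-monoS ws ss dss t α))

  -- Formal substitution and evaluation agree once the truncation order exceeds the weighted degree,
  -- where each variable is weighted by the degree of the series put in its place.
  ev-evalS : ∀ D (ws : Vec ℕ m) (ss : Vec Ser m) → Degs ws ss → ∀ t (ts : Terms m) →
             All (λ tm → weight ws (proj₂ tm) ≤ D) ts → ev (suc D) (evalS ts ss) t ≡ evalT ts (evs ws ss t)
  ev-evalS D ws ss ds t [] [] = ev-zero (suc D) t (λ _ _ → refl)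
  ev-evalS D ws ss ds t ((c , α) ∷ ts) (r ∷ rs) = trans (ev-+ (suc D) (λ i → c *ᶠ monoS α ss i) (evalS ts ss) t)
    (cong₂ _+ᶠ_ (trans (ev-scale (suc D) c (monoS α ss) t) (cong (c *ᶠ_)
        (trans (ev-ext (weight ws α) D t (Deg-monoS ws ss ds α) r) (ev-monoS ws ss ds t α))))
      (ev-evalS D ws ss ds t ts rs))

  lineS : Pt m → Pt m → Vec Ser m
  lineS = zipWith lin

  ones : (m : ℕ) → Vec ℕ m
  ones m = replicate m 1

  weight-ones : (α : Vec ℕ m) → weight (ones m) α ≡ Vec.sum α
  weight-ones [] = refl
  weight-ones (i ∷ α) = cong₂ _+_ (*-identityʳ i) (weight-ones α)

  Deg-lin : ∀ b u → Deg 1 (lin b u)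
  Deg-lin b u (suc (suc i)) _ = refl
  Deg-lin b u (suc zero) (s≤s ())

  Degs-lineS : (b v : Pt m) → Degs (ones m) (lineS b v)
  Degs-lineS [] [] = tt
  Degs-lineS (b ∷ x) (v ∷ y) = Deg-lin b v , Degs-lineS x y

  evs-lineS : (b v : Pt m) (t : 𝔽) → evs (ones m) (lineS b v) t ≡ line b v t
  evs-lineS [] [] t = refl
  evs-lineS (b ∷ x) (v ∷ y) t = cong₂ _∷_ (cong (λ z → b +ᶠ t *ᶠ z) (ev-const v t)) (evs-lineS x y t)

  -- The form in which Schwartz-Zippel and the root counts on lines consume a degree bound.
  LineDeg : (d : ℕ) → (Pt m → 𝔽) → Set
  LineDeg {m} d g = (b v : Pt m) → Σ Ser λ a → ∀ t → g (line b v t) ≡ ev (suc d) a t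

  private
    line-degrees : {ts : Terms m} → All (λ t → Vec.sum (proj₂ t) ≤ d) ts → All (λ tm → weight (ones m) (proj₂ tm) ≤ d) ts
    line-degrees = All.map (λ {tm} r → ≤-trans (≤-reflexive (weight-ones (proj₂ tm))) r)

    restrict : (ts : Terms m) → All (λ t → Vec.sum (proj₂ t) ≤ d) ts → (b v : Pt m) (t : 𝔽) →
               evalT ts (line b v t) ≡ ev (suc d) (evalS ts (lineS b v)) t
    restrict {m} {d} ts ds b v t = sym (trans (ev-evalS d (ones m) (lineS b v) (Degs-lineS b v) t ts (line-degrees ds))
      (cong (evalT ts) (evs-lineS b v t)))

  poly⇒lineDeg : {g : Pt m → 𝔽} → IsPoly m d g → LineDeg d g
  poly⇒lineDeg (Q , p) b v = evalS (MPoly.terms Q) (lineS b v) ,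
    λ t → trans (sym (p _)) (restrict (MPoly.terms Q) (MPoly.degree Q) b v t)

  private
    powS-top : ∀ b u k → powS (lin b u) k (k * 1) ≡ pow u k
    powS-top b u zero = refl
    powS-top b u (suc k) = trans (conv-top 1 (k * 1) (Deg-lin b u) (Deg-powS 1 (lin b u) (Deg-lin b u) k)) (cong (u *ᶠ_) (powS-top b u k))

    monoS-top : (b v : Pt m) (α : Vec ℕ m) → monoS α (lineS b v) (weight (ones m) α) ≡ mono α v
    monoS-top [] [] [] = refl
    monoS-top {suc m} (b ∷ x) (v ∷ y) (i ∷ α) = trans
      (conv-top (i * 1) (weight (ones m) α) (Deg-powS 1 (lin b v) (Deg-lin b v) i) (Deg-monoS (ones m) (lineS x y) (Degs-lineS x y) α))
      (cong₂ _*ᶠ_ (powS-top b v i) (monoS-top x y α))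

    top low : ℕ → Terms m → Terms m
    top e [] = []
    top e ((c , α) ∷ ts) with Vec.sum α ℕ.≟ e
    ... | yes _ = (c , α) ∷ top e ts
    ... | no _ = top e ts
    low e [] = []
    low e ((c , α) ∷ ts) with Vec.sum α ℕ.≟ e
    ... | yes _ = low e ts
    ... | no _ = (c , α) ∷ low e ts

    top-low : ∀ e (ts : Terms m) x → evalT ts x ≡ evalT (top e ts) x +ᶠ evalT (low e ts) x
    top-low e [] x = sym (+ᶠ-identityˡ 0ᶠ)
    top-low e ((c , α) ∷ ts) x with Vec.sum α ℕ.≟ e
    ... | yes _ = trans (cong (c *ᶠ mono α x +ᶠ_) (top-low e ts x)) (sym (+ᶠ-assoc _ _ _))
    ... | no _ = trans (cong (c *ᶠ mono α x +ᶠ_) (top-low e ts x)) (swap _ _ _)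
      where
      swap : ∀ a b c → a +ᶠ (b +ᶠ c) ≡ b +ᶠ (a +ᶠ c)
      swap = solve 3 (λ a b c → a :+ (b :+ c) := b :+ (a :+ c)) refl

    top-degree : ∀ e (ts : Terms m) → All (λ t → Vec.sum (proj₂ t) ≤ e) ts → All (λ t → Vec.sum (proj₂ t) ≤ e) (top e ts)
    top-degree e [] [] = []
    top-degree e ((c , α) ∷ ts) (r ∷ rs) with Vec.sum α ℕ.≟ e
    ... | yes _ = r ∷ top-degree e ts rs
    ... | no _ = top-degree e ts rs

    low-degree : ∀ e (ts : Terms m) → All (λ t → Vec.sum (proj₂ t) ≤ suc e) ts → All (λ t → Vec.sum (proj₂ t) ≤ e) (low (suc e) ts)
    low-degree e [] [] = []
    low-degree e ((c , α) ∷ ts) (r ∷ rs) with Vec.sum α ℕ.≟ suc e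
    ... | yes _ = low-degree e ts rs
    ... | no ne = ℕ.s≤s⁻¹ (≤∧≢⇒< r ne) ∷ low-degree e ts rs

    evalS-top : ∀ e (ts : Terms m) → All (λ t → Vec.sum (proj₂ t) ≤ e) ts → (b v : Pt m) →
                evalS ts (lineS b v) e ≡ evalT (top e ts) v
    evalS-top e [] [] b v = refl
    evalS-top {m} e ((c , α) ∷ ts) (r ∷ rs) b v with Vec.sum α ℕ.≟ e
    ... | yes refl = cong₂ (λ y z → c *ᶠ y +ᶠ z) (trans (cong (monoS α (lineS b v)) (sym (weight-ones α))) (monoS-top b v α)) (evalS-top e ts rs b v)
    ... | no ne = trans (cong₂ (λ y z → c *ᶠ y +ᶠ z)
        (Deg-monoS (ones m) (lineS b v) (Degs-lineS b v) α e (subst (_< e) (sym (weight-ones α)) (≤∧≢⇒< r ne)))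
        (evalS-top e ts rs b v))
      (trans (cong (_+ᶠ evalT (top e ts) v) (*ᶠ-zeroʳ c)) (+ᶠ-identityˡ _))

  -- The homogeneous part T of degree e + 1 is the coefficient of t^(e+1) along every line, depending only on the direction.
  leading-form : {g : Pt m → 𝔽} → IsPoly m (suc e) g →
    Σ (Pt m → 𝔽) λ T → IsPoly m (suc e) T ×
      (∀ b v → Σ Ser λ a → a (suc e) ≡ T v × (∀ t → g (line b v t) ≡ ev (suc (suc e)) a t)) ×
      ((∀ v → T v ≡ 0ᶠ) → IsPoly m e g)
  leading-form {m} {e} {g} (Q , p) =
    evalT (top (suc e) ts) ,
    (record { terms = top (suc e) ts ; degree = top-degree (suc e) ts (MPoly.degree Q) } , λ _ → refl) ,
    (λ b v → evalS ts (lineS b v) , evalS-top (suc e) ts (MPoly.degree Q) b v ,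
       λ t → trans (sym (p _)) (restrict ts (MPoly.degree Q) b v t)) ,
    λ z → record { terms = low (suc e) ts ; degree = low-degree e ts (MPoly.degree Q) } ,
       λ x → trans (sym (trans (top-low (suc e) ts x) (trans (cong (_+ᶠ evalT (low (suc e) ts) x) (z x)) (+ᶠ-identityˡ _)))) (p x)
    where ts = MPoly.terms Q

  private
    line-through-inverse : (y r : Pt n) {t : 𝔽} → ¬ (t ≡ 0ᶠ) → (t ⁻¹ᶠ) ⊙ (line y r t ⊟ y) ≡ r
    line-through-inverse [] [] t≢0 = refl
    line-through-inverse (y ∷ ys) (r ∷ rs) {t} t≢0 = cong₂ _∷_
      (trans (expand y r t (t ⁻¹ᶠ)) (trans (cong (_*ᶠ r) (*-inverseʳ t t≢0)) (*ᶠ-identityˡ r))) (line-through-inverse ys rs t≢0)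
      where
      expand : ∀ y r t i → 0ᶠ +ᶠ i *ᶠ (y +ᶠ t *ᶠ r +ᶠ (-ᶠ 1ᶠ) *ᶠ y) ≡ t *ᶠ i *ᶠ r
      expand = solve 4 (λ y r t i → con (0 , 0) :+ i :* (y :+ t :* r :+ (:- con (1 , 0)) :* y) := t :* i :* r) refl

  -- For fixed nonzero `t` the map `r ↦ y + t r` permutes the space; it exchanges points for
  -- directions seen from `y`.
  ∑ᵖ-polar : (y : Pt n) {t : 𝔽} → ¬ (t ≡ 0ᶠ) → (g : Pt n → ℕ) → ∑ᵖ n (λ r → g (line y r t)) ≡ ∑ᵖ n g
  ∑ᵖ-polar {n} y {t} t≢0 g = ∑-reindex (finitePt n) (finitePt n) (λ r → line y r t) (λ x → (t ⁻¹ᶠ) ⊙ (x ⊟ y))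
    (λ r → line-through-inverse y r t≢0) (λ x → line-through y x t≢0) g

  line-root-count : (h : Pt n → 𝔽) → LineDeg d h → (y₀ r : Pt n) → ¬ (h y₀ ≡ 0ᶠ) → ∑ᶠ (λ t → I (h (line y₀ r t) ≟ᶠ 0ᶠ)) ≤ d
  line-root-count {d = d} h lin y₀ r nz with a , e ← lin y₀ r =
    ≤-trans (≤-reflexive (∑-cong elements (λ t → I-cong (_ ≟ᶠ 0ᶠ) (_ ≟ᶠ 0ᶠ) (trans (sym (e t))) (trans (e t)))))
      (root-count d a 0ᶠ (λ z → nz (trans (sym (cong h (line-0 y₀ r))) (trans (e 0ᶠ) z))))

  -- Schwartz-Zippel inside the hyperplane through y₀ with normal l (everything, if l = 0),
  -- by counting zeros along the lines through the non-root y₀.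
  schwartz-zippel : (h : Pt n → 𝔽) → LineDeg d h → (l y₀ : Pt n) → ¬ (h y₀ ≡ 0ᶠ) →
    let Z = ∑ᵖ n (λ y → I (dot l (y ⊟ y₀) ≟ᶠ 0ᶠ) * I (h y ≟ᶠ 0ᶠ)) in
    q * Z ≤ Z + d * ∑ᵖ n (λ r → I (dot l r ≟ᶠ 0ᶠ))
  schwartz-zippel {n} {d} h lin l y₀ nz = begin
    q * Z ≡⟨ sym (∑-const elements Z) ⟩
    ∑ᶠ (λ t → Z) ≤⟨ ∑-mono elements pointwise ⟩
    ∑ᶠ (λ t → I (t ≟ᶠ 0ᶠ) * Z + ∑ᵖ n (λ r → I (dot l r ≟ᶠ 0ᶠ) * I (h (line y₀ r t) ≟ᶠ 0ᶠ)))
      ≡⟨ trans (∑-+ elements _ _) (cong₂ _+_ (Finite.∑-δ finite𝔽 0ᶠ (λ _ → Z)) (∑-swap elements (points n) _)) ⟩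
    Z + ∑ᵖ n (λ r → ∑ᶠ (λ t → I (dot l r ≟ᶠ 0ᶠ) * I (h (line y₀ r t) ≟ᶠ 0ᶠ)))
      ≤⟨ +-monoʳ-≤ Z (∑-mono (points n) on-line) ⟩
    Z + ∑ᵖ n (λ r → d * I (dot l r ≟ᶠ 0ᶠ))
      ≡⟨ cong (Z +_) (∑-*ˡ (points n) d _) ⟩
    Z + d * ∑ᵖ n (λ r → I (dot l r ≟ᶠ 0ᶠ)) ∎
    where
    open ≤-Reasoning
    Z = ∑ᵖ n (λ y → I (dot l (y ⊟ y₀) ≟ᶠ 0ᶠ) * I (h y ≟ᶠ 0ᶠ))
    slope : ∀ r t → dot l (line y₀ r t ⊟ y₀) ≡ dot l r *ᶠ t
    slope r t = trans (dot-⊟ l (line y₀ r t) y₀) (trans (cong (_+ᶠ (-ᶠ dot l y₀)) (dot-line l y₀ r t)) (cancel (dot l y₀) t (dot l r)))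
      where
      cancel : ∀ a t b → a +ᶠ t *ᶠ b +ᶠ (-ᶠ a) ≡ b *ᶠ t
      cancel = solve 3 (λ a t b → a :+ t :* b :+ (:- a) := b :* t) refl
    -- For `t ≠ 0` the zeros are counted by their directions from `y₀`. At `t = 0` only `y₀` is
    -- seen, and one extra copy of `Z` pays for that parameter.
    pointwise : ∀ t → Z ≤ I (t ≟ᶠ 0ᶠ) * Z + ∑ᵖ n (λ r → I (dot l r ≟ᶠ 0ᶠ) * I (h (line y₀ r t) ≟ᶠ 0ᶠ))
    pointwise t with t ≟ᶠ 0ᶠ
    ... | yes _ = ≤-trans (≤-reflexive (sym (+-identityʳ Z))) (m≤m+n _ _)
    ... | no t≢0 = ≤-reflexive (trans (sym (∑ᵖ-polar y₀ t≢0 _)) (∑-cong (points n) (λ r →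
      cong (_* I (h (line y₀ r t) ≟ᶠ 0ᶠ)) (I-cong (_ ≟ᶠ 0ᶠ) (_ ≟ᶠ 0ᶠ)
        (λ e → no-zero-divisors t≢0 (trans (sym (slope r t)) e))
        (λ e → trans (slope r t) (trans (cong (_*ᶠ t) e) (*ᶠ-zeroˡ t)))))))
    on-line : ∀ r → ∑ᶠ (λ t → I (dot l r ≟ᶠ 0ᶠ) * I (h (line y₀ r t) ≟ᶠ 0ᶠ)) ≤ d * I (dot l r ≟ᶠ 0ᶠ)
    on-line r = begin
      ∑ᶠ (λ t → i * I (h (line y₀ r t) ≟ᶠ 0ᶠ)) ≡⟨ ∑-*ˡ elements i _ ⟩
      i * ∑ᶠ (λ t → I (h (line y₀ r t) ≟ᶠ 0ᶠ)) ≤⟨ *-monoʳ-≤ i (line-root-count h lin y₀ r nz) ⟩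
      i * d ≡⟨ *-comm i d ⟩
      d * i ∎
      where i = I (dot l r ≟ᶠ 0ᶠ)

  schwartz-zippel₀ : (h : Pt n → 𝔽) → LineDeg d h → (y₀ : Pt n) → ¬ (h y₀ ≡ 0ᶠ) →
    let Z = ∑ᵖ n (λ y → I (h y ≟ᶠ 0ᶠ)) in q * Z ≤ Z + d * q ^ n
  schwartz-zippel₀ {n} {d} h lin y₀ nz = subst₂ (λ Z Y → q * Z ≤ Z + d * Y)
    (∑-cong (points n) (λ y → trans (cong (_* I (h y ≟ᶠ 0ᶠ)) (I-yes (_ ≟ᶠ 0ᶠ) (zero-dot (y ⊟ y₀)))) (+-identityʳ _)))
    (trans (∑-cong (points n) (λ r → I-yes (_ ≟ᶠ 0ᶠ) (zero-dot r))) (∑ᵖ-one n))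
    (schwartz-zippel {d = d} h lin 0ᵥ y₀ nz)
    where
    zero-dot : (x : Pt n) → dot 0ᵥ x ≡ 0ᶠ
    zero-dot x = trans (dot-comm 0ᵥ x) (dot-zeroʳ x)

-- The point-line agreement graph and its core.

module Core (F : FiniteField) where
  open import Data.Nat using (_+_; _*_; _^_; _≤_; _<_)
  open import Data.Nat.Properties hiding (_≟_)
  open FiniteSums
  open FieldAlgebra F
  open Series F
  open Polynomials F

  bit : Bool → ℕ
  bit true = 1
  bit false = 0

  ∑-cartesianProduct : {A B : Set} (xs : List A) (ys : List B) (g : A × B → ℕ) →
    ∑ (cartesianProduct xs ys) g ≡ ∑ xs (λ x → ∑ ys (λ y → g (x , y)))
  ∑-cartesianProduct [] ys g = refl
  ∑-cartesianProduct (x ∷ xs) ys g = trans (∑-++ (map (x ,_) ys) _ g)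
    (cong₂ _+_ (∑-map (x ,_) ys g) (∑-cartesianProduct xs ys g))

  finite-× : {A B : Set} → Finite A → Finite B → Finite (A × B)
  finite-× FA FB = record
    { elems = cartesianProduct FA.elems FB.elems
    ; unique = Unique.cartesianProduct⁺ FA.unique FB.unique
    ; complete = λ (a , b) → ∈-cartesianProduct⁺ (FA.complete a) (FB.complete b)
    ; _≟_ = Product.≡-dec FA._≟_ FB._≟_ }
    where
    module FA = Finite FA
    module FB = Finite FB

  module _ {A : Set} (FA : Finite A) where
    private module FA = Finite FA

    without : (A → Bool) → A → A → Bool
    without X a x with x FA.≟ a
    ... | yes _ = false
    ... | no _ = X x

    ∑-without : (X : A → Bool) (a : A) → X a ≡ true → (g : A → ℕ) →
      ∑ FA.elems (λ x → bit (X x) * g x) ≡ g a + ∑ FA.elems (λ x → bit (without X a x) * g x)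
    ∑-without X a Xa g = trans (∑-cong FA.elems split)
      (trans (∑-+ FA.elems _ _) (cong (_+ ∑ FA.elems (λ x → bit (without X a x) * g x)) (FA.∑-δ a g)))
      where
      split : ∀ x → bit (X x) * g x ≡ I (x FA.≟ a) * g x + bit (without X a x) * g x
      split x with x FA.≟ a
      ... | yes refl = trans (cong (λ z → bit z * g x) Xa) (sym (+-identityʳ _))
      ... | no _ = refl

  -- Repeatedly deleting a vertex of too small degree preserves K |E| > α |X| + β |Y|.
  module Pruning {A B : Set} (FA : Finite A) (FB : Finite B) (w : A → B → ℕ) (K α β : ℕ) where
    private
      module FA = Finite FA
      module FB = Finite FB

    degA : (B → Bool) → A → ℕ
    degA Y a = ∑ FB.elems (λ b → bit (Y b) * w a b)

    degB : (A → Bool) → B → ℕ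
    degB X b = ∑ FA.elems (λ a → bit (X a) * w a b)

    edges : (A → Bool) → (B → Bool) → ℕ
    edges X Y = ∑ FA.elems (λ a → bit (X a) * degA Y a)

    cardA : (A → Bool) → ℕ
    cardA X = ∑ FA.elems (λ a → bit (X a) * 1)

    cardB : (B → Bool) → ℕ
    cardB Y = ∑ FB.elems (λ b → bit (Y b) * 1)

    edges-swap : ∀ X Y → edges X Y ≡ ∑ FB.elems (λ b → bit (Y b) * degB X b)
    edges-swap X Y = begin
      ∑ FA.elems (λ a → bit (X a) * ∑ FB.elems (λ b → bit (Y b) * w a b))
        ≡⟨ ∑-cong FA.elems (λ a → sym (∑-*ˡ FB.elems (bit (X a)) _)) ⟩
      ∑ FA.elems (λ a → ∑ FB.elems (λ b → bit (X a) * (bit (Y b) * w a b)))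
        ≡⟨ ∑-swap FA.elems FB.elems _ ⟩
      ∑ FB.elems (λ b → ∑ FA.elems (λ a → bit (X a) * (bit (Y b) * w a b)))
        ≡⟨ ∑-cong FB.elems (λ b → trans (∑-cong FA.elems (λ a → comm₃ (bit (X a)) (bit (Y b)) (w a b))) (∑-*ˡ FA.elems (bit (Y b)) _)) ⟩
      ∑ FB.elems (λ b → bit (Y b) * ∑ FA.elems (λ a → bit (X a) * w a b)) ∎
      where
      open ≡-Reasoning
      comm₃ : ∀ x y z → x * (y * z) ≡ y * (x * z)
      comm₃ = ringℕ

    record CoreSubgraph : Set where
      field
        X : A → Bool
        Y : B → Bool
        nonempty : 0 < edges X Y
        minA : ∀ a → X a ≡ true → α ≤ K * degA Y a
        minB : ∀ b → Y b ≡ true → β ≤ K * degB X b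

    private
      -- A vertex of degree below `p / K` takes fewer than `p / K` edges with it, while its removal
      -- lowers the left-hand side by exactly `p`.
      drop-vertex : ∀ deg E' a r (p : ℕ) → K * deg < p → p * suc a + r < K * (deg + E') → p * a + r < K * E'
      drop-vertex deg E' a r p small big = +-cancelˡ-< p _ _ (begin-strict
        p + (p * a + r) ≡⟨ e₁ p a r ⟩
        p * suc a + r <⟨ big ⟩
        K * (deg + E') ≡⟨ *-distribˡ-+ K deg E' ⟩
        K * deg + K * E' ≤⟨ +-monoˡ-≤ (K * E') (<⇒≤ small) ⟩
        p + K * E' ∎)
        where
        open ≤-Reasoning
        e₁ : ∀ p a r → p + (p * a + r) ≡ p * suc a + r
        e₁ = ringℕ

    prune : ∀ fuel X Y → cardA X + cardB Y ≤ fuel → α * cardA X + β * cardB Y < K * edges X Y → CoreSubgraph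
    prune fuel X Y le big with FA.∃? (λ a → (X a Bool.≟ true) ×-dec (K * degA Y a ℕ.<? α))
    prune zero X Y le big | yes (a , Xa , small) =
      contradiction (≤-trans (≤-reflexive (sym (∑-without FA X a Xa (λ _ → 1)))) (≤-trans (m≤m+n _ _) le)) λ ()
    prune (suc fuel) X Y le big | yes (a , Xa , small) =
      prune fuel (without FA X a) Y
        (ℕ.s≤s⁻¹ (subst (λ z → z + cardB Y ≤ suc fuel) (∑-without FA X a Xa (λ _ → 1)) le))
        (drop-vertex (degA Y a) _ _ _ α small
          (subst₂ (λ z E → α * z + β * cardB Y < K * E) (∑-without FA X a Xa (λ _ → 1)) (∑-without FA X a Xa (degA Y)) big))
    ... | no ¬a with FB.∃? (λ b → (Y b Bool.≟ true) ×-dec (K * degB X b ℕ.<? β))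
    prune zero X Y le big | no ¬a | yes (b , Yb , small) =
      contradiction (≤-trans (≤-reflexive (sym (∑-without FB Y b Yb (λ _ → 1)))) (≤-trans (m≤n+m _ (cardA X)) le)) λ ()
    prune (suc fuel) X Y le big | no ¬a | yes (b , Yb , small) =
      prune fuel X (without FB Y b)
        (ℕ.s≤s⁻¹ (subst (_≤ suc fuel) (trans (cong (cardA X +_) (∑-without FB Y b Yb (λ _ → 1))) (+-suc (cardA X) _)) le))
        (subst₂ (λ z E → z < K * E) (+-comm (β * _) (α * cardA X)) (sym (edges-swap X (without FB Y b)))
          (drop-vertex (degB X b) _ _ _ β small
            (subst₂ _<_ (trans (+-comm (α * cardA X) _) (cong (λ z → β * z + α * cardA X) (∑-without FB Y b Yb (λ _ → 1))))
              (cong (K *_) (trans (edges-swap X Y) (∑-without FB Y b Yb (degB X)))) big)))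
    ... | no ¬b = record
      { X = X ; Y = Y
      ; nonempty = n≢0⇒n>0 (λ E≡0 → n≮0 (subst (α * cardA X + β * cardB Y <_) (trans (cong (K *_) E≡0) (*-zeroʳ K)) big))
      ; minA = λ a Xa → ≮⇒≥ (λ lt → ¬a (a , Xa , lt))
      ; minB = λ b Yb → ≮⇒≥ (λ lt → ¬b (b , Yb , lt)) }

    core : α * length FA.elems + β * length FB.elems < K * ∑ FA.elems (λ a → ∑ FB.elems (w a)) → CoreSubgraph
    core big = prune _ (λ _ → true) (λ _ → true) ≤-refl
      (subst₂ _<_ (sym (cong₂ (λ x y → α * x + β * y) (card FA.elems) (card FB.elems)))
        (cong (K *_) (sym (trans (∑-cong FA.elems (λ a → trans (+-identityʳ _) (∑-cong FB.elems (λ b → +-identityʳ _)))) refl))) big)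
      where
      card : {C : Set} (xs : List C) → ∑ xs (λ _ → 1) ≡ length xs
      card xs = trans (∑-const xs 1) (*-identityʳ _)

  -- Invariance under moving the base point along a fixed direction is a form that restricts
  -- directly to hyperplanes, by lifting points and directions.
  record Oracle (n d : ℕ) : Set where
    field
      P : Pt n → Pt n → Vec 𝔽 (suc d)
      invariant : ∀ b u s t → ¬ (u ≡ 0ᵥ) → evalU F (P (line b u s) u) t ≡ evalU F (P b u) (s +ᶠ t)

    val : Pt n → Pt n → 𝔽 → 𝔽
    val b u t = evalU F (P b u) t

  module Test {n d : ℕ} (f : Pt n → 𝔽) (O : Oracle n d) where
    open Oracle O public

    Agree : Pt n → Pt n → Set
    Agree x u = ¬ (u ≡ 0ᵥ) × f x ≡ val x u 0ᶠ

    agree? : ∀ x u → Dec (Agree x u)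
    agree? x u = ¬? (u ≟ᵖ 0ᵥ) ×-dec (f x ≟ᶠ val x u 0ᶠ)

    passes : ℕ
    passes = ∑ᵖ n (λ x → ∑ᵖ n (λ u → I (agree? x u)))

    -- The core subgraph as seen from its points: a share 2/K of the directions at a point of `X` is
    -- good, and on a line in a good direction a share 2/K of the parameters agrees with `f` at
    -- points that lie in `X` again. This closure is what lets arguments made at one point be
    -- repeated at all others.
    record LineCore (K : ℕ) : Set₁ where
      field
        X : Pt n → Bool
        U : Pt n → Pt n → Set
        U? : ∀ z u → Dec (U z u)
        point : ∃ λ z → X z ≡ true
        many-U : ∀ z → X z ≡ true → 2 * q ^ n ≤ K * ∑ᵖ n (λ u → I (U? z u))
        U-agree : ∀ z u → U z u → Agree z u
        many-t : ∀ z u → U z u → 2 * q ≤ K * ∑ᶠ (λ t → I ((X (line z u t) Bool.≟ true) ×-dec (f (line z u t) ≟ᶠ val z u t)))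

    private
      N = q ^ n
      FB = finite-× (finitePt n) (finitePt n)

      -- Lines enter as pairs of a base point and a direction, so that a line occurs once for each
      -- of its base points. The weight counts the parameters at which `z` is reached, provided that
      -- the test accepts `z` and `u`.
      w : Pt n → Pt n × Pt n → ℕ
      w z (b , u) = ∑ᶠ (λ t → I (line b u t ≟ᵖ z) * I (agree? z u))

      ∑w : ∑ᵖ n (λ z → ∑ (Finite.elems FB) (w z)) ≡ q * passes
      ∑w = begin
        ∑ᵖ n (λ z → ∑ (Finite.elems FB) (w z))
          ≡⟨ ∑-cong (points n) (λ z → ∑-cartesianProduct (points n) (points n) (w z)) ⟩
        ∑ᵖ n (λ z → ∑ᵖ n (λ b → ∑ᵖ n (λ u → w z (b , u))))
          ≡⟨ ∑-cong (points n) (λ z → trans (∑-swap (points n) (points n) _) (∑-cong (points n) (λ u → ∑-swap (points n) elements _))) ⟩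
        ∑ᵖ n (λ z → ∑ᵖ n (λ u → ∑ᶠ (λ t → ∑ᵖ n (λ b → I (line b u t ≟ᵖ z) * I (agree? z u)))))
          ≡⟨ ∑-cong (points n) (λ z → ∑-cong (points n) (λ u → trans (∑-cong elements (λ t → collapse z u t)) (∑-const elements _))) ⟩
        ∑ᵖ n (λ z → ∑ᵖ n (λ u → q * I (agree? z u)))
          ≡⟨ trans (∑-cong (points n) (λ z → ∑-*ˡ (points n) q _)) (∑-*ˡ (points n) q _) ⟩
        q * passes ∎
        where
        open ≡-Reasoning
        collapse : ∀ z u t → ∑ᵖ n (λ b → I (line b u t ≟ᵖ z) * I (agree? z u)) ≡ I (agree? z u)
        collapse z u t = trans (∑ᵖ-translate u t (λ b → I (b ≟ᵖ z) * I (agree? z u))) (Finite.∑-δ (finitePt n) z (λ _ → I (agree? z u)))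

      -- The edge bound `4 q N²` is split evenly: `N` points with threshold `2 q N` and `N²`
      -- parametrised lines with threshold `2 q` demand `2 q N²` each.
      module P K = Pruning (finitePt n) FB w K (2 * (q * N)) (2 * q)

      start : ∀ K → 4 * (N * N) < K * passes →
        2 * (q * N) * length (points n) + 2 * q * length (Finite.elems FB) < K * ∑ᵖ n (λ z → ∑ (Finite.elems FB) (w z))
      start K big = subst₂ _<_
        (trans (e₁ q N) (cong₂ (λ a b → 2 * (q * N) * a + 2 * q * b) (sym (length-points n)) (sym lenFB)))
        (trans (e₂ q K passes) (cong (K *_) (sym ∑w))) (*-monoʳ-< q {{ℕ.>-nonZero q>0}} big)
        where
        e₁ : ∀ q N → q * (4 * (N * N)) ≡ 2 * (q * N) * N + 2 * q * (N * N)
        e₁ = ringℕ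
        e₂ : ∀ q K p → q * (K * p) ≡ K * (q * p)
        e₂ = ringℕ
        lenFB : length (Finite.elems FB) ≡ N * N
        lenFB = trans (sym (trans (∑-const (Finite.elems FB) 1) (*-identityʳ _)))
          (trans (∑-cartesianProduct (points n) (points n) (λ _ → 1))
            (trans (∑-cong (points n) (λ _ → ∑ᵖ-one n)) (∑ᵖ-const n N)))

    from-subgraph : ∀ K → P.CoreSubgraph K → LineCore K
    from-subgraph K S = record
      { X = X ; U = U ; U? = U?
      ; point = nonempty-point
      ; many-U = many-U
      ; U-agree = λ z u → proj₁
      ; many-t = many-t }
      where
      instance q≢0 : NonZero q
      q≢0 = ℕ.>-nonZero q>0
      open P K
      open CoreSubgraph S

      U : Pt n → Pt n → Set
      -- Any surviving base point of the line will do, because `many-t` shifts the parameter so that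
      -- it starts at `z`.
      U z u = Agree z u × ∃ λ s → Y (line z u (-ᶠ s) , u) ≡ true

      U? : ∀ z u → Dec (U z u)
      U? z u = agree? z u ×-dec Finite.∃? finite𝔽 (λ s → Y (line z u (-ᶠ s) , u) Bool.≟ true)

      nonempty-point : ∃ λ z → X z ≡ true
      nonempty-point with ∑-pos⇒∃ (points n) nonempty
      ... | z , _ , pos with X z in eq
      ... | true = z , eq

      many-U : ∀ z → X z ≡ true → 2 * N ≤ K * ∑ᵖ n (λ u → I (U? z u))
      many-U z Xz = *-cancelˡ-≤ q (begin
        q * (2 * N) ≡⟨ e₁ q N ⟩
        2 * (q * N) ≤⟨ minA z Xz ⟩
        K * degA Y z ≤⟨ *-monoʳ-≤ K deg≤ ⟩
        K * ∑ᵖ n (λ u → q * I (U? z u)) ≡⟨ cong (K *_) (∑-*ˡ (points n) q _) ⟩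
        K * (q * ∑ᵖ n (λ u → I (U? z u))) ≡⟨ e₂ K q _ ⟩
        q * (K * ∑ᵖ n (λ u → I (U? z u))) ∎)
        where
        open ≤-Reasoning
        e₁ : ∀ q N → q * (2 * N) ≡ 2 * (q * N)
        e₁ = ringℕ
        e₂ : ∀ K q S → K * (q * S) ≡ q * (K * S)
        e₂ = ringℕ
        term≤ : ∀ u t b → bit (Y (b , u)) * (I (line b u t ≟ᵖ z) * I (agree? z u)) ≤ I (line b u t ≟ᵖ z) * I (U? z u)
        term≤ u t b with Y (b , u) in eqY | line b u t ≟ᵖ z
        ... | false | _ = z≤n
        ... | true | no _ = z≤n
        ... | true | yes e = subst₂ _≤_ (sym (trans (+-identityʳ _) (+-identityʳ _))) (sym (+-identityʳ _))
          (I-mono (agree? z u) (U? z u) (λ ag → ag , t , trans (cong (λ p → Y (p , u)) (trans (cong (λ p → line p u (-ᶠ t)) (sym e)) (line-back b u t))) eqY))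
        collapse : ∀ u t → ∑ᵖ n (λ b → I (line b u t ≟ᵖ z) * I (U? z u)) ≡ I (U? z u)
        collapse u t = trans (∑ᵖ-translate u t (λ b → I (b ≟ᵖ z) * I (U? z u))) (Finite.∑-δ (finitePt n) z (λ _ → I (U? z u)))
        deg≤ : degA Y z ≤ ∑ᵖ n (λ u → q * I (U? z u))
        deg≤ = begin
          degA Y z
            ≡⟨ trans (∑-cartesianProduct (points n) (points n) _) (∑-swap (points n) (points n) _) ⟩
          ∑ᵖ n (λ u → ∑ᵖ n (λ b → bit (Y (b , u)) * w z (b , u)))
            ≡⟨ ∑-cong (points n) (λ u → trans (∑-cong (points n) (λ b → sym (∑-*ˡ elements (bit (Y (b , u))) _))) (∑-swap (points n) elements _)) ⟩
          ∑ᵖ n (λ u → ∑ᶠ (λ t → ∑ᵖ n (λ b → bit (Y (b , u)) * (I (line b u t ≟ᵖ z) * I (agree? z u)))))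
            ≤⟨ ∑-mono (points n) (λ u → ∑-mono elements (λ t → ≤-trans (∑-mono (points n) (term≤ u t)) (≤-reflexive (collapse u t)))) ⟩
          ∑ᵖ n (λ u → ∑ᶠ (λ t → I (U? z u)))
            ≡⟨ ∑-cong (points n) (λ u → ∑-const elements _) ⟩
          ∑ᵖ n (λ u → q * I (U? z u)) ∎

      many-t : ∀ z u → U z u → 2 * q ≤ K * ∑ᶠ (λ t → I ((X (line z u t) Bool.≟ true) ×-dec (f (line z u t) ≟ᶠ val z u t)))
      many-t z u (ag , s , Yb) = ≤-trans (minB (b , u) Yb) (*-monoʳ-≤ K (begin
        ∑ᵖ n (λ x → bit (X x) * w x (b , u))
          ≡⟨ ∑-cong (points n) (λ x → sym (∑-*ˡ elements (bit (X x)) _)) ⟩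
        ∑ᵖ n (λ x → ∑ᶠ (λ t → bit (X x) * (I (line b u t ≟ᵖ x) * I (agree? x u))))
          ≡⟨ ∑-swap (points n) elements _ ⟩
        ∑ᶠ (λ t → ∑ᵖ n (λ x → bit (X x) * (I (line b u t ≟ᵖ x) * I (agree? x u))))
          ≡⟨ ∑-cong elements (λ t → trans (∑-cong (points n) (λ x → trans (comm₃ (bit (X x)) (I (line b u t ≟ᵖ x)) _)
               (cong (_* (bit (X x) * I (agree? x u))) (I-cong (line b u t ≟ᵖ x) (x ≟ᵖ line b u t) sym sym))))
               (Finite.∑-δ (finitePt n) (line b u t) (λ x → bit (X x) * I (agree? x u)))) ⟩
        ∑ᶠ (λ t → h (line b u t))
          ≡⟨ sym (∑ᶠ-shift s (λ t → h (line b u t))) ⟩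
        ∑ᶠ (λ t → h (line b u (t +ᶠ s)))
          ≡⟨ ∑-cong elements (λ t → cong h (trans (line-line z u (-ᶠ s) (t +ᶠ s)) (cong (line z u) (cancel s t)))) ⟩
        ∑ᶠ (λ t → h (line z u t))
          ≤⟨ ∑-mono elements final ⟩
        ∑ᶠ (λ t → I ((X (line z u t) Bool.≟ true) ×-dec (f (line z u t) ≟ᶠ val z u t))) ∎))
        where
        open ≤-Reasoning
        b = line z u (-ᶠ s)
        h : Pt n → ℕ
        h x = bit (X x) * I (agree? x u)
        comm₃ : ∀ x y z → x * (y * z) ≡ y * (x * z)
        comm₃ = ringℕ
        cancel : ∀ s t → (-ᶠ s) +ᶠ (t +ᶠ s) ≡ t
        cancel = solve 2 (λ s t → (:- s) :+ (t :+ s) := t) refl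
        final : ∀ t → h (line z u t) ≤ I ((X (line z u t) Bool.≟ true) ×-dec (f (line z u t) ≟ᶠ val z u t))
        final t with X (line z u t)
        ... | false = z≤n
        ... | true = ≤-trans (≤-reflexive (+-identityʳ _)) (I-mono (agree? (line z u t) u) ((true Bool.≟ true) ×-dec (f (line z u t) ≟ᶠ val z u t))
          (λ (u≢0 , e) → refl , trans e (trans (invariant z u t 0ᶠ u≢0) (cong (val z u) (+ᶠ-identityʳ t)))))

    line-core : ∀ K → 4 * (N * N) < K * passes → LineCore K
    line-core K big = from-subgraph K (P.core K (start K big))

  -- Agreements of `f` and `Q` are counted along the good directions at `z`. For each `t ≠ 0` the
  -- points `z + t u` are distinct for distinct `u`, which gives at most `q M` in all, and `t = 0`
  -- adds at most one per direction. The latter is absorbed by `2 K ≤ q`, at the price of 3 in the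
  -- place of 4.
  agreement : ∀ {n} (f Q : Pt n → 𝔽) K (z : Pt n) {U : Pt n → Set} (U? : ∀ u → Dec (U u)) → 2 * K ≤ q →
    2 * q ^ n ≤ K * ∑ᵖ n (λ u → I (U? u)) →
    (∀ u → U u → 2 * q ≤ K * ∑ᶠ (λ t → I (f (line z u t) ≟ᶠ Q (line z u t)))) →
    3 * q ^ n ≤ K * K * ∑ᵖ n (λ y → I (f y ≟ᶠ Q y))
  agreement {n} f Q K z {U} U? 2K≤q manyU many = *-cancelˡ-≤ (2 * q) (begin
    2 * q * (3 * N) ≡⟨ e₁ q N ⟩
    3 * q * (2 * N) ≤⟨ *-monoʳ-≤ (3 * q) manyU ⟩
    3 * q * (K * u#) ≤⟨ +-cancelʳ-≤ (q * (K * u#)) _ _ balance ⟩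
    2 * q * (K * K * M) ∎)
    where
    open ≤-Reasoning
    instance q≢0 : NonZero (2 * q)
    q≢0 = ℕ.>-nonZero (*-mono-≤ {1} {2} (s≤s z≤n) q>0)
    N = q ^ n
    M = ∑ᵖ n (λ y → I (f y ≟ᶠ Q y))
    u# = ∑ᵖ n (λ u → I (U? u))
    c : Pt n → 𝔽 → ℕ
    c u t = I (f (line z u t) ≟ᶠ Q (line z u t))
    e₁ : ∀ q N → 2 * q * (3 * N) ≡ 3 * q * (2 * N)
    e₁ = ringℕ
    lower : 2 * q * u# ≤ K * ∑ᵖ n (λ u → I (U? u) * ∑ᶠ (c u))
    lower = begin
      2 * q * u# ≡⟨ sym (∑-*ˡ (points n) (2 * q) _) ⟩
      ∑ᵖ n (λ u → 2 * q * I (U? u)) ≡⟨ ∑-cong (points n) (λ u → *-comm (2 * q) _) ⟩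
      ∑ᵖ n (λ u → I (U? u) * (2 * q)) ≤⟨ ∑-mono (points n) (λ u → I*-mono (U? u) (many u)) ⟩
      ∑ᵖ n (λ u → I (U? u) * (K * ∑ᶠ (c u))) ≡⟨ ∑-cong (points n) (λ u → comm₃ (I (U? u)) K _) ⟩
      ∑ᵖ n (λ u → K * (I (U? u) * ∑ᶠ (c u))) ≡⟨ ∑-*ˡ (points n) K _ ⟩
      K * ∑ᵖ n (λ u → I (U? u) * ∑ᶠ (c u)) ∎
      where
      comm₃ : ∀ x y z → x * (y * z) ≡ y * (x * z)
      comm₃ = ringℕ
    upper : ∑ᵖ n (λ u → I (U? u) * ∑ᶠ (c u)) ≤ u# + q * M
    upper = begin
      ∑ᵖ n (λ u → I (U? u) * ∑ᶠ (c u))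
        ≡⟨ trans (∑-cong (points n) (λ u → sym (∑-*ˡ elements (I (U? u)) _))) (∑-swap (points n) elements _) ⟩
      ∑ᶠ (λ t → ∑ᵖ n (λ u → I (U? u) * c u t))
        ≤⟨ ∑-mono elements split ⟩
      ∑ᶠ (λ t → I (t ≟ᶠ 0ᶠ) * u# + M)
        ≡⟨ trans (∑-+ elements _ _) (cong₂ _+_ (Finite.∑-δ finite𝔽 0ᶠ (λ _ → u#)) (∑-const elements M)) ⟩
      u# + q * M ∎
      where
      split : ∀ t → ∑ᵖ n (λ u → I (U? u) * c u t) ≤ I (t ≟ᶠ 0ᶠ) * u# + M
      split t with t ≟ᶠ 0ᶠ
      ... | yes _ = ≤-trans (∑-mono (points n) (λ u → ≤-trans (*-monoʳ-≤ (I (U? u)) (I≤1 (f (line z u t) ≟ᶠ Q (line z u t)))) (≤-reflexive (*-identityʳ _))))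
                            (≤-trans (≤-reflexive (sym (+-identityʳ u#))) (m≤m+n _ M))
      ... | no t≢0 = ≤-trans (∑-mono (points n) (λ u → I*-≤ (U? u) (c u t))) (≤-reflexive (∑ᵖ-polar z t≢0 (λ y → I (f y ≟ᶠ Q y))))
    balance : 3 * q * (K * u#) + q * (K * u#) ≤ 2 * q * (K * K * M) + q * (K * u#)
    balance = begin
      3 * q * (K * u#) + q * (K * u#) ≡⟨ e₂ q K u# ⟩
      2 * K * (2 * q * u#) ≤⟨ *-monoʳ-≤ (2 * K) (≤-trans lower (*-monoʳ-≤ K upper)) ⟩
      2 * K * (K * (u# + q * M)) ≡⟨ e₃ q K u# M ⟩
      2 * q * (K * K * M) + 2 * K * (K * u#) ≤⟨ +-monoʳ-≤ (2 * q * (K * K * M)) (*-monoˡ-≤ (K * u#) 2K≤q) ⟩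
      2 * q * (K * K * M) + q * (K * u#) ∎
      where
      e₂ : ∀ q K u → 3 * q * (K * u) + q * (K * u) ≡ 2 * K * (2 * q * u)
      e₂ = ringℕ
      e₃ : ∀ q K u M → 2 * K * (K * (u + q * M)) ≡ 2 * q * (K * K * M) + 2 * K * (K * u)
      e₃ = ringℕ

-- The characteristic, the Frobenius map and p-th roots of scalars.

module Frobenius (F : FiniteField) where
  open import Data.Nat using (_+_; _*_; _≤_; _<_)
  open import Data.Nat.Properties hiding (_≟_)
  open import Data.Nat.DivMod using (_/_; _%_; m≡m%n+[m/n]*n; m%n<n)
  open import Data.Nat.Induction using (<-rec)
  open import Data.Fin.Properties using (pigeonhole)
  open import Data.List.Relation.Unary.Any using (index)
  open import Data.List.Relation.Unary.Any.Properties using (lookup-index)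
  open FiniteSums
  open FieldAlgebra F
  open Series F
  open Polynomials F

  pigeonhole-finite : {A : Set} (FA : Finite A) (m : ℕ) → length (Finite.elems FA) < m → (f : Fin m → A) →
                      ∃₂ λ i j → i Fin.< j × f i ≡ f j
  pigeonhole-finite FA m lt f with i , j , i<j , e ← pigeonhole lt (λ i → index (Finite.complete FA (f i)))
    = i , j , i<j , trans (lookup-index (Finite.complete FA (f i)))
        (trans (cong (List.lookup (Finite.elems FA)) e) (sym (lookup-index (Finite.complete FA (f j)))))

  -- An omitted `y` would have an empty fibre while every other fibre has at most one element, so
  -- that the fibres together would be too small to hold all arguments.
  injective⇒surjective : {A : Set} (FA : Finite A) (φ : A → A) → (∀ {x y} → φ x ≡ φ y → x ≡ y) → ∀ y → ∃ λ x → φ x ≡ y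
  injective⇒surjective FA φ inj y with Finite.∃? FA (λ x → Finite._≟_ FA (φ x) y)
  ... | yes found = found
  ... | no missed = contradiction
    (begin-strict
      length FA.elems <⟨ n<1+n _ ⟩
      suc (length FA.elems) ≡⟨ +-comm 1 _ ⟩
      length FA.elems + 1 ≡⟨ cong₂ _+_ (sym (card FA.elems)) (sym (FA.∑-δ₁ y)) ⟩
      ∑ FA.elems (λ _ → 1) + ∑ FA.elems (λ z → I (z FA.≟ y)) ≡⟨ cong (_+ ∑ FA.elems (λ z → I (z FA.≟ y))) (∑-pushforward FA FA φ (λ _ → 1)) ⟩
      ∑ FA.elems (λ z → 1 * fibre z) + ∑ FA.elems (λ z → I (z FA.≟ y)) ≡⟨ sym (∑-+ FA.elems _ _) ⟩
      ∑ FA.elems (λ z → 1 * fibre z + I (z FA.≟ y)) ≤⟨ ∑-mono FA.elems bound ⟩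
      ∑ FA.elems (λ _ → 1) ≡⟨ card FA.elems ⟩
      length FA.elems ∎)
    (<-irrefl refl)
    where
    open ≤-Reasoning
    module FA = Finite FA
    fibre : _ → ℕ
    fibre z = ∑ FA.elems (λ x → I (φ x FA.≟ z))
    card : {C : Set} (xs : List C) → ∑ xs (λ _ → 1) ≡ length xs
    card xs = trans (∑-const xs 1) (*-identityʳ _)
    empty : ∀ z → (∀ x → ¬ φ x ≡ z) → fibre z ≡ 0
    empty z none = trans (∑-cong FA.elems (λ x → I-no (φ x FA.≟ z) (none x))) (∑-zero FA.elems)
    fibre≤1 : ∀ z → fibre z ≤ 1
    fibre≤1 z with FA.∃? (λ x → φ x FA.≟ z)
    ... | yes (x₀ , e₀) = ≤-trans (∑-mono FA.elems (λ x → I-mono (φ x FA.≟ z) (x FA.≟ x₀) (λ e → inj (trans e (sym e₀))))) (≤-reflexive (FA.∑-δ₁ x₀))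
    ... | no none = ≤-trans (≤-reflexive (empty z (λ x e → none (x , e)))) z≤n
    bound : ∀ z → 1 * fibre z + I (z FA.≟ y) ≤ 1
    bound z with z FA.≟ y
    ... | yes refl = ≤-reflexive (cong (λ k → 1 * k + 1) (empty z (λ x e → missed (x , e))))
    ... | no _ = ≤-trans (≤-reflexive (trans (+-identityʳ _) (+-identityʳ _))) (fibre≤1 z)

  private
    ⟦⟧-cancel : ∀ i k → ⟦ i ⟧ ≡ ⟦ i + k ⟧ → ⟦ k ⟧ ≡ 0ᶠ
    ⟦⟧-cancel i k e = +ᶠ-cancelʳ ⟦ i ⟧ (trans (+ᶠ-comm ⟦ k ⟧ ⟦ i ⟧) (trans (sym (⟦⟧-+ i k)) (trans (sym e) (sym (+ᶠ-identityˡ _)))))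

    torsion : ∃ λ k → 0 < k × ⟦ k ⟧ ≡ 0ᶠ
    torsion with i , j , i<j , e ← pigeonhole-finite finite𝔽 (suc q) ≤-refl (λ i → ⟦ toℕ i ⟧)
            with k , eq ← m≤n⇒∃[o]m+o≡n (<⇒≤ i<j)
      = k , n≢0⇒n>0 (λ { refl → <-irrefl (trans (sym (+-identityʳ _)) eq) i<j }) , ⟦⟧-cancel (toℕ i) k (trans e (cong ⟦_⟧ (sym eq)))

    Least : ℕ → Set
    Least p = 0 < p × ⟦ p ⟧ ≡ 0ᶠ × (∀ k → k < p → ⟦ k ⟧ ≡ 0ᶠ → k ≡ 0)

    least : ∀ k → 0 < k × ⟦ k ⟧ ≡ 0ᶠ → ∃ Least
    least = <-rec _ λ k rec (pos , z) → case anyUpTo? (λ j → (0 ℕ.<? j) ×-dec (⟦ j ⟧ ≟ᶠ 0ᶠ)) k of λ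
      { (yes (j , j<k , hyp)) → rec j<k hyp
      ; (no none) → k , pos , z , λ j j<k e → n≤0⇒n≡0 (≮⇒≥ λ 0<j → none (j , j<k , 0<j , e)) }

  abstract
    private
      characteristic : ∃ Least
      characteristic = least _ (proj₂ torsion)

  char : ℕ
  char = proj₁ characteristic

  private
    char-least : Least char
    char-least = proj₂ characteristic

  instance
    char-nonZero : NonZero char
    char-nonZero = ℕ.>-nonZero (proj₁ char-least)

  ⟦char⟧≡0 : ⟦ char ⟧ ≡ 0ᶠ
  ⟦char⟧≡0 = proj₁ (proj₂ char-least)

  ⟦⟧≡0⇒char∣ : ∀ k → ⟦ k ⟧ ≡ 0ᶠ → char ∣ k
  ⟦⟧≡0⇒char∣ k e = divides (k / char) (trans (m≡m%n+[m/n]*n k char) (cong (_+ k / char * char) r≡0))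
    where
    r≡0 : k % char ≡ 0
    r≡0 = proj₂ (proj₂ char-least) (k % char) (m%n<n k char) (trans (sym (trans (cong (⟦ k % char ⟧ +ᶠ_)
      (trans (⟦⟧-* (k / char) char) (trans (cong (⟦ k / char ⟧ *ᶠ_) ⟦char⟧≡0) (*ᶠ-zeroʳ _)))) (+ᶠ-identityʳ _)))
      (trans (sym (⟦⟧-+ (k % char) (k / char * char))) (trans (cong ⟦_⟧ (sym (m≡m%n+[m/n]*n k char))) e)))

  char>1 : 1 < char
  char>1 with char | char-least
  ... | suc zero | _ , e , _ = contradiction (trans (sym (+ᶠ-identityʳ 1ᶠ)) e) 1ᶠ≢0ᶠ
  ... | suc (suc _) | _ = s≤s (s≤s z≤n)

  -- (k + 1) [t^(k+1)] (y + t)^(n+1) = (n + 1) [t^k] (y + t)^n; at n + 1 = char the inner coefficients vanish.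
  private
    module _ (y : 𝔽) where
      c : ℕ → Ser
      c n = powS (lin y 1ᶠ) n

      c-suc : ∀ n k → c (suc n) (suc k) ≡ y *ᶠ c n (suc k) +ᶠ c n k
      c-suc n k = cong (y *ᶠ c n (suc k) +ᶠ_) (trans (conv-constˡ k (λ { (suc i) _ → refl })) (*ᶠ-identityˡ _))

      c-deriv : ∀ n k → ⟦ suc k ⟧ *ᶠ c (suc n) (suc k) ≡ ⟦ suc n ⟧ *ᶠ c n k
      c-deriv zero zero = trans (cong (⟦ 1 ⟧ *ᶠ_) (c-suc 0 0)) (base ⟦ 1 ⟧ y)
        where
        base : ∀ a y → a *ᶠ (y *ᶠ 0ᶠ +ᶠ 1ᶠ) ≡ a *ᶠ 1ᶠ
        base = solve 2 (λ a y → a :* (y :* con (0 , 0) :+ con (1 , 0)) := a :* con (1 , 0)) refl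
      c-deriv zero (suc k) = trans (cong (⟦ suc (suc k) ⟧ *ᶠ_) (c-suc 0 (suc k))) (base ⟦ suc (suc k) ⟧ ⟦ 1 ⟧ y)
        where
        base : ∀ a b y → a *ᶠ (y *ᶠ 0ᶠ +ᶠ 0ᶠ) ≡ b *ᶠ 0ᶠ
        base = solve 3 (λ a b y → a :* (y :* con (0 , 0) :+ con (0 , 0)) := b :* con (0 , 0)) refl
      c-deriv (suc n) zero = trans (cong (⟦ 1 ⟧ *ᶠ_) (c-suc (suc n) 0)) (trans (expand y (c (suc n) 1) (c (suc n) 0))
          (trans (cong (λ z → y *ᶠ z +ᶠ c (suc n) 0) (c-deriv n 0)) (collect y ⟦ suc n ⟧ (c n 0))))
        where
        expand : ∀ y a b → (1ᶠ +ᶠ 0ᶠ) *ᶠ (y *ᶠ a +ᶠ b) ≡ y *ᶠ ((1ᶠ +ᶠ 0ᶠ) *ᶠ a) +ᶠ b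
        expand = solve 3 (λ y a b → (con (1 , 0) :+ con (0 , 0)) :* (y :* a :+ b) := y :* ((con (1 , 0) :+ con (0 , 0)) :* a) :+ b) refl
        collect : ∀ y s a → y *ᶠ (s *ᶠ a) +ᶠ y *ᶠ a ≡ (1ᶠ +ᶠ s) *ᶠ (y *ᶠ a)
        collect = solve 3 (λ y s a → y :* (s :* a) :+ y :* a := (con (1 , 0) :+ s) :* (y :* a)) refl
      c-deriv (suc n) (suc k) = begin
        ⟦ suc (suc k) ⟧ *ᶠ c (suc (suc n)) (suc (suc k))
          ≡⟨ cong (⟦ suc (suc k) ⟧ *ᶠ_) (c-suc (suc n) (suc k)) ⟩
        ⟦ suc (suc k) ⟧ *ᶠ (y *ᶠ c (suc n) (suc (suc k)) +ᶠ c (suc n) (suc k))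
          ≡⟨ expand ⟦ suc k ⟧ y (c (suc n) (suc (suc k))) (c (suc n) (suc k)) ⟩
        y *ᶠ (⟦ suc (suc k) ⟧ *ᶠ c (suc n) (suc (suc k))) +ᶠ ⟦ suc k ⟧ *ᶠ c (suc n) (suc k) +ᶠ c (suc n) (suc k)
          ≡⟨ cong₂ (λ u v → y *ᶠ u +ᶠ v +ᶠ c (suc n) (suc k)) (c-deriv n (suc k)) (c-deriv n k) ⟩
        y *ᶠ (⟦ suc n ⟧ *ᶠ c n (suc k)) +ᶠ ⟦ suc n ⟧ *ᶠ c n k +ᶠ c (suc n) (suc k)
          ≡⟨ cong (y *ᶠ (⟦ suc n ⟧ *ᶠ c n (suc k)) +ᶠ ⟦ suc n ⟧ *ᶠ c n k +ᶠ_) (c-suc n k) ⟩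
        y *ᶠ (⟦ suc n ⟧ *ᶠ c n (suc k)) +ᶠ ⟦ suc n ⟧ *ᶠ c n k +ᶠ (y *ᶠ c n (suc k) +ᶠ c n k)
          ≡⟨ collect y ⟦ suc n ⟧ (c n (suc k)) (c n k) ⟩
        ⟦ suc (suc n) ⟧ *ᶠ (y *ᶠ c n (suc k) +ᶠ c n k)
          ≡⟨ cong (⟦ suc (suc n) ⟧ *ᶠ_) (sym (c-suc n k)) ⟩
        ⟦ suc (suc n) ⟧ *ᶠ c (suc n) (suc k) ∎
        where
        open ≡-Reasoning
        expand : ∀ s y a b → (1ᶠ +ᶠ s) *ᶠ (y *ᶠ a +ᶠ b) ≡ y *ᶠ ((1ᶠ +ᶠ s) *ᶠ a) +ᶠ s *ᶠ b +ᶠ b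
        expand = solve 4 (λ s y a b → (con (1 , 0) :+ s) :* (y :* a :+ b) := y :* ((con (1 , 0) :+ s) :* a) :+ s :* b :+ b) refl
        collect : ∀ y s a b → y *ᶠ (s *ᶠ a) +ᶠ s *ᶠ b +ᶠ (y *ᶠ a +ᶠ b) ≡ (1ᶠ +ᶠ s) *ᶠ (y *ᶠ a +ᶠ b)
        collect = solve 4 (λ y s a b → y :* (s :* a) :+ s :* b :+ (y :* a :+ b) := (con (1 , 0) :+ s) :* (y :* a :+ b)) refl

      c-constant : ∀ n → c n 0 ≡ pow y n
      c-constant zero = refl
      c-constant (suc n) = cong (y *ᶠ_) (c-constant n)

      c-top : ∀ n → c n n ≡ 1ᶠ
      c-top zero = refl
      c-top (suc n) = trans (c-suc n n) (trans (cong₂ (λ u v → y *ᶠ u +ᶠ v) (vanish n) (c-top n)) (base y))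
        where
        base : ∀ y → y *ᶠ 0ᶠ +ᶠ 1ᶠ ≡ 1ᶠ
        base = solve 1 (λ y → y :* con (0 , 0) :+ con (1 , 0) := con (1 , 0)) refl
        vanish : ∀ n → c n (suc n) ≡ 0ᶠ
        vanish n = Deg-powS 1 (lin y 1ᶠ) (Deg-lin y 1ᶠ) n (suc n) (s≤s (≤-reflexive (*-identityʳ n)))

    ev-ends : ∀ n (a : Ser) t → (∀ i → 0 < i → i < suc n → a i ≡ 0ᶠ) → ev (suc (suc n)) a t ≡ a 0 +ᶠ pow t (suc n) *ᶠ a (suc n)
    ev-ends n a t z = cong (a 0 +ᶠ_) (trans (cong (t *ᶠ_) (last n (a ∘ suc) (λ i i<n → z (suc i) (s≤s z≤n) (s≤s i<n)))) (sym (*ᶠ-assoc t _ _)))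
      where
      last : ∀ n (a : Ser) → (∀ i → i < n → a i ≡ 0ᶠ) → ev (suc n) a t ≡ pow t n *ᶠ a n
      last zero a z = base (a 0) t
        where
        base : ∀ a t → a +ᶠ t *ᶠ 0ᶠ ≡ 1ᶠ *ᶠ a
        base = solve 2 (λ a t → a :+ t :* con (0 , 0) := con (1 , 0) :* a) refl
      last (suc n) a z = trans (cong₂ (λ x y → x +ᶠ t *ᶠ y) (z 0 (s≤s z≤n)) (last n (a ∘ suc) (λ i i<n → z (suc i) (s≤s i<n))))
        (step t (pow t n) (a (suc n)))
        where
        step : ∀ t p a → 0ᶠ +ᶠ t *ᶠ (p *ᶠ a) ≡ t *ᶠ p *ᶠ a
        step = solve 3 (λ t p a → con (0 , 0) :+ t :* (p :* a) := t :* p :* a) refl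

    freshman : ∀ p → ⟦ suc p ⟧ ≡ 0ᶠ → (∀ k → k < suc p → ⟦ k ⟧ ≡ 0ᶠ → k ≡ 0) → ∀ t y → pow (y +ᶠ t) (suc p) ≡ pow y (suc p) +ᶠ pow t (suc p)
    freshman p z min t y = begin
      pow (y +ᶠ t) (suc p) ≡⟨ cong (λ u → pow u (suc p)) (linear y t) ⟩
      pow (ev 2 (lin y 1ᶠ) t) (suc p) ≡⟨ sym (ev-powS 1 (lin y 1ᶠ) (Deg-lin y 1ᶠ) t (suc p)) ⟩
      ev (suc (suc p * 1)) (c y (suc p)) t ≡⟨ cong (λ m → ev (suc m) (c y (suc p)) t) (*-identityʳ (suc p)) ⟩
      ev (suc (suc p)) (c y (suc p)) t ≡⟨ ev-ends p (c y (suc p)) t inner ⟩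
      c y (suc p) 0 +ᶠ pow t (suc p) *ᶠ c y (suc p) (suc p) ≡⟨ cong₂ (λ u v → u +ᶠ pow t (suc p) *ᶠ v) (c-constant y (suc p)) (c-top y (suc p)) ⟩
      pow y (suc p) +ᶠ pow t (suc p) *ᶠ 1ᶠ ≡⟨ cong (pow y (suc p) +ᶠ_) (*ᶠ-identityʳ _) ⟩
      pow y (suc p) +ᶠ pow t (suc p) ∎
      where
      open ≡-Reasoning
      linear : ∀ y t → y +ᶠ t ≡ y +ᶠ t *ᶠ (1ᶠ +ᶠ t *ᶠ 0ᶠ)
      linear = solve 2 (λ y t → y :+ t := y :+ t :* (con (1 , 0) :+ t :* con (0 , 0))) refl
      inner : ∀ i → 0 < i → i < suc p → c y (suc p) i ≡ 0ᶠ
      inner (suc i) _ lt = no-zero-divisors (λ e → case min (suc i) lt e of λ ())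
        (trans (*ᶠ-comm _ ⟦ suc i ⟧) (trans (c-deriv y p i) (trans (cong (_*ᶠ c y p i) z) (*ᶠ-zeroˡ _))))

  frob : 𝔽 → 𝔽
  frob x = pow x char

  frob-+ : ∀ x y → frob (x +ᶠ y) ≡ frob x +ᶠ frob y
  frob-+ x y with char | char-least
  ... | suc p | _ , z , min = freshman p z min y x

  pow-*ᶠ : ∀ x y k → pow (x *ᶠ y) k ≡ pow x k *ᶠ pow y k
  pow-*ᶠ x y zero = sym (*ᶠ-identityˡ 1ᶠ)
  pow-*ᶠ x y (suc k) = trans (cong (x *ᶠ y *ᶠ_) (pow-*ᶠ x y k)) (shuffle x y (pow x k) (pow y k))
    where
    shuffle : ∀ x y a b → x *ᶠ y *ᶠ (a *ᶠ b) ≡ x *ᶠ a *ᶠ (y *ᶠ b)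
    shuffle = solve 4 (λ x y a b → x :* y :* (a :* b) := x :* a :* (y :* b)) refl

  pow-nonzero : ∀ {x} k → ¬ (x ≡ 0ᶠ) → ¬ (pow x k ≡ 0ᶠ)
  pow-nonzero zero nz = 1ᶠ≢0ᶠ
  pow-nonzero (suc k) nz = *-nonzero nz (pow-nonzero k nz)

  frob-0 : frob 0ᶠ ≡ 0ᶠ
  frob-0 = +ᶠ-cancelʳ (frob 0ᶠ) (trans (sym (frob-+ 0ᶠ 0ᶠ)) (trans (cong frob (+ᶠ-identityˡ 0ᶠ)) (sym (+ᶠ-identityˡ _))))

  frob-reflects-0 : ∀ {x} → frob x ≡ 0ᶠ → x ≡ 0ᶠ
  frob-reflects-0 {x} e with x ≟ᶠ 0ᶠ
  ... | yes z = z
  ... | no nz = contradiction e (pow-nonzero char nz)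

  frob-injective : ∀ {x y} → frob x ≡ frob y → x ≡ y
  frob-injective {x} {y} e = x-y≡0⇒x≡y (frob-reflects-0 (+ᶠ-cancelʳ (frob y)
    (trans (sym (frob-+ (x +ᶠ (-ᶠ y)) y)) (trans (cong frob (x-y+y≡x x y)) (trans e (sym (+ᶠ-identityˡ _)))))))

  abstract
    -- Finite fields are perfect: the Frobenius map is additive with trivial kernel, hence
    -- injective, hence onto.
    frob-root : ∀ y → ∃ λ x → frob x ≡ y
    frob-root = injective⇒surjective finite𝔽 frob frob-injective

-- Formal derivatives, the first variation, and p-th roots of polynomials.

module Derivatives (F : FiniteField) where
  open import Data.Nat using (pred; _+_; _*_; _≤_)
  open import Data.Nat.Properties hiding (_≟_)
  open import Data.Nat.DivMod using (_/_; m/n*n≤m; m/n≤m; m*n/n≡m)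
  open FiniteSums
  open FieldAlgebra F
  open Series F
  open Polynomials F
  open Frobenius F

  private
    variable
      m : ℕ

  dpow : 𝔽 → ℕ → 𝔽
  dpow x e = ⟦ e ⟧ *ᶠ pow x (pred e)

  dmono : Vec ℕ m → Pt m → Pt m → 𝔽
  dmono [] [] [] = 0ᶠ
  dmono (e ∷ α) (x ∷ xs) (δ ∷ δs) = dpow x e *ᶠ δ *ᶠ mono α xs +ᶠ pow x e *ᶠ dmono α xs δs

  -- The differential at `x` applied to the vector `δ`; linearity in `δ` is `dT-line`, and on basis
  -- vectors it is the partial derivative by `evalT-∂`.
  dT : Terms m → Pt m → Pt m → 𝔽
  dT [] x δ = 0ᶠ
  dT ((c , α) ∷ ts) x δ = c *ᶠ dmono α x δ +ᶠ dT ts x δ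

  Perts : ℕ → Vec Ser m → Vec Ser m → Pt m → Set
  Perts M [] [] [] = ⊤
  Perts M (s ∷ ss) (s' ∷ ss') (δ ∷ δs) = Pert M s s' δ × Perts M ss ss' δs

  heads : Vec Ser m → Pt m
  heads = Vec.map (λ s → s 0)

  private
    pert-same : ∀ M (a : Ser) → Pert M a a 0ᶠ
    pert-same M a = (λ _ _ → refl) , sym (+ᶠ-identityʳ _)

    pert-subst : ∀ {M a a' δ ε} → δ ≡ ε → Pert M a a' δ → Pert M a a' ε
    pert-subst refl p = p

    powS-head : ∀ (s : Ser) e → powS s e 0 ≡ pow (s 0) e
    powS-head s zero = refl
    powS-head s (suc e) = cong (s 0 *ᶠ_) (powS-head s e)

    monoS-head : (α : Vec ℕ m) (ss : Vec Ser m) → monoS α ss 0 ≡ mono α (heads ss)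
    monoS-head [] [] = refl
    monoS-head (e ∷ α) (s ∷ ss) = cong₂ _*ᶠ_ (powS-head s e) (monoS-head α ss)

    x*dpow : ∀ x e → x *ᶠ dpow x e ≡ ⟦ e ⟧ *ᶠ pow x e
    x*dpow x zero = zero-case x
      where
      zero-case : ∀ x → x *ᶠ (0ᶠ *ᶠ 1ᶠ) ≡ 0ᶠ *ᶠ 1ᶠ
      zero-case = solve 1 (λ x → x :* (con (0 , 0) :* con (1 , 0)) := con (0 , 0) :* con (1 , 0)) refl
    x*dpow x (suc e) = comm x ⟦ suc e ⟧ (pow x e)
      where
      comm : ∀ x a b → x *ᶠ (a *ᶠ b) ≡ a *ᶠ (x *ᶠ b)
      comm = solve 3 (λ x a b → x :* (a :* b) := a :* (x :* b)) refl

    pert-powS : ∀ M {s s' : Ser} {δ} → Pert (suc M) s s' δ → ∀ e → Pert (suc M) (powS s e) (powS s' e) (dpow (s 0) e *ᶠ δ)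
    pert-powS M {s} {δ = δ} p zero = pert-subst {a = const 1ᶠ} {a' = const 1ᶠ} (zero-case δ) (pert-same (suc M) (const 1ᶠ))
      where
      zero-case : ∀ d → 0ᶠ ≡ 0ᶠ *ᶠ 1ᶠ *ᶠ d
      zero-case = solve 1 (λ d → con (0 , 0) := con (0 , 0) :* con (1 , 0) :* d) refl
    pert-powS M {s} {s'} {δ} p (suc e) = pert-subst {a = powS s (suc e)} {a' = powS s' (suc e)} eq (pert-conv M p (pert-powS M p e))
      where
      eq : δ *ᶠ powS s e 0 +ᶠ s 0 *ᶠ (dpow (s 0) e *ᶠ δ) ≡ dpow (s 0) (suc e) *ᶠ δ
      eq = trans (cong₂ _+ᶠ_ (cong (δ *ᶠ_) (powS-head s e)) (trans (sym (*ᶠ-assoc _ _ _)) (cong (_*ᶠ δ) (x*dpow (s 0) e))))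
        (collect δ (pow (s 0) e) ⟦ e ⟧)
        where
        collect : ∀ d p k → d *ᶠ p +ᶠ k *ᶠ p *ᶠ d ≡ (1ᶠ +ᶠ k) *ᶠ p *ᶠ d
        collect = solve 3 (λ d p k → d :* p :+ k :* p :* d := (con (1 , 0) :+ k) :* p :* d) refl

    pert-monoS : ∀ M (ss ss' : Vec Ser m) (δs : Pt m) → Perts (suc M) ss ss' δs → (α : Vec ℕ m) →
                 Pert (suc M) (monoS α ss) (monoS α ss') (dmono α (heads ss) δs)
    pert-monoS M [] [] [] _ [] = pert-same (suc M) (const 1ᶠ)
    pert-monoS M (s ∷ ss) (s' ∷ ss') (δ ∷ δs) (p , ps) (e ∷ α) =
      pert-subst {a = monoS (e ∷ α) (s ∷ ss)} {a' = monoS (e ∷ α) (s' ∷ ss')}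
        (cong₂ (λ x y → dpow (s 0) e *ᶠ δ *ᶠ x +ᶠ y *ᶠ dmono α (heads ss) δs) (monoS-head α ss) (powS-head s e))
        (pert-conv M (pert-powS M p e) (pert-monoS M ss ss' δs ps α))

  -- Taylor expansion to first order: if the substituted series change from degree `suc M` on, so
  -- does the composite, and in that degree the change is the differential at the constant terms.
  -- With `M = 0` this yields the tangent equation, in general the step of Newton iteration.
  first-variation : ∀ M (ss ss' : Vec Ser m) (δs : Pt m) → Perts (suc M) ss ss' δs → (ts : Terms m) →
    evalS ts ss (suc M) ≡ evalS ts ss' (suc M) +ᶠ dT ts (heads ss) δs
  first-variation M ss ss' δs ps [] = sym (+ᶠ-identityˡ 0ᶠ)
  first-variation M ss ss' δs ps ((c , α) ∷ ts) = trans
    (cong₂ (λ x y → c *ᶠ x +ᶠ y) (proj₂ (pert-monoS M ss ss' δs ps α)) (first-variation M ss ss' δs ps ts))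
    (shuffle c _ _ _ _)
    where
    shuffle : ∀ c a b x y → c *ᶠ (a +ᶠ b) +ᶠ (x +ᶠ y) ≡ c *ᶠ a +ᶠ x +ᶠ (c *ᶠ b +ᶠ y)
    shuffle = solve 5 (λ c a b x y → c :* (a :+ b) :+ (x :+ y) := c :* a :+ x :+ (c :* b :+ y)) refl

  basis : Fin m → Pt m
  basis {suc m} zero = 1ᶠ ∷ 0ᵥ
  basis {suc m} (suc i) = 0ᶠ ∷ basis i

  decr : Fin m → Vec ℕ m → Vec ℕ m
  decr zero (e ∷ α) = pred e ∷ α
  decr (suc i) (e ∷ α) = e ∷ decr i α

  private
    dmono-0 : (α : Vec ℕ m) (x : Pt m) → dmono α x 0ᵥ ≡ 0ᶠ
    dmono-0 [] [] = refl
    dmono-0 (e ∷ α) (x ∷ xs) = trans (cong (λ z → dpow x e *ᶠ 0ᶠ *ᶠ mono α xs +ᶠ pow x e *ᶠ z) (dmono-0 α xs)) (zeros (dpow x e) (mono α xs) (pow x e))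
      where
      zeros : ∀ a b c → a *ᶠ 0ᶠ *ᶠ b +ᶠ c *ᶠ 0ᶠ ≡ 0ᶠ
      zeros = solve 3 (λ a b c → a :* con (0 , 0) :* b :+ c :* con (0 , 0) := con (0 , 0)) refl

    dmono-basis : (i : Fin m) (α : Vec ℕ m) (x : Pt m) → dmono α x (basis i) ≡ ⟦ lookup α i ⟧ *ᶠ mono (decr i α) x
    dmono-basis zero (e ∷ α) (x ∷ xs) = trans (cong (λ z → dpow x e *ᶠ 1ᶠ *ᶠ mono α xs +ᶠ pow x e *ᶠ z) (dmono-0 α xs)) (units ⟦ e ⟧ (pow x (pred e)) (mono α xs) (pow x e))
      where
      units : ∀ k a b c → k *ᶠ a *ᶠ 1ᶠ *ᶠ b +ᶠ c *ᶠ 0ᶠ ≡ k *ᶠ (a *ᶠ b)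
      units = solve 4 (λ k a b c → k :* a :* con (1 , 0) :* b :+ c :* con (0 , 0) := k :* (a :* b)) refl
    dmono-basis (suc i) (e ∷ α) (x ∷ xs) = trans (cong (λ z → dpow x e *ᶠ 0ᶠ *ᶠ mono α xs +ᶠ pow x e *ᶠ z) (dmono-basis i α xs)) (shuffle (dpow x e) (mono α xs) (pow x e) _ _)
      where
      shuffle : ∀ a b c k y → a *ᶠ 0ᶠ *ᶠ b +ᶠ c *ᶠ (k *ᶠ y) ≡ k *ᶠ (c *ᶠ y)
      shuffle = solve 5 (λ a b c k y → a :* con (0 , 0) :* b :+ c :* (k :* y) := k :* (c :* y)) refl

  -- Terms whose exponent is zero in the field are dropped, not kept with coefficient zero. So a
  -- reduced list stays reduced, and an empty result certifies that all exponents are divisible by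
  -- the characteristic.
  ∂ : Fin m → Terms m → Terms m
  ∂ i [] = []
  ∂ i ((c , α) ∷ ts) with ⟦ lookup α i ⟧ ≟ᶠ 0ᶠ
  ... | yes _ = ∂ i ts
  ... | no _ = (⟦ lookup α i ⟧ *ᶠ c , decr i α) ∷ ∂ i ts

  evalT-∂ : (i : Fin m) (ts : Terms m) (x : Pt m) → evalT (∂ i ts) x ≡ dT ts x (basis i)
  evalT-∂ i [] x = refl
  evalT-∂ i ((c , α) ∷ ts) x with ⟦ lookup α i ⟧ ≟ᶠ 0ᶠ
  ... | yes z = trans (evalT-∂ i ts x) (sym (trans (cong (λ y → c *ᶠ y +ᶠ dT ts x (basis i))
      (trans (dmono-basis i α x) (trans (cong (_*ᶠ mono (decr i α) x) z) (*ᶠ-zeroˡ _)))) (drop c _)))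
    where
    drop : ∀ c x → c *ᶠ 0ᶠ +ᶠ x ≡ x
    drop = solve 2 (λ c x → c :* con (0 , 0) :+ x := x) refl
  ... | no _ = cong₂ _+ᶠ_ (trans (shuffle _ c _) (cong (c *ᶠ_) (sym (dmono-basis i α x)))) (evalT-∂ i ts x)
    where
    shuffle : ∀ k c y → k *ᶠ c *ᶠ y ≡ c *ᶠ (k *ᶠ y)
    shuffle = solve 3 (λ k c y → k :* c :* y := c :* (k :* y)) refl

  dT-line : (ts : Terms m) (x δ ε : Pt m) (t : 𝔽) → dT ts x (line δ ε t) ≡ dT ts x δ +ᶠ t *ᶠ dT ts x ε
  dT-line [] x δ ε t = sym (trans (+ᶠ-identityˡ _) (*ᶠ-zeroʳ t))
  dT-line ((c , α) ∷ ts) x δ ε t = trans (cong₂ (λ u v → c *ᶠ u +ᶠ v) (dmono-line α x δ ε) (dT-line ts x δ ε t)) (shuffle c t _ _ _ _)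
    where
    shuffle : ∀ c t a b x y → c *ᶠ (a +ᶠ t *ᶠ b) +ᶠ (x +ᶠ t *ᶠ y) ≡ c *ᶠ a +ᶠ x +ᶠ t *ᶠ (c *ᶠ b +ᶠ y)
    shuffle = solve 6 (λ c t a b x y → c :* (a :+ t :* b) :+ (x :+ t :* y) := c :* a :+ x :+ t :* (c :* b :+ y)) refl
    dmono-line : ∀ {m} (α : Vec ℕ m) (x δ ε : Pt m) → dmono α x (line δ ε t) ≡ dmono α x δ +ᶠ t *ᶠ dmono α x ε
    dmono-line [] [] [] [] = sym (trans (+ᶠ-identityˡ _) (*ᶠ-zeroʳ t))
    dmono-line (e ∷ α) (x ∷ xs) (δ ∷ δs) (ε ∷ εs) = trans
      (cong (λ z → dpow x e *ᶠ (δ +ᶠ t *ᶠ ε) *ᶠ mono α xs +ᶠ pow x e *ᶠ z) (dmono-line α xs δs εs))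
      (step (dpow x e) δ t ε (mono α xs) (pow x e) (dmono α xs δs) (dmono α xs εs))
      where
      step : ∀ d x t y m p u v → d *ᶠ (x +ᶠ t *ᶠ y) *ᶠ m +ᶠ p *ᶠ (u +ᶠ t *ᶠ v) ≡ d *ᶠ x *ᶠ m +ᶠ p *ᶠ u +ᶠ t *ᶠ (d *ᶠ y *ᶠ m +ᶠ p *ᶠ v)
      step = solve 8 (λ d x t y m p u v → d :* (x :+ t :* y) :* m :+ p :* (u :+ t :* v) := d :* x :* m :+ p :* u :+ t :* (d :* y :* m :+ p :* v)) refl

  private
    dT-0 : (ts : Terms m) (x : Pt m) → dT ts x 0ᵥ ≡ 0ᶠ
    dT-0 [] x = refl
    dT-0 ((c , α) ∷ ts) x = trans (cong₂ (λ u v → c *ᶠ u +ᶠ v) (dmono-0 α x) (dT-0 ts x)) (trans (+ᶠ-identityʳ _) (*ᶠ-zeroʳ c))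

  dT₃ : (ts : Terms 3) (x : Pt 3) (a b c : 𝔽) →
    dT ts x (a ∷ b ∷ c ∷ []) ≡ a *ᶠ dT ts x (basis zero) +ᶠ b *ᶠ dT ts x (basis (suc zero)) +ᶠ c *ᶠ dT ts x (basis (suc (suc zero)))
  dT₃ ts x a b c = begin
    dT ts x (a ∷ b ∷ c ∷ [])
      ≡⟨ cong (dT ts x) (cong₂ _∷_ (first a b c) (cong₂ _∷_ (second a b c) (cong₂ _∷_ (third a b c) refl))) ⟩
    dT ts x (line (line (line 0ᵥ e₀ a) e₁ b) e₂ c)
      ≡⟨ trans (dT-line ts x _ e₂ c) (cong (_+ᶠ c *ᶠ dT ts x e₂) (trans (dT-line ts x _ e₁ b)
           (cong (_+ᶠ b *ᶠ dT ts x e₁) (trans (dT-line ts x 0ᵥ e₀ a) (trans (cong (_+ᶠ a *ᶠ dT ts x e₀) (dT-0 ts x)) (+ᶠ-identityˡ _)))))) ⟩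
    a *ᶠ dT ts x e₀ +ᶠ b *ᶠ dT ts x e₁ +ᶠ c *ᶠ dT ts x e₂ ∎
    where
    open ≡-Reasoning
    e₀ e₁ e₂ : Pt 3
    e₀ = basis zero
    e₁ = basis (suc zero)
    e₂ = basis (suc (suc zero))
    first : ∀ a b c → a ≡ 0ᶠ +ᶠ a *ᶠ 1ᶠ +ᶠ b *ᶠ 0ᶠ +ᶠ c *ᶠ 0ᶠ
    first = solve 3 (λ a b c → a := con (0 , 0) :+ a :* con (1 , 0) :+ b :* con (0 , 0) :+ c :* con (0 , 0)) refl
    second : ∀ a b c → b ≡ 0ᶠ +ᶠ a *ᶠ 0ᶠ +ᶠ b *ᶠ 1ᶠ +ᶠ c *ᶠ 0ᶠ
    second = solve 3 (λ a b c → b := con (0 , 0) :+ a :* con (0 , 0) :+ b :* con (1 , 0) :+ c :* con (0 , 0)) refl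
    third : ∀ a b c → c ≡ 0ᶠ +ᶠ a *ᶠ 0ᶠ +ᶠ b *ᶠ 0ᶠ +ᶠ c *ᶠ 1ᶠ
    third = solve 3 (λ a b c → c := con (0 , 0) :+ a :* con (0 , 0) :+ b :* con (0 , 0) :+ c :* con (1 , 0)) refl

  Degree≤ : ℕ → Terms m → Set
  Degree≤ N = All (λ t → Vec.sum (proj₂ t) ≤ N)

  -- A reduced nonempty term list represents a nonzero formal polynomial.
  record Reduced (ts : Terms m) : Set where
    field
      distinct : AllPairs (λ s t → ¬ (proj₂ s ≡ proj₂ t)) ts
      nonzero : All (λ t → ¬ (proj₁ t ≡ 0ᶠ)) ts

  module _ (i : Fin m) where
    private
      suc-entry : ∀ {k} → ¬ (⟦ k ⟧ ≡ 0ᶠ) → suc (pred k) ≡ k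
      suc-entry {zero} nz = contradiction refl nz
      suc-entry {suc k} nz = refl

    -- An exponent that is nonzero in the field is a positive number, so that its decrement can be
    -- undone. Hence differentiation does not merge distinct monomials.
    decr-injective : (α β : Vec ℕ m) → ¬ (⟦ lookup α i ⟧ ≡ 0ᶠ) → ¬ (⟦ lookup β i ⟧ ≡ 0ᶠ) → decr i α ≡ decr i β → α ≡ β
    decr-injective α β = go i α β
      where
      go : ∀ {m} (i : Fin m) (α β : Vec ℕ m) → ¬ (⟦ lookup α i ⟧ ≡ 0ᶠ) → ¬ (⟦ lookup β i ⟧ ≡ 0ᶠ) → decr i α ≡ decr i β → α ≡ β
      go zero (e ∷ α) (e' ∷ β) nz nz' eq = cong₂ _∷_
        (trans (sym (suc-entry nz)) (trans (cong (suc ∘ Vec.head) eq) (suc-entry nz'))) (cong Vec.tail eq)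
      go (suc i) (e ∷ α) (e' ∷ β) nz nz' eq = cong₂ _∷_ (cong Vec.head eq) (go i α β nz nz' (cong Vec.tail eq))

    sum-decr : (α : Vec ℕ m) → ¬ (⟦ lookup α i ⟧ ≡ 0ᶠ) → suc (Vec.sum (decr i α)) ≡ Vec.sum α
    sum-decr α = go i α
      where
      go : ∀ {m} (i : Fin m) (α : Vec ℕ m) → ¬ (⟦ lookup α i ⟧ ≡ 0ᶠ) → suc (Vec.sum (decr i α)) ≡ Vec.sum α
      go zero (e ∷ α) nz = cong (_+ Vec.sum α) (suc-entry nz)
      go (suc i) (e ∷ α) nz = trans (sym (+-suc e _)) (cong (e +_) (go i α nz))

    weight-decr : (ws α : Vec ℕ m) → weight ws (decr i α) ≤ weight ws α
    weight-decr ws α = go i ws α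
      where
      go : ∀ {m} (i : Fin m) (ws α : Vec ℕ m) → weight ws (decr i α) ≤ weight ws α
      go zero (w ∷ ws) (e ∷ α) = +-monoˡ-≤ (weight ws α) (*-monoˡ-≤ w (pred[n]≤n {e}))
      go (suc i) (w ∷ ws) (e ∷ α) = +-monoʳ-≤ (e * w) (go i ws α)

    ∂-degree : ∀ {N} (ts : Terms m) → Degree≤ (suc N) ts → Degree≤ N (∂ i ts)
    ∂-degree [] [] = []
    ∂-degree ((c , α) ∷ ts) (r ∷ rs) with ⟦ lookup α i ⟧ ≟ᶠ 0ᶠ
    ... | yes _ = ∂-degree ts rs
    ... | no nz = ℕ.s≤s⁻¹ (≤-trans (≤-reflexive (sum-decr α nz)) r) ∷ ∂-degree ts rs

    ∂-weight : ∀ {D} (ws : Vec ℕ m) (ts : Terms m) → All (λ t → weight ws (proj₂ t) ≤ D) ts → All (λ t → weight ws (proj₂ t) ≤ D) (∂ i ts)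
    ∂-weight ws [] [] = []
    ∂-weight ws ((c , α) ∷ ts) (r ∷ rs) with ⟦ lookup α i ⟧ ≟ᶠ 0ᶠ
    ... | yes _ = ∂-weight ws ts rs
    ... | no nz = ≤-trans (weight-decr ws α) r ∷ ∂-weight ws ts rs

    private
      ∂-fresh : ∀ α → ¬ (⟦ lookup α i ⟧ ≡ 0ᶠ) → (ts : Terms m) → All (λ t → ¬ (α ≡ proj₂ t)) ts → All (λ t → ¬ (decr i α ≡ proj₂ t)) (∂ i ts)
      ∂-fresh α nz [] [] = []
      ∂-fresh α nz ((c , β) ∷ ts) (r ∷ rs) with ⟦ lookup β i ⟧ ≟ᶠ 0ᶠ
      ... | yes _ = ∂-fresh α nz ts rs
      ... | no nz' = (λ e → r (decr-injective α β nz nz' e)) ∷ ∂-fresh α nz ts rs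

    ∂-reduced : (ts : Terms m) → Reduced ts → Reduced (∂ i ts)
    ∂-reduced ts red = record { distinct = go₁ ts distinct ; nonzero = go₂ ts nonzero }
      where
      open Reduced red
      go₁ : (ts : Terms m) → AllPairs (λ s t → ¬ (proj₂ s ≡ proj₂ t)) ts → AllPairs (λ s t → ¬ (proj₂ s ≡ proj₂ t)) (∂ i ts)
      go₁ [] [] = []
      go₁ ((c , α) ∷ ts) (r ∷ rs) with ⟦ lookup α i ⟧ ≟ᶠ 0ᶠ
      ... | yes _ = go₁ ts rs
      ... | no nz = ∂-fresh α nz ts r ∷ go₁ ts rs
      go₂ : (ts : Terms m) → All (λ t → ¬ (proj₁ t ≡ 0ᶠ)) ts → All (λ t → ¬ (proj₁ t ≡ 0ᶠ)) (∂ i ts)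
      go₂ [] [] = []
      go₂ ((c , α) ∷ ts) (r ∷ rs) with ⟦ lookup α i ⟧ ≟ᶠ 0ᶠ
      ... | yes _ = go₂ ts rs
      ... | no nz = *-nonzero nz r ∷ go₂ ts rs

    ∂-empty : (ts : Terms m) → ∂ i ts ≡ [] → All (λ t → ⟦ lookup (proj₂ t) i ⟧ ≡ 0ᶠ) ts
    ∂-empty [] e = []
    ∂-empty ((c , α) ∷ ts) e with ⟦ lookup α i ⟧ ≟ᶠ 0ᶠ
    ... | yes z = z ∷ ∂-empty ts e

  Vanishing-exponents : Vec ℕ m → Set
  Vanishing-exponents α = ∀ i → ⟦ lookup α i ⟧ ≡ 0ᶠ

  quotient : Vec ℕ m → Vec ℕ m
  quotient = Vec.map (_/ char)

  quotient-exact : (α : Vec ℕ m) → Vanishing-exponents α → Vec.map (_* char) (quotient α) ≡ α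
  quotient-exact [] z = refl
  quotient-exact (e ∷ α) z with divides k refl ← ⟦⟧≡0⇒char∣ e (z zero) = cong₂ _∷_ (cong (_* char) (m*n/n≡m k char)) (quotient-exact α (z ∘ suc))

  -- When all exponents are divisible by the characteristic, this is a p-th root in the sense of
  -- `frob-rootT`.
  rootT : Terms m → Terms m
  rootT [] = []
  rootT ((c , α) ∷ ts) = (proj₁ (frob-root c) , quotient α) ∷ rootT ts

  private
    pow-pow : ∀ x i j → pow (pow x i) j ≡ pow x (i * j)
    pow-pow x zero j = pow-1 j
      where
      pow-1 : ∀ j → pow 1ᶠ j ≡ 1ᶠ
      pow-1 zero = refl
      pow-1 (suc j) = trans (*ᶠ-identityˡ _) (pow-1 j)
    pow-pow x (suc i) j = trans (pow-*ᶠ x (pow x i) j) (trans (cong (pow x j *ᶠ_) (pow-pow x i j)) (sym (pow-+ x j (i * j))))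

    frob-mono : (β : Vec ℕ m) (x : Pt m) → frob (mono β x) ≡ mono (Vec.map (_* char) β) x
    frob-mono [] [] = pow-pow 1ᶠ 0 char
    frob-mono (e ∷ β) (a ∷ x) = trans (pow-*ᶠ (pow a e) (mono β x) char) (cong₂ _*ᶠ_ (pow-pow a e char) (frob-mono β x))

  frob-rootT : (ts : Terms m) → All (λ t → Vanishing-exponents (proj₂ t)) ts → (x : Pt m) → frob (evalT (rootT ts) x) ≡ evalT ts x
  frob-rootT [] [] x = frob-0
  frob-rootT ((c , α) ∷ ts) (z ∷ zs) x = trans (frob-+ _ _) (cong₂ _+ᶠ_
    (trans (pow-*ᶠ _ _ char) (cong₂ _*ᶠ_ (proj₂ (frob-root c)) (trans (frob-mono (quotient α) x) (cong (λ β → mono β x) (quotient-exact α z)))))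
    (frob-rootT ts zs x))

  -- Because `char` is at least 2 the degree is at least halved, which takes any bound `suc N` down
  -- to `N`. This makes the search for a simple root terminate at p-th roots as well as at
  -- derivatives.
  rootT-degree : ∀ {N} (ts : Terms m) → Degree≤ (suc N) ts → Degree≤ N (rootT ts)
  rootT-degree [] [] = []
  rootT-degree {N = N} ((c , α) ∷ ts) (r ∷ rs) = ℕ.s≤s⁻¹ (half (Vec.sum (quotient α)) (≤-trans (double α) r)) ∷ rootT-degree ts rs
    where
    double : ∀ {m} (α : Vec ℕ m) → 2 * Vec.sum (quotient α) ≤ Vec.sum α
    double [] = z≤n
    double (e ∷ α) = ≤-trans (≤-reflexive (*-distribˡ-+ 2 (e / char) _)) (+-mono-≤
      (≤-trans (≤-trans (*-monoˡ-≤ (e / char) char>1) (≤-reflexive (*-comm char (e / char)))) (m/n*n≤m e char)) (double α))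
    half : ∀ s → 2 * s ≤ suc N → suc s ≤ suc N
    half zero le = s≤s z≤n
    half (suc s) le = ≤-trans (≤-trans (s≤s (m≤m+n (suc s) s)) (≤-reflexive (dbl s))) le
      where
      dbl : ∀ s → suc (suc s + s) ≡ 2 * suc s
      dbl = ringℕ

  rootT-weight : ∀ {D} (ws : Vec ℕ m) (ts : Terms m) → All (λ t → weight ws (proj₂ t) ≤ D) ts → All (λ t → weight ws (proj₂ t) ≤ D) (rootT ts)
  rootT-weight ws [] [] = []
  rootT-weight ws ((c , α) ∷ ts) (r ∷ rs) = ≤-trans (go ws α) r ∷ rootT-weight ws ts rs
    where
    go : ∀ {m} (ws α : Vec ℕ m) → weight ws (quotient α) ≤ weight ws α
    go [] [] = z≤n
    go (w ∷ ws) (e ∷ α) = +-mono-≤ (*-monoˡ-≤ w (m/n≤m e char)) (go ws α)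

  rootT-reduced : (ts : Terms m) → All (λ t → Vanishing-exponents (proj₂ t)) ts → Reduced ts → Reduced (rootT ts)
  rootT-reduced {m} ts zs red = record { distinct = go₁ ts zs distinct ; nonzero = go₂ ts nonzero }
    where
    open Reduced red
    fresh : ∀ α → Vanishing-exponents α → (ts : Terms m) → All (λ t → Vanishing-exponents (proj₂ t)) ts →
            All (λ t → ¬ (α ≡ proj₂ t)) ts → All (λ t → ¬ (quotient α ≡ proj₂ t)) (rootT ts)
    fresh α z [] [] [] = []
    fresh α z ((c , β) ∷ ts) (y ∷ ys) (r ∷ rs) =
      (λ e → r (trans (sym (quotient-exact α z)) (trans (cong (Vec.map (_* char)) e) (quotient-exact β y)))) ∷ fresh α z ts ys rs
    go₁ : (ts : Terms m) → All (λ t → Vanishing-exponents (proj₂ t)) ts → AllPairs (λ s t → ¬ (proj₂ s ≡ proj₂ t)) ts →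
          AllPairs (λ s t → ¬ (proj₂ s ≡ proj₂ t)) (rootT ts)
    go₁ [] [] [] = []
    go₁ ((c , α) ∷ ts) (z ∷ zs) (r ∷ rs) = fresh α z ts zs r ∷ go₁ ts zs rs
    go₂ : (ts : Terms m) → All (λ t → ¬ (proj₁ t ≡ 0ᶠ)) ts → All (λ t → ¬ (proj₁ t ≡ 0ᶠ)) (rootT ts)
    go₂ [] [] = []
    go₂ ((c , α) ∷ ts) (r ∷ rs) = (λ e → r (trans (sym (proj₂ (frob-root c))) (trans (cong frob e) frob-0))) ∷ go₂ ts rs

-- The theorem in the plane.

module Plane (F : FiniteField) where
  open import Data.Nat using (_+_; _*_; _^_; _∸_; _≤_; _<_)
  open import Data.Nat.Properties hiding (_≟_)
  open import Data.Nat.DivMod using (_/_; m≡m%n+[m/n]*n; m%n<n; m/n*n≤m)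
  open FiniteSums
  open FieldAlgebra F
  open Series F
  open Polynomials F
  open Core F
  open Frobenius F
  open Derivatives F

  emb : Pt 2 → 𝔽 → Pt 3
  emb (x ∷ y ∷ []) z = x ∷ y ∷ z ∷ []

  x₀ x₁ x₂ : Fin 3
  x₀ = zero
  x₁ = suc zero
  x₂ = suc (suc zero)

  Vanishes : (Pt 2 → Bool) → (Pt 2 → 𝔽) → Terms 3 → Set
  Vanishes X f ts = ∀ p → X p ≡ true → evalT ts (emb p (f p)) ≡ 0ᶠ

  -- A nonzero polynomial vanishing on the graph of f over X is replaced by a derivative or, in
  -- characteristic p, by a p-th root, as long as its z-derivative vanishes there as well.
  module SimpleRoot (X : Pt 2 → Bool) (f : Pt 2 → 𝔽) (point : ∃ λ z → X z ≡ true)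
    (ws : Vec ℕ 3) (D : ℕ)
    (tangent : ∀ ts → All (λ t → weight ws (proj₂ t) ≤ D) ts → Vanishes X f ts →
               ∀ p → X p ≡ true → evalT (∂ x₂ ts) (emb p (f p)) ≡ 0ᶠ →
               evalT (∂ x₀ ts) (emb p (f p)) ≡ 0ᶠ × evalT (∂ x₁ ts) (emb p (f p)) ≡ 0ᶠ) where

    Weighted : Terms 3 → Set
    Weighted = All (λ t → weight ws (proj₂ t) ≤ D)

    record Simple : Set where
      field
        ts : Terms 3
        weighted : Weighted ts
        vanishes : Vanishes X f ts
        p : Pt 2
        p∈X : X p ≡ true
        simple : ¬ (evalT (∂ x₂ ts) (emb p (f p)) ≡ 0ᶠ)

    private
      constant : ∀ (ts : Terms 3) → Degree≤ 0 ts → Reduced ts → ¬ (ts ≡ []) → ∀ x → ¬ (evalT ts x ≡ 0ᶠ)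
      constant [] _ _ ne = contradiction refl ne
      constant ((c , i ∷ j ∷ k ∷ []) ∷ []) (le ∷ []) red ne (x ∷ y ∷ z ∷ []) e
        with refl ← m+n≡0⇒m≡0 i (n≤0⇒n≡0 le)
        with refl ← m+n≡0⇒m≡0 j (n≤0⇒n≡0 le)
        with refl ← m+n≡0⇒m≡0 k (n≤0⇒n≡0 le) = All.head (Reduced.nonzero red) (trans (simplify c) e)
        where
        simplify : ∀ c → c ≡ c *ᶠ (1ᶠ *ᶠ (1ᶠ *ᶠ (1ᶠ *ᶠ 1ᶠ))) +ᶠ 0ᶠ
        simplify = solve 1 (λ c → c := c :* (con (1 , 0) :* (con (1 , 0) :* (con (1 , 0) :* con (1 , 0)))) :+ con (0 , 0)) refl
      constant ((c , i ∷ j ∷ k ∷ []) ∷ (c' , i' ∷ j' ∷ k' ∷ []) ∷ _) (le ∷ le' ∷ _) red ne x e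
        with refl ← m+n≡0⇒m≡0 i (n≤0⇒n≡0 le)
        with refl ← m+n≡0⇒m≡0 j (n≤0⇒n≡0 le)
        with refl ← m+n≡0⇒m≡0 k (n≤0⇒n≡0 le)
        with refl ← m+n≡0⇒m≡0 i' (n≤0⇒n≡0 le')
        with refl ← m+n≡0⇒m≡0 j' (n≤0⇒n≡0 le')
        with refl ← m+n≡0⇒m≡0 k' (n≤0⇒n≡0 le') = contradiction refl (All.head (AllPairs.head (Reduced.distinct red)))

      empty? : (ts : Terms 3) → Dec (ts ≡ [])
      empty? [] = yes refl
      empty? (_ ∷ _) = no λ ()

      rootT-nonempty : (ts : Terms 3) → ¬ (ts ≡ []) → ¬ (rootT ts ≡ [])
      rootT-nonempty [] ne = contradiction refl ne
      rootT-nonempty (_ ∷ _) ne ()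

    find : ∀ N (ts : Terms 3) → Degree≤ N ts → Reduced ts → ¬ (ts ≡ []) → Weighted ts → Vanishes X f ts → Simple
    -- A nonempty reduced list of degree 0 is a nonzero constant, which cannot vanish over the given
    -- point of `X`.
    find zero ts deg red ne wt van =
      contradiction (van (proj₁ point) (proj₂ point)) (constant ts deg red ne (emb (proj₁ point) (f (proj₁ point))))
    find (suc N) ts deg red ne wt van
      with Finite.∃? (finitePt 2) (λ p → (X p Bool.≟ true) ×-dec ¬? (evalT (∂ x₂ ts) (emb p (f p)) ≟ᶠ 0ᶠ))
    ... | yes (p , Xp , nz) = record { ts = ts ; weighted = wt ; vanishes = van ; p = p ; p∈X = Xp ; simple = nz }
    ... | no none = go (empty? (∂ x₂ ts)) (empty? (∂ x₀ ts)) (empty? (∂ x₁ ts))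
      where
      van₂ : Vanishes X f (∂ x₂ ts)
      van₂ p Xp with evalT (∂ x₂ ts) (emb p (f p)) ≟ᶠ 0ᶠ
      ... | yes z = z
      ... | no nz = contradiction (p , Xp , nz) none
      descend : ∀ i → Vanishes X f (∂ i ts) → ¬ (∂ i ts ≡ []) → Simple
      descend i v n = find N (∂ i ts) (∂-degree i ts deg) (∂-reduced i ts red) n (∂-weight i ws ts wt) v
      go : Dec (∂ x₂ ts ≡ []) → Dec (∂ x₀ ts ≡ []) → Dec (∂ x₁ ts ≡ []) → Simple
      go (no n) _ _ = descend x₂ van₂ n
      go (yes _) (no n) _ = descend x₀ (λ p Xp → proj₁ (tangent ts wt van p Xp (van₂ p Xp))) n
      go (yes _) (yes _) (no n) = descend x₁ (λ p Xp → proj₂ (tangent ts wt van p Xp (van₂ p Xp))) n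
      go (yes e₂) (yes e₀) (yes e₁) = find N (rootT ts) (rootT-degree ts deg) (rootT-reduced ts exps red)
          (rootT-nonempty ts ne) (rootT-weight ws ts wt)
          (λ p Xp → frob-reflects-0 (trans (frob-rootT ts exps (emb p (f p))) (van p Xp)))
        where
        exps : All (λ t → Vanishing-exponents (proj₂ t)) ts
        exps = All.zipWith (λ { (a , b , c) zero → a ; (a , b , c) (suc zero) → b ; (a , b , c) (suc (suc zero)) → c })
          (∂-empty x₀ ts e₀ , All.zip (∂-empty x₁ ts e₁ , ∂-empty x₂ ts e₂))

  module Interpolation (f : Pt 2 → 𝔽) where
    private
      mk : (es : List (Vec ℕ 3)) → Vec 𝔽 (length es) → Terms 3
      mk [] [] = []
      mk (α ∷ es) (c ∷ cs) = (c , α) ∷ mk es cs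

      evalT-mk : (es : List (Vec ℕ 3)) (a b : Vec 𝔽 (length es)) (x : Pt 3) →
                 evalT (mk es (a ⊟ b)) x ≡ evalT (mk es a) x +ᶠ (-ᶠ evalT (mk es b) x)
      evalT-mk [] [] [] x = zeros
        where
        zeros : 0ᶠ ≡ 0ᶠ +ᶠ (-ᶠ 0ᶠ)
        zeros = sym (+ᶠ-inverseʳ 0ᶠ)
      evalT-mk (α ∷ es) (a ∷ as) (b ∷ bs) x = trans (cong (λ z → (a +ᶠ (-ᶠ 1ᶠ) *ᶠ b) *ᶠ mono α x +ᶠ z) (evalT-mk es as bs x)) (shuffle a b (mono α x) _ _)
        where
        shuffle : ∀ a b m u v → (a +ᶠ (-ᶠ 1ᶠ) *ᶠ b) *ᶠ m +ᶠ (u +ᶠ (-ᶠ v)) ≡ a *ᶠ m +ᶠ u +ᶠ (-ᶠ (b *ᶠ m +ᶠ v))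
        shuffle = solve 5 (λ a b m u v → (a :+ (:- con (1 , 0)) :* b) :* m :+ (u :+ (:- v)) := a :* m :+ u :+ (:- (b :* m :+ v))) refl

      prune : Terms 3 → Terms 3
      prune [] = []
      prune ((c , α) ∷ ts) with c ≟ᶠ 0ᶠ
      ... | yes _ = prune ts
      ... | no _ = (c , α) ∷ prune ts

      evalT-prune : (ts : Terms 3) (x : Pt 3) → evalT (prune ts) x ≡ evalT ts x
      evalT-prune [] x = refl
      evalT-prune ((c , α) ∷ ts) x with c ≟ᶠ 0ᶠ
      ... | yes refl = trans (evalT-prune ts x) (sym (trans (cong (_+ᶠ evalT ts x) (*ᶠ-zeroˡ _)) (+ᶠ-identityˡ _)))
      ... | no _ = cong (c *ᶠ mono α x +ᶠ_) (evalT-prune ts x)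

      prune-exponents : {P : Vec ℕ 3 → Set} (es : List (Vec ℕ 3)) (cs : Vec 𝔽 (length es)) → All P es → All (λ t → P (proj₂ t)) (prune (mk es cs))
      prune-exponents [] [] [] = []
      prune-exponents (α ∷ es) (c ∷ cs) (p ∷ ps) with c ≟ᶠ 0ᶠ
      ... | yes _ = prune-exponents es cs ps
      ... | no _ = p ∷ prune-exponents es cs ps

      prune-reduced : (es : List (Vec ℕ 3)) (cs : Vec 𝔽 (length es)) → Unique es → Reduced (prune (mk es cs))
      prune-reduced es cs u = record { distinct = go₁ es cs u ; nonzero = go₂ (mk es cs) }
        where
        go₁ : (es : List (Vec ℕ 3)) (cs : Vec 𝔽 (length es)) → Unique es → AllPairs (λ s t → ¬ (proj₂ s ≡ proj₂ t)) (prune (mk es cs))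
        go₁ [] [] [] = []
        go₁ (α ∷ es) (c ∷ cs) (p ∷ ps) with c ≟ᶠ 0ᶠ
        ... | yes _ = go₁ es cs ps
        ... | no _ = prune-exponents es cs p ∷ go₁ es cs ps
        go₂ : (ts : Terms 3) → All (λ t → ¬ (proj₁ t ≡ 0ᶠ)) (prune ts)
        go₂ [] = []
        go₂ ((c , α) ∷ ts) with c ≟ᶠ 0ᶠ
        ... | yes _ = go₂ ts
        ... | no nz = nz ∷ go₂ ts

      prune-empty : (es : List (Vec ℕ 3)) (cs : Vec 𝔽 (length es)) → prune (mk es cs) ≡ [] → cs ≡ 0ᵥ
      prune-empty [] [] e = refl
      prune-empty (α ∷ es) (c ∷ cs) e with c ≟ᶠ 0ᶠ
      ... | yes z = cong₂ _∷_ z (prune-empty es cs e)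

      values : (ps : List (Pt 2)) → Terms 3 → Vec 𝔽 (length ps)
      values [] ts = []
      values (p ∷ ps) ts = evalT ts (emb p (f p)) ∷ values ps ts

      values-≡ : (ps : List (Pt 2)) (ts us : Terms 3) → values ps ts ≡ values ps us → ∀ {p} → p ∈ ps → evalT ts (emb p (f p)) ≡ evalT us (emb p (f p))
      values-≡ (p ∷ ps) ts us e (here refl) = cong Vec.head e
      values-≡ (p ∷ ps) ts us e (there m) = values-≡ ps ts us (cong Vec.tail e) m

      lookup-injective : {A : Set} {xs : List A} → Unique xs → ∀ i j → List.lookup xs i ≡ List.lookup xs j → i ≡ j
      lookup-injective (n ∷ u) zero zero e = refl
      lookup-injective {xs = x ∷ xs} (n ∷ u) zero (suc j) e = contradiction e (All.lookup n (∈-lookup j))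
      lookup-injective {xs = x ∷ xs} (n ∷ u) (suc i) zero e = contradiction (sym e) (All.lookup n (∈-lookup i))
      lookup-injective (n ∷ u) (suc i) (suc j) e = cong suc (lookup-injective u i j e)

    -- Pigeonhole: there are more coefficient vectors than vectors of values at the `q ^ 2` points,
    -- so two of them produce the same values. Their difference vanishes on the graph and is
    -- nonzero; removing its zero coefficients makes it reduced.
    interpolate : (es : List (Vec ℕ 3)) → Unique es → q ^ 2 < length es →
      Σ (Terms 3) λ ts → Reduced ts × ¬ (ts ≡ []) × (∀ p → evalT ts (emb p (f p)) ≡ 0ᶠ) ×
        (∀ {P : Vec ℕ 3 → Set} → All P es → All (λ t → P (proj₂ t)) ts)
    interpolate es u lt with i , j , i<j , e ← pigeonhole-finite (finitePt (length (points 2))) (length (points (length es)))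
        (subst₂ _<_ (sym (trans (length-points (length (points 2))) (cong (q ^_) (length-points 2)))) (sym (length-points (length es))) (^-monoʳ-< q q>1 lt))
        (λ i → values (points 2) (mk es (List.lookup (points (length es)) i)))
      = prune (mk es (a ⊟ b)) , prune-reduced es (a ⊟ b) u ,
        (λ emp → <⇒≢ i<j (cong Fin.toℕ (lookup-injective (Finite.unique (finitePt (length es))) i j (⊟≡0⇒≡ (prune-empty es (a ⊟ b) emp))))) ,
        (λ p → trans (evalT-prune (mk es (a ⊟ b)) (emb p (f p))) (trans (evalT-mk es a b (emb p (f p)))
          (x≡y⇒x-y≡0 (values-≡ (points 2) (mk es a) (mk es b) e (Finite.complete (finitePt 2) p))))) ,
        prune-exponents es (a ⊟ b)
      where
      a = List.lookup (points (length es)) i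
      b = List.lookup (points (length es)) j

  -- The scaling law moves the parameter of a line into its direction; the degree bound makes
  -- functions assembled from such pieces polynomials.
  Hom : ℕ → (Pt 2 → 𝔽) → Set
  Hom k g = IsPoly 2 k g × (∀ s u → g (s ⊙ u) ≡ pow s k *ᶠ g u)

  private
    hom-subst : ∀ {j k g} → j ≡ k → Hom j g → Hom k g
    hom-subst refl h = h

    hom-0 : ∀ {k} → Hom k (λ _ → 0ᶠ)
    hom-0 = poly-const 0ᶠ , λ s u → sym (*ᶠ-zeroʳ _)

    hom-const : ∀ c → Hom 0 (λ _ → c)
    hom-const c = poly-const c , λ s u → sym (*ᶠ-identityˡ c)

    hom-+ : ∀ {k g h} → Hom k g → Hom k h → Hom k (λ u → g u +ᶠ h u)
    hom-+ (p , e) (r , e') = poly-+ p r , λ s u → trans (cong₂ _+ᶠ_ (e s u) (e' s u)) (sym (*ᶠ-distribˡ _ _ _))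

    hom-* : ∀ {k l g h} → Hom k g → Hom l h → Hom (k + l) (λ u → g u *ᶠ h u)
    hom-* {k} {l} {g} {h} (p , e) (r , e') = poly-* p r , λ s u → trans (cong₂ _*ᶠ_ (e s u) (e' s u))
      (trans (shuffle (pow s k) (g u) (pow s l) (h u)) (cong (_*ᶠ (g u *ᶠ h u)) (sym (pow-+ s k l))))
      where
      shuffle : ∀ a x b y → a *ᶠ x *ᶠ (b *ᶠ y) ≡ a *ᶠ b *ᶠ (x *ᶠ y)
      shuffle = solve 4 (λ a x b y → a :* x :* (b :* y) := a :* b :* (x :* y)) refl

    hom-scale : ∀ {k g} c → Hom k g → Hom k (λ u → c *ᶠ g u)
    hom-scale c h = hom-* (hom-const c) h

  -- The pattern of a power series in two variables restricted to the lines through the origin, as a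
  -- function of the direction.
  Graded : (Pt 2 → Ser) → Set
  Graded a = ∀ i → Hom i (λ u → a u i)

  private
    -- The offsets `k` and `l` serve the induction, since each step of `conv` shifts the first
    -- series by one degree.
    hom-conv : ∀ k l {a b : Pt 2 → Ser} → (∀ i → Hom (k + i) (λ u → a u i)) → (∀ i → Hom (l + i) (λ u → b u i)) →
               ∀ n → Hom (k + l + n) (λ u → conv (a u) (b u) n)
    hom-conv k l ha hb zero = hom-subst (e k l) (hom-* (ha 0) (hb 0))
      where
      e : ∀ k l → k + 0 + (l + 0) ≡ k + l + 0
      e = ringℕ
    hom-conv k l ha hb (suc n) = hom-+ (hom-subst (e₁ k l n) (hom-* (ha 0) (hb (suc n))))
      (hom-subst (e₂ k l n) (hom-conv (suc k) l (λ i → hom-subst (+-suc k i) (ha (suc i))) hb n))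
      where
      e₁ : ∀ k l n → k + 0 + (l + suc n) ≡ k + l + suc n
      e₁ = ringℕ
      e₂ : ∀ k l n → suc k + l + n ≡ k + l + suc n
      e₂ = ringℕ

    graded-const : ∀ c → Graded (λ _ → const c)
    graded-const c zero = hom-const c
    graded-const c (suc i) = hom-0

    graded-conv : ∀ {a b} → Graded a → Graded b → Graded (λ u → conv (a u) (b u))
    graded-conv ha hb n = hom-conv 0 0 ha hb n

    graded-powS : ∀ {a} → Graded a → ∀ e → Graded (λ u → powS (a u) e)
    graded-powS ha zero = graded-const 1ᶠ
    graded-powS {a} ha (suc e) = graded-conv {a} ha (graded-powS ha e)

  curve : Pt 2 → Pt 2 → Ser → Vec Ser 3
  curve (x ∷ y ∷ []) (a ∷ b ∷ []) s = lin x a ∷ lin y b ∷ s ∷ []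

  private
    graded-lin : ∀ c (g : Pt 2 → 𝔽) → Hom 1 g → Graded (λ u → lin c (g u))
    graded-lin c g hg zero = hom-const c
    graded-lin c g hg (suc zero) = hg
    graded-lin c g hg (suc (suc i)) = hom-0

    hom-coordinate₀ : Hom 1 Vec.head
    hom-coordinate₀ = poly-cong (λ { (_ ∷ _) → refl }) (poly-var zero) , λ { s (a ∷ _) → base s a }
      where
      base : ∀ s a → 0ᶠ +ᶠ s *ᶠ a ≡ s *ᶠ 1ᶠ *ᶠ a
      base = solve 2 (λ s a → con (0 , 0) :+ s :* a := s :* con (1 , 0) :* a) refl

    hom-coordinate₁ : Hom 1 (Vec.head ∘ Vec.tail)
    hom-coordinate₁ = poly-cong (λ { (_ ∷ _ ∷ _) → refl }) (poly-var (suc zero)) , λ { s (_ ∷ a ∷ _) → base s a }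
      where
      base : ∀ s a → 0ᶠ +ᶠ s *ᶠ a ≡ s *ᶠ 1ᶠ *ᶠ a
      base = solve 2 (λ s a → con (0 , 0) :+ s :* a := s :* con (1 , 0) :* a) refl

    graded-cong : ∀ {a b : Pt 2 → Ser} → (∀ u i → a u i ≡ b u i) → Graded a → Graded b
    graded-cong e ha i with p , h ← ha i = poly-cong (λ u → e u i) p ,
      λ s u → trans (sym (e (s ⊙ u) i)) (trans (h s u) (cong (pow s i *ᶠ_) (e u i)))

    graded-evalS : ∀ (ts : Terms 3) (p : Pt 2) {a : Pt 2 → Ser} → Graded a → Graded (λ u → evalS ts (curve p u (a u)))
    graded-evalS [] p ha i = hom-0
    graded-evalS ((c , i₀ ∷ i₁ ∷ i₂ ∷ []) ∷ ts) (x ∷ y ∷ []) {a} ha n = hom-+ (hom-scale c (mono-graded n)) (graded-evalS ts (x ∷ y ∷ []) ha n)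
      where
      mono-graded : Graded (λ u → monoS (i₀ ∷ i₁ ∷ i₂ ∷ []) (curve (x ∷ y ∷ []) u (a u)))
      mono-graded = graded-cong (λ { (_ ∷ _ ∷ []) i → refl })
        (graded-conv {b = λ u → conv (powS (lin y (Vec.head (Vec.tail u))) i₁) (conv (powS (a u) i₂) (const 1ᶠ))}
          (graded-powS (graded-lin x Vec.head hom-coordinate₀) i₀)
          (graded-conv {b = λ u → conv (powS (a u) i₂) (const 1ᶠ)} (graded-powS (graded-lin y (Vec.head ∘ Vec.tail) hom-coordinate₁) i₁)
            (graded-conv {b = λ _ → const 1ᶠ} (graded-powS ha i₂) (graded-const 1ᶠ))))

  curve-perts : ∀ M p u {s s' : Ser} {δ} → Pert M s s' δ → Perts M (curve p u s) (curve p u s') (0ᶠ ∷ 0ᶠ ∷ δ ∷ [])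
  curve-perts M (x ∷ y ∷ []) (a ∷ b ∷ []) h =
    ((λ _ _ → refl) , sym (+ᶠ-identityʳ _)) , ((λ _ _ → refl) , sym (+ᶠ-identityʳ _)) , h , tt

  curve-heads : ∀ p u s → heads (curve p u s) ≡ emb p (s 0)
  curve-heads (x ∷ y ∷ []) (a ∷ b ∷ []) s = refl

  private
    poly-translate : ∀ {d g} (p : Pt 2) → IsPoly 2 d g → IsPoly 2 d (λ x → g (x ⊟ p))
    poly-translate (a ∷ b ∷ []) h = poly-cong (λ { (x ∷ y ∷ []) → refl })
      (poly-∘ h ((λ x → lookup x zero +ᶠ (-ᶠ 1ᶠ) *ᶠ a) ∷ (λ x → lookup x (suc zero) +ᶠ (-ᶠ 1ᶠ) *ᶠ b) ∷ [])
        (poly-+ (poly-var zero) (poly-const _) VAll.∷ (poly-+ (poly-var (suc zero)) (poly-const _) VAll.∷ VAll.[])))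

  -- Newton iteration for the branch of A(p + x , z) = 0 through a simple root (p , z₀): the approximation
  -- of order j is a power series in t with coefficients homogeneous in the direction u.
  module Newton (ts : Terms 3) (p : Pt 2) (z₀ : 𝔽) where
    slope : 𝔽
    slope = dT ts (emb p z₀) (basis x₂)

    branch : ℕ → Pt 2 → Ser
    branch zero u = const z₀
    branch (suc j) u i with i ℕ.≟ suc j
    -- The new coefficient enters degree `suc j` of the composite linearly, with factor `slope`, so
    -- a single division cancels the error of the previous approximation.
    ... | yes _ = (-ᶠ (slope ⁻¹ᶠ)) *ᶠ evalS ts (curve p u (branch j u)) (suc j)
    ... | no _ = branch j u i

    branch-old : ∀ j u i → ¬ (i ≡ suc j) → branch (suc j) u i ≡ branch j u i
    branch-old j u i ne with i ℕ.≟ suc j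
    ... | yes e = contradiction e ne
    ... | no _ = refl

    branch-deg : ∀ j u → Deg j (branch j u)
    branch-deg zero u (suc i) _ = refl
    branch-deg (suc j) u i lt = trans (branch-old j u i (λ { refl → <-irrefl refl lt })) (branch-deg j u i (<-trans (n<1+n j) lt))

    branch-graded : ∀ j → Graded (branch j)
    branch-graded zero = graded-const z₀
    branch-graded (suc j) i with i ℕ.≟ suc j
    ... | yes refl = hom-scale (-ᶠ (slope ⁻¹ᶠ)) (graded-evalS ts p (branch-graded j) (suc j))
    ... | no _ = branch-graded j i

    module _ (nz : ¬ (slope ≡ 0ᶠ)) (u : Pt 2) (c : Ser) (c₀ : c 0 ≡ z₀) where
      private
        perts : ∀ j → (∀ i → i ≤ j → c i ≡ branch j u i) →
                Perts (suc j) (curve p u c) (curve p u (branch j u)) (0ᶠ ∷ 0ᶠ ∷ c (suc j) ∷ [])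
        perts j agree = curve-perts (suc j) p u
          ((λ { i (s≤s i≤j) → agree i i≤j }) , sym (trans (cong (_+ᶠ c (suc j)) (branch-deg j u (suc j) ≤-refl)) (+ᶠ-identityˡ _)))

      -- Compared with the approximation of order `j`, the first variation in degree `suc j` reads
      -- `e + c (suc j) slope = 0`, which has one solution because the root is simple.
      branch-unique : ∀ j → (∀ i → i ≤ j → evalS ts (curve p u c) i ≡ 0ᶠ) → ∀ i → i ≤ j → c i ≡ branch j u i
      branch-unique zero van zero z≤n = c₀
      branch-unique (suc j) van i le with i ℕ.≟ suc j
      ... | no ne = branch-unique j (λ k k≤j → van k (m≤n⇒m≤1+n k≤j)) i (ℕ.s≤s⁻¹ (≤∧≢⇒< le ne))
      ... | yes refl = solved
        where
        earlier : ∀ i → i ≤ j → c i ≡ branch j u i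
        earlier = branch-unique j (λ k k≤j → van k (m≤n⇒m≤1+n k≤j))
        e = evalS ts (curve p u (branch j u)) (suc j)
        equation : e +ᶠ c (suc j) *ᶠ slope ≡ 0ᶠ
        equation = trans (cong (e +ᶠ_) (sym (trans (cong (λ x → dT ts x (0ᶠ ∷ 0ᶠ ∷ c (suc j) ∷ [])) (trans (curve-heads p u c) (cong (emb p) c₀)))
            (trans (dT₃ ts (emb p z₀) 0ᶠ 0ᶠ (c (suc j))) (drop _ _ (c (suc j)) slope)))))
          (trans (sym (first-variation j (curve p u c) (curve p u (branch j u)) _ (perts j earlier) ts)) (van (suc j) ≤-refl))
          where
          drop : ∀ x y c s → 0ᶠ *ᶠ x +ᶠ 0ᶠ *ᶠ y +ᶠ c *ᶠ s ≡ c *ᶠ s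
          drop = solve 4 (λ x y c s → con (0 , 0) :* x :+ con (0 , 0) :* y :+ c :* s := c :* s) refl
        solved : c (suc j) ≡ (-ᶠ (slope ⁻¹ᶠ)) *ᶠ e
        solved = *-cancelʳ nz (trans (isolate e (c (suc j) *ᶠ slope)) (trans (cong (_+ᶠ (-ᶠ e)) equation) (trans (+ᶠ-identityˡ _)
          (sym (trans (move (slope ⁻¹ᶠ) e slope) (*-cancel-inverse (-ᶠ e) nz))))))
          where
          isolate : ∀ e x → x ≡ e +ᶠ x +ᶠ (-ᶠ e)
          isolate = solve 2 (λ e x → x := e :+ x :+ (:- e)) refl
          move : ∀ s e t → (-ᶠ s) *ᶠ e *ᶠ t ≡ (-ᶠ e) *ᶠ s *ᶠ t
          move = solve 3 (λ s e t → (:- s) :* e :* t := (:- e) :* s :* t) refl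

    -- The point `x` is reached from `p` in direction `x - p` at time 1. Truncation at degree `d`
    -- fits the comparison with line polynomials, whose degree is at most `d`.
    polynomial : ℕ → Pt 2 → 𝔽
    polynomial d x = ev (suc d) (branch d (x ⊟ p)) 1ᶠ

    private
      poly-ev : ∀ n {d} {a : Pt 2 → Ser} → (∀ i → i < n → IsPoly 2 d (λ u → a u i)) → IsPoly 2 d (λ u → ev n (a u) 1ᶠ)
      poly-ev zero h = poly-const 0ᶠ
      poly-ev (suc n) h = poly-+ (h 0 (s≤s z≤n)) (poly-scale 1ᶠ (poly-ev n (λ i i<n → h (suc i) (s≤s i<n))))

      ev-graded : ∀ n (a : Ser) t → ev n (λ i → pow t i *ᶠ a i) 1ᶠ ≡ ev n a t
      ev-graded n a t = trans (ev-cong n 1ᶠ (λ i _ → cong (_*ᶠ a i) (sym (*ᶠ-identityˡ _)))) (trans (go n a 1ᶠ) (*ᶠ-identityˡ _))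
        where
        go : ∀ n (a : Ser) s → ev n (λ i → s *ᶠ pow t i *ᶠ a i) 1ᶠ ≡ s *ᶠ ev n a t
        go zero a s = sym (*ᶠ-zeroʳ s)
        go (suc n) a s = trans (cong (λ z → s *ᶠ 1ᶠ *ᶠ a 0 +ᶠ 1ᶠ *ᶠ z)
            (trans (ev-cong n 1ᶠ (λ i _ → cong (_*ᶠ a (suc i)) (sym (*ᶠ-assoc s t (pow t i))))) (go n (a ∘ suc) (s *ᶠ t)))) (collect s (a 0) t _)
          where
          collect : ∀ s a t e → s *ᶠ 1ᶠ *ᶠ a +ᶠ 1ᶠ *ᶠ (s *ᶠ t *ᶠ e) ≡ s *ᶠ (a +ᶠ t *ᶠ e)
          collect = solve 4 (λ s a t e → s :* con (1 , 0) :* a :+ con (1 , 0) :* (s :* t :* e) := s :* (a :+ t :* e)) refl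

      line-⊟ : ∀ {n} (p u : Pt n) t → line p u t ⊟ p ≡ t ⊙ u
      line-⊟ [] [] t = refl
      line-⊟ (p ∷ ps) (u ∷ us) t = cong₂ _∷_ (cancel p t u) (line-⊟ ps us t)
        where
        cancel : ∀ p t u → p +ᶠ t *ᶠ u +ᶠ (-ᶠ 1ᶠ) *ᶠ p ≡ 0ᶠ +ᶠ t *ᶠ u
        cancel = solve 3 (λ p t u → p :+ t :* u :+ (:- con (1 , 0)) :* p := con (0 , 0) :+ t :* u) refl

    polynomial-poly : ∀ d → IsPoly 2 d (polynomial d)
    polynomial-poly d = poly-translate p (poly-ev (suc d) (λ { i (s≤s i≤d) → poly-weaken i≤d (proj₁ (branch-graded d i)) }))

    -- By homogeneity, time 1 in direction `t u` is the same as time `t` in direction `u`.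
    polynomial-line : ∀ d u t → polynomial d (line p u t) ≡ ev (suc d) (branch d u) t
    polynomial-line d u t = trans (cong (λ x → ev (suc d) (branch d x) 1ᶠ) (line-⊟ p u t))
      (trans (ev-cong (suc d) 1ᶠ (λ i _ → proj₂ (branch-graded d i) t u)) (ev-graded (suc d) (branch d u) t))

  private
    curve-evs : ∀ {d} (p u : Pt 2) (c : Vec 𝔽 (suc d)) t →
      evs (1 ∷ 1 ∷ d ∷ []) (curve p u (coeffs c)) t ≡ emb (line p u t) (evalU F c t)
    curve-evs (x ∷ y ∷ []) (a ∷ b ∷ []) c t = cong₂ _∷_ (cong (λ z → x +ᶠ t *ᶠ z) (ev-const a t))
      (cong₂ _∷_ (cong (λ z → y +ᶠ t *ᶠ z) (ev-const b t)) (cong (_∷ []) (sym (evalU≡ev c t))))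

    curve-degs : ∀ {d} (p u : Pt 2) (c : Vec 𝔽 (suc d)) → Degs (1 ∷ 1 ∷ d ∷ []) (curve p u (coeffs c))
    curve-degs (x ∷ y ∷ []) (a ∷ b ∷ []) c = Deg-lin x a , Deg-lin y b , Deg-coeffs c , tt

    evalS-constants : (ts : Terms 3) (x y z : 𝔽) → ∀ i → evalS ts (const x ∷ const y ∷ const z ∷ []) (suc i) ≡ 0ᶠ
    evalS-constants [] x y z i = refl
    evalS-constants ((c , i₀ ∷ i₁ ∷ i₂ ∷ []) ∷ ts) x y z i = trans (cong₂ (λ u v → c *ᶠ u +ᶠ v)
      (Deg-monoS (0 ∷ 0 ∷ 0 ∷ []) (const x ∷ const y ∷ const z ∷ []) (Deg-const x , Deg-const y , Deg-const z , tt) (i₀ ∷ i₁ ∷ i₂ ∷ []) (suc i)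
        (s≤s (≤-trans (≤-reflexive (zeros i₀ i₁ i₂)) z≤n)))
      (evalS-constants ts x y z i)) (trans (+ᶠ-identityʳ _) (*ᶠ-zeroʳ c))
      where
      zeros : ∀ i j k → i * 0 + (j * 0 + (k * 0 + 0)) ≡ 0
      zeros = ringℕ

  module PlaneTheorem {d : ℕ} (f : Pt 2 → 𝔽) (O : Oracle 2 d) (K : ℕ) (0<K : 0 < K) (2K≤q : 2 * K ≤ q)
    (C : Test.LineCore f O K) (D : ℕ) (d≤D : d ≤ D) (0<D : 0 < D) (KD≤2q : K * suc D ≤ 2 * q) where
    open Test f O
    open LineCore C

    private
      instance K≢0 : NonZero K
      K≢0 = ℕ.>-nonZero 0<K

      ws : Vec ℕ 3
      ws = 1 ∷ 1 ∷ d ∷ []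

      -- On the curve `(p + t u , P(t))` the polynomial has degree at most `D` in `t`. It vanishes
      -- at every agreeing parameter inside `X`, and there are at least 2q/K, hence at least `suc D`
      -- of them; so all coefficients of the restriction are zero.
      on-curve : ∀ ts → All (λ t → weight ws (proj₂ t) ≤ D) ts → Vanishes X f ts → ∀ p u → U p u →
                 ∀ i → i < suc D → evalS ts (curve p u (coeffs (P p u))) i ≡ 0ᶠ
      on-curve ts wt van p u Uu = many-roots⇒zero (suc D) _ (λ t → (X (line p u t) Bool.≟ true) ×-dec (f (line p u t) ≟ᶠ val p u t))
        (λ t (Xt , ft) → trans (ev-evalS D ws (curve p u (coeffs (P p u))) (curve-degs p u (P p u)) t ts wt)
          (trans (cong (evalT ts) (trans (curve-evs p u (P p u) t) (cong (emb (line p u t)) (sym ft)))) (van (line p u t) Xt)))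
        (*-cancelˡ-≤ K (≤-trans KD≤2q (many-t p u Uu)))

      start : ∀ p u → U p u → coeffs (P p u) 0 ≡ f p
      start p u Uu = sym (trans (proj₂ (U-agree p u Uu)) (trans (evalU≡ev (P p u) 0ᶠ) (ev-at-0 d (coeffs (P p u)))))

      -- The coefficient of `t` in the restriction to the curve, obtained from the first variation
      -- against the constant curve at its starting point. Once the z-derivative is zero, only the
      -- planar gradient paired with `u` is left.
      tangent-line : ∀ ts → All (λ t → weight ws (proj₂ t) ≤ D) ts → Vanishes X f ts → ∀ p u → U p u →
        evalT (∂ x₂ ts) (emb p (f p)) ≡ 0ᶠ → dot u (evalT (∂ x₀ ts) (emb p (f p)) ∷ evalT (∂ x₁ ts) (emb p (f p)) ∷ []) ≡ 0ᶠ
      tangent-line ts wt van p@(x ∷ y ∷ []) u@(a ∷ b ∷ []) Uu z = begin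
        a *ᶠ A₀ +ᶠ (b *ᶠ A₁ +ᶠ 0ᶠ) ≡⟨ pad (a *ᶠ A₀) (b *ᶠ A₁) (c 1) ⟩
        a *ᶠ A₀ +ᶠ b *ᶠ A₁ +ᶠ c 1 *ᶠ 0ᶠ ≡⟨ cong₂ _+ᶠ_ (cong₂ (λ v w → a *ᶠ v +ᶠ b *ᶠ w) (evalT-∂ x₀ ts P₀) (evalT-∂ x₁ ts P₀)) (cong (c 1 *ᶠ_) (trans (sym z) (evalT-∂ x₂ ts P₀))) ⟩
        a *ᶠ dT ts P₀ (basis x₀) +ᶠ b *ᶠ dT ts P₀ (basis x₁) +ᶠ c 1 *ᶠ dT ts P₀ (basis x₂) ≡⟨ sym (dT₃ ts P₀ a b (c 1)) ⟩
        dT ts P₀ (a ∷ b ∷ c 1 ∷ []) ≡⟨ cong (λ w → dT ts (x ∷ y ∷ w ∷ []) (a ∷ b ∷ c 1 ∷ [])) (sym (start p u Uu)) ⟩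
        dT ts (heads (curve p u c)) (a ∷ b ∷ c 1 ∷ []) ≡⟨ sym (+ᶠ-identityˡ _) ⟩
        0ᶠ +ᶠ dT ts (heads (curve p u c)) (a ∷ b ∷ c 1 ∷ []) ≡⟨ cong (_+ᶠ dT ts (heads (curve p u c)) (a ∷ b ∷ c 1 ∷ [])) (sym (evalS-constants ts x y (c 0) 0)) ⟩
        evalS ts (const x ∷ const y ∷ const (c 0) ∷ []) 1 +ᶠ dT ts (heads (curve p u c)) (a ∷ b ∷ c 1 ∷ [])
          ≡⟨ sym (first-variation 0 (curve p u c) (const x ∷ const y ∷ const (c 0) ∷ []) (a ∷ b ∷ c 1 ∷ []) perts ts) ⟩
        evalS ts (curve p u c) 1 ≡⟨ on-curve ts wt van p u Uu 1 (s≤s 0<D) ⟩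
        0ᶠ ∎
        where
        open ≡-Reasoning
        P₀ = emb p (f p)
        A₀ = evalT (∂ x₀ ts) P₀
        A₁ = evalT (∂ x₁ ts) P₀
        c = coeffs (P p u)
        pad : ∀ u v c → u +ᶠ (v +ᶠ 0ᶠ) ≡ u +ᶠ v +ᶠ c *ᶠ 0ᶠ
        pad = solve 3 (λ u v c → u :+ (v :+ con (0 , 0)) := u :+ v :+ c :* con (0 , 0)) refl
        perts : Perts 1 (curve p u c) (const x ∷ const y ∷ const (c 0) ∷ []) (a ∷ b ∷ c 1 ∷ [])
        perts = ((λ { zero _ → refl ; (suc _) (s≤s ()) }) , sym (+ᶠ-identityˡ _)) ,
                ((λ { zero _ → refl ; (suc _) (s≤s ()) }) , sym (+ᶠ-identityˡ _)) ,
                ((λ { zero _ → refl ; (suc _) (s≤s ()) }) , sym (+ᶠ-identityˡ _)) , tt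

      -- A nonzero gradient would confine the good directions at `p` to `q` of the `q ^ 2` vectors,
      -- whereas a share 2/K of all vectors is good and `2 K ≤ q`.
      tangent : ∀ ts → All (λ t → weight ws (proj₂ t) ≤ D) ts → Vanishes X f ts → ∀ p → X p ≡ true →
        evalT (∂ x₂ ts) (emb p (f p)) ≡ 0ᶠ → evalT (∂ x₀ ts) (emb p (f p)) ≡ 0ᶠ × evalT (∂ x₁ ts) (emb p (f p)) ≡ 0ᶠ
      tangent ts wt van p Xp z with (evalT (∂ x₀ ts) (emb p (f p)) ∷ evalT (∂ x₁ ts) (emb p (f p)) ∷ []) ≟ᵖ 0ᵥ
      ... | yes e = cong Vec.head e , cong (Vec.head ∘ Vec.tail) e
      ... | no ne = contradiction few (<⇒≱ (≤-trans (s≤s (≤-trans (m≤m+n K (K + 0)) 2K≤q)) (≤-trans (+-monoˡ-≤ q q>0) (≤-reflexive (dbl q)))))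
        where
        open ≤-Reasoning
        dbl : ∀ q → q + q ≡ 2 * q
        dbl = ringℕ
        normal = evalT (∂ x₀ ts) (emb p (f p)) ∷ evalT (∂ x₁ ts) (emb p (f p)) ∷ []
        instance qq≢0 : NonZero (q * q)
        qq≢0 = ℕ.>-nonZero (*-mono-≤ q>0 q>0)
        few : 2 * q ≤ K
        few = *-cancelˡ-≤ (q * q) (begin
          q * q * (2 * q) ≡⟨ e₁ q ⟩
          q * (2 * q ^ 2) ≤⟨ *-monoʳ-≤ q (many-U p Xp) ⟩
          q * (K * ∑ᵖ 2 (λ u → I (U? p u))) ≤⟨ *-monoʳ-≤ q (*-monoʳ-≤ K (∑-mono (points 2) (λ u → I-mono (U? p u) (dot u normal ≟ᶠ 0ᶠ) (λ Uu → tangent-line ts wt van p u Uu z)))) ⟩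
          q * (K * ∑ᵖ 2 (λ u → I (dot u normal ≟ᶠ 0ᶠ))) ≡⟨ e₂ q K _ ⟩
          K * (q * ∑ᵖ 2 (λ u → I (dot u normal ≟ᶠ 0ᶠ))) ≡⟨ cong (K *_) (hyperplane-count normal ne 0ᶠ) ⟩
          K * q ^ 2 ≡⟨ e₃ q K ⟩
          q * q * K ∎)
          where
          e₁ : ∀ q → q * q * (2 * q) ≡ q * (2 * (q * (q * 1)))
          e₁ = ringℕ
          e₂ : ∀ q K S → q * (K * S) ≡ K * (q * S)
          e₂ = ringℕ
          e₃ : ∀ q K → K * (q * (q * 1)) ≡ q * q * K
          e₃ = ringℕ

    open SimpleRoot X f point ws D tangent public

    from-simple : Simple → Σ (Pt 2 → 𝔽) λ Q → IsPoly 2 d Q × 3 * q ^ 2 ≤ K * K * ∑ᵖ 2 (λ y → I (f y ≟ᶠ Q y))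
    from-simple S = polynomial d , polynomial-poly d ,
      agreement f (polynomial d) K p (U? p) 2K≤q (many-U p p∈X)
        (λ u Uu → ≤-trans (many-t p u Uu) (*-monoʳ-≤ K (∑-mono elements (λ t → I-mono ((X (line p u t) Bool.≟ true) ×-dec (f (line p u t) ≟ᶠ val p u t)) (f (line p u t) ≟ᶠ polynomial d (line p u t))
          (λ (_ , ft) → trans ft (sym (along u Uu t)))))))
      where
      open Simple S
      open Newton ts p (f p)
      along : ∀ u → U p u → ∀ t → polynomial d (line p u t) ≡ val p u t
      along u Uu t = trans (polynomial-line d u t) (trans
        (ev-cong (suc d) t (λ { i (s≤s i≤d) → sym (branch-unique (λ e → simple (trans (evalT-∂ x₂ ts (emb p (f p))) e)) u (coeffs (P p u)) (start p u Uu) d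
          (λ k k≤d → on-curve ts weighted vanishes p u Uu k (s≤s (≤-trans k≤d d≤D))) i i≤d) }))
        (sym (evalU≡ev (P p u) t)))

  private
    box : ℕ → ℕ → List (Vec ℕ 3)
    box e k = cartesianProductWith _∷_ (upTo e) (cartesianProductWith _∷_ (upTo e) (map (_∷ []) (upTo k)))

    length-product : {A B C : Set} (g : A → B → C) (xs : List A) (ys : List B) → length (cartesianProductWith g xs ys) ≡ length xs * length ys
    length-product g [] ys = refl
    length-product g (x ∷ xs) ys = trans (length-++ (map (g x) ys)) (cong₂ _+_ (length-map (g x) ys) (length-product g xs ys))

    length-box : ∀ e k → length (box e k) ≡ e * (e * k)
    length-box e k = trans (length-product _∷_ (upTo e) _) (cong₂ _*_ (length-upTo e)
      (trans (length-product _∷_ (upTo e) _) (cong₂ _*_ (length-upTo e) (trans (length-map (_∷ []) (upTo k)) (length-upTo k)))))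

    box-unique : ∀ e k → Unique (box e k)
    box-unique e k = Unique.cartesianProductWith⁺ _∷_ (λ { refl → refl , refl }) (Unique.upTo⁺ e)
      (Unique.cartesianProductWith⁺ _∷_ (λ { refl → refl , refl }) (Unique.upTo⁺ e) (Unique.map⁺ (λ { refl → refl }) (Unique.upTo⁺ k)))

    box-bounds : ∀ e k {α} → α ∈ box e k → ∃ λ i → ∃ λ j → ∃ λ l → i < e × j < e × l < k × α ≡ i ∷ j ∷ l ∷ []
    box-bounds e k m with i , _ , i∈ , m' , refl ← ∈-cartesianProductWith⁻ _∷_ (upTo e) (cartesianProductWith _∷_ (upTo e) (map (_∷ []) (upTo k))) m
                     with j , _ , j∈ , m'' , refl ← ∈-cartesianProductWith⁻ _∷_ (upTo e) (map (_∷ []) (upTo k)) m'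
                     with l , l∈ , refl ← ∈-map⁻ (_∷ []) m'' = i , j , l , ∈-upTo⁻ i∈ , ∈-upTo⁻ j∈ , ∈-upTo⁻ l∈ , refl

  -- Interpolating with exponents i , j < e = ⌊q / 2K⌋ and k < 17 K² beats the q² constraints, while the weighted
  -- degree stays below the number 2q / K of agreements on a core line.
  plane-theorem : ∀ {d} (f : Pt 2 → 𝔽) (O : Oracle 2 d) K → 0 < K → 0 < d → 17 * (K * K * K * d) ≤ q → Test.LineCore f O K →
    Σ (Pt 2 → 𝔽) λ Q → IsPoly 2 d Q × 3 * q ^ 2 ≤ K * K * ∑ᵖ 2 (λ y → I (f y ≟ᶠ Q y))
  plane-theorem {d} f O (suc K') 0<K 0<d big C = build (interpolate (box e k) (box-unique e k) enough)
    where
    open Interpolation f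
    K = suc K'
    e = q / (2 * K)
    k = 17 * (K * K)
    -- `suc D` exceeds every weight in the box, and `K (suc D)` consists of `2 K e ≤ q` and
    -- `17 K³ d ≤ q`.
    D = 2 * e + k * d ∸ 1
    2Ke≤q : e * (2 * K) ≤ q
    2Ke≤q = m/n*n≤m q (2 * K)
    q<2Ke+2K : q < 2 * K + e * (2 * K)
    q<2Ke+2K = subst (_< 2 * K + e * (2 * K)) (sym (m≡m%n+[m/n]*n q (2 * K))) (+-monoˡ-< (e * (2 * K)) (m%n<n q (2 * K)))
    K≤Kd : 2 * K ≤ 17 * (K * K * K * d)
    K≤Kd = *-mono-≤ {2} {17} (s≤s (s≤s z≤n)) (begin
      K ≡⟨ sym (trans (*-identityʳ _) (trans (*-identityʳ _) (*-identityʳ _))) ⟩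
      K * 1 * 1 * 1 ≤⟨ *-mono-≤ {K * 1 * 1} {K * K * K} (*-mono-≤ {K * 1} {K * K} (*-monoʳ-≤ K 0<K) 0<K) 0<d ⟩
      K * K * K * d ∎)
      where open ≤-Reasoning
    2K≤q : 2 * K ≤ q
    2K≤q = ≤-trans K≤Kd big
    e>0 : 0 < e
    e>0 = n≢0⇒n>0 λ e≡0 → <⇒≱ q<2Ke+2K (≤-trans (≤-reflexive (trans (cong (λ z → 2 * K + z * (2 * K)) e≡0) (+-identityʳ _))) 2K≤q)
    -- From `q < 2 K (e + 1)` and `e ≥ 1` follows `q² < 16 K² e²`, which the factor 17 in `k`
    -- covers.
    enough : q ^ 2 < length (box e k)
    enough = begin-strict
      q ^ 2 ≡⟨ cong (q *_) (*-identityʳ q) ⟩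
      q * q <⟨ *-mono-< q<2Ke+2K q<2Ke+2K ⟩
      (2 * K + e * (2 * K)) * (2 * K + e * (2 * K)) ≡⟨ e₁ K e ⟩
      K * K * (4 + 8 * e + 4 * (e * e)) ≤⟨ *-monoʳ-≤ (K * K) (+-monoˡ-≤ (4 * (e * e)) (+-mono-≤ (*-monoʳ-≤ 4 (*-mono-≤ e>0 e>0)) (*-monoʳ-≤ 8 (≤-trans (≤-reflexive (sym (*-identityʳ e))) (*-monoʳ-≤ e e>0))))) ⟩
      K * K * (4 * (e * e) + 8 * (e * e) + 4 * (e * e)) ≤⟨ ≤-trans (m≤m+n _ (K * K * (e * e))) (≤-reflexive (e₂ K e)) ⟩
      e * (e * k) ≡⟨ sym (length-box e k) ⟩
      length (box e k) ∎
      where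
      open ≤-Reasoning
      e₁ : ∀ K e → (2 * K + e * (2 * K)) * (2 * K + e * (2 * K)) ≡ K * K * (4 + 8 * e + 4 * (e * e))
      e₁ = ringℕ
      e₂ : ∀ K e → K * K * (4 * (e * e) + 8 * (e * e) + 4 * (e * e)) + K * K * (e * e) ≡ e * (e * (17 * (K * K)))
      e₂ = ringℕ
    pos : 2 + d ≤ 2 * e + k * d
    pos = +-mono-≤ (*-monoʳ-≤ 2 e>0) (≤-trans (≤-reflexive (sym (*-identityˡ d))) (*-monoˡ-≤ d {1} {k} (s≤s z≤n)))
    sucD : suc D ≡ 2 * e + k * d
    sucD = m+[n∸m]≡n (≤-trans (s≤s z≤n) pos)
    d<D : suc d ≤ D
    d<D = ℕ.s≤s⁻¹ (≤-trans pos (≤-reflexive (sym sucD)))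
    KD≤2q : K * suc D ≤ 2 * q
    KD≤2q = begin
      K * suc D ≡⟨ cong (K *_) sucD ⟩
      K * (2 * e + k * d) ≡⟨ e₁ K e d ⟩
      e * (2 * K) + 17 * (K * K * K * d) ≤⟨ +-mono-≤ 2Ke≤q big ⟩
      q + q ≡⟨ cong (q +_) (sym (+-identityʳ q)) ⟩
      2 * q ∎
      where
      open ≤-Reasoning
      e₁ : ∀ K e d → K * (2 * e + 17 * (K * K) * d) ≡ e * (2 * K) + 17 * (K * K * K * d)
      e₁ = ringℕ
    weights : ∀ {α} → α ∈ box e k → weight (1 ∷ 1 ∷ d ∷ []) α ≤ D
    weights m with i , j , l , i<e , j<e , l<k , refl ← box-bounds e k m = ℕ.s≤s⁻¹ (begin
      suc (i * 1 + (j * 1 + (l * d + 0))) ≡⟨ e₁ i j l d ⟩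
      suc i + (j + l * d) ≤⟨ +-mono-≤ i<e (+-mono-≤ (<⇒≤ j<e) (*-monoˡ-≤ d (<⇒≤ l<k))) ⟩
      e + (e + k * d) ≡⟨ e₂ e (k * d) ⟩
      2 * e + k * d ≡⟨ sym sucD ⟩
      suc D ∎)
      where
      open ≤-Reasoning
      e₁ : ∀ i j l d → suc (i * 1 + (j * 1 + (l * d + 0))) ≡ suc i + (j + l * d)
      e₁ = ringℕ
      e₂ : ∀ e x → e + (e + x) ≡ 2 * e + x
      e₂ = ringℕ
    degrees : ∀ {α} → α ∈ box e k → Vec.sum α ≤ e + (e + k)
    degrees m with i , j , l , i<e , j<e , l<k , refl ← box-bounds e k m =
      +-mono-≤ (<⇒≤ i<e) (+-mono-≤ (<⇒≤ j<e) (≤-trans (≤-reflexive (+-identityʳ l)) (<⇒≤ l<k)))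
    open PlaneTheorem f O K 0<K 2K≤q C D (<⇒≤ d<D) (≤-trans (s≤s z≤n) d<D) KD≤2q
    build : _ → _
    build (ts , red , ne , van , exps) = from-simple
      (find (e + (e + k)) ts (exps (All.tabulate degrees)) red ne (exps (All.tabulate weights)) (λ p _ → van p))

-- Second moments for random hyperplanes.

module Sampling (F : FiniteField) where
  open import Data.Nat using (_+_; _*_; _^_; _≤_)
  open import Data.Nat.Properties hiding (_≟_)
  open FiniteSums
  open FieldAlgebra F
  open Core F using (finite-×; ∑-cartesianProduct)

  ∑-*-∑ : {A B : Set} (xs : List A) (ys : List B) (g : A → ℕ) (h : B → ℕ) → ∑ xs g * ∑ ys h ≡ ∑ xs (λ x → ∑ ys (λ y → g x * h y))
  ∑-*-∑ xs ys g h = trans (sym (∑-*ʳ xs (∑ ys h) g)) (∑-cong xs (λ x → sym (∑-*ˡ ys (g x) h)))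

  private
    -- The inequality `(u - m)(Q - p) ≥ 0` without subtraction. It sets the excess of a kernel over
    -- its generic size against the deficit of the masses below their maximum.
    rearrange : ∀ u m p Q → m ≤ u → p ≤ Q → u * p + Q * m ≤ m * p + Q * u
    rearrange u m p Q m≤u p≤Q with a , refl ← m≤n⇒∃[o]m+o≡n m≤u with b , refl ← m≤n⇒∃[o]m+o≡n p≤Q =
      subst ((m + a) * p + (p + b) * m ≤_) (e m a p b) (m≤m+n _ (a * b))
      where
      e : ∀ m a p b → (m + a) * p + (p + b) * m + a * b ≡ m * p + (p + b) * (m + a)
      e = ringℕ

  module _ {M k : ℕ} where
    Linear : (Pt M → Pt k) → Set
    Linear l = ∀ b u t → l (line b u t) ≡ line (l b) (l u) t

    module _ (l₁ l₂ : Pt M → Pt k) (lin₁ : Linear l₁) (lin₂ : Linear l₂) where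
      kernel : ℕ
      kernel = ∑ᵖ M (λ W → I (l₁ W ≟ᵖ 0ᵥ) * I (l₂ W ≟ᵖ 0ᵥ))

      private
        FP = finite-× (finitePt k) (finitePt k)
        fibre : Pt k × Pt k → ℕ
        fibre β = ∑ᵖ M (λ W → I (Finite._≟_ FP (l₁ W , l₂ W) β))

        0-line : ∀ {n} (x : Pt n) → line 0ᵥ x 1ᶠ ≡ x
        0-line [] = refl
        0-line (a ∷ x) = cong₂ _∷_ (trans (+ᶠ-identityˡ _) (*ᶠ-identityˡ a)) (0-line x)

        shift-zero : ∀ {n} {x y : Pt n} → line x y 1ᶠ ≡ y → x ≡ 0ᵥ
        shift-zero {n} {x} {y} e = trans (sym (⊞-⊟ x y)) (trans (cong (_⊟ y) (trans e (sym (0-line y)))) (⊞-⊟ 0ᵥ y))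

        -- A nonempty fibre of a linear map is a translate of its kernel.
        fibre≤kernel : ∀ β → fibre β ≤ kernel
        fibre≤kernel β@(β₁ , β₂) with Finite.∃? (finitePt M) (λ W → Finite._≟_ FP (l₁ W , l₂ W) β)
        ... | no none = ≤-trans (≤-reflexive (trans (∑-cong (points M) (λ W → I-no (Finite._≟_ FP (l₁ W , l₂ W) β) (λ e → none (W , e)))) (∑-zero (points M)))) z≤n
        ... | yes (W* , refl) = begin
          fibre β ≡⟨ sym (∑ᵖ-translate W* 1ᶠ (λ W → I (Finite._≟_ FP (l₁ W , l₂ W) β))) ⟩
          ∑ᵖ M (λ W → I (Finite._≟_ FP (l₁ (line W W* 1ᶠ) , l₂ (line W W* 1ᶠ)) β))
            ≤⟨ ∑-mono (points M) (λ W → ≤-trans (I-mono (Finite._≟_ FP _ β) ((l₁ W ≟ᵖ 0ᵥ) ×-dec (l₂ W ≟ᵖ 0ᵥ))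
                 (λ e → shift-zero (trans (sym (lin₁ W W* 1ᶠ)) (cong proj₁ e)) , shift-zero (trans (sym (lin₂ W W* 1ᶠ)) (cong proj₂ e))))
                 (≤-reflexive (I-× (l₁ W ≟ᵖ 0ᵥ) (l₂ W ≟ᵖ 0ᵥ)))) ⟩
          kernel ∎
          where open ≤-Reasoning

      -- When the two maps are in general position, the kernel has q^(M-2k) elements and this is the
      -- bound that pairwise independence would give.
      joint≤ : (g h : Pt k → ℕ) → ∑ᵖ M (λ W → g (l₁ W) * h (l₂ W)) ≤ kernel * (∑ᵖ k g * ∑ᵖ k h)
      joint≤ g h = begin
        ∑ᵖ M (λ W → g (l₁ W) * h (l₂ W)) ≡⟨ ∑-pushforward (finitePt M) FP (λ W → l₁ W , l₂ W) (λ (x , y) → g x * h y) ⟩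
        ∑ (Finite.elems FP) (λ β → g (proj₁ β) * h (proj₂ β) * fibre β) ≤⟨ ∑-mono (Finite.elems FP) (λ β → *-monoʳ-≤ (g (proj₁ β) * h (proj₂ β)) (fibre≤kernel β)) ⟩
        ∑ (Finite.elems FP) (λ β → g (proj₁ β) * h (proj₂ β) * kernel) ≡⟨ trans (∑-*ʳ (Finite.elems FP) kernel _) (*-comm _ kernel) ⟩
        kernel * ∑ (Finite.elems FP) (λ β → g (proj₁ β) * h (proj₂ β)) ≡⟨ cong (kernel *_) (trans (∑-cartesianProduct (points k) (points k) _) (sym (∑-*-∑ (points k) (points k) g h))) ⟩
        kernel * (∑ᵖ k g * ∑ᵖ k h) ∎
        where open ≤-Reasoning

      -- The q^(2k) fibres cover the space, and none is larger than the kernel.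
      kernel-lower : q ^ M ≤ q ^ k * q ^ k * kernel
      kernel-lower = subst₂ _≤_ (trans (∑ᵖ-const M 1) (*-identityʳ _))
        (trans (cong (kernel *_) (cong₂ _*_ (∑ᵖ-one k) (∑ᵖ-one k))) (*-comm kernel _)) (joint≤ (λ _ → 1) (λ _ → 1))

    -- Writing s = kernel, the pairs (α , α′) in general position have s = q^(M-2k), and the total excess of q^(2k) s
    -- over q^M is computed by double counting, without classifying the degenerate pairs.
    second-moment : {A : Set} (L : List A) (l : A → Pt M → Pt k) (lin : ∀ α → Linear (l α)) (g : A → Pt k → ℕ) → (∀ α β → g α β ≤ 1) →
      let R = q ^ k * q ^ k
          X = λ W → ∑ L (λ α → g α (l α W))
          T = ∑ L (λ α → ∑ᵖ k (g α)) in
      R * ∑ᵖ M (λ W → X W * X W) + length L * (length L * (R * q ^ M))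
        ≤ q ^ M * (T * T) + R * (R * ∑ᵖ M (λ W → ∑ L (λ α → I (l α W ≟ᵖ 0ᵥ)) * ∑ L (λ α → I (l α W ≟ᵖ 0ᵥ))))
    second-moment L l lin g g≤1 = begin
      R * ∑ᵖ M (λ W → X W * X W) + length L * (length L * (R * q ^ M))
        ≡⟨ cong₂ _+_ (trans (cong (R *_) expand) (trans (sym (∑-*ˡ L R _)) (∑-cong L (λ α → sym (∑-*ˡ L R _)))))
             (trans (sym (∑-const L _)) (∑-cong L (λ _ → sym (∑-const L _)))) ⟩
      ∑ L (λ α → ∑ L (λ α' → R * m α α')) + ∑ L (λ α → ∑ L (λ α' → R * q ^ M))
        ≡⟨ trans (sym (∑-+ L _ _)) (∑-cong L (λ α → sym (∑-+ L _ _))) ⟩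
      ∑ L (λ α → ∑ L (λ α' → R * m α α' + R * q ^ M))
        ≤⟨ ∑-mono L (λ α → ∑-mono L (λ α' → pointwise α α')) ⟩
      ∑ L (λ α → ∑ L (λ α' → q ^ M * (φ α * φ α') + R * (R * s α α')))
        ≡⟨ trans (∑-cong L (λ α → ∑-+ L _ _)) (∑-+ L _ _) ⟩
      ∑ L (λ α → ∑ L (λ α' → q ^ M * (φ α * φ α'))) + ∑ L (λ α → ∑ L (λ α' → R * (R * s α α')))
        ≡⟨ cong₂ _+_ (trans (∑-cong L (λ α → ∑-*ˡ L (q ^ M) _)) (trans (∑-*ˡ L (q ^ M) _) (cong (q ^ M *_) (sym (∑-*-∑ L L φ φ)))))
             (trans (∑-cong L (λ α → trans (∑-*ˡ L R _) (cong (R *_) (∑-*ˡ L R _)))) (trans (∑-*ˡ L R _) (cong (R *_) (trans (∑-*ˡ L R _) (cong (R *_) collect))))) ⟩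
      q ^ M * (T * T) + R * (R * ∑ᵖ M (λ W → Z W * Z W)) ∎
      where
      open ≤-Reasoning
      R = q ^ k * q ^ k
      X : Pt M → ℕ
      X W = ∑ L (λ α → g α (l α W))
      Z : Pt M → ℕ
      Z W = ∑ L (λ α → I (l α W ≟ᵖ 0ᵥ))
      φ : _ → ℕ
      φ α = ∑ᵖ k (g α)
      T = ∑ L φ
      m s : _ → _ → ℕ
      m α α' = ∑ᵖ M (λ W → g α (l α W) * g α' (l α' W))
      s α α' = kernel (l α) (l α') (lin α) (lin α')
      swap₃ : (h : Pt M → _ → _ → ℕ) → ∑ᵖ M (λ W → ∑ L (λ α → ∑ L (λ α' → h W α α'))) ≡ ∑ L (λ α → ∑ L (λ α' → ∑ᵖ M (λ W → h W α α')))
      swap₃ h = trans (∑-swap (points M) L _) (∑-cong L (λ α → ∑-swap (points M) L _))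
      expand : ∑ᵖ M (λ W → X W * X W) ≡ ∑ L (λ α → ∑ L (λ α' → m α α'))
      expand = trans (∑-cong (points M) (λ W → ∑-*-∑ L L _ _)) (swap₃ _)
      collect : ∑ L (λ α → ∑ L (λ α' → s α α')) ≡ ∑ᵖ M (λ W → Z W * Z W)
      collect = sym (trans (∑-cong (points M) (λ W → ∑-*-∑ L L _ _)) (swap₃ (λ W α α' → I (l α W ≟ᵖ 0ᵥ) * I (l α' W ≟ᵖ 0ᵥ))))
      φ≤ : ∀ α → φ α ≤ q ^ k
      φ≤ α = ≤-trans (∑ᵖ-≤const k (g≤1 α)) (≤-reflexive (*-identityʳ _))
      pointwise : ∀ α α' → R * m α α' + R * q ^ M ≤ q ^ M * (φ α * φ α') + R * (R * s α α')
      pointwise α α' = ≤-trans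
        (+-monoˡ-≤ (R * q ^ M) (≤-trans (*-monoʳ-≤ R (joint≤ (l α) (l α') (lin α) (lin α') (g α) (g α'))) (≤-reflexive (sym (*-assoc R (s α α') _)))))
        (rearrange (R * s α α') (q ^ M) (φ α * φ α') R (kernel-lower (l α) (l α') (lin α) (lin α')) (*-mono-≤ (φ≤ α) (φ≤ α')))

  module Hyperplane (n : ℕ) where
    N : ℕ
    N = q ^ n

    -- The hyperplane W = c ∷ w is the graph of y ↦ c + w · y; coordinates are y.
    height : Pt (suc n) → Pt n → 𝔽
    height W y = dot W (1ᶠ ∷ y)

    gradient : Pt (suc n) → Pt n → 𝔽
    gradient W v = dot W (0ᶠ ∷ v)

    lift : Pt (suc n) → Pt n → Pt (suc n)
    lift W y = height W y ∷ y

    lift-dir : Pt (suc n) → Pt n → Pt (suc n)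
    lift-dir W v = gradient W v ∷ v

    height-line : ∀ W y v t → height W (line y v t) ≡ height W y +ᶠ t *ᶠ gradient W v
    height-line W y v t = trans (cong (λ a → dot W (a ∷ line y v t)) (one t)) (dot-line W (1ᶠ ∷ y) (0ᶠ ∷ v) t)
      where
      one : ∀ t → 1ᶠ ≡ 1ᶠ +ᶠ t *ᶠ 0ᶠ
      one = solve 1 (λ t → con (1 , 0) := con (1 , 0) :+ t :* con (0 , 0)) refl

    lift-line : ∀ W y v t → lift W (line y v t) ≡ line (lift W y) (lift-dir W v) t
    lift-line W y v t = cong (_∷ line y v t) (height-line W y v t)

    private
      zero-slope : ∀ (c : 𝔽) (w y : Pt n) (a : 𝔽) → dot (c ∷ w) (a ∷ y) ≡ c *ᶠ a +ᶠ dot y w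
      zero-slope c w y a = cong (c *ᶠ a +ᶠ_) (dot-comm w y)

    level-count : ∀ (c : 𝔽) (w : Pt n) → ¬ (w ≡ 0ᵥ) → ∀ a b → q * ∑ᵖ n (λ y → I (dot (c ∷ w) (a ∷ y) ≟ᶠ b)) ≡ N
    level-count c w w≢0 a b = trans (cong (q *_) (∑-cong (points n) (λ y → I-cong (_ ≟ᶠ b) (dot y w ≟ᶠ b +ᶠ (-ᶠ (c *ᶠ a)))
      (λ e → trans (sym (cancel (c *ᶠ a) (dot y w))) (cong (_+ᶠ (-ᶠ (c *ᶠ a))) (trans (sym (zero-slope c w y a)) e)))
      (λ e → trans (zero-slope c w y a) (trans (cong (c *ᶠ a +ᶠ_) e) (back (c *ᶠ a) b))))))
      (hyperplane-count w w≢0 _)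
      where
      cancel : ∀ x y → x +ᶠ y +ᶠ (-ᶠ x) ≡ y
      cancel = solve 2 (λ x y → x :+ y :+ (:- x) := y) refl
      back : ∀ x y → x +ᶠ (y +ᶠ (-ᶠ x)) ≡ y
      back = solve 2 (λ x y → x :+ (y :+ (:- x)) := y) refl

    -- With slope zero the height is the constant `c`, nonzero here. So `W = 0` is the only
    -- parameter at which the height vanishes more often than generically.
    degenerate : ∀ c (w : Pt n) → ¬ (c ∷ w ≡ 0ᵥ) → w ≡ 0ᵥ → ∀ y → ¬ (height (c ∷ w) y ≡ 0ᶠ)
    degenerate c w W≢0 w≡0 y e = W≢0 (cong₂ _∷_ (trans (sym (trans (zero-slope c w y 1ᶠ)
      (trans (cong₂ _+ᶠ_ (*ᶠ-identityʳ c) (trans (cong (dot y) w≡0) (dot-zeroʳ y))) (+ᶠ-identityʳ c)))) e) w≡0)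

    height-zero : ∀ W → ¬ (W ≡ 0ᵥ) → q * ∑ᵖ n (λ y → I (height W y ≟ᶠ 0ᶠ)) ≤ N
    height-zero (c ∷ w) W≢0 = go (w ≟ᵖ 0ᵥ)
      where
      go : Dec (w ≡ 0ᵥ) → q * ∑ᵖ n (λ y → I (height (c ∷ w) y ≟ᶠ 0ᶠ)) ≤ N
      go (no w≢0) = ≤-reflexive (level-count c w w≢0 1ᶠ 0ᶠ)
      go (yes w≡0) = ≤-trans (≤-reflexive (trans (cong (q *_) (trans (∑-cong (points n) (λ y → I-no (_ ≟ᶠ 0ᶠ) (degenerate c w W≢0 w≡0 y)))
        (∑-zero (points n)))) (*-zeroʳ q))) z≤n

    ∑-shift-height : ∀ w y (g : 𝔽 → ℕ) → ∑ᶠ (λ c → g (height (c ∷ w) y)) ≡ ∑ᶠ g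
    ∑-shift-height w y g = trans (∑-cong elements (λ c → cong g (cong (_+ᶠ dot w y) (*ᶠ-identityʳ c)))) (∑ᶠ-shift (dot w y) g)

    module Points (S : Pt (suc n) → ℕ) (S≤1 : ∀ x → S x ≤ 1) where
      mass : ℕ
      mass = ∑ᵖ (suc n) S

      in-plane : Pt (suc n) → ℕ
      in-plane W = ∑ᵖ n (λ y → S (lift W y))

      -- Through each point pass `N` of the `q N` hyperplanes: the slope `w` is free and determines
      -- `c`.
      mean : ∑ᵖ (suc n) in-plane ≡ N * mass
      mean = begin
        ∑ᵖ (suc n) in-plane ≡⟨ trans (∑ᵖ-suc n in-plane) (∑-swap elements (points n) _) ⟩
        ∑ᵖ n (λ w → ∑ᶠ (λ c → ∑ᵖ n (λ y → S (height (c ∷ w) y ∷ y)))) ≡⟨ ∑-cong (points n) (λ w → ∑-swap elements (points n) _) ⟩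
        ∑ᵖ n (λ w → ∑ᵖ n (λ y → ∑ᶠ (λ c → S (height (c ∷ w) y ∷ y)))) ≡⟨ ∑-cong (points n) (λ w → ∑-cong (points n) (λ y → ∑-shift-height w y (λ a → S (a ∷ y)))) ⟩
        ∑ᵖ n (λ w → ∑ᵖ n (λ y → ∑ᶠ (λ a → S (a ∷ y)))) ≡⟨ ∑ᵖ-const n _ ⟩
        N * ∑ᵖ n (λ y → ∑ᶠ (λ a → S (a ∷ y))) ≡⟨ cong (N *_) (trans (∑-swap (points n) elements _) (sym (∑ᵖ-suc n S))) ⟩
        N * mass ∎
        where open ≡-Reasoning

      private
        l : Pt n → Pt (suc n) → Pt 1
        l y W = height W y ∷ []

        gS : Pt n → Pt 1 → ℕ
        gS y (a ∷ []) = S (a ∷ y)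

        one-point : ∀ (g : Pt 1 → ℕ) → ∑ᵖ 1 g ≡ ∑ᶠ (λ a → g (a ∷ []))
        one-point g = trans (∑ᵖ-suc 0 g) (∑-cong elements (λ a → +-identityʳ _))

      -- In `second-moment`, the parameters `W ≠ 0` have at most `N / q` zeros each; this is the
      -- generic amount and cancels. Only `W = 0`, with `N` zeros, is left, and it yields the
      -- variance term `q⁴ N²`.
      second : q * q * ∑ᵖ (suc n) (λ W → in-plane W * in-plane W) ≤ q * N * (mass * mass) + q * q * (q * q) * (N * N)
      second = +-cancelʳ-≤ (q * q * (q * N * (N * N))) _ _ (begin
        q * q * S₂ + q * q * (q * N * (N * N))
          ≡⟨ cong₂ _+_ refl (e₁ q N) ⟩
        q * q * S₂ + N * (N * (q * 1 * (q * 1) * (q * N)))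
          ≡⟨ cong₂ _+_ (cong₂ _*_ (cong₂ _*_ (sym (*-identityʳ q)) (sym (*-identityʳ q))) refl) (cong₂ (λ x y → x * (y * (q * 1 * (q * 1) * (q * N)))) (sym (length-points n)) (sym (length-points n))) ⟩
        q * 1 * (q * 1) * S₂ + length (points n) * (length (points n) * (q * 1 * (q * 1) * (q * N)))
          ≤⟨ second-moment (points n) l (λ y b u t → cong (_∷ []) (dot-lineˡ b u (1ᶠ ∷ y) t)) gS (λ { y (a ∷ []) → S≤1 (a ∷ y) }) ⟩
        q * N * (T * T) + q * 1 * (q * 1) * (q * 1 * (q * 1) * Z₂)
          ≡⟨ cong₂ (λ x y → q * N * (x * x) + y) T≡ (e₂ q Z₂) ⟩
        q * N * (mass * mass) + q * q * (q * q * Z₂)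
          ≤⟨ +-monoʳ-≤ (q * N * (mass * mass)) (*-monoʳ-≤ (q * q) zeros) ⟩
        q * N * (mass * mass) + q * q * (q * N * (N * N) + q * q * (N * N))
          ≡⟨ e₃ q N (mass * mass) ⟩
        q * N * (mass * mass) + q * q * (q * q) * (N * N) + q * q * (q * N * (N * N)) ∎)
        where
        open ≤-Reasoning
        S₂ = ∑ᵖ (suc n) (λ W → in-plane W * in-plane W)
        T = ∑ᵖ n (λ y → ∑ᵖ 1 (gS y))
        Zf : Pt (suc n) → ℕ
        Zf W = ∑ᵖ n (λ y → I (l y W ≟ᵖ 0ᵥ))
        Z₂ = ∑ᵖ (suc n) (λ W → Zf W * Zf W)
        T≡ : T ≡ mass
        T≡ = trans (∑-cong (points n) (λ y → one-point _)) (trans (∑-swap (points n) elements _) (sym (∑ᵖ-suc n S)))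
        e₁ : ∀ q N → q * q * (q * N * (N * N)) ≡ N * (N * (q * 1 * (q * 1) * (q * N)))
        e₁ = ringℕ
        e₂ : ∀ q Z → q * 1 * (q * 1) * (q * 1 * (q * 1) * Z) ≡ q * q * (q * q * Z)
        e₂ = ringℕ
        e₃ : ∀ q N M → q * N * M + q * q * (q * N * (N * N) + q * q * (N * N)) ≡ q * N * M + q * q * (q * q) * (N * N) + q * q * (q * N * (N * N))
        e₃ = ringℕ
        Zf≡ : ∀ W → Zf W ≡ ∑ᵖ n (λ y → I (height W y ≟ᶠ 0ᶠ))
        Zf≡ W = ∑-cong (points n) (λ y → I-cong (l y W ≟ᵖ 0ᵥ) (height W y ≟ᶠ 0ᶠ) (cong Vec.head) (cong (_∷ [])))
        sq : ∀ W → q * Zf W * (q * Zf W) ≤ N * N + I (W ≟ᵖ 0ᵥ) * (q * q * (N * N))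
        sq W with W ≟ᵖ 0ᵥ
        ... | no ne = ≤-trans (*-mono-≤ le' le') (m≤m+n (N * N) _)
          where
          le' : q * Zf W ≤ N
          le' = subst (λ z → q * z ≤ N) (sym (Zf≡ W)) (height-zero W ne)
        ... | yes _ = ≤-trans (*-mono-≤ le' le') (≤-trans (≤-reflexive (e₄ q N)) (m≤n+m _ (N * N)))
          where
          le' : q * Zf W ≤ q * N
          le' = *-monoʳ-≤ q (≤-trans (∑ᵖ-≤const n (λ y → I≤1 (l y W ≟ᵖ 0ᵥ))) (≤-reflexive (*-identityʳ N)))
          e₄ : ∀ q N → q * N * (q * N) ≡ q * q * (N * N) + 0
          e₄ = ringℕ
        zeros : q * q * Z₂ ≤ q * N * (N * N) + q * q * (N * N)
        zeros = begin
          q * q * Z₂ ≡⟨ sym (∑-*ˡ (points (suc n)) (q * q) _) ⟩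
          ∑ᵖ (suc n) (λ W → q * q * (Zf W * Zf W)) ≡⟨ ∑-cong (points (suc n)) (λ W → e₅ q (Zf W)) ⟩
          ∑ᵖ (suc n) (λ W → q * Zf W * (q * Zf W)) ≤⟨ ∑-mono (points (suc n)) sq ⟩
          ∑ᵖ (suc n) (λ W → N * N + I (W ≟ᵖ 0ᵥ) * (q * q * (N * N))) ≡⟨ trans (∑-+ (points (suc n)) _ _) (cong₂ _+_ (∑ᵖ-const (suc n) (N * N)) (Finite.∑-δ (finitePt (suc n)) 0ᵥ (λ _ → q * q * (N * N)))) ⟩
          q * N * (N * N) + q * q * (N * N) ∎
          where
          e₅ : ∀ q z → q * q * (z * z) ≡ q * z * (q * z)
          e₅ = ringℕ

    -- Flags are pairs of a point and a direction. A nonzero direction with zero tail is vertical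
    -- and lies in no graph, hence the condition `vertical`.
    module Flags (g : Pt (suc n) → Pt (suc n) → ℕ) (g≤1 : ∀ x u → g x u ≤ 1) (vertical : ∀ x b → g x (b ∷ 0ᵥ) ≡ 0) where
      mass : ℕ
      mass = ∑ᵖ (suc n) (λ x → ∑ᵖ (suc n) (g x))

      in-plane : Pt (suc n) → ℕ
      in-plane W = ∑ᵖ n (λ y → ∑ᵖ n (λ v → g (lift W y) (lift-dir W v)))

      private
        regroup : mass ≡ ∑ᵖ n (λ y → ∑ᵖ n (λ v → ∑ᶠ (λ a → ∑ᶠ (λ b → g (a ∷ y) (b ∷ v)))))
        regroup = begin
          mass ≡⟨ trans (∑ᵖ-suc n _) (∑-swap elements (points n) _) ⟩
          ∑ᵖ n (λ y → ∑ᶠ (λ a → ∑ᵖ (suc n) (g (a ∷ y)))) ≡⟨ ∑-cong (points n) (λ y → ∑-cong elements (λ a → trans (∑ᵖ-suc n _) (∑-swap elements (points n) _))) ⟩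
          ∑ᵖ n (λ y → ∑ᶠ (λ a → ∑ᵖ n (λ v → ∑ᶠ (λ b → g (a ∷ y) (b ∷ v))))) ≡⟨ ∑-cong (points n) (λ y → ∑-swap elements (points n) _) ⟩
          ∑ᵖ n (λ y → ∑ᵖ n (λ v → ∑ᶠ (λ a → ∑ᶠ (λ b → g (a ∷ y) (b ∷ v))))) ∎
          where open ≡-Reasoning

      -- A flag with nonvertical direction lies in `N / q` hyperplanes: the direction imposes one
      -- linear condition on the slope, and the point then fixes `c`.
      mean : q * ∑ᵖ (suc n) in-plane ≡ N * mass
      mean = begin
        q * ∑ᵖ (suc n) in-plane
          ≡⟨ cong (q *_) (trans (∑-swap (points (suc n)) (points n) _) (∑-cong (points n) (λ y → ∑-swap (points (suc n)) (points n) _))) ⟩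
        q * ∑ᵖ n (λ y → ∑ᵖ n (λ v → ∑ᵖ (suc n) (λ W → g (lift W y) (lift-dir W v))))
          ≡⟨ trans (sym (∑-*ˡ (points n) q _)) (∑-cong (points n) (λ y → sym (∑-*ˡ (points n) q _))) ⟩
        ∑ᵖ n (λ y → ∑ᵖ n (λ v → q * ∑ᵖ (suc n) (λ W → g (lift W y) (lift-dir W v))))
          ≡⟨ ∑-cong (points n) (λ y → ∑-cong (points n) (λ v → at-flag y v)) ⟩
        ∑ᵖ n (λ y → ∑ᵖ n (λ v → N * ∑ᶠ (λ a → ∑ᶠ (λ b → g (a ∷ y) (b ∷ v)))))
          ≡⟨ trans (∑-cong (points n) (λ y → ∑-*ˡ (points n) N _)) (∑-*ˡ (points n) N _) ⟩
        N * ∑ᵖ n (λ y → ∑ᵖ n (λ v → ∑ᶠ (λ a → ∑ᶠ (λ b → g (a ∷ y) (b ∷ v)))))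
          ≡⟨ cong (N *_) (sym regroup) ⟩
        N * mass ∎
        where
        open ≡-Reasoning
        slope : ∀ c w v → gradient (c ∷ w) v ≡ dot w v
        slope c w v = trans (cong (_+ᶠ dot w v) (*ᶠ-zeroʳ c)) (+ᶠ-identityˡ _)
        at-flag : ∀ y v → q * ∑ᵖ (suc n) (λ W → g (lift W y) (lift-dir W v)) ≡ N * ∑ᶠ (λ a → ∑ᶠ (λ b → g (a ∷ y) (b ∷ v)))
        at-flag y v = begin
          q * ∑ᵖ (suc n) (λ W → g (lift W y) (lift-dir W v))
            ≡⟨ cong (q *_) (trans (∑ᵖ-suc n _) (∑-swap elements (points n) _)) ⟩
          q * ∑ᵖ n (λ w → ∑ᶠ (λ c → g (height (c ∷ w) y ∷ y) (gradient (c ∷ w) v ∷ v)))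
            ≡⟨ cong (q *_) (∑-cong (points n) (λ w → trans (∑-cong elements (λ c → cong (λ b → g (height (c ∷ w) y ∷ y) (b ∷ v)) (slope c w v)))
                 (∑-shift-height w y (λ a → g (a ∷ y) (dot w v ∷ v))))) ⟩
          q * ∑ᵖ n (λ w → G (dot w v))
            ≡⟨ cong (q *_) (∑-pushforward (finitePt n) finite𝔽 (λ w → dot w v) G) ⟩
          q * ∑ᶠ (λ b → G b * ∑ᵖ n (λ w → I (dot w v ≟ᶠ b)))
            ≡⟨ trans (sym (∑-*ˡ elements q _)) (∑-cong elements (λ b → counted b (v ≟ᵖ 0ᵥ))) ⟩
          ∑ᶠ (λ b → N * G b)
            ≡⟨ trans (∑-*ˡ elements N G) (cong (N *_) (∑-swap elements elements _)) ⟩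
          N * ∑ᶠ (λ a → ∑ᶠ (λ b → g (a ∷ y) (b ∷ v))) ∎
          where
          G : 𝔽 → ℕ
          G b = ∑ᶠ (λ a → g (a ∷ y) (b ∷ v))
          counted : ∀ b → Dec (v ≡ 0ᵥ) → q * (G b * ∑ᵖ n (λ w → I (dot w v ≟ᶠ b))) ≡ N * G b
          counted b (no v≢0) = trans (comm₃ q (G b) _) (trans (cong (G b *_) (hyperplane-count v v≢0 b)) (*-comm (G b) N))
            where
            comm₃ : ∀ x y z → x * (y * z) ≡ y * (x * z)
            comm₃ = ringℕ
          counted b (yes v≡0) = trans (cong (λ z → q * (z * ∑ᵖ n (λ w → I (dot w v ≟ᶠ b)))) G≡0) (trans (*-zeroʳ q) (sym (trans (cong (N *_) G≡0) (*-zeroʳ N))))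
            where
            G≡0 : G b ≡ 0
            G≡0 = trans (∑-cong elements (λ a → trans (cong (λ z → g (a ∷ y) (b ∷ z)) v≡0) (vertical (a ∷ y) b))) (∑-zero elements)

      private
        L = cartesianProduct (points n) (points n)

        length-L : length L ≡ N * N
        length-L = trans (sym (trans (∑-const L 1) (*-identityʳ _))) (trans (∑-cartesianProduct (points n) (points n) (λ _ → 1))
          (trans (∑-cong (points n) (λ _ → ∑ᵖ-one n)) (∑ᵖ-const n N)))

        l : Pt n × Pt n → Pt (suc n) → Pt 2
        l (y , v) W = height W y ∷ gradient W v ∷ []

        gF : Pt n × Pt n → Pt 2 → ℕ
        gF (y , v) (a ∷ b ∷ []) = g (a ∷ y) (b ∷ v)

        two-points : ∀ (h : Pt 2 → ℕ) → ∑ᵖ 2 h ≡ ∑ᶠ (λ a → ∑ᶠ (λ b → h (a ∷ b ∷ [])))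
        two-points h = trans (∑ᵖ-suc 1 h) (∑-cong elements (λ a → trans (∑ᵖ-suc 0 (λ z → h (a ∷ z))) (∑-cong elements (λ b → +-identityʳ _))))

      -- As for points, but with two linear forms in `W`, the height at `y` and the gradient along
      -- `v`; hence `q⁴` in the place of `q²`.
      second : q * q * (q * q) * ∑ᵖ (suc n) (λ W → in-plane W * in-plane W) ≤
               q * N * (mass * mass) + q * q * (q * q) * (q * q * (q * q)) * (N * N * (N * N))
      second = +-cancelʳ-≤ (q * q * (q * q) * (q * N * (N * N * (N * N)))) _ _ (begin
        q * q * (q * q) * S₂ + q * q * (q * q) * (q * N * (N * N * (N * N)))
          ≡⟨ cong₂ _+_ (trans (e₀ q S₂) (cong (R *_) (∑-cong (points (suc n)) (λ W → cong₂ _*_ (X≡ W) (X≡ W))))) (e₁ q N) ⟩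
        R * ∑ᵖ (suc n) (λ W → Xf W * Xf W) + N * N * (N * N * (R * (q * N)))
          ≡⟨ cong (λ z → R * ∑ᵖ (suc n) (λ W → Xf W * Xf W) + z * (z * (R * (q * N)))) (sym length-L) ⟩
        R * ∑ᵖ (suc n) (λ W → Xf W * Xf W) + length L * (length L * (R * (q * N)))
          ≤⟨ second-moment L l (λ { (y , v) b u t → cong₂ (λ r s → r ∷ s ∷ []) (dot-lineˡ b u (1ᶠ ∷ y) t) (dot-lineˡ b u (0ᶠ ∷ v) t) })
               gF (λ { (y , v) (a ∷ b ∷ []) → g≤1 (a ∷ y) (b ∷ v) }) ⟩
        q * N * (T * T) + R * (R * Z₂)
          ≡⟨ cong₂ (λ x y → q * N * (x * x) + y) T≡ (e₂ q Z₂) ⟩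
        q * N * (mass * mass) + q * q * (q * q) * (q * q * (q * q) * Z₂)
          ≤⟨ +-monoʳ-≤ (q * N * (mass * mass)) (*-monoʳ-≤ (q * q * (q * q)) zeros) ⟩
        q * N * (mass * mass) + q * q * (q * q) * (q * N * (N * N * (N * N)) + q * q * (q * q) * (N * N * (N * N)))
          ≡⟨ e₃ (q * q * (q * q)) (q * N * (N * N * (N * N))) (N * N * (N * N)) (q * N * (mass * mass)) ⟩
        q * N * (mass * mass) + q * q * (q * q) * (q * q * (q * q)) * (N * N * (N * N)) + q * q * (q * q) * (q * N * (N * N * (N * N))) ∎)
        where
        open ≤-Reasoning
        R = q ^ 2 * q ^ 2
        S₂ = ∑ᵖ (suc n) (λ W → in-plane W * in-plane W)
        Xf Zf A B : Pt (suc n) → ℕ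
        Xf W = ∑ L (λ α → gF α (l α W))
        Zf W = ∑ L (λ α → I (l α W ≟ᵖ 0ᵥ))
        A W = ∑ᵖ n (λ y → I (height W y ≟ᶠ 0ᶠ))
        B W = ∑ᵖ n (λ v → I (gradient W v ≟ᶠ 0ᶠ))
        T = ∑ L (λ α → ∑ᵖ 2 (gF α))
        Z₂ = ∑ᵖ (suc n) (λ W → Zf W * Zf W)
        X≡ : ∀ W → in-plane W ≡ Xf W
        X≡ W = sym (∑-cartesianProduct (points n) (points n) _)
        T≡ : T ≡ mass
        T≡ = trans (∑-cartesianProduct (points n) (points n) _) (trans (∑-cong (points n) (λ y → ∑-cong (points n) (λ v → two-points _))) (sym regroup))
        e₀ : ∀ q S → q * q * (q * q) * S ≡ q * (q * 1) * (q * (q * 1)) * S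
        e₀ = ringℕ
        e₁ : ∀ q N → q * q * (q * q) * (q * N * (N * N * (N * N))) ≡ N * N * (N * N * (q * (q * 1) * (q * (q * 1)) * (q * N)))
        e₁ = ringℕ
        e₂ : ∀ q Z → q * (q * 1) * (q * (q * 1)) * (q * (q * 1) * (q * (q * 1)) * Z) ≡ q * q * (q * q) * (q * q * (q * q) * Z)
        e₂ = ringℕ
        e₃ : ∀ Q x y M → M + Q * (x + Q * y) ≡ M + Q * Q * y + Q * x
        e₃ = ringℕ
        Zf≡ : ∀ W → Zf W ≡ A W * B W
        Zf≡ W = trans (∑-cartesianProduct (points n) (points n) _) (trans
          (∑-cong (points n) (λ y → ∑-cong (points n) (λ v → trans
            (I-cong (l (y , v) W ≟ᵖ 0ᵥ) ((height W y ≟ᶠ 0ᶠ) ×-dec (gradient W v ≟ᶠ 0ᶠ))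
              (λ e → cong Vec.head e , cong (Vec.head ∘ Vec.tail) e) (λ (e , e') → cong₂ (λ r s → r ∷ s ∷ []) e e'))
            (I-× (height W y ≟ᶠ 0ᶠ) (gradient W v ≟ᶠ 0ᶠ)))))
          (sym (∑-*-∑ (points n) (points n) _ _)))
        generic : ∀ W → ¬ (W ≡ 0ᵥ) → q * q * Zf W ≤ N * N
        generic W@(c ∷ w) W≢0 = go (w ≟ᵖ 0ᵥ)
          where
          go : Dec (w ≡ 0ᵥ) → q * q * Zf W ≤ N * N
          go (no w≢0) = ≤-reflexive (trans (cong (q * q *_) (Zf≡ W)) (trans (e q (A W) (B W))
            (cong₂ _*_ (level-count c w w≢0 1ᶠ 0ᶠ) (level-count c w w≢0 0ᶠ 0ᶠ))))
            where
            e : ∀ q a b → q * q * (a * b) ≡ q * a * (q * b)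
            e = ringℕ
          go (yes w≡0) = ≤-trans (≤-reflexive (trans (cong (q * q *_) (trans (Zf≡ W) (cong (_* B W)
            (trans (∑-cong (points n) (λ y → I-no (height W y ≟ᶠ 0ᶠ) (degenerate c w W≢0 w≡0 y))) (∑-zero (points n)))))) (*-zeroʳ (q * q)))) z≤n
        sq : ∀ W → q * q * Zf W * (q * q * Zf W) ≤ N * N * (N * N) + I (W ≟ᵖ 0ᵥ) * (q * q * (q * q) * (N * N * (N * N)))
        sq W with W ≟ᵖ 0ᵥ
        ... | no ne = ≤-trans (*-mono-≤ (generic W ne) (generic W ne)) (m≤m+n _ _)
        ... | yes _ = ≤-trans (*-mono-≤ le le) (≤-trans (≤-reflexive (e₄ (q * q) (N * N))) (m≤n+m _ (N * N * (N * N))))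
          where
          le : q * q * Zf W ≤ q * q * (N * N)
          le = *-monoʳ-≤ (q * q) (≤-trans (∑-≤const L (λ α → I≤1 (l α W ≟ᵖ 0ᵥ))) (≤-reflexive (trans (*-identityʳ _) length-L)))
          e₄ : ∀ Q M → Q * M * (Q * M) ≡ Q * Q * (M * M) + 0
          e₄ = ringℕ
        zeros : q * q * (q * q) * Z₂ ≤ q * N * (N * N * (N * N)) + q * q * (q * q) * (N * N * (N * N))
        zeros = begin
          q * q * (q * q) * Z₂ ≡⟨ sym (∑-*ˡ (points (suc n)) (q * q * (q * q)) _) ⟩
          ∑ᵖ (suc n) (λ W → q * q * (q * q) * (Zf W * Zf W)) ≡⟨ ∑-cong (points (suc n)) (λ W → e₅ (q * q) (Zf W)) ⟩
          ∑ᵖ (suc n) (λ W → q * q * Zf W * (q * q * Zf W)) ≤⟨ ∑-mono (points (suc n)) sq ⟩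
          ∑ᵖ (suc n) (λ W → N * N * (N * N) + I (W ≟ᵖ 0ᵥ) * (q * q * (q * q) * (N * N * (N * N))))
            ≡⟨ trans (∑-+ (points (suc n)) _ _) (cong₂ _+_ (∑ᵖ-const (suc n) (N * N * (N * N))) (Finite.∑-δ (finitePt (suc n)) 0ᵥ (λ _ → q * q * (q * q) * (N * N * (N * N))))) ⟩
          q * N * (N * N * (N * N)) + q * q * (q * q) * (N * N * (N * N)) ∎
          where
          e₅ : ∀ Q z → Q * Q * (z * z) ≡ Q * z * (Q * z)
          e₅ = ringℕ

-- Exact cliques in almost transitive graphs.

module Clique where
  open import Data.Nat using (_+_; _*_; _≤_; _<_)
  open import Data.Nat.Properties hiding (_≟_)
  open FiniteSums

  -- If non-adjacent vertices have at most δ common neighbours, the vertices adjacent to more than 2/3 of a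
  -- well-chosen neighbourhood form an exact clique.
  module _ {A : Set} (FA : Finite A) (V : A → Set) (E : A → A → Set) (E? : ∀ a b → Dec (E a b))
    (E-sym : ∀ {a b} → E a b → E b a) (E-vertex : ∀ {a b} → E a b → V a) (δ G : ℕ) (0<δ : 0 < δ) (0<G : 0 < G) where

    open Finite FA using (elems)

    private
      M = length elems
      adj : A → A → ℕ
      adj a b = I (E? a b)
      non : A → A → ℕ
      non a b = I (¬? (E? a b))

    module _ (defect : ∀ a b → V a → V b → ¬ E a b → ∑ elems (λ c → adj a c * adj b c) ≤ δ)
             (many : M * M ≤ G * ∑ elems (λ a → ∑ elems (adj a)))
             (large : 24 * (G * G * δ) ≤ M) where

      private
        deg : A → ℕ
        deg a = ∑ elems (adj a)

        bad : A → A → ℕ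
        bad o a = ∑ elems (λ b → adj o b * non a b)

        missing : A → ℕ
        missing o = ∑ elems (λ a → adj o a * bad o a)

        M>0 : 0 < M
        M>0 = ≤-trans (*-mono-≤ {1} {24} (s≤s z≤n) (*-mono-≤ (*-mono-≤ 0<G 0<G) 0<δ)) large

        -- Counted by the non-adjacent pair instead of by the hub: such a pair has at most `δ`
        -- common neighbours that could serve as hub.
        total-missing : ∑ elems missing ≤ M * (M * δ)
        total-missing = begin
          ∑ elems (λ o → ∑ elems (λ a → adj o a * bad o a))
            ≡⟨ ∑-swap elems elems _ ⟩
          ∑ elems (λ a → ∑ elems (λ o → adj o a * bad o a))
            ≡⟨ ∑-cong elems (λ a → trans (∑-cong elems (λ o → sym (∑-*ˡ elems (adj o a) _))) (∑-swap elems elems _)) ⟩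
          ∑ elems (λ a → ∑ elems (λ b → ∑ elems (λ o → adj o a * (adj o b * non a b))))
            ≤⟨ ∑-mono elems (λ a → ∑-mono elems (λ b → common a b)) ⟩
          ∑ elems (λ a → ∑ elems (λ b → δ))
            ≡⟨ trans (∑-cong elems (λ a → ∑-const elems δ)) (∑-const elems _) ⟩
          M * (M * δ) ∎
          where
          open ≤-Reasoning
          common : ∀ a b → ∑ elems (λ o → adj o a * (adj o b * non a b)) ≤ δ
          common a b with E? a b
          ... | yes _ = ≤-trans (≤-reflexive (trans (∑-cong elems (λ o → trans (cong (adj o a *_) (*-zeroʳ (adj o b))) (*-zeroʳ (adj o a)))) (∑-zero elems))) z≤n
          -- A common neighbour is what shows that `a` and `b` are vertices, as `defect` demands;
          -- without one the sum is zero.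
          ... | no ¬e with ∑ elems (λ o → adj o a * (adj o b * 1)) in eq
          ... | zero = z≤n
          ... | suc k = subst (_≤ δ) eq (≤-trans (≤-reflexive (∑-cong elems (λ o → cong₂ _*_ (I-cong (E? o a) (E? a o) E-sym E-sym)
                    (trans (*-identityʳ _) (I-cong (E? o b) (E? b o) E-sym E-sym))))) (defect a b Va Vb ¬e))
            where
            witness : ∃ λ o → 0 < adj o a * (adj o b * 1)
            witness with o , _ , pos ← ∑-pos⇒∃ elems (subst (0 <_) (sym eq) (s≤s z≤n)) = o , pos
            o = proj₁ witness
            Va : V a
            Va = E-vertex (E-sym (I-pos (E? o a) (n≢0⇒n>0 (λ z → <-irrefl (sym (cong (_* (adj o b * 1)) z)) (proj₂ witness)))))
            Vb : V b
            Vb = E-vertex (E-sym (I-pos (E? o b) (n≢0⇒n>0 (λ z → <-irrefl (sym (trans (cong (λ y → adj o a * (y * 1)) z) (*-zeroʳ (adj o a)))) (proj₂ witness)))))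

        -- The summand `δ M` makes one averaging step do two things at the hub: bound the missing
        -- pairs from above and the degree from below.
        averaged : ∑ elems (λ o → δ * M + missing o) ≤ ∑ elems (λ o → 2 * (G * δ) * deg o)
        averaged = begin
          ∑ elems (λ o → δ * M + missing o) ≡⟨ trans (∑-+ elems _ _) (cong (_+ ∑ elems missing) (∑-const elems (δ * M))) ⟩
          M * (δ * M) + ∑ elems missing ≤⟨ +-monoʳ-≤ (M * (δ * M)) total-missing ⟩
          M * (δ * M) + M * (M * δ) ≡⟨ e₁ M δ ⟩
          2 * δ * (M * M) ≤⟨ *-monoʳ-≤ (2 * δ) many ⟩
          2 * δ * (G * ∑ elems deg) ≡⟨ e₂ δ G (∑ elems deg) ⟩
          2 * (G * δ) * ∑ elems deg ≡⟨ sym (∑-*ˡ elems (2 * (G * δ)) deg) ⟩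
          ∑ elems (λ o → 2 * (G * δ) * deg o) ∎
          where
          open ≤-Reasoning
          e₁ : ∀ M δ → M * (δ * M) + M * (M * δ) ≡ 2 * δ * (M * M)
          e₁ = ringℕ
          e₂ : ∀ δ G D → 2 * δ * (G * D) ≡ 2 * (G * δ) * D
          e₂ = ringℕ

        hub : ∃ λ o → δ * M + missing o ≤ 2 * (G * δ) * deg o
        hub with o , _ , le ← ∑-≤⇒∃ elems {λ o → δ * M + missing o} {λ o → 2 * (G * δ) * deg o} M>0 averaged = o , le

        module AtHub (o : A) (le : δ * M + missing o ≤ 2 * (G * δ) * deg o) where
          open ≤-Reasoning
          n₀ = deg o

          instance δ≢0 : NonZero δ
          δ≢0 = ℕ.>-nonZero 0<δ

          n₀-large : M ≤ 2 * G * n₀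
          n₀-large = *-cancelˡ-≤ δ (≤-trans (m≤m+n (δ * M) _) (≤-trans le (≤-reflexive (e δ G n₀))))
            where
            e : ∀ δ G n → 2 * (G * δ) * n ≡ δ * (2 * G * n)
            e = ringℕ

          few-missing : missing o ≤ 2 * (G * δ) * n₀
          few-missing = ≤-trans (m≤n+m _ (δ * M)) le

          δ-small : 12 * (G * δ) ≤ n₀
          δ-small = *-cancelˡ-≤ (2 * G) {{ℕ.>-nonZero (*-mono-≤ {1} {2} (s≤s z≤n) 0<G)}} (≤-trans (≤-reflexive (e G δ)) (≤-trans large n₀-large))
            where
            e : ∀ G δ → 2 * G * (12 * (G * δ)) ≡ 24 * (G * G * δ)
            e = ringℕ

          n₀>0 : 0 < n₀
          n₀>0 = ≤-trans (*-mono-≤ {1} {12} (s≤s z≤n) (*-mono-≤ 0<G 0<δ)) δ-small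

          C : A → Set
          C a = E o a × 3 * bad o a < n₀

          C? : ∀ a → Dec (C a)
          C? a = E? o a ×-dec (3 * bad o a ℕ.<? n₀)

          -- Two members together miss less than two thirds of the neighbourhood of the hub, so more
          -- than `n₀ / 3` of it is adjacent to both. For a non-adjacent pair that would mean
          -- `n₀ ≤ 3 δ`, against `δ-small`.
          complete : ∀ a b → C a → C b → E a b
          complete a b (Eoa , ba) (Eob , bb) with E? a b
          ... | yes e = e
          ... | no ¬e = contradiction n₀-small (<⇒≱ (≤-trans (*-monoˡ-< δ {3} {12} (s≤s (s≤s (s≤s (s≤s z≤n))))) (≤-trans (*-monoʳ-≤ 12 (≤-trans (≤-reflexive (sym (*-identityˡ δ))) (*-monoˡ-≤ δ 0<G))) δ-small)))
            where
            cover : n₀ ≤ ∑ elems (λ c → adj a c * adj b c) + (bad o a + bad o b)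
            cover = begin
              n₀ ≤⟨ ∑-mono elems pointwise ⟩
              ∑ elems (λ c → adj a c * adj b c + (adj o c * non a c + adj o c * non b c))
                ≡⟨ trans (∑-+ elems _ _) (cong (∑ elems (λ c → adj a c * adj b c) +_) (∑-+ elems _ _)) ⟩
              ∑ elems (λ c → adj a c * adj b c) + (bad o a + bad o b) ∎
              where
              pointwise : ∀ c → adj o c ≤ adj a c * adj b c + (adj o c * non a c + adj o c * non b c)
              pointwise c with E? o c | E? a c | E? b c
              ... | no _ | _ | _ = z≤n
              ... | yes _ | yes _ | yes _ = s≤s z≤n
              ... | yes _ | yes _ | no _ = s≤s z≤n
              ... | yes _ | no _ | _ = s≤s z≤n
            n₀-small : n₀ ≤ 3 * δ
            n₀-small = +-cancelʳ-≤ (2 * n₀) _ _ (begin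
              n₀ + 2 * n₀ ≡⟨ e₁ n₀ ⟩
              3 * n₀ ≤⟨ *-monoʳ-≤ 3 (≤-trans cover (+-monoˡ-≤ (bad o a + bad o b) (defect a b (E-vertex (E-sym Eoa)) (E-vertex (E-sym Eob)) ¬e))) ⟩
              3 * (δ + (bad o a + bad o b)) ≡⟨ e₂ δ (bad o a) (bad o b) ⟩
              3 * δ + (3 * bad o a + 3 * bad o b) ≤⟨ +-monoʳ-≤ (3 * δ) (+-mono-≤ (<⇒≤ ba) (<⇒≤ bb)) ⟩
              3 * δ + (n₀ + n₀) ≡⟨ cong (λ z → 3 * δ + (n₀ + z)) (sym (+-identityʳ n₀)) ⟩
              3 * δ + 2 * n₀ ∎)
              where
              e₁ : ∀ n → n + 2 * n ≡ 3 * n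
              e₁ = ringℕ
              e₂ : ∀ d x y → 3 * (d + (x + y)) ≡ 3 * d + (3 * x + 3 * y)
              e₂ = ringℕ

          -- Markov's inequality: each neighbour of the hub outside `C` misses at least a third of
          -- the neighbourhood, so there are at most `3 missing / n₀ ≤ 6 G δ ≤ n₀ / 2` of them.
          size : M ≤ 4 * G * ∑ elems (λ a → I (C? a))
          size = begin
            M ≤⟨ n₀-large ⟩
            2 * G * n₀ ≤⟨ *-monoʳ-≤ (2 * G) (+-cancelʳ-≤ n₀ _ _ half) ⟩
            2 * G * (2 * c#) ≡⟨ e G c# ⟩
            4 * G * c# ∎
            where
            c# = ∑ elems (λ a → I (C? a))
            e : ∀ G c → 2 * G * (2 * c) ≡ 4 * G * c
            e = ringℕ
            instance n₀≢0 : NonZero n₀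
            n₀≢0 = ℕ.>-nonZero n₀>0
            weighted : n₀ * n₀ ≤ n₀ * c# + 3 * missing o
            weighted = begin
              n₀ * n₀ ≡⟨ sym (∑-*ˡ elems n₀ _) ⟩
              ∑ elems (λ a → n₀ * adj o a) ≤⟨ ∑-mono elems pointwise ⟩
              ∑ elems (λ a → n₀ * I (C? a) + 3 * (adj o a * bad o a)) ≡⟨ trans (∑-+ elems _ _) (cong₂ _+_ (∑-*ˡ elems n₀ _) (∑-*ˡ elems 3 _)) ⟩
              n₀ * c# + 3 * missing o ∎
              where
              pointwise : ∀ a → n₀ * adj o a ≤ n₀ * I (C? a) + 3 * (adj o a * bad o a)
              pointwise a with E? o a
              ... | no _ = ≤-trans (≤-reflexive (*-zeroʳ n₀)) z≤n
              ... | yes _ with 3 * bad o a ℕ.<? n₀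
              ... | yes _ = m≤m+n (n₀ * 1) _
              ... | no ¬lt = ≤-trans (≤-reflexive (*-identityʳ n₀)) (≤-trans (≮⇒≥ ¬lt) (≤-trans (≤-reflexive (cong (3 *_) (sym (+-identityʳ (bad o a))))) (m≤n+m _ (n₀ * 0))))
            half : n₀ + n₀ ≤ 2 * c# + n₀
            half = *-cancelˡ-≤ n₀ (begin
              n₀ * (n₀ + n₀) ≡⟨ f₁ n₀ ⟩
              2 * (n₀ * n₀) ≤⟨ *-monoʳ-≤ 2 (≤-trans weighted (+-monoʳ-≤ (n₀ * c#) (*-monoʳ-≤ 3 few-missing))) ⟩
              2 * (n₀ * c# + 3 * (2 * (G * δ) * n₀)) ≡⟨ f₂ n₀ c# (G * δ) ⟩
              n₀ * (2 * c# + 12 * (G * δ)) ≤⟨ *-monoʳ-≤ n₀ (+-monoʳ-≤ (2 * c#) δ-small) ⟩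
              n₀ * (2 * c# + n₀) ∎)
              where
              f₁ : ∀ n → n * (n + n) ≡ 2 * (n * n)
              f₁ = ringℕ
              f₂ : ∀ n c x → 2 * (n * c + 3 * (2 * x * n)) ≡ n * (2 * c + 12 * x)
              f₂ = ringℕ

      abstract
        large-clique : Σ (A → Set) λ C → Σ (∀ a → Dec (C a)) λ C? →
          (∀ a → C a → V a) × (∀ a b → C a → C b → E a b) × M ≤ 4 * G * ∑ elems (λ a → I (C? a))
        large-clique with o , le ← hub = H.C , H.C? , (λ a c → E-vertex (E-sym (proj₁ c))) , H.complete , H.size
          where module H = AtHub o le

-- Consistency of polynomials on pairs of hyperplanes.

module Consistency (F : FiniteField) where
  open import Data.Nat using (_+_; _*_; _≤_; _<_)
  open import Data.Nat.Properties hiding (_≟_)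
  open FiniteSums
  open FieldAlgebra F
  open Series F
  open Polynomials F
  open Sampling F

  -- Supplies a direction inside the intersection of two hyperplanes; two coordinates are enough to
  -- build it.
  orthogonal : ∀ {n} (l : Pt (suc (suc n))) → Σ (Pt (suc (suc n))) λ r → ¬ (r ≡ 0ᵥ) × dot l r ≡ 0ᶠ
  orthogonal (a ∷ b ∷ l) with a ≟ᶠ 0ᶠ
  ... | yes refl = 1ᶠ ∷ 0ᶠ ∷ 0ᵥ , (λ e → 1ᶠ≢0ᶠ (cong Vec.head e)) , trans (cong (λ z → 0ᶠ *ᶠ 1ᶠ +ᶠ (b *ᶠ 0ᶠ +ᶠ z)) (dot-zeroʳ l)) (simplify b)
    where
    simplify : ∀ b → 0ᶠ *ᶠ 1ᶠ +ᶠ (b *ᶠ 0ᶠ +ᶠ 0ᶠ) ≡ 0ᶠ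
    simplify = solve 1 (λ b → con (0 , 0) :* con (1 , 0) :+ (b :* con (0 , 0) :+ con (0 , 0)) := con (0 , 0)) refl
  ... | no a≢0 = b ∷ (-ᶠ a) ∷ 0ᵥ ,
      (λ e → a≢0 (trans (negneg a) (trans (cong -ᶠ_ (cong (Vec.head ∘ Vec.tail) e)) neg0))) ,
      trans (cong (λ z → a *ᶠ b +ᶠ (b *ᶠ (-ᶠ a) +ᶠ z)) (dot-zeroʳ l)) (cancel a b)
    where
    cancel : ∀ a b → a *ᶠ b +ᶠ (b *ᶠ (-ᶠ a) +ᶠ 0ᶠ) ≡ 0ᶠ
    cancel = solve 2 (λ a b → a :* b :+ (b :* (:- a) :+ con (0 , 0)) := con (0 , 0)) refl
    negneg : ∀ a → a ≡ -ᶠ (-ᶠ a)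
    negneg = solve 1 (λ a → a := :- (:- a)) refl
    neg0 : -ᶠ 0ᶠ ≡ 0ᶠ
    neg0 = solve 0 (:- con (0 , 0) := con (0 , 0)) refl

  module HyperplaneCounts (n : ℕ) where
    open Hyperplane n public

    gradient-tail : ∀ c (w v : Pt n) → gradient (c ∷ w) v ≡ dot w v
    gradient-tail c w v = trans (cong (_+ᶠ dot w v) (*ᶠ-zeroʳ c)) (+ᶠ-identityˡ _)

    height-tail : ∀ c (w y : Pt n) → height (c ∷ w) y ≡ c +ᶠ dot w y
    height-tail c w y = cong (_+ᶠ dot w y) (*ᶠ-identityʳ c)

    gradient-count : ∀ (v : Pt n) → ¬ (v ≡ 0ᵥ) → ∀ b → ∑ᵖ (suc n) (λ W → I (gradient W v ≟ᶠ b)) ≡ N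
    gradient-count v v≢0 b = trans (∑ᵖ-suc n _) (trans (∑-cong elements (λ c → ∑-cong (points n) (λ w →
        I-cong (_ ≟ᶠ b) (dot w v ≟ᶠ b) (trans (sym (gradient-tail c w v))) (trans (gradient-tail c w v)))))
      (trans (∑-const elements _) (hyperplane-count v v≢0 b)))

    height-count : ∀ (y : Pt n) a → ∑ᵖ (suc n) (λ W → I (height W y ≟ᶠ a)) ≡ N
    height-count y a = trans (∑ᵖ-suc n _) (trans (∑-swap elements (points n) _)
      (trans (∑-cong (points n) (λ w → trans (∑-shift-height w y (λ z → I (z ≟ᶠ a))) (Finite.∑-δ₁ finite𝔽 a))) (∑ᵖ-one n)))

    height-⊟ : ∀ W W' y → height (W ⊟ W') y ≡ height W y +ᶠ (-ᶠ height W' y)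
    height-⊟ W W' y = dot-⊟ˡ W W' (1ᶠ ∷ y)

    coincidence-count : ∀ W W' → ¬ (Vec.tail W ≡ Vec.tail W') → q * ∑ᵖ n (λ y → I (height W y ≟ᶠ height W' y)) ≡ N
    coincidence-count W@(c ∷ w) W'@(c' ∷ w') w≢w' = trans (cong (q *_) (∑-cong (points n) (λ y → I-cong (_ ≟ᶠ _) (height (W ⊟ W') y ≟ᶠ 0ᶠ)
      (λ e → trans (height-⊟ W W' y) (x≡y⇒x-y≡0 e)) (λ e → x-y≡0⇒x≡y (trans (sym (height-⊟ W W' y)) e)))))
      (level-count _ (w ⊟ w') (λ e → w≢w' (⊟≡0⇒≡ e)) 1ᶠ 0ᶠ)

    -- Puts the intersection of two hyperplanes into the form in which `schwartz-zippel` counts: a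
    -- slice through `y₀` with a normal vector.
    coincidence-slice : ∀ W W' y₀ → height W y₀ ≡ height W' y₀ → ∀ y → height W y ≡ height W' y → dot (Vec.tail (W ⊟ W')) (y ⊟ y₀) ≡ 0ᶠ
    coincidence-slice W@(c ∷ w) W'@(c' ∷ w') y₀ e₀ y e = begin
      dot (w ⊟ w') (y ⊟ y₀) ≡⟨ sym (+ᶠ-identityˡ _) ⟩
      0ᶠ +ᶠ dot (w ⊟ w') (y ⊟ y₀) ≡⟨ cong (_+ᶠ dot (w ⊟ w') (y ⊟ y₀)) (sym (vanish (c +ᶠ (-ᶠ 1ᶠ) *ᶠ c'))) ⟩
      dot (W ⊟ W') ((1ᶠ ∷ y) ⊟ (1ᶠ ∷ y₀)) ≡⟨ dot-⊟ (W ⊟ W') (1ᶠ ∷ y) (1ᶠ ∷ y₀) ⟩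
      height (W ⊟ W') y +ᶠ (-ᶠ height (W ⊟ W') y₀) ≡⟨ cong₂ (λ a b → a +ᶠ (-ᶠ b)) (zero-diff y e) (zero-diff y₀ e₀) ⟩
      0ᶠ +ᶠ (-ᶠ 0ᶠ) ≡⟨ +ᶠ-inverseʳ 0ᶠ ⟩
      0ᶠ ∎
      where
      open ≡-Reasoning
      vanish : ∀ k → k *ᶠ (1ᶠ +ᶠ (-ᶠ 1ᶠ) *ᶠ 1ᶠ) ≡ 0ᶠ
      vanish = solve 1 (λ k → k :* (con (1 , 0) :+ (:- con (1 , 0)) :* con (1 , 0)) := con (0 , 0)) refl
      zero-diff : ∀ y → height W y ≡ height W' y → height (W ⊟ W') y ≡ 0ᶠ
      zero-diff y e = trans (height-⊟ W W' y) (x≡y⇒x-y≡0 e)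

  module ConsistencyGraph (n′ d : ℕ) (0<d : 0 < d) where
    n : ℕ
    n = suc (suc n′)

    open HyperplaneCounts n public

    module _ (V : Pt (suc n) → Set) (V? : ∀ W → Dec (V W)) (h : Pt (suc n) → Pt n → 𝔽) (h-poly : ∀ W → V W → IsPoly n d (h W)) where

      Consistent : Pt (suc n) → Pt (suc n) → Set
      Consistent W W' = ∀ y → height W y ≡ height W' y → h W y ≡ h W' y

      E : Pt (suc n) → Pt (suc n) → Set
      E W W' = V W × V W' × Consistent W W'

      consistent? : ∀ W W' → Dec (Consistent W W')
      consistent? W W' = Finite.∀? (finitePt n) (λ y → (height W y ≟ᶠ height W' y) →-dec (h W y ≟ᶠ h W' y))

      E? : ∀ W W' → Dec (E W W')
      E? W W' = V? W ×-dec (V? W' ×-dec consistent? W W')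

      E-sym : ∀ {W W'} → E W W' → E W' W
      E-sym (v , v' , c) = v' , v , λ y e → sym (c y (sym e))

      disagreement : ∀ W W' → V W → V W' → ¬ E W W' → ∃ λ y → height W y ≡ height W' y × ¬ (h W y ≡ h W' y)
      disagreement W W' v v' ¬e with Finite.∃? (finitePt n) (λ y → (height W y ≟ᶠ height W' y) ×-dec ¬? (h W y ≟ᶠ h W' y))
      ... | yes found = found
      ... | no none = contradiction (v , v' , λ y e → agree y e) ¬e
        where
        agree : ∀ y → height W y ≡ height W' y → h W y ≡ h W' y
        agree y e with h W y ≟ᶠ h W' y
        ... | yes p = p
        ... | no np = contradiction (y , e , np) none

      -- W₁ ∩ W₂ contains a line through a point of disagreement; a third hyperplane consistent with both either
      -- contains its direction or meets it in one of at most d points of agreement.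
      defect : ∀ W₁ W₂ → V W₁ → V W₂ → ¬ E W₁ W₂ → ∑ᵖ (suc n) (λ W → I (E? W₁ W) * I (E? W₂ W)) ≤ 2 * (d * N)
      defect W₁@(c₁ ∷ w₁) W₂@(c₂ ∷ w₂) v₁ v₂ ¬e
        with y₀ , heq , h≢ ← disagreement W₁ W₂ v₁ v₂ ¬e
        with r , r≢0 , orth ← orthogonal (w₁ ⊟ w₂) = begin
        ∑ᵖ (suc n) (λ W → I (E? W₁ W) * I (E? W₂ W))
          ≤⟨ ∑-mono (points (suc n)) cover ⟩
        ∑ᵖ (suc n) (λ W → I (gradient W r ≟ᶠ gradient W₁ r) + ∑ᶠ (λ t → z t * I (height W (ℓ t) ≟ᶠ height W₁ (ℓ t))))
          ≡⟨ trans (∑-+ (points (suc n)) _ _) (cong₂ _+_ (gradient-count r r≢0 (gradient W₁ r)) (∑-swap (points (suc n)) elements _)) ⟩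
        N + ∑ᶠ (λ t → ∑ᵖ (suc n) (λ W → z t * I (height W (ℓ t) ≟ᶠ height W₁ (ℓ t))))
          ≡⟨ cong (N +_) (∑-cong elements (λ t → trans (∑-*ˡ (points (suc n)) (z t) _) (cong (z t *_) (height-count (ℓ t) _)))) ⟩
        N + ∑ᶠ (λ t → z t * N)
          ≡⟨ cong (N +_) (∑-*ʳ elements N z) ⟩
        N + ∑ᶠ z * N
          ≤⟨ +-mono-≤ (≤-trans (≤-reflexive (sym (*-identityˡ N))) (*-monoˡ-≤ N 0<d)) (*-monoˡ-≤ N roots) ⟩
        d * N + d * N
          ≡⟨ cong (d * N +_) (sym (+-identityʳ (d * N))) ⟩
        2 * (d * N) ∎
        where
        open ≤-Reasoning
        ℓ : 𝔽 → Pt n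
        ℓ = line y₀ r
        g : Pt n → 𝔽
        g y = h W₁ y +ᶠ (-ᶠ h W₂ y)
        z : 𝔽 → ℕ
        z t = I (g (ℓ t) ≟ᶠ 0ᶠ)
        grad≡ : gradient W₁ r ≡ gradient W₂ r
        grad≡ = x-y≡0⇒x≡y (trans (sym (dot-⊟ˡ W₁ W₂ (0ᶠ ∷ r))) (trans (gradient-tail _ (w₁ ⊟ w₂) r) orth))
        heights : ∀ t → height W₁ (ℓ t) ≡ height W₂ (ℓ t)
        heights t = trans (height-line W₁ y₀ r t) (trans (cong₂ (λ a b → a +ᶠ t *ᶠ b) heq grad≡) (sym (height-line W₂ y₀ r t)))
        roots : ∑ᶠ z ≤ d
        roots = line-root-count g (poly⇒lineDeg (poly-- (h-poly W₁ v₁) (h-poly W₂ v₂))) y₀ r (λ e → h≢ (x-y≡0⇒x≡y e))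
        cover : ∀ W → I (E? W₁ W) * I (E? W₂ W) ≤ I (gradient W r ≟ᶠ gradient W₁ r) + ∑ᶠ (λ t → z t * I (height W (ℓ t) ≟ᶠ height W₁ (ℓ t)))
        cover W = ≤-trans (≤-reflexive (sym (I-× (E? W₁ W) (E? W₂ W)))) (go (E? W₁ W ×-dec E? W₂ W) (gradient W r ≟ᶠ gradient W₁ r))
          where
          go : (p : Dec (E W₁ W × E W₂ W)) (p' : Dec (gradient W r ≡ gradient W₁ r)) →
               I p ≤ I p' + ∑ᶠ (λ t → z t * I (height W (ℓ t) ≟ᶠ height W₁ (ℓ t)))
          go (no _) _ = z≤n
          go (yes _) (yes _) = s≤s z≤n
          go (yes ((_ , _ , con₁) , (_ , _ , con₂))) (no ne) = ≤-trans (≤-reflexive (sym (trans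
              (cong₂ _*_ (I-yes (_ ≟ᶠ 0ᶠ) (x≡y⇒x-y≡0 (trans (con₁ (ℓ t) (sym meet)) (sym (con₂ (ℓ t) (trans (sym (heights t)) (sym meet))))))) (I-yes (_ ≟ᶠ _) meet)) (*-identityʳ 1))))
              (term≤∑ (λ t → z t * I (height W (ℓ t) ≟ᶠ height W₁ (ℓ t))) (FiniteField.elements-complete F t))
            where
            γ = gradient W r +ᶠ (-ᶠ gradient W₁ r)
            γ≢0 : ¬ (γ ≡ 0ᶠ)
            γ≢0 e = ne (x-y≡0⇒x≡y e)
            t = (height W₁ y₀ +ᶠ (-ᶠ height W y₀)) *ᶠ (γ ⁻¹ᶠ)
            meet : height W (ℓ t) ≡ height W₁ (ℓ t)
            meet = trans (height-line W y₀ r t) (trans (solved (height W y₀) (height W₁ y₀) (gradient W r) (gradient W₁ r) t tγ) (sym (height-line W₁ y₀ r t)))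
              where
              tγ : t *ᶠ γ ≡ height W₁ y₀ +ᶠ (-ᶠ height W y₀)
              tγ = *-cancel-inverse _ γ≢0
              solved : ∀ a b g g' t → t *ᶠ (g +ᶠ (-ᶠ g')) ≡ b +ᶠ (-ᶠ a) → a +ᶠ t *ᶠ g ≡ b +ᶠ t *ᶠ g'
              solved a b g g' t e = trans (split a t g g') (trans (cong (λ x → a +ᶠ x +ᶠ t *ᶠ g') e) (join a b (t *ᶠ g')))
                where
                split : ∀ a t g g' → a +ᶠ t *ᶠ g ≡ a +ᶠ t *ᶠ (g +ᶠ (-ᶠ g')) +ᶠ t *ᶠ g'
                split = solve 4 (λ a t g g' → a :+ t :* g := a :+ t :* (g :+ (:- g')) :+ t :* g') refl
                join : ∀ a b x → a +ᶠ (b +ᶠ (-ᶠ a)) +ᶠ x ≡ b +ᶠ x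
                join = solve 3 (λ a b x → a :+ (b :+ (:- a)) :+ x := b :+ x) refl

      common : Pt (suc n) → Pt (suc n) → ℕ
      common W W' = ∑ᵖ n (λ y → I (height W y ≟ᶠ height W' y) * I (h W y ≟ᶠ h W' y))

      private
        2≤q : 2 ≤ q
        2≤q = q>1

      -- The summands belong to the possible positions: equal hyperplanes share up to `N` points,
      -- parallel ones none, consistent ones the `N / q` points of their intersection, and
      -- inconsistent ones at most `2 d N / q²` by Schwartz-Zippel on the intersection.
      common≤ : ∀ W W' → V W → V W' → q * q * common W W' ≤ I (W ≟ᵖ W') * (q * q * N) + (I (E? W W') * (q * N) + 2 * (d * N))
      common≤ W@(c ∷ w) W'@(c' ∷ w') v v' = go (w ≟ᵖ w') (c ≟ᶠ c') (E? W W')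
        where
        open ≤-Reasoning
        go : Dec (w ≡ w') → Dec (c ≡ c') → (e? : Dec (E W W')) → q * q * common W W' ≤ I (W ≟ᵖ W') * (q * q * N) + (I e? * (q * N) + 2 * (d * N))
        go (yes w≡w') (yes c≡c') e? = ≤-trans (*-monoʳ-≤ (q * q) (≤-trans (∑ᵖ-≤const n (λ y → *-mono-≤ (I≤1 (height W y ≟ᶠ height W' y)) (I≤1 (h W y ≟ᶠ h W' y)))) (≤-reflexive (*-identityʳ N))))
          (≤-trans (≤-reflexive (trans (sym (+-identityʳ (q * q * N))) (cong (_* (q * q * N)) (sym (I-yes (W ≟ᵖ W') (cong₂ _∷_ c≡c' w≡w')))))) (m≤m+n _ _))
        go (yes w≡w') (no c≢c') e? = ≤-trans (≤-reflexive (trans (cong (q * q *_) (trans (∑-cong (points n) (λ y → cong (_* I (h W y ≟ᶠ h W' y))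
          (I-no (_ ≟ᶠ _) (λ e → c≢c' (+ᶠ-cancelʳ (dot w y) (trans (sym (height-tail c w y)) (trans e (trans (height-tail c' w' y) (cong (λ u → c' +ᶠ dot u y) (sym w≡w')))))))))) (∑-zero (points n)))) (*-zeroʳ (q * q)))) z≤n
        go (no w≢w') _ (yes _) = begin
          q * q * common W W' ≤⟨ *-monoʳ-≤ (q * q) (∑-mono (points n) (λ y → ≤-trans (*-monoʳ-≤ (I (height W y ≟ᶠ height W' y)) (I≤1 (h W y ≟ᶠ h W' y))) (≤-reflexive (*-identityʳ _)))) ⟩
          q * q * ∑ᵖ n (λ y → I (height W y ≟ᶠ height W' y)) ≡⟨ *-assoc q q _ ⟩
          q * (q * ∑ᵖ n (λ y → I (height W y ≟ᶠ height W' y))) ≡⟨ cong (q *_) (coincidence-count W W' w≢w') ⟩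
          q * N ≡⟨ sym (+-identityʳ (q * N)) ⟩
          1 * (q * N) ≤⟨ m≤m+n _ _ ⟩
          1 * (q * N) + 2 * (d * N) ≤⟨ m≤n+m _ (I (W ≟ᵖ W') * (q * q * N)) ⟩
          I (W ≟ᵖ W') * (q * q * N) + (1 * (q * N) + 2 * (d * N)) ∎
        go (no w≢w') _ (no ¬e) with y₀ , heq , h≢ ← disagreement W W' v v' ¬e = begin
          q * q * common W W' ≤⟨ *-monoʳ-≤ (q * q) (∑-mono (points n) (λ y → *-mono-≤
               (I-mono (height W y ≟ᶠ height W' y) (dot l (y ⊟ y₀) ≟ᶠ 0ᶠ) (coincidence-slice W W' y₀ heq y))
               (I-mono (h W y ≟ᶠ h W' y) (g y ≟ᶠ 0ᶠ) x≡y⇒x-y≡0))) ⟩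
          q * q * Z ≤⟨ +-cancelʳ-≤ (q * q * Z) _ _ twice ⟩
          2 * (d * N) ≤⟨ m≤n+m _ (I (W ≟ᵖ W') * (q * q * N)) ⟩
          I (W ≟ᵖ W') * (q * q * N) + (0 + 2 * (d * N)) ∎
          where
          l = Vec.tail (W ⊟ W')
          g : Pt n → 𝔽
          g y = h W y +ᶠ (-ᶠ h W' y)
          Z = ∑ᵖ n (λ y → I (dot l (y ⊟ y₀) ≟ᶠ 0ᶠ) * I (g y ≟ᶠ 0ᶠ))
          Y = ∑ᵖ n (λ r → I (dot l r ≟ᶠ 0ᶠ))
          qY : q * Y ≡ N
          qY = trans (cong (q *_) (∑-cong (points n) (λ r → I-cong (_ ≟ᶠ 0ᶠ) (dot r l ≟ᶠ 0ᶠ) (trans (dot-comm r l)) (trans (dot-comm l r)))))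
            (hyperplane-count l (λ e → w≢w' (⊟≡0⇒≡ e)) 0ᶠ)
          -- Schwartz-Zippel leaves a `Z` on its right-hand side; doubling the inequality and using
          -- `q ≥ 2` allows it to be cancelled.
          twice : q * q * Z + q * q * Z ≤ 2 * (d * N) + q * q * Z
          twice = begin
            q * q * Z + q * q * Z ≡⟨ e₁ q Z ⟩
            2 * q * (q * Z) ≤⟨ *-monoʳ-≤ (2 * q) (schwartz-zippel {d = d} g (poly⇒lineDeg (poly-- (h-poly W v) (h-poly W' v'))) l y₀ (λ e → h≢ (x-y≡0⇒x≡y e))) ⟩
            2 * q * (Z + d * Y) ≡⟨ e₂ q Z d Y ⟩
            2 * (d * (q * Y)) + 2 * (q * Z) ≤⟨ +-mono-≤ (≤-reflexive (cong (λ x → 2 * (d * x)) qY)) (≤-trans (*-monoˡ-≤ (q * Z) 2≤q) (≤-reflexive (sym (*-assoc q q Z)))) ⟩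
            2 * (d * N) + q * q * Z ∎
            where
            e₁ : ∀ q Z → q * q * Z + q * q * Z ≡ 2 * q * (q * Z)
            e₁ = ringℕ
            e₂ : ∀ q Z d Y → 2 * q * (Z + d * Y) ≡ 2 * (d * (q * Y)) + 2 * (q * Z)
            e₂ = ringℕ

      module _ (f : Pt (suc n) → 𝔽) (H : ℕ)
        (dense : q * N * N ≤ H * ∑ᵖ (suc n) (λ W → I (V? W) * ∑ᵖ n (λ y → I (f (lift W y) ≟ᶠ h W y))))
        (N-large : 4 * (H * H) ≤ N) (q-large : 8 * (d * (H * H)) ≤ q) where
        private
          c : Pt (suc n) → Pt (suc n) → ℕ
          c W (a ∷ y) = I (V? W) * (I (height W y ≟ᶠ a) * I (f (a ∷ y) ≟ᶠ h W y))

          D : Pt (suc n) → ℕ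
          D x = ∑ᵖ (suc n) (λ W → c W x)

          edges = ∑ᵖ (suc n) (λ W → ∑ᵖ (suc n) (λ W' → I (E? W W')))

          ∑D : ∑ᵖ (suc n) D ≡ ∑ᵖ (suc n) (λ W → I (V? W) * ∑ᵖ n (λ y → I (f (lift W y) ≟ᶠ h W y)))
          ∑D = trans (∑-swap (points (suc n)) (points (suc n)) _) (∑-cong (points (suc n)) (λ W →
            trans (∑ᵖ-suc n _) (trans (∑-swap elements (points n) _) (trans (∑-cong (points n) (λ y → trans (∑-*ˡ elements (I (V? W)) _)
              (cong (I (V? W) *_) (trans (∑-cong elements (λ a → cong (_* I (f (a ∷ y) ≟ᶠ h W y)) (I-cong (height W y ≟ᶠ a) (a ≟ᶠ height W y) sym sym)))
                (Finite.∑-δ finite𝔽 (height W y) (λ a → I (f (a ∷ y) ≟ᶠ h W y)))))))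
              (∑-*ˡ (points n) (I (V? W)) _)))))

          pair≤ : ∀ W W' → q * q * ∑ᵖ (suc n) (λ x → c W x * c W' x) ≤ I (W ≟ᵖ W') * (q * q * N) + (I (E? W W') * (q * N) + 2 * (d * N))
          pair≤ W W' = go (V? W) (V? W') refl refl
            where
            open ≤-Reasoning
            bound = I (W ≟ᵖ W') * (q * q * N) + (I (E? W W') * (q * N) + 2 * (d * N))
            vanish : (∀ x → c W x * c W' x ≡ 0) → q * q * ∑ᵖ (suc n) (λ x → c W x * c W' x) ≤ bound
            vanish z = ≤-trans (≤-reflexive (trans (cong (q * q *_) (trans (∑-cong (points (suc n)) z) (∑-zero (points (suc n))))) (*-zeroʳ (q * q)))) z≤n
            go : (v : Dec (V W)) (v' : Dec (V W')) → V? W ≡ v → V? W' ≡ v' → q * q * ∑ᵖ (suc n) (λ x → c W x * c W' x) ≤ bound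
            go (no _) _ e _ = vanish (λ { (a ∷ y) → cong (λ v → I v * (I (height W y ≟ᶠ a) * I (f (a ∷ y) ≟ᶠ h W y)) * c W' (a ∷ y)) e })
            go (yes _) (no _) _ e' = vanish (λ { (a ∷ y) → trans (cong (λ v → c W (a ∷ y) * (I v * (I (height W' y ≟ᶠ a) * I (f (a ∷ y) ≟ᶠ h W' y)))) e') (*-zeroʳ (c W (a ∷ y))) })
            go (yes v) (yes v') _ _ = ≤-trans (*-monoʳ-≤ (q * q) small) (common≤ W W' v v')
              where
              small : ∑ᵖ (suc n) (λ x → c W x * c W' x) ≤ common W W'
              small = begin
                ∑ᵖ (suc n) (λ x → c W x * c W' x) ≡⟨ trans (∑ᵖ-suc n _) (∑-swap elements (points n) _) ⟩
                ∑ᵖ n (λ y → ∑ᶠ (λ a → c W (a ∷ y) * c W' (a ∷ y))) ≤⟨ ∑-mono (points n) (λ y → ∑-mono elements (λ a → pointwise y a)) ⟩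
                ∑ᵖ n (λ y → ∑ᶠ (λ a → I (a ≟ᶠ height W y) * (I (height W y ≟ᶠ height W' y) * I (h W y ≟ᶠ h W' y)))) ≡⟨ ∑-cong (points n) (λ y → Finite.∑-δ finite𝔽 (height W y) (λ _ → I (height W y ≟ᶠ height W' y) * I (h W y ≟ᶠ h W' y))) ⟩
                common W W' ∎
                where
                pointwise : ∀ y a → c W (a ∷ y) * c W' (a ∷ y) ≤ I (a ≟ᶠ height W y) * (I (height W y ≟ᶠ height W' y) * I (h W y ≟ᶠ h W' y))
                pointwise y a = begin
                  c W (a ∷ y) * c W' (a ∷ y) ≤⟨ *-mono-≤ (I*-≤ (V? W) _) (I*-≤ (V? W') _) ⟩
                  I (height W y ≟ᶠ a) * I (f (a ∷ y) ≟ᶠ h W y) * (I (height W' y ≟ᶠ a) * I (f (a ∷ y) ≟ᶠ h W' y))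
                    ≡⟨ trans (cong₂ _*_ (sym (I-× (height W y ≟ᶠ a) (f (a ∷ y) ≟ᶠ h W y))) (sym (I-× (height W' y ≟ᶠ a) (f (a ∷ y) ≟ᶠ h W' y))))
                         (sym (I-× ((height W y ≟ᶠ a) ×-dec (f (a ∷ y) ≟ᶠ h W y)) ((height W' y ≟ᶠ a) ×-dec (f (a ∷ y) ≟ᶠ h W' y)))) ⟩
                  I (((height W y ≟ᶠ a) ×-dec (f (a ∷ y) ≟ᶠ h W y)) ×-dec ((height W' y ≟ᶠ a) ×-dec (f (a ∷ y) ≟ᶠ h W' y)))
                    ≤⟨ I-mono (((height W y ≟ᶠ a) ×-dec (f (a ∷ y) ≟ᶠ h W y)) ×-dec ((height W' y ≟ᶠ a) ×-dec (f (a ∷ y) ≟ᶠ h W' y)))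
                         ((a ≟ᶠ height W y) ×-dec ((height W y ≟ᶠ height W' y) ×-dec (h W y ≟ᶠ h W' y)))
                         (λ ((e , g) , (e' , g')) → sym e , trans e (sym e') , trans (sym g) g') ⟩
                  I ((a ≟ᶠ height W y) ×-dec ((height W y ≟ᶠ height W' y) ×-dec (h W y ≟ᶠ h W' y)))
                    ≡⟨ trans (I-× (a ≟ᶠ height W y) _) (cong (I (a ≟ᶠ height W y) *_) (I-× (height W y ≟ᶠ height W' y) (h W y ≟ᶠ h W' y))) ⟩
                  I (a ≟ᶠ height W y) * (I (height W y ≟ᶠ height W' y) * I (h W y ≟ᶠ h W' y)) ∎

          ∑D² : q * q * ∑ᵖ (suc n) (λ x → D x * D x) ≤ q * N * (q * q * N) + (edges * (q * N) + q * N * (q * N * (2 * (d * N))))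
          ∑D² = begin
            q * q * ∑ᵖ (suc n) (λ x → D x * D x)
              ≡⟨ cong (q * q *_) (trans (∑-cong (points (suc n)) (λ x → ∑-*-∑ (points (suc n)) (points (suc n)) _ _))
                   (trans (∑-swap (points (suc n)) (points (suc n)) _) (∑-cong (points (suc n)) (λ W → ∑-swap (points (suc n)) (points (suc n)) _)))) ⟩
            q * q * ∑ᵖ (suc n) (λ W → ∑ᵖ (suc n) (λ W' → ∑ᵖ (suc n) (λ x → c W x * c W' x)))
              ≡⟨ trans (sym (∑-*ˡ (points (suc n)) (q * q) _)) (∑-cong (points (suc n)) (λ W → sym (∑-*ˡ (points (suc n)) (q * q) _))) ⟩
            ∑ᵖ (suc n) (λ W → ∑ᵖ (suc n) (λ W' → q * q * ∑ᵖ (suc n) (λ x → c W x * c W' x)))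
              ≤⟨ ∑-mono (points (suc n)) (λ W → ∑-mono (points (suc n)) (λ W' → pair≤ W W')) ⟩
            ∑ᵖ (suc n) (λ W → ∑ᵖ (suc n) (λ W' → I (W ≟ᵖ W') * (q * q * N) + (I (E? W W') * (q * N) + 2 * (d * N))))
              ≡⟨ ∑-cong (points (suc n)) (λ W → trans (∑-+ (points (suc n)) _ _) (cong₂ _+_
                   (trans (∑-cong (points (suc n)) (λ W' → cong (_* (q * q * N)) (I-cong (W ≟ᵖ W') (W' ≟ᵖ W) sym sym))) (Finite.∑-δ (finitePt (suc n)) W (λ _ → q * q * N)))
                   (trans (∑-+ (points (suc n)) _ _) (cong₂ _+_ (∑-*ʳ (points (suc n)) (q * N) _) (∑ᵖ-const (suc n) _))))) ⟩
            ∑ᵖ (suc n) (λ W → q * q * N + (∑ᵖ (suc n) (λ W' → I (E? W W')) * (q * N) + q * N * (2 * (d * N))))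
              ≡⟨ trans (∑-+ (points (suc n)) _ _) (cong₂ _+_ (∑ᵖ-const (suc n) _)
                   (trans (∑-+ (points (suc n)) _ _) (cong₂ _+_ (∑-*ʳ (points (suc n)) (q * N) _) (∑ᵖ-const (suc n) _)))) ⟩
            q * N * (q * q * N) + (edges * (q * N) + q * N * (q * N * (2 * (d * N)))) ∎
            where open ≤-Reasoning

        -- `D x` counts the hyperplanes through `x` whose polynomial takes the value `f x` there.
        -- Cauchy-Schwarz makes its second moment large, and this moment counts points at which
        -- pairs of hyperplane polynomials agree with `f`. By `common≤` so many points require many
        -- consistent pairs: `N-large` pays for the diagonal and `q-large` for the inconsistent
        -- pairs.
        many-edges : q * N * (q * N) ≤ 2 * (H * H) * edges
        many-edges = +-cancelʳ-≤ (q * N * (q * N)) _ _ (*-cancelˡ-≤ (q * N * (q * N)) {{ℕ.>-nonZero (*-mono-≤ qN>0 qN>0)}} (begin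
          q * N * (q * N) * (q * N * (q * N) + q * N * (q * N))
            ≡⟨ e₁ q N ⟩
          2 * (q * q) * (q * N * N * (q * N * N))
            ≤⟨ *-monoʳ-≤ (2 * (q * q)) (*-mono-≤ dense dense) ⟩
          2 * (q * q) * (H * A * (H * A))
            ≡⟨ e₂ q H A ⟩
          2 * (H * H) * (q * q * (A * A))
            ≤⟨ *-monoʳ-≤ (2 * (H * H)) (*-monoʳ-≤ (q * q) (subst₂ _≤_ (cong₂ _*_ ∑D ∑D) (cong (_* ∑ᵖ (suc n) (λ x → D x * D x)) (length-points (suc n))) (cauchy-schwarz (points (suc n)) D))) ⟩
          2 * (H * H) * (q * q * (q * N * ∑ᵖ (suc n) (λ x → D x * D x)))
            ≡⟨ e₃ q N (H * H) _ ⟩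
          2 * (H * H) * (q * N) * (q * q * ∑ᵖ (suc n) (λ x → D x * D x))
            ≤⟨ *-monoʳ-≤ (2 * (H * H) * (q * N)) ∑D² ⟩
          2 * (H * H) * (q * N) * (q * N * (q * q * N) + (edges * (q * N) + q * N * (q * N * (2 * (d * N)))))
            ≡⟨ e₄ q N (H * H) edges d ⟩
          q * N * (q * N) * (2 * (H * H) * edges) + (q * N * (q * N) * (q * q * N) * (2 * (H * H)) + q * N * (q * N) * (q * N * N) * (4 * (d * (H * H))))
            ≤⟨ +-monoʳ-≤ (q * N * (q * N) * (2 * (H * H) * edges)) errors ⟩
          q * N * (q * N) * (2 * (H * H) * edges) + q * N * (q * N) * (q * N * (q * N))
            ≡⟨ sym (*-distribˡ-+ (q * N * (q * N)) _ _) ⟩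
          q * N * (q * N) * (2 * (H * H) * edges + q * N * (q * N)) ∎))
          where
          open ≤-Reasoning
          A = ∑ᵖ (suc n) (λ W → I (V? W) * ∑ᵖ n (λ y → I (f (lift W y) ≟ᶠ h W y)))
          rest = q * N * (q * N) * (q * q * N) * (2 * (H * H)) + q * N * (q * N) * (q * N * N) * (4 * (d * (H * H)))
          N>0 : 0 < N
          N>0 = ℕ.>-nonZero⁻¹ N {{m^n≢0 q n {{ℕ.>-nonZero q>0}}}}
          qN>0 : 0 < q * N
          qN>0 = *-mono-≤ q>0 N>0
          errors : rest ≤ q * N * (q * N) * (q * N * (q * N))
          errors = *-cancelˡ-≤ 2 (begin
            2 * rest
              ≡⟨ f₁ (q * N * (q * N)) (q * q * N) (q * N * N) (H * H) d ⟩
            q * N * (q * N) * (q * q * N) * (4 * (H * H)) + q * N * (q * N) * (q * N * N) * (8 * (d * (H * H)))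
              ≤⟨ +-mono-≤ (*-monoʳ-≤ (q * N * (q * N) * (q * q * N)) N-large) (*-monoʳ-≤ (q * N * (q * N) * (q * N * N)) q-large) ⟩
            q * N * (q * N) * (q * q * N) * N + q * N * (q * N) * (q * N * N) * q
              ≡⟨ f₂ q N ⟩
            2 * (q * N * (q * N) * (q * N * (q * N))) ∎)
            where
            f₁ : ∀ P x y HH d → 2 * (P * x * (2 * HH) + P * y * (4 * (d * HH))) ≡ P * x * (4 * HH) + P * y * (8 * (d * HH))
            f₁ = ringℕ
            f₂ : ∀ q N → q * N * (q * N) * (q * q * N) * N + q * N * (q * N) * (q * N * N) * q ≡ 2 * (q * N * (q * N) * (q * N * (q * N)))
            f₂ = ringℕ
          e₁ : ∀ q N → q * N * (q * N) * (q * N * (q * N) + q * N * (q * N)) ≡ 2 * (q * q) * (q * N * N * (q * N * N))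
          e₁ = ringℕ
          e₂ : ∀ q H A → 2 * (q * q) * (H * A * (H * A)) ≡ 2 * (H * H) * (q * q * (A * A))
          e₂ = ringℕ
          e₃ : ∀ q N HH S → 2 * HH * (q * q * (q * N * S)) ≡ 2 * HH * (q * N) * (q * q * S)
          e₃ = ringℕ
          e₄ : ∀ q N HH E d → 2 * HH * (q * N) * (q * N * (q * q * N) + (E * (q * N) + q * N * (q * N * (2 * (d * N)))))
               ≡ q * N * (q * N) * (2 * HH * E) + (q * N * (q * N) * (q * q * N) * (2 * HH) + q * N * (q * N) * (q * N * N) * (4 * (d * HH)))
          e₄ = ringℕ

-- Gluing the polynomials of a clique.

module Gluing (F : FiniteField) where
  open import Data.Nat using (_+_; _*_; _^_; _≤_; _<_)
  open import Data.Nat.Properties hiding (_≟_)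
  open FiniteSums
  open FieldAlgebra F
  open Series F
  open Polynomials F
  open Sampling F
  open Consistency F

  -- Newton interpolation by divided differences. The nodes are constants and the values enter
  -- linearly, so values and argument may themselves be polynomials in a point.
  interp : List 𝔽 → (𝔽 → 𝔽) → 𝔽 → 𝔽
  interp [] val s = 0ᶠ
  interp (c ∷ cs) val s = val c +ᶠ (s +ᶠ (-ᶠ c)) *ᶠ interp cs (λ c' → (val c' +ᶠ (-ᶠ val c)) *ᶠ ((c' +ᶠ (-ᶠ c)) ⁻¹ᶠ)) s

  interp-correct : ∀ (cs : List 𝔽) → Unique cs → (a : Ser) (val : 𝔽 → 𝔽) → (∀ {c} → c ∈ cs → val c ≡ ev (length cs) a c) →
                   ∀ s → interp cs val s ≡ ev (length cs) a s
  interp-correct [] u a val e s = refl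
  interp-correct (c ∷ cs) (c≢ ∷ u) a val e s = trans
    (cong₂ (λ x y → x +ᶠ (s +ᶠ (-ᶠ c)) *ᶠ y) (e (here refl)) (interp-correct cs u (quo (length cs) a c) _ divided s))
    (sym (ev-quo (length cs) a c s))
    where
    divided : ∀ {c'} → c' ∈ cs → (val c' +ᶠ (-ᶠ val c)) *ᶠ ((c' +ᶠ (-ᶠ c)) ⁻¹ᶠ) ≡ ev (length cs) (quo (length cs) a c) c'
    divided {c'} m = trans (cong (_*ᶠ ((c' +ᶠ (-ᶠ c)) ⁻¹ᶠ)) (trans
        (cong₂ (λ x y → x +ᶠ (-ᶠ y)) (trans (e (there m)) (ev-quo (length cs) a c c')) (e (here refl)))
        (cancel (ev (suc (length cs)) a c) (c' +ᶠ (-ᶠ c)) (ev (length cs) (quo (length cs) a c) c'))))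
      (*-cancel-inverse′ _ (λ z → All.lookup c≢ m (sym (x-y≡0⇒x≡y z))))
      where
      cancel : ∀ x y z → x +ᶠ y *ᶠ z +ᶠ (-ᶠ x) ≡ z *ᶠ y
      cancel = solve 3 (λ x y z → x :+ y :* z :+ (:- x) := z :* y) refl

  -- Each node adds at most the degree of one factor `s - c` to the degree of the values.
  interp-poly : ∀ {m D} (cs : List 𝔽) (val : 𝔽 → Pt m → 𝔽) (s : Pt m → 𝔽) → (∀ {c} → c ∈ cs → IsPoly m D (val c)) → IsPoly m 1 s →
                IsPoly m (length cs + D) (λ x → interp cs (λ c → val c x) (s x))
  interp-poly [] val s ps p = poly-const 0ᶠ
  interp-poly {D = D} (c ∷ cs) val s ps p = poly-+ (poly-weaken (m≤n⇒m≤1+n (m≤n+m D (length cs))) (ps (here refl)))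
    (poly-* (poly-- p (poly-const c)) (interp-poly cs (λ c' x → (val c' x +ᶠ (-ᶠ val c x)) *ᶠ ((c' +ᶠ (-ᶠ c)) ⁻¹ᶠ)) s
      (λ {c'} m → poly-cong (λ x → *ᶠ-comm _ _) (poly-scale ((c' +ᶠ (-ᶠ c)) ⁻¹ᶠ) (poly-- (ps (there m)) (ps (here refl))))) p))

  at : ∀ {k n} → Vec (Pt k → 𝔽) n → Pt k → Pt n
  at fs x = Vec.map (λ f → f x) fs

  poly-dot : ∀ {k n} (w : Pt n) (fs : Vec (Pt k → 𝔽) n) → VAll.All (IsPoly k 1) fs → IsPoly k 1 (λ x → dot w (at fs x))
  poly-dot [] [] VAll.[] = poly-const 0ᶠ
  poly-dot (c ∷ w) (f ∷ fs) (p VAll.∷ ps) = poly-+ (poly-scale c p) (poly-dot w fs ps)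

  coordinates : (n : ℕ) → Vec (Pt n → 𝔽) n
  coordinates n = tabulate (λ i x → lookup x i)

  tail-coordinates : (n : ℕ) → Vec (Pt (suc n) → 𝔽) n
  tail-coordinates n = tabulate (λ i x → lookup x (suc i))

  at-coordinates : ∀ {n} (x : Pt n) → at (coordinates n) x ≡ x
  at-coordinates x = trans (sym (Vecₚ.tabulate-∘ (λ f → f x) (λ i x → lookup x i))) (Vecₚ.tabulate∘lookup x)

  at-tail-coordinates : ∀ {n} a (y : Pt n) → at (tail-coordinates n) (a ∷ y) ≡ y
  at-tail-coordinates a y = trans (sym (Vecₚ.tabulate-∘ (λ f → f (a ∷ y)) (λ i x → lookup x (suc i)))) (Vecₚ.tabulate∘lookup y)

  poly-coordinates : ∀ n → VAll.All (IsPoly n 1) (coordinates n)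
  poly-coordinates n = VAllₚ.tabulate⁺ poly-var

  poly-tail-coordinates : ∀ n → VAll.All (IsPoly (suc n) 1) (tail-coordinates n)
  poly-tail-coordinates n = VAllₚ.tabulate⁺ (λ i → poly-var (suc i))

  poly-∘-line : ∀ {k n d} {g : Pt n → 𝔽} → IsPoly n d g → (fs : Vec (Pt k → 𝔽) n) → VAll.All (IsPoly k 1) fs → (v : Pt n) (τ : Pt k → 𝔽) → IsPoly k 1 τ →
                IsPoly k d (λ x → g (line (at fs x) v (τ x)))
  poly-∘-line {k} {g = g} p fs ps v τ pτ = poly-cong (λ x → cong g (moved-at fs v x)) (poly-∘ p (moved fs v) (moved-poly fs ps v))
    where
    moved : ∀ {n} → Vec (Pt k → 𝔽) n → Pt n → Vec (Pt k → 𝔽) n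
    moved = Vec.zipWith (λ f c x → f x +ᶠ τ x *ᶠ c)
    moved-at : ∀ {n} (fs : Vec (Pt k → 𝔽) n) (v : Pt n) x → at (moved fs v) x ≡ line (at fs x) v (τ x)
    moved-at [] [] x = refl
    moved-at (f ∷ fs) (c ∷ v) x = cong (f x +ᶠ τ x *ᶠ c ∷_) (moved-at fs v x)
    moved-poly : ∀ {n} (fs : Vec (Pt k → 𝔽) n) → VAll.All (IsPoly k 1) fs → (v : Pt n) → VAll.All (IsPoly k 1) (moved fs v)
    moved-poly [] VAll.[] [] = VAll.[]
    moved-poly (f ∷ fs) (p VAll.∷ ps) (c ∷ v) = poly-+ p (poly-cong (λ x → *ᶠ-comm c (τ x)) (poly-scale c pτ)) VAll.∷ moved-poly fs ps v

  non-orthogonal : ∀ {n} (l : Pt n) → ¬ (l ≡ 0ᵥ) → ∃ λ v → ¬ (dot l v ≡ 0ᶠ)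
  non-orthogonal [] l≢0 = contradiction refl l≢0
  non-orthogonal (a ∷ l) l≢0 with a ≟ᶠ 0ᶠ
  ... | no a≢0 = 1ᶠ ∷ 0ᵥ , λ e → a≢0 (trans (sym (trans (cong₂ _+ᶠ_ (*ᶠ-identityʳ a) (dot-zeroʳ l)) (+ᶠ-identityʳ a))) e)
  ... | yes refl with v , nz ← non-orthogonal l (λ e → l≢0 (cong (0ᶠ ∷_) e)) =
    0ᶠ ∷ v , λ e → nz (trans (sym (trans (cong (_+ᶠ dot l v) (*ᶠ-zeroˡ 0ᶠ)) (+ᶠ-identityˡ _))) e)

  -- A series obtained from `LineDeg` is only controlled in its first `suc d` coefficients. Cutting
  -- off the others gives the zeros in higher degree that a comparison of leading coefficients
  -- needs.
  truncate : ℕ → Ser → Ser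
  truncate d a i with i ℕ.≤? d
  ... | yes _ = a i
  ... | no _ = 0ᶠ

  truncate-deg : ∀ d a → Deg d (truncate d a)
  truncate-deg d a i d<i with i ℕ.≤? d
  ... | yes i≤d = contradiction i≤d (<⇒≱ d<i)
  ... | no _ = refl

  ev-truncate : ∀ d a t → ev (suc d) (truncate d a) t ≡ ev (suc d) a t
  ev-truncate d a t = ev-cong (suc d) t λ { i (s≤s i≤d) → same i i≤d }
    where
    same : ∀ i → i ≤ d → truncate d a i ≡ a i
    same i i≤d with i ℕ.≤? d
    ... | yes _ = refl
    ... | no ¬p = contradiction i≤d ¬p

  module Glue (n′ d : ℕ) (0<d : 0 < d) where
    open ConsistencyGraph n′ d 0<d using (n)
    open HyperplaneCounts n

    module _ (h : Pt (suc n) → Pt n → 𝔽) (C : Pt (suc n) → Set) (C? : ∀ W → Dec (C W)) (h-poly : ∀ W → C W → IsPoly n d (h W))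
      (consistent : ∀ W W' → C W → C W' → ∀ y → height W y ≡ height W' y → h W y ≡ h W' y)
      (B : ℕ) (size : q * N ≤ B * ∑ᵖ (suc n) (λ W → I (C? W))) (q-large : 16 * (B * d) ≤ q) where

      private
        N>0 : 0 < N
        N>0 = ℕ.>-nonZero⁻¹ N {{m^n≢0 q n {{ℕ.>-nonZero q>0}}}}

        instance
          N≢0 : NonZero N
          N≢0 = ℕ.>-nonZero N>0
          q≢0 : NonZero q
          q≢0 = ℕ.>-nonZero q>0

        B>0 : 0 < B
        B>0 = n≢0⇒n>0 λ z → <⇒≱ (*-mono-≤ q>0 N>0) (≤-trans size (≤-reflexive (cong (_* ∑ᵖ (suc n) (λ W → I (C? W))) z)))

        Bd>0 : 0 < B * d
        Bd>0 = *-mono-≤ B>0 0<d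

        -- The common end of the contradictions below: a share 1/B of `q` objects is bounded by a
        -- small multiple of `d`, which `q-large` excludes.
        too-small : ∀ k → k ≤ 15 * d → ¬ (q ≤ B * k)
        too-small k k≤ le = <⇒≱ (≤-trans (*-monoˡ-< (B * d) {{ℕ.>-nonZero Bd>0}} {15} {16} ≤-refl) q-large) (≤-trans le (≤-trans (*-monoʳ-≤ B k≤) (≤-reflexive (e B d))))
          where
          e : ∀ B d → B * (15 * d) ≡ 15 * (B * d)
          e = ringℕ

        d-bound : ∀ a b → a + b ≤ 15 → a * d + b ≤ 15 * d
        d-bound a b le = ≤-trans (+-monoʳ-≤ (a * d) (≤-trans (≤-reflexive (sym (*-identityʳ b))) (*-monoʳ-≤ b 0<d))) (≤-trans (≤-reflexive (sym (*-distribʳ-+ d a b))) (*-monoˡ-≤ d le))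

        -- Averaging over slopes: among the `q` parallel translates of some slope, a share 1/B
        -- belongs to the clique.
        pencil : ∃ λ w₀ → q ≤ B * ∑ᶠ (λ c → I (C? (c ∷ w₀)))
        pencil with w₀ , _ , le ← ∑-≤⇒∃ (points n) {λ _ → q} {λ w → B * ∑ᶠ (λ c → I (C? (c ∷ w)))} (subst (0 <_) (sym (length-points n)) N>0)
          (subst₂ _≤_ (trans (*-comm q N) (sym (∑ᵖ-const n q))) (trans (cong (B *_) (trans (∑ᵖ-suc n _) (∑-swap elements (points n) _))) (sym (∑-*ˡ (points n) B _))) size) = w₀ , le

        v : Pt n
        v = 1ᶠ ∷ 0ᵥ

        v≢0 : ¬ (v ≡ 0ᵥ)
        v≢0 e = 1ᶠ≢0ᶠ (cong Vec.head e)

      private module FromPencil (w₀ : Pt n) (wide : q ≤ B * ∑ᶠ (λ c → I (C? (c ∷ w₀)))) where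
        b₀ = dot w₀ v

        Through : 𝔽 → Pt (suc n) → Set
        Through b W = C W × gradient W v ≡ b

        through? : ∀ b W → Dec (Through b W)
        through? b W = C? W ×-dec (gradient W v ≟ᶠ b)

        through# : 𝔽 → ℕ
        through# b = ∑ᵖ (suc n) (λ W → I (through? b W))

        -- Averaging over the slope along `v`. The slope `b₀` of the pencil is handicapped by
        -- `2 B N`, which is all that its hyperplanes could contribute, so the slope found is
        -- another one and its hyperplanes cross the pencil.
        direction : ∃ λ b → ¬ (b ≡ b₀) × N < 2 * B * through# b
        direction = result (∑-<⇒∃ elements {g₁} {g₂} totals)
          where
          g₁ g₂ : 𝔽 → ℕ
          g₁ b = N + I (b ≟ᶠ b₀) * (2 * B * N)
          g₂ b = 2 * B * through# b
          open ≤-Reasoning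
          totals : ∑ᶠ g₁ < ∑ᶠ g₂
          totals = begin-strict
            ∑ᶠ g₁ ≡⟨ trans (∑-+ elements _ _) (cong₂ _+_ (∑-const elements N) (Finite.∑-δ finite𝔽 b₀ (λ _ → 2 * B * N))) ⟩
            q * N + 2 * B * N <⟨ +-monoʳ-< (q * N) (*-monoˡ-< N (≤-trans (s≤s (≤-trans (*-monoʳ-≤ 2 (≤-trans (≤-reflexive (sym (*-identityʳ B))) (*-monoʳ-≤ B 0<d))) (*-monoˡ-≤ (B * d) {2} {15} (s≤s (s≤s z≤n))))) (≤-trans (*-monoˡ-< (B * d) {{ℕ.>-nonZero Bd>0}} {15} {16} ≤-refl) q-large))) ⟩
            q * N + q * N ≡⟨ cong (q * N +_) (sym (+-identityʳ (q * N))) ⟩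
            2 * (q * N) ≤⟨ *-monoʳ-≤ 2 size ⟩
            2 * (B * ∑ᵖ (suc n) (λ W → I (C? W))) ≡⟨ sym (*-assoc 2 B _) ⟩
            2 * B * ∑ᵖ (suc n) (λ W → I (C? W)) ≡⟨ cong (2 * B *_) (sym partition) ⟩
            2 * B * ∑ᶠ through# ≡⟨ sym (∑-*ˡ elements (2 * B) through#) ⟩
            ∑ᶠ g₂ ∎
            where
            partition : ∑ᶠ through# ≡ ∑ᵖ (suc n) (λ W → I (C? W))
            partition = trans (∑-swap elements (points (suc n)) _) (∑-cong (points (suc n)) (λ W → trans
              (∑-cong elements (λ b → trans (I-× (C? W) (gradient W v ≟ᶠ b)) (trans (*-comm (I (C? W)) _) (cong (_* I (C? W)) (I-cong (gradient W v ≟ᶠ b) (b ≟ᶠ gradient W v) sym sym)))))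
              (Finite.∑-δ finite𝔽 (gradient W v) (λ _ → I (C? W)))))
          result : (∃ λ b → b ∈ elements × g₁ b < g₂ b) → ∃ λ b → ¬ (b ≡ b₀) × N < 2 * B * through# b
          result (b , _ , lt) with b ≟ᶠ b₀
          ... | no b≢ = b , b≢ , subst (_< g₂ b) (+-identityʳ N) lt
          ... | yes refl = contradiction (≤-trans (*-monoʳ-≤ (2 * B) (≤-trans (∑-mono (points (suc n)) (λ W → I-mono (through? b W) (gradient W v ≟ᶠ b) proj₂))
                (≤-reflexive (gradient-count v v≢0 b)))) (≤-trans (≤-reflexive (sym (+-identityʳ _))) (m≤n+m _ N))) (<⇒≱ lt)

        module FromDirection (b : 𝔽) (b≢b₀ : ¬ (b ≡ b₀)) (dense : N < 2 * B * through# b) where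
          β = b +ᶠ (-ᶠ b₀)

          β≢0 : ¬ (β ≡ 0ᶠ)
          β≢0 e = b≢b₀ (x-y≡0⇒x≡y e)

          heights nodes : List 𝔽
          heights = filter (λ c → C? (c ∷ w₀)) elements
          nodes = take (suc d) heights

          length-heights : length heights ≡ ∑ᶠ (λ c → I (C? (c ∷ w₀)))
          length-heights = length-filter≡∑ (λ c → C? (c ∷ w₀)) elements

          length-nodes : length nodes ≡ suc d
          length-nodes = trans (length-take (suc d) heights) (m≤n⇒m⊓n≡m (≮⇒≥ λ lt →
            too-small d (m≤m+n d _) (≤-trans wide (*-monoʳ-≤ B (≤-trans (≤-reflexive (sym length-heights)) (ℕ.s≤s⁻¹ lt))))))

          nodes-unique : Unique nodes
          nodes-unique = Unique.take⁺ (suc d) (Unique.filter⁺ (λ c → C? (c ∷ w₀)) (FiniteField.elements-unique F))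

          nodes-C : All (λ c → C (c ∷ w₀)) nodes
          nodes-C = Allₚ.take⁺ (suc d) (Allₚ.all-filter (λ c → C? (c ∷ w₀)) elements)

          -- The level of `x` in the pencil: `x` lies on the hyperplane `s x ∷ w₀`.
          s : Pt (suc n) → 𝔽
          s x = Vec.head x +ᶠ (-ᶠ dot w₀ (Vec.tail x))

          -- Moving from `x` in direction `b ∷ v` changes the level at rate `β`, so level `c` is
          -- reached at time `(c - s x) / β`. Hyperplanes of slope `b` along `v` contain this
          -- direction.
          slide : Pt (suc n) → 𝔽 → Pt n
          slide x c = line (Vec.tail x) v ((c +ᶠ (-ᶠ s x)) *ᶠ (β ⁻¹ᶠ))

          -- Interpolation, in the level, of the values found where the line through `x` in
          -- direction `b ∷ v` meets `suc d` members of the pencil.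
          R : Pt (suc n) → 𝔽
          R x = interp nodes (λ c → h (c ∷ w₀) (slide x c)) (s x)

          s-poly : IsPoly (suc n) 1 s
          s-poly = poly-cong (λ { (a ∷ y) → cong (λ z → a +ᶠ (-ᶠ dot w₀ z)) (at-tail-coordinates a y) })
            (poly-- (poly-var zero) (poly-dot w₀ (tail-coordinates n) (poly-tail-coordinates n)))

          R-poly : IsPoly (suc n) (suc d + d) R
          R-poly = subst (λ k → IsPoly (suc n) (k + d) R) length-nodes (interp-poly nodes (λ c x → h (c ∷ w₀) (slide x c)) s
            (λ {c} m → poly-cong (λ { (a ∷ y) → cong (λ z → h (c ∷ w₀) (line z v ((c +ᶠ (-ᶠ s (a ∷ y))) *ᶠ (β ⁻¹ᶠ)))) (at-tail-coordinates a y) })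
              (poly-∘-line (h-poly (c ∷ w₀) (All.lookup nodes-C m)) (tail-coordinates n) (poly-tail-coordinates n) v _
                (poly-cong (λ x → *ᶠ-comm (β ⁻¹ᶠ) _) (poly-scale (β ⁻¹ᶠ) (poly-- (poly-const c) s-poly))))) s-poly)

          -- The line of interpolation stays inside `W`. There `h W` has degree at most `d` and, by
          -- consistency, takes the prescribed values at the `suc d` nodes, so interpolation
          -- reproduces it.
          R-on-through : ∀ W → Through b W → ∀ y → R (lift W y) ≡ h W y
          R-on-through W (CW , grad) y = trans (interp-correct nodes nodes-unique a _ values (s x))
            (trans (cong (λ k → ev k a (s x)) length-nodes) (trans (sym (proj₂ along (s x))) (cong (h W) (trans (reparam (s x)) at-rest))))
            where
            x = lift W y
            base = line y v (-ᶠ (s x *ᶠ (β ⁻¹ᶠ)))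
            dir = (β ⁻¹ᶠ) ⊙ v
            along = poly⇒lineDeg (h-poly W CW) base dir
            a = proj₁ along
            reparam-vec : ∀ {m} (y v : Pt m) s i c → line (line y v (-ᶠ (s *ᶠ i))) (i ⊙ v) c ≡ line y v ((c +ᶠ (-ᶠ s)) *ᶠ i)
            reparam-vec [] [] s i c = refl
            reparam-vec (y ∷ ys) (v ∷ vs) s i c = cong₂ _∷_ (step y v s i c) (reparam-vec ys vs s i c)
              where
              step : ∀ y v s i c → y +ᶠ (-ᶠ (s *ᶠ i)) *ᶠ v +ᶠ c *ᶠ (0ᶠ +ᶠ i *ᶠ v) ≡ y +ᶠ (c +ᶠ (-ᶠ s)) *ᶠ i *ᶠ v
              step = solve 5 (λ y v s i c → y :+ (:- (s :* i)) :* v :+ c :* (con (0 , 0) :+ i :* v) := y :+ (c :+ (:- s)) :* i :* v) refl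
            reparam : ∀ c → line base dir c ≡ slide x c
            reparam c = reparam-vec y v (s x) (β ⁻¹ᶠ) c
            at-rest : slide x (s x) ≡ y
            at-rest = trans (cong (line y v) (trans (cong (_*ᶠ (β ⁻¹ᶠ)) (+ᶠ-inverseʳ (s x))) (*ᶠ-zeroˡ _))) (line-0 y v)
            meets : ∀ c → height W (slide x c) ≡ height (c ∷ w₀) (slide x c)
            meets c = trans (height-line W y v t) (trans (cong (λ g → height W y +ᶠ t *ᶠ g) grad)
              (trans (solved (height W y) (dot w₀ y) c t b b₀ (*-cancel-inverse _ β≢0)) (sym (trans (height-tail c w₀ (slide x c)) (cong (c +ᶠ_) (dot-line w₀ y v t))))))
              where
              t = (c +ᶠ (-ᶠ s x)) *ᶠ (β ⁻¹ᶠ)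
              solved : ∀ H D c t b b₀ → t *ᶠ (b +ᶠ (-ᶠ b₀)) ≡ c +ᶠ (-ᶠ (H +ᶠ (-ᶠ D))) → H +ᶠ t *ᶠ b ≡ c +ᶠ (D +ᶠ t *ᶠ b₀)
              solved H D c t b b₀ e = trans (split H t b b₀) (trans (cong (λ z → H +ᶠ z +ᶠ t *ᶠ b₀) e) (join H D c (t *ᶠ b₀)))
                where
                split : ∀ H t b c → H +ᶠ t *ᶠ b ≡ H +ᶠ t *ᶠ (b +ᶠ (-ᶠ c)) +ᶠ t *ᶠ c
                split = solve 4 (λ H t b c → H :+ t :* b := H :+ t :* (b :+ (:- c)) :+ t :* c) refl
                join : ∀ H D c x → H +ᶠ (c +ᶠ (-ᶠ (H +ᶠ (-ᶠ D)))) +ᶠ x ≡ c +ᶠ (D +ᶠ x)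
                join = solve 4 (λ H D c x → H :+ (c :+ (:- (H :+ (:- D)))) :+ x := c :+ (D :+ x)) refl
            values : ∀ {c} → c ∈ nodes → h (c ∷ w₀) (slide x c) ≡ ev (length nodes) a c
            values {c} m = trans (sym (consistent W (c ∷ w₀) CW (All.lookup nodes-C m) (slide x c) (meets c)))
              (trans (cong (h W) (sym (reparam c))) (trans (proj₂ along c) (cong (λ k → ev k a c) (sym length-nodes))))

          poly-lift : ∀ {e g} W → IsPoly (suc n) e g → IsPoly n e (λ y → g (lift W y))
          poly-lift {g = g} W p = poly-cong (λ y → cong g (cong₂ _∷_ (cong (height W) (at-coordinates y)) (at-coordinates y)))
            (poly-∘ p ((λ y → height W (at (coordinates n) y)) ∷ coordinates n)
              (poly-dot W ((λ _ → 1ᶠ) ∷ coordinates n) (poly-const 1ᶠ VAll.∷ poly-coordinates n) VAll.∷ poly-coordinates n))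

          difference : Pt (suc n) → Pt n → 𝔽
          difference W y = R (lift W y) +ᶠ (-ᶠ h W y)

          difference-poly : ∀ W → C W → IsPoly n (suc d + d) (difference W)
          difference-poly W CW = poly-- (poly-lift W R-poly) (poly-weaken (m≤n+m d (suc d)) (h-poly W CW))

          tails-differ : ∀ W → Through b W → ¬ (Vec.tail W ≡ w₀)
          tails-differ (c' ∷ w) (_ , grad) refl = b≢b₀ (trans (sym grad) (gradient-tail c' w v))

          -- Treats all clique members of the pencil at once, whether nodes or not. Where such a
          -- member meets a hyperplane of slope `b`, `R` is already correct. Counting these
          -- incidences in two ways gives at least `through# b` such points, more than `N / 2B`,
          -- which is too many zeros for a nonzero difference of degree `2 d + 1`.
          R-on-pencil : ∀ c → C (c ∷ w₀) → ∀ y → R (lift (c ∷ w₀) y) ≡ h (c ∷ w₀) y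
          R-on-pencil c Cc y₀ with difference (c ∷ w₀) y₀ ≟ᶠ 0ᶠ
          ... | yes z = x-y≡0⇒x≡y z
          ... | no nz = contradiction (*-cancelʳ-≤ q (B * (4 * d + 4)) N small) (too-small (4 * d + 4) (d-bound 4 4 (m≤m+n 8 7)))
            where
            open ≤-Reasoning
            W₀ = c ∷ w₀
            Z = ∑ᵖ n (λ y → I (difference W₀ y ≟ᶠ 0ᶠ))
            hit : ∀ W y → I (through? b W) * I (height W y ≟ᶠ height W₀ y) ≤
                          I (difference W₀ y ≟ᶠ 0ᶠ) * (I (gradient W v ≟ᶠ b) * I (height W y ≟ᶠ height W₀ y))
            hit W y = ≤-trans (≤-reflexive (sym (I-× (through? b W) (height W y ≟ᶠ height W₀ y)))) (≤-trans
              (I-mono (through? b W ×-dec (height W y ≟ᶠ height W₀ y)) ((difference W₀ y ≟ᶠ 0ᶠ) ×-dec ((gradient W v ≟ᶠ b) ×-dec (height W y ≟ᶠ height W₀ y)))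
                (λ ((CW , grad) , e) → x≡y⇒x-y≡0 (trans (cong (λ z → R (z ∷ y)) (sym e)) (trans (R-on-through W (CW , grad) y) (consistent W W₀ CW Cc y e))) , grad , e))
              (≤-reflexive (trans (I-× (difference W₀ y ≟ᶠ 0ᶠ) _) (cong (I (difference W₀ y ≟ᶠ 0ᶠ) *_) (I-× (gradient W v ≟ᶠ b) (height W y ≟ᶠ height W₀ y))))))
            two-conditions : ∀ y a → q * ∑ᵖ (suc n) (λ W → I (gradient W v ≟ᶠ b) * I (height W y ≟ᶠ a)) ≡ N
            two-conditions y a = trans (cong (q *_) (trans (∑ᵖ-suc n _) (trans (∑-swap elements (points n) _) (∑-cong (points n) (λ w →
                trans (∑-cong elements (λ c → cong (_* I (height (c ∷ w) y ≟ᶠ a)) (I-cong (gradient (c ∷ w) v ≟ᶠ b) (dot w v ≟ᶠ b) (trans (sym (gradient-tail c w v))) (trans (gradient-tail c w v)))))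
                (trans (∑-*ˡ elements (I (dot w v ≟ᶠ b)) _) (trans (cong (I (dot w v ≟ᶠ b) *_) (trans (∑-shift-height w y (λ z → I (z ≟ᶠ a))) (Finite.∑-δ₁ finite𝔽 a))) (*-identityʳ _))))))))
              (hyperplane-count v v≢0 b)
            through≤Z : through# b ≤ Z
            through≤Z = *-cancelʳ-≤ (through# b) Z N (begin
              through# b * N
                ≡⟨ sym (∑-*ʳ (points (suc n)) N _) ⟩
              ∑ᵖ (suc n) (λ W → I (through? b W) * N)
                ≡⟨ ∑-cong (points (suc n)) (λ W → I*-cong (through? b W) (λ t → sym (coincidence-count W W₀ (tails-differ W t)))) ⟩
              ∑ᵖ (suc n) (λ W → I (through? b W) * (q * ∑ᵖ n (λ y → I (height W y ≟ᶠ height W₀ y))))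
                ≡⟨ ∑-cong (points (suc n)) (λ W → trans (comm₃ (I (through? b W)) q _) (cong (q *_) (sym (∑-*ˡ (points n) (I (through? b W)) _)))) ⟩
              ∑ᵖ (suc n) (λ W → q * ∑ᵖ n (λ y → I (through? b W) * I (height W y ≟ᶠ height W₀ y)))
                ≤⟨ ∑-mono (points (suc n)) (λ W → *-monoʳ-≤ q (∑-mono (points n) (hit W))) ⟩
              ∑ᵖ (suc n) (λ W → q * ∑ᵖ n (λ y → I (difference W₀ y ≟ᶠ 0ᶠ) * (I (gradient W v ≟ᶠ b) * I (height W y ≟ᶠ height W₀ y))))
                ≡⟨ trans (∑-*ˡ (points (suc n)) q _) (cong (q *_) (trans (∑-swap (points (suc n)) (points n) _) (∑-cong (points n) (λ y → ∑-*ˡ (points (suc n)) (I (difference W₀ y ≟ᶠ 0ᶠ)) _)))) ⟩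
              q * ∑ᵖ n (λ y → I (difference W₀ y ≟ᶠ 0ᶠ) * ∑ᵖ (suc n) (λ W → I (gradient W v ≟ᶠ b) * I (height W y ≟ᶠ height W₀ y)))
                ≡⟨ trans (sym (∑-*ˡ (points n) q _)) (∑-cong (points n) (λ y → trans (comm₃ q (I (difference W₀ y ≟ᶠ 0ᶠ)) _) (cong (I (difference W₀ y ≟ᶠ 0ᶠ) *_) (two-conditions y (height W₀ y))))) ⟩
              ∑ᵖ n (λ y → I (difference W₀ y ≟ᶠ 0ᶠ) * N)
                ≡⟨ ∑-*ʳ (points n) N _ ⟩
              Z * N ∎)
              where
              comm₃ : ∀ x y z → x * (y * z) ≡ y * (x * z)
              comm₃ = ringℕ
            small : q * N ≤ B * (4 * d + 4) * N
            small = begin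
              q * N ≤⟨ *-monoʳ-≤ q (≤-trans (<⇒≤ dense) (*-monoʳ-≤ (2 * B) through≤Z)) ⟩
              q * (2 * B * Z) ≡⟨ e₁ q B Z ⟩
              2 * B * (q * Z) ≤⟨ *-monoʳ-≤ (2 * B) (schwartz-zippel₀ {d = suc d + d} (difference W₀) (poly⇒lineDeg (difference-poly W₀ Cc)) y₀ nz) ⟩
              2 * B * (Z + (suc d + d) * N) ≤⟨ *-monoʳ-≤ (2 * B) (+-monoˡ-≤ ((suc d + d) * N) (≤-trans (∑ᵖ-≤const n (λ y → I≤1 (difference W₀ y ≟ᶠ 0ᶠ))) (≤-reflexive (*-identityʳ N)))) ⟩
              2 * B * (N + (suc d + d) * N) ≡⟨ e₂ B N d ⟩
              B * (4 * d + 4) * N ∎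
              where
              e₁ : ∀ q B Z → q * (2 * B * Z) ≡ 2 * B * (q * Z)
              e₁ = ringℕ
              e₂ : ∀ B N d → 2 * B * (N + (suc d + d) * N) ≡ B * (4 * d + 4) * N
              e₂ = ringℕ

          -- A hyperplane not parallel to the pencil contains a line crossing it. The line meets all
          -- members at distinct parameters, at least `q / B` of them in the clique, and there the
          -- difference vanishes; this is more than its degree `2 d + 1` allows.
          R-on-clique : ∀ W → C W → ∀ y → R (lift W y) ≡ h W y
          R-on-clique W@(c ∷ w) CW y with w ≟ᵖ w₀
          ... | yes refl = R-on-pencil c CW y
          ... | no w≢w₀ with difference W y ≟ᶠ 0ᶠ
          ... | yes z = x-y≡0⇒x≡y z
          ... | no nz = contradiction crowded (too-small (2 * d + 1) (d-bound 2 1 (m≤m+n 3 12)))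
            where
            open ≤-Reasoning
            away = non-orthogonal (w ⊟ w₀) (λ e → w≢w₀ (⊟≡0⇒≡ e))
            v' = proj₁ away
            γ = dot (w ⊟ w₀) v'
            σ = height W y +ᶠ (-ᶠ dot w₀ y)
            ∑-affine : (g : 𝔽 → ℕ) → ∑ᶠ (λ t → g (t *ᶠ γ +ᶠ σ)) ≡ ∑ᶠ g
            ∑-affine g = ∑-reindex finite𝔽 finite𝔽 (λ t → t *ᶠ γ +ᶠ σ) (λ c → (c +ᶠ (-ᶠ σ)) *ᶠ (γ ⁻¹ᶠ))
              (λ t → trans (cong (_*ᶠ (γ ⁻¹ᶠ)) (x+y-y≡x (t *ᶠ γ) σ)) (*-cancel-inverse′ t (proj₂ away)))
              (λ c → trans (cong (_+ᶠ σ) (*-cancel-inverse (c +ᶠ (-ᶠ σ)) (proj₂ away))) (x-y+y≡x c σ)) g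
            meets : ∀ t → height W (line y v' t) ≡ height ((t *ᶠ γ +ᶠ σ) ∷ w₀) (line y v' t)
            meets t = trans (height-line W y v' t) (trans (cong (λ g → height W y +ᶠ t *ᶠ g) (gradient-tail c w v'))
              (trans (shuffle (height W y) t (dot w v') (dot w₀ v') (dot w₀ y))
                (trans (cong₂ (λ g z → t *ᶠ g +ᶠ σ +ᶠ z) (sym (dot-⊟ˡ w w₀ v')) (sym (dot-line w₀ y v' t))) (sym (height-tail (t *ᶠ γ +ᶠ σ) w₀ (line y v' t))))))
              where
              shuffle : ∀ H t g g' D → H +ᶠ t *ᶠ g ≡ t *ᶠ (g +ᶠ (-ᶠ g')) +ᶠ (H +ᶠ (-ᶠ D)) +ᶠ (D +ᶠ t *ᶠ g')
              shuffle = solve 5 (λ H t g g' D → H :+ t :* g := t :* (g :+ (:- g')) :+ (H :+ (:- D)) :+ (D :+ t :* g')) refl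
            vanishes : ∀ t → C ((t *ᶠ γ +ᶠ σ) ∷ w₀) → difference W (line y v' t) ≡ 0ᶠ
            vanishes t Ct = x≡y⇒x-y≡0 (trans (cong (λ z → R (z ∷ line y v' t)) (meets t))
              (trans (R-on-pencil (t *ᶠ γ +ᶠ σ) Ct (line y v' t)) (sym (consistent W ((t *ᶠ γ +ᶠ σ) ∷ w₀) CW Ct (line y v' t) (meets t)))))
            crowded : q ≤ B * (2 * d + 1)
            crowded = begin
              q ≤⟨ wide ⟩
              B * ∑ᶠ (λ c → I (C? (c ∷ w₀))) ≡⟨ cong (B *_) (sym (∑-affine (λ c → I (C? (c ∷ w₀))))) ⟩
              B * ∑ᶠ (λ t → I (C? ((t *ᶠ γ +ᶠ σ) ∷ w₀))) ≤⟨ *-monoʳ-≤ B (∑-mono elements (λ t → I-mono (C? ((t *ᶠ γ +ᶠ σ) ∷ w₀)) (difference W (line y v' t) ≟ᶠ 0ᶠ) (vanishes t))) ⟩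
              B * ∑ᶠ (λ t → I (difference W (line y v' t) ≟ᶠ 0ᶠ)) ≤⟨ *-monoʳ-≤ B (line-root-count (difference W) (poly⇒lineDeg (difference-poly W CW)) y v' nz) ⟩
              B * (suc d + d) ≡⟨ cong (B *_) (e d) ⟩
              B * (2 * d + 1) ∎
              where
              e : ∀ d → suc d + d ≡ 2 * d + 1
              e = ringℕ

          -- Inside a clique hyperplane `R` has degree at most `d ≤ e`, so the form of degree
          -- `suc e` is zero in all directions of that hyperplane. Together the directions are too
          -- many zeros for a nonzero form.
          lower : ∀ e → d ≤ e → suc e ≤ 2 * d + 1 → IsPoly (suc n) (suc e) R → IsPoly (suc n) e R
          lower e d≤e e≤ p = proj₂ (proj₂ (proj₂ lead)) vanish
            where
            open ≤-Reasoning
            lead = leading-form p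
            T = proj₁ lead
            -- With this many parameters, equality of values along a line is equality of all
            -- coefficients up to degree `suc e`.
            q-big : suc (suc e) ≤ q
            q-big = ≰⇒≥ λ q≤ → too-small (2 * d + 2) (d-bound 2 2 (m≤m+n 4 11)) (≤-trans q≤ (≤-trans (s≤s e≤) (≤-trans (≤-reflexive (e₁ d)) (≤-trans (≤-reflexive (sym (*-identityˡ _))) (*-monoˡ-≤ (2 * d + 2) B>0)))))
              where
              e₁ : ∀ d → suc (2 * d + 1) ≡ 2 * d + 2
              e₁ = ringℕ
            on-planes : ∀ W → C W → ∀ v → T (lift-dir W v) ≡ 0ᶠ
            on-planes W CW v = trans (sym (proj₁ (proj₂ form))) (trans
              (ev-injective (suc (suc e)) (proj₁ form) (truncate d (proj₁ short)) (λ t → t ≟ᶠ t)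
                (λ t _ → trans (sym (proj₂ (proj₂ form) t)) (trans (cong R (sym (lift-line W 0ᵥ v t)))
                  (trans (R-on-clique W CW (line 0ᵥ v t)) (trans (proj₂ short t) (trans (sym (ev-truncate d (proj₁ short) t))
                    (sym (ev-ext d (suc e) t (truncate-deg d (proj₁ short)) (m≤n⇒m≤1+n d≤e))))))))
                (≤-trans q-big (≤-reflexive (sym (trans (∑-cong elements (λ t → I-yes (t ≟ᶠ t) refl)) (trans (∑-const elements 1) (*-identityʳ q)))))) (suc e) ≤-refl)
              (truncate-deg d (proj₁ short) (suc e) (s≤s d≤e)))
              where
              form = proj₁ (proj₂ (proj₂ lead)) (lift W 0ᵥ) (lift-dir W v)
              short = poly⇒lineDeg (h-poly W CW) 0ᵥ v
            Z = ∑ᵖ (suc n) (λ r → I (T r ≟ᶠ 0ᶠ))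
            clique# = ∑ᵖ (suc n) (λ W → I (C? W))
            -- Incidences of clique hyperplanes and their directions: a direction with nonzero tail
            -- lies in `N` hyperplanes, and the case of zero tail is charged with all `q N`.
            many-zeros : clique# * N ≤ Z * N + q * N
            many-zeros = begin
              clique# * N
                ≡⟨ trans (sym (∑-*ʳ (points (suc n)) N _)) (∑-cong (points (suc n)) (λ W → trans (*-comm _ N) (sym (∑ᵖ-const n _)))) ⟩
              ∑ᵖ (suc n) (λ W → ∑ᵖ n (λ v → I (C? W)))
                ≤⟨ ∑-mono (points (suc n)) (λ W → ∑-mono (points n) (λ v → I-mono (C? W) (T (lift-dir W v) ≟ᶠ 0ᶠ) (λ CW → on-planes W CW v))) ⟩
              ∑ᵖ (suc n) (λ W → ∑ᵖ n (λ v → I (T (lift-dir W v) ≟ᶠ 0ᶠ)))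
                ≡⟨ ∑-swap (points (suc n)) (points n) _ ⟩
              ∑ᵖ n (λ v → ∑ᵖ (suc n) (λ W → I (T (gradient W v ∷ v) ≟ᶠ 0ᶠ)))
                ≤⟨ ∑-mono (points n) (λ v → by-direction v (v ≟ᵖ 0ᵥ)) ⟩
              ∑ᵖ n (λ v → ∑ᶠ (λ b → I (T (b ∷ v) ≟ᶠ 0ᶠ)) * N + I (v ≟ᵖ 0ᵥ) * (q * N))
                ≡⟨ trans (∑-+ (points n) _ _) (cong₂ _+_ (trans (∑-*ʳ (points n) N _) (cong (_* N) (trans (∑-swap (points n) elements _) (sym (∑ᵖ-suc n _))))) (Finite.∑-δ (finitePt n) 0ᵥ (λ _ → q * N))) ⟩
              Z * N + q * N ∎
              where
              by-direction : ∀ v → (z : Dec (v ≡ 0ᵥ)) → ∑ᵖ (suc n) (λ W → I (T (gradient W v ∷ v) ≟ᶠ 0ᶠ)) ≤ ∑ᶠ (λ b → I (T (b ∷ v) ≟ᶠ 0ᶠ)) * N + I z * (q * N)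
              by-direction v (yes _) = ≤-trans (≤-trans (∑ᵖ-≤const (suc n) (λ W → I≤1 (T (gradient W v ∷ v) ≟ᶠ 0ᶠ))) (≤-reflexive (trans (*-identityʳ _) (sym (+-identityʳ (q * N)))))) (m≤n+m _ (∑ᶠ (λ b → I (T (b ∷ v) ≟ᶠ 0ᶠ)) * N))
              by-direction v (no v≢) = ≤-trans (≤-reflexive (trans (∑-pushforward (finitePt (suc n)) finite𝔽 (λ W → gradient W v) (λ b → I (T (b ∷ v) ≟ᶠ 0ᶠ)))
                (trans (∑-cong elements (λ b → cong (I (T (b ∷ v) ≟ᶠ 0ᶠ) *_) (gradient-count v v≢ b))) (∑-*ʳ elements N _)))) (m≤m+n _ _)
            vanish : ∀ r → T r ≡ 0ᶠ
            vanish r with T r ≟ᶠ 0ᶠ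
            ... | yes z = z
            ... | no nz = contradiction (*-cancelʳ-≤ q (B * (2 * d + 3)) (q * N) {{ℕ.>-nonZero (*-mono-≤ q>0 N>0)}} small) (too-small (2 * d + 3) (d-bound 2 3 (m≤m+n 5 10)))
              where
              clique≤ : clique# ≤ Z + q
              clique≤ = *-cancelʳ-≤ clique# (Z + q) N (≤-trans many-zeros (≤-reflexive (sym (*-distribʳ-+ N Z q))))
              q≤N : q ≤ N
              q≤N = ≤-trans (≤-reflexive (sym (*-identityʳ q))) (*-monoʳ-≤ q (ℕ.>-nonZero⁻¹ (q ^ suc n′) {{m^n≢0 q (suc n′)}}))
              small : q * (q * N) ≤ B * (2 * d + 3) * (q * N)
              small = begin
                q * (q * N) ≤⟨ *-monoʳ-≤ q (≤-trans size (*-monoʳ-≤ B clique≤)) ⟩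
                q * (B * (Z + q)) ≡⟨ e₁ q B Z ⟩
                B * (q * Z + q * q) ≤⟨ *-monoʳ-≤ B (+-mono-≤ (schwartz-zippel₀ {d = suc e} T (poly⇒lineDeg (proj₁ (proj₂ lead))) r nz) (*-monoʳ-≤ q q≤N)) ⟩
                B * (Z + suc e * (q * N) + q * N) ≤⟨ *-monoʳ-≤ B (+-monoˡ-≤ (q * N) (+-mono-≤ (≤-trans (∑ᵖ-≤const (suc n) (λ r → I≤1 (T r ≟ᶠ 0ᶠ))) (≤-reflexive (*-identityʳ (q * N)))) (*-monoˡ-≤ (q * N) e≤))) ⟩
                B * (q * N + (2 * d + 1) * (q * N) + q * N) ≡⟨ e₂ B (q * N) d ⟩
                B * (2 * d + 3) * (q * N) ∎
                where
                e₁ : ∀ q B Z → q * (B * (Z + q)) ≡ B * (q * Z + q * q)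
                e₁ = ringℕ
                e₂ : ∀ B M d → B * (M + (2 * d + 1) * M + M) ≡ B * (2 * d + 3) * M
                e₂ = ringℕ

          lower-all : ∀ k → k + d ≤ 2 * d + 1 → IsPoly (suc n) (k + d) R → IsPoly (suc n) d R
          lower-all zero le p = p
          lower-all (suc k) le p = lower-all k (≤-trans (n≤1+n _) le) (lower (k + d) (m≤n+m d k) le p)

          glued : IsPoly (suc n) d R
          glued = lower-all (suc d) (≤-reflexive (e d)) R-poly
            where
            e : ∀ d → suc d + d ≡ 2 * d + 1
            e = ringℕ

      abstract
        glue : Σ (Pt (suc n) → 𝔽) λ R → IsPoly (suc n) d R × (∀ W → C W → ∀ y → R (lift W y) ≡ h W y)
        glue = from-pencil pencil
          where
          from-pencil : (∃ λ w₀ → q ≤ B * ∑ᶠ (λ c → I (C? (c ∷ w₀)))) → Σ (Pt (suc n) → 𝔽) λ R → IsPoly (suc n) d R × (∀ W → C W → ∀ y → R (lift W y) ≡ h W y)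
          from-pencil (w₀ , wide) = from-direction P.direction
            where
            module P = FromPencil w₀ wide
            from-direction : (∃ λ b → ¬ (b ≡ P.b₀) × N < 2 * B * P.through# b) → Σ (Pt (suc n) → 𝔽) λ R → IsPoly (suc n) d R × (∀ W → C W → ∀ y → R (lift W y) ≡ h W y)
            from-direction (b , b≢ , dense) = D.R , D.glued , D.R-on-clique
              where module D = P.FromDirection b b≢ dense

-- Induction on the dimension.

module Dimension (F : FiniteField) where
  open import Data.Bool using (T)
  open import Data.Nat using (_+_; _*_; _^_; _≤_; _<_)
  open import Data.Nat.Properties hiding (_≟_)
  open FiniteSums
  open FieldAlgebra F
  open Polynomials F
  open Core F
  open Plane F
  open Sampling F
  open Clique
  open Consistency F
  open Gluing F

  agreeing : ∀ {n} → (f Q : Pt n → 𝔽) → ℕ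
  agreeing {n} f Q = ∑ᵖ n (λ y → I (f y ≟ᶠ Q y))

  module _ (d K : ℕ) (0<d : 0 < d) (0<K : 0 < K) where

    K³ : ℕ
    K³ = K * K * K

    -- In units of 1/K and 1/K² the thresholds are 5 - 2⁻ⁿ and 2 + 2⁻ⁿ: each dimension costs 2⁻⁽ⁿ⁺¹⁾ of both.
    Claim : ℕ → Set
    Claim n = (f : Pt n → 𝔽) (O : Oracle n d) →
      5 * (2 ^ n * (q ^ n * q ^ n)) ≤ K * (2 ^ n * Test.passes f O) + q ^ n * q ^ n →
      Σ (Pt n → 𝔽) λ Q → IsPoly n d Q × (2 * 2 ^ n + 1) * q ^ n ≤ 2 ^ n * (K * K) * agreeing f Q

    module _ (big : K³ * K³ * (K³ * K³) * d * 2 ^ 30 ≤ q) where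
      private
        Y = K³ * K³ * (K³ * K³) * d

        K≤K³ : K ≤ K³
        K≤K³ = ≤-trans (≤-reflexive (sym (trans (*-identityʳ (K * 1)) (*-identityʳ K)))) (*-mono-≤ {K * 1} {K * K} (*-monoʳ-≤ K 0<K) 0<K)

        1≤K³ : 1 ≤ K³
        1≤K³ = ≤-trans 0<K K≤K³

        L²d≤Y : K³ * K³ * d ≤ Y
        L²d≤Y = *-monoˡ-≤ d (≤-trans (≤-reflexive (sym (*-identityʳ (K³ * K³)))) (*-monoʳ-≤ (K³ * K³) (*-mono-≤ 1≤K³ 1≤K³)))

        L²≤Y : K³ * K³ ≤ Y
        L²≤Y = ≤-trans (≤-trans (≤-reflexive (sym (*-identityʳ (K³ * K³)))) (*-monoʳ-≤ (K³ * K³) 0<d)) L²d≤Y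

        L≤L² : K³ ≤ K³ * K³
        L≤L² = ≤-trans (≤-reflexive (sym (*-identityʳ K³))) (*-monoʳ-≤ K³ 1≤K³)

        -- Numerical requirements on `q` are brought to the form of a constant, compared with
        -- `2 ^ 30` by computation, times a quantity that is at most `Y`.
        bound : ∀ c X {_ : T (c ℕ.≤ᵇ 2 ^ 30)} → X ≤ Y → c * X ≤ q
        bound c X {c≤} X≤ = ≤-trans (≤-reflexive (*-comm c X)) (≤-trans (*-mono-≤ X≤ (≤ᵇ⇒≤ c (2 ^ 30) c≤)) big)

      -- The plane theorem turns a passing density above 4/K into agreement 3/K²; the thresholds
      -- here are 5 - 1/4 and 2 + 1/4.
      plane : Claim 2
      plane f O hyp = result (plane-theorem f O K 0<K 0<d (bound 17 (K³ * d) (≤-trans (*-monoˡ-≤ d L≤L²) L²d≤Y)) (Test.line-core f O K enough))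
        where
        N = q ^ 2
        t# = Test.passes f O
        open ≤-Reasoning
        N²>0 : 0 < N * N
        N²>0 = *-mono-≤ N>0 N>0
          where
          N>0 : 0 < N
          N>0 = ℕ.>-nonZero⁻¹ N {{m^n≢0 q 2 {{ℕ.>-nonZero q>0}}}}
        enough : 4 * (N * N) < K * t#
        enough = *-cancelˡ-< 4 _ _ (+-cancelʳ-< (N * N) _ _ (begin-strict
          4 * (4 * (N * N)) + N * N <⟨ m<m+n (4 * (4 * (N * N)) + N * N) {3 * (N * N)} (*-mono-≤ {1} {3} (s≤s z≤n) N²>0) ⟩
          4 * (4 * (N * N)) + N * N + 3 * (N * N) ≡⟨ e₁ (N * N) ⟩
          5 * (4 * (N * N)) ≤⟨ hyp ⟩
          K * (4 * t#) + N * N ≡⟨ e₂ K t# (N * N) ⟩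
          4 * (K * t#) + N * N ∎))
          where
          e₁ : ∀ x → 4 * (4 * x) + x + 3 * x ≡ 5 * (4 * x)
          e₁ = ringℕ
          e₂ : ∀ K T x → K * (4 * T) + x ≡ 4 * (K * T) + x
          e₂ = ringℕ
        result : (Σ (Pt 2 → 𝔽) λ Q → IsPoly 2 d Q × 3 * N ≤ K * K * agreeing f Q) →
                 Σ (Pt 2 → 𝔽) λ Q → IsPoly 2 d Q × 9 * N ≤ 4 * (K * K) * agreeing f Q
        result (Q , p , le) = Q , p , (begin
          9 * N ≤⟨ *-monoˡ-≤ N {9} {12} (m≤m+n 9 3) ⟩
          12 * N ≡⟨ *-assoc 4 3 N ⟩
          4 * (3 * N) ≤⟨ *-monoʳ-≤ 4 le ⟩
          4 * (K * K * agreeing f Q) ≡⟨ sym (*-assoc 4 (K * K) (agreeing f Q)) ⟩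
          4 * (K * K) * agreeing f Q ∎)

      module Step (n′ : ℕ) where
        open ConsistencyGraph n′ d 0<d
        open ≤-Reasoning

        A : ℕ
        A = 2 ^ n

        private
          instance
            q≢0 : NonZero q
            q≢0 = ℕ.>-nonZero q>0
            N≢0 : NonZero N
            N≢0 = m^n≢0 q n
            A≢0 : NonZero A
            A≢0 = m^n≢0 2 n

          N>0 : 0 < N
          N>0 = ℕ.>-nonZero⁻¹ N

          qN>0 : 0 < q * N
          qN>0 = *-mono-≤ q>0 N>0

          q≤N : q ≤ N
          q≤N = ≤-trans (≤-reflexive (sym (*-identityʳ q))) (*-monoʳ-≤ q (ℕ.>-nonZero⁻¹ (q ^ suc n′) {{m^n≢0 q (suc n′)}}))

          4≤q : 4 ≤ q
          4≤q = ≤-trans (≤-trans (≤-reflexive refl) (*-monoʳ-≤ 4 1≤K³)) (bound 4 K³ (≤-trans L≤L² L²≤Y))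

          4^j≤ : ∀ j c → c ≤ q → 4 ^ j * c ≤ q ^ j * q
          4^j≤ j c c≤q = *-mono-≤ (^-monoˡ-≤ j 4≤q) c≤q

          2^j*2^j : ∀ j → 2 ^ j * 2 ^ j ≡ 4 ^ j
          2^j*2^j zero = refl
          2^j*2^j (suc j) = trans (e (2 ^ j)) (cong (4 *_) (2^j*2^j j))
            where
            e : ∀ x → 2 * x * (2 * x) ≡ 4 * (x * x)
            e = ringℕ

        restrict : Oracle (suc n) d → Pt (suc n) → Oracle n d
        restrict O W = record
          { P = λ y v → P (lift W y) (lift-dir W v)
          ; invariant = λ b u s t u≢0 → trans (cong (λ z → evalU F (P z (lift-dir W u)) t) (lift-line W b u s))
              (invariant (lift W b) (lift-dir W u) s t (λ e → u≢0 (cong Vec.tail e))) }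
          where open Oracle O

        module Flagged (f : Pt (suc n) → 𝔽) (O : Oracle (suc n) d)
          (hyp : 5 * (2 ^ suc n * (q ^ suc n * q ^ suc n)) ≤ K * (2 ^ suc n * Test.passes f O) + q ^ suc n * q ^ suc n) where
          open Test f O using (passes; agree?)

          Slanted : Pt (suc n) → Set
          Slanted u = ¬ (Vec.tail u ≡ 0ᵥ)

          slanted? : ∀ u → Dec (Slanted u)
          slanted? u = ¬? (Vec.tail u ≟ᵖ 0ᵥ)

          -- Vertical directions are left out because no graph contains them. There are at most `q`
          -- per point, and `4KA≤N` bounds the cost by 1/(4A) in units of 1/K.
          g : Pt (suc n) → Pt (suc n) → ℕ
          g x u = I (agree? x u) * I (slanted? u)

          open Flags g (λ x u → *-mono-≤ (I≤1 (agree? x u)) (I≤1 (slanted? u)))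
            (λ x b → trans (cong (I (agree? x (b ∷ 0ᵥ)) *_) (I-no (slanted? (b ∷ 0ᵥ)) (λ s → s refl))) (*-zeroʳ (I (agree? x (b ∷ 0ᵥ)))))
            public

          in-plane≤passes : ∀ W → in-plane W ≤ Test.passes (λ y → f (lift W y)) (restrict O W)
          in-plane≤passes W = ∑-mono (points n) (λ y → ∑-mono (points n) (λ v → ≤-trans (≤-reflexive (sym (I-× (agree? (lift W y) (lift-dir W v)) (slanted? (lift-dir W v)))))
            (I-mono (agree? (lift W y) (lift-dir W v) ×-dec slanted? (lift-dir W v)) (Test.agree? (λ y → f (lift W y)) (restrict O W) y v) (λ ((_ , e) , s) → s , e))))

          private
            passes≤ : passes ≤ mass + q * (q * N)
            passes≤ = begin
              passes
                ≤⟨ ∑-mono (points (suc n)) (λ x → ∑-mono (points (suc n)) (λ u → split x u (slanted? u))) ⟩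
              ∑ᵖ (suc n) (λ x → ∑ᵖ (suc n) (λ u → g x u + I (Vec.tail u ≟ᵖ 0ᵥ)))
                ≡⟨ trans (∑-cong (points (suc n)) (λ x → trans (∑-+ (points (suc n)) _ _) (cong (∑ᵖ (suc n) (g x) +_) vertical#))) (trans (∑-+ (points (suc n)) _ _) (cong (mass +_) (∑ᵖ-const (suc n) q))) ⟩
              mass + q * N * q
                ≡⟨ cong (mass +_) (*-comm (q * N) q) ⟩
              mass + q * (q * N) ∎
              where
              vertical# : ∑ᵖ (suc n) (λ u → I (Vec.tail u ≟ᵖ 0ᵥ)) ≡ q
              vertical# = trans (∑ᵖ-suc n _) (trans (∑-cong elements (λ b → Finite.∑-δ₁ (finitePt n) 0ᵥ)) (trans (∑-const elements 1) (*-identityʳ q)))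
              split : ∀ x u (s : Dec (Slanted u)) → I (agree? x u) ≤ I (agree? x u) * I s + I (Vec.tail u ≟ᵖ 0ᵥ)
              split x u (yes s) = ≤-trans (≤-reflexive (sym (*-identityʳ _))) (m≤m+n _ _)
              split x u (no ¬s) = ≤-trans (I≤1 (agree? x u)) (≤-trans (≤-reflexive (sym (I-yes (Vec.tail u ≟ᵖ 0ᵥ) zero-tail))) (m≤n+m _ (I (agree? x u) * 0)))
                where
                zero-tail : Vec.tail u ≡ 0ᵥ
                zero-tail with Vec.tail u ≟ᵖ 0ᵥ
                ... | yes e = e
                ... | no ne = contradiction ne ¬s

            4KA≤N : 4 * K * A ≤ N
            4KA≤N = begin
              4 * K * (2 ^ n) ≤⟨ *-monoʳ-≤ (4 * K) (^-monoˡ-≤ n {2} {4} (s≤s (s≤s z≤n))) ⟩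
              4 * K * (4 * (4 * 4 ^ n′)) ≡⟨ e₁ K (4 ^ n′) ⟩
              4 ^ n′ * (64 * K) ≤⟨ 4^j≤ n′ (64 * K) (bound 64 K (≤-trans K≤K³ (≤-trans L≤L² L²≤Y))) ⟩
              q ^ n′ * q ≤⟨ m≤m*n (q ^ n′ * q) q ⟩
              q ^ n′ * q * q ≡⟨ e₂ (q ^ n′) q ⟩
              q * (q * q ^ n′) ∎
              where
              e₁ : ∀ K x → 4 * K * (4 * (4 * x)) ≡ x * (64 * K)
              e₁ = ringℕ
              e₂ : ∀ x q → x * q * q ≡ q * (q * x)
              e₂ = ringℕ

          area : ℕ
          area = q * q * (N * N)

          -- In units of 1/K, the density of the remaining flags is at least 5 - 3/(4A): the
          -- hypothesis gives 5 - 1/(2A) and the vertical directions cost 1/(4A). Membership in `V`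
          -- asks for 5 - 1/A, so a gap of 1/(4A) is left for sampling.
          mass-large : 20 * A * area ≤ 4 * K * A * mass + 3 * area
          mass-large = begin
            20 * A * area ≡⟨ e₁ A q N ⟩
            2 * (5 * (2 * A * (q * N * (q * N)))) ≤⟨ *-monoʳ-≤ 2 hyp ⟩
            2 * (K * (2 * A * passes) + q * N * (q * N)) ≤⟨ *-monoʳ-≤ 2 (+-monoˡ-≤ (q * N * (q * N)) (*-monoʳ-≤ K (*-monoʳ-≤ (2 * A) passes≤))) ⟩
            2 * (K * (2 * A * (mass + q * (q * N))) + q * N * (q * N)) ≡⟨ e₂ K A mass q N ⟩
            4 * K * A * mass + (4 * K * A * (q * (q * N)) + 2 * area) ≤⟨ +-monoʳ-≤ (4 * K * A * mass) (+-monoˡ-≤ (2 * area) (*-monoˡ-≤ (q * (q * N)) 4KA≤N)) ⟩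
            4 * K * A * mass + (N * (q * (q * N)) + 2 * area) ≡⟨ cong (4 * K * A * mass +_) (e₃ q N) ⟩
            4 * K * A * mass + 3 * area ∎
            where
            e₁ : ∀ A q N → 20 * A * (q * q * (N * N)) ≡ 2 * (5 * (2 * A * (q * N * (q * N))))
            e₁ = ringℕ
            e₂ : ∀ K A m q N → 2 * (K * (2 * A * (m + q * (q * N))) + q * N * (q * N)) ≡ 4 * K * A * m + (4 * K * A * (q * (q * N)) + 2 * (q * q * (N * N)))
            e₂ = ringℕ
            e₃ : ∀ q N → N * (q * (q * N)) + 2 * (q * q * (N * N)) ≡ 3 * (q * q * (N * N))
            e₃ = ringℕ

          V : Pt (suc n) → Set
          V W = 5 * (A * (N * N)) ≤ K * (A * in-plane W) + N * N

          V? : ∀ W → Dec (V W)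
          V? W = 5 * (A * (N * N)) ℕ.≤? K * (A * in-plane W) + N * N

          good bad : ℕ
          good = ∑ᵖ (suc n) (λ W → I (V? W))
          bad = ∑ᵖ (suc n) (λ W → I (¬? (V? W)))

          good+bad : good + bad ≡ q * N
          good+bad = trans (sym (∑-+ (points (suc n)) _ _)) (trans (∑-cong (points (suc n)) (λ W → I-¬ (V? W))) (∑ᵖ-one (suc n)))

          private
            X : Pt (suc n) → ℕ
            X W = 4 * K * A * (q * q * in-plane W)

            μ = 4 * K * A * mass

            ∑X : ∑ᵖ (suc n) X ≡ q * N * μ
            ∑X = trans (∑-*ˡ (points (suc n)) (4 * K * A) _) (trans (cong (4 * K * A *_) (trans (∑-*ˡ (points (suc n)) (q * q) in-plane) (trans (*-assoc q q _) (cong (q *_) mean)))) (e q N (4 * K * A) mass))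
              where
              e : ∀ q N k m → k * (q * (N * m)) ≡ q * N * (k * m)
              e = ringℕ

            gap : ∀ W → ¬ V W → X W + area ≤ μ
            gap W ¬v = +-cancelʳ-≤ (3 * area) _ _ (≤-trans (begin
              X W + area + 3 * area ≡⟨ e₁ (4 * K * A) (q * q) (in-plane W) (N * N) ⟩
              q * q * (4 * K * A * in-plane W + 4 * (N * N)) ≡⟨ cong (q * q *_) (e₂ K A (in-plane W) (N * N)) ⟩
              q * q * (4 * (K * (A * in-plane W) + N * N)) ≤⟨ *-monoʳ-≤ (q * q) (*-monoʳ-≤ 4 (<⇒≤ (≰⇒> ¬v))) ⟩
              q * q * (4 * (5 * (A * (N * N)))) ≡⟨ e₃ (q * q) A (N * N) ⟩
              20 * A * area ∎) mass-large)
              where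
              e₁ : ∀ k Q I M → k * (Q * I) + Q * M + 3 * (Q * M) ≡ Q * (k * I + 4 * M)
              e₁ = ringℕ
              e₂ : ∀ K A I M → 4 * K * A * I + 4 * M ≡ 4 * (K * (A * I) + M)
              e₂ = ringℕ
              e₃ : ∀ Q A M → Q * (4 * (5 * (A * M))) ≡ 20 * A * (Q * M)
              e₃ = ringℕ

            in-plane≤ : ∀ W → in-plane W ≤ N * N
            in-plane≤ W = ∑ᵖ-≤const n (λ y → ≤-trans (∑ᵖ-≤const n (λ v → *-mono-≤ (I≤1 (agree? (lift W y) (lift-dir W v))) (I≤1 (slanted? (lift-dir W v))))) (≤-reflexive (*-identityʳ N)))

            -- Each bad hyperplane falls short of the mean by at least `area`, and a good one can
            -- make up for at most `4 K A` bad ones because densities do not exceed 1.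
            averaging : q * N ≤ (4 * K * A + 1) * good
            averaging = begin
              q * N ≡⟨ sym good+bad ⟩
              good + bad ≤⟨ +-monoʳ-≤ good (*-cancelˡ-≤ area {{area≢0}} (+-cancelˡ-≤ (q * N * μ) _ _ summed)) ⟩
              good + 4 * K * A * good ≡⟨ e (4 * K * A) good ⟩
              (4 * K * A + 1) * good ∎
              where
              area≢0 : NonZero area
              area≢0 = ℕ.>-nonZero (*-mono-≤ (*-mono-≤ q>0 q>0) (*-mono-≤ N>0 N>0))
              e : ∀ k g → g + k * g ≡ (k + 1) * g
              e = ringℕ
              pointwise : ∀ W → X W + area * I (¬? (V? W)) ≤ μ + I (V? W) * (area * (4 * K * A))
              pointwise W with V? W
              ... | yes _ = begin
                4 * K * A * (q * q * in-plane W) + area * 0 ≡⟨ trans (cong (4 * K * A * (q * q * in-plane W) +_) (*-zeroʳ area)) (+-identityʳ _) ⟩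
                4 * K * A * (q * q * in-plane W) ≤⟨ *-monoʳ-≤ (4 * K * A) (*-monoʳ-≤ (q * q) (in-plane≤ W)) ⟩
                4 * K * A * area ≡⟨ trans (*-comm (4 * K * A) area) (sym (+-identityʳ _)) ⟩
                1 * (area * (4 * K * A)) ≤⟨ m≤n+m _ μ ⟩
                μ + 1 * (area * (4 * K * A)) ∎
              ... | no ¬v = begin
                X W + area * 1 ≡⟨ cong (X W +_) (*-identityʳ area) ⟩
                X W + area ≤⟨ gap W ¬v ⟩
                μ ≡⟨ sym (+-identityʳ μ) ⟩
                μ + 0 ∎
              summed : q * N * μ + area * bad ≤ q * N * μ + area * (4 * K * A * good)
              summed = begin
                q * N * μ + area * bad ≡⟨ cong₂ _+_ (sym ∑X) (sym (∑-*ˡ (points (suc n)) area _)) ⟩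
                ∑ᵖ (suc n) X + ∑ᵖ (suc n) (λ W → area * I (¬? (V? W))) ≡⟨ sym (∑-+ (points (suc n)) _ _) ⟩
                ∑ᵖ (suc n) (λ W → X W + area * I (¬? (V? W))) ≤⟨ ∑-mono (points (suc n)) pointwise ⟩
                ∑ᵖ (suc n) (λ W → μ + I (V? W) * (area * (4 * K * A))) ≡⟨ trans (∑-+ (points (suc n)) _ _) (cong₂ _+_ (∑ᵖ-const (suc n) μ) (∑-*ʳ (points (suc n)) (area * (4 * K * A)) _)) ⟩
                q * N * μ + good * (area * (4 * K * A)) ≡⟨ cong (q * N * μ +_) (move good area (4 * K * A)) ⟩
                q * N * μ + area * (4 * K * A * good) ∎
                where
                move : ∀ g a k → g * (a * k) ≡ a * (k * g)
                move = ringℕ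

            -- Chebyshev's inequality with deviation `area`. The power of `q` in the bound does not
            -- grow with the dimension, while the number `q N` of hyperplanes does.
            concentration : bad ≤ 16 * (K * K) * (A * A) * (q * q * (q * q))
            concentration = *-cancelʳ-≤ bad _ (area * area) {{area²≢0}} (≤-trans
              (chebyshev (points (suc n)) X μ area (4 * K * A * (4 * K * A) * (q * q * (q * q) * (q * q * (q * q)) * (N * N * (N * N)))) (λ W → ¬? (V? W))
                (λ W ¬v → inj₁ (gap W ¬v)) (trans ∑X (cong (_* μ) (sym (length-points (suc n))))) squares)
              (≤-reflexive (e K A (q * q) (N * N))))
              where
              area²≢0 : NonZero (area * area)
              area²≢0 = ℕ.>-nonZero (*-mono-≤ area>0 area>0)
                where
                area>0 : 0 < area
                area>0 = *-mono-≤ (*-mono-≤ q>0 q>0) (*-mono-≤ N>0 N>0)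
              e : ∀ K A Q M → 4 * K * A * (4 * K * A) * (Q * Q * (Q * Q) * (M * M)) ≡ 16 * (K * K) * (A * A) * (Q * Q) * (Q * M * (Q * M))
              e = ringℕ
              squares : ∑ᵖ (suc n) (λ W → X W * X W) ≤ length (points (suc n)) * (μ * μ) + 4 * K * A * (4 * K * A) * (q * q * (q * q) * (q * q * (q * q)) * (N * N * (N * N)))
              squares = begin
                ∑ᵖ (suc n) (λ W → X W * X W)
                  ≡⟨ ∑-cong (points (suc n)) (λ W → e₁ (4 * K * A) (q * q) (in-plane W)) ⟩
                ∑ᵖ (suc n) (λ W → 4 * K * A * (4 * K * A) * (q * q * (q * q) * (in-plane W * in-plane W)))
                  ≡⟨ trans (∑-*ˡ (points (suc n)) (4 * K * A * (4 * K * A)) _) (cong (4 * K * A * (4 * K * A) *_) (∑-*ˡ (points (suc n)) (q * q * (q * q)) _)) ⟩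
                4 * K * A * (4 * K * A) * (q * q * (q * q) * ∑ᵖ (suc n) (λ W → in-plane W * in-plane W))
                  ≤⟨ *-monoʳ-≤ (4 * K * A * (4 * K * A)) second ⟩
                4 * K * A * (4 * K * A) * (q * N * (mass * mass) + q * q * (q * q) * (q * q * (q * q)) * (N * N * (N * N)))
                  ≡⟨ e₂ (4 * K * A) (q * N) mass _ ⟩
                q * N * (μ * μ) + 4 * K * A * (4 * K * A) * (q * q * (q * q) * (q * q * (q * q)) * (N * N * (N * N)))
                  ≡⟨ cong (λ z → z * (μ * μ) + 4 * K * A * (4 * K * A) * (q * q * (q * q) * (q * q * (q * q)) * (N * N * (N * N)))) (sym (length-points (suc n))) ⟩
                length (points (suc n)) * (μ * μ) + 4 * K * A * (4 * K * A) * (q * q * (q * q) * (q * q * (q * q)) * (N * N * (N * N))) ∎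
                where
                e₁ : ∀ k Q I → k * (Q * I) * (k * (Q * I)) ≡ k * k * (Q * Q * (I * I))
                e₁ = ringℕ
                e₂ : ∀ k M m V → k * k * (M * (m * m) + V) ≡ M * (k * m * (k * m)) + k * k * V
                e₂ = ringℕ

          -- The share must not depend on the dimension, whereas averaging gives 1/(4 K A + 1). For
          -- `n ≥ 4` the bound of order `q⁴` on bad hyperplanes is at most half of `q ^ (n + 1)`.
          -- For `n = 2` and `n = 3` it is not, but there `A ≤ 8`, and averaging gives 33 = 4 · 8 +
          -- 1.
          many-good : q * N ≤ 33 * K * good
          many-good = cases n′ refl
            where
            small-case : A ≤ 8 → q * N ≤ 33 * K * good
            small-case A≤8 = ≤-trans averaging (*-monoˡ-≤ good (begin
              4 * K * A + 1 ≤⟨ +-mono-≤ (*-monoʳ-≤ (4 * K) A≤8) 0<K ⟩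
              4 * K * 8 + K ≡⟨ e K ⟩
              33 * K ∎))
              where
              e : ∀ K → 4 * K * 8 + K ≡ 33 * K
              e = ringℕ
            cases : ∀ j → n′ ≡ j → q * N ≤ 33 * K * good
            cases zero refl = small-case (m≤m+n 4 4)
            cases (suc zero) refl = small-case ≤-refl
            cases (suc (suc j)) refl = begin
              q * N ≤⟨ +-cancelʳ-≤ (q * N) _ _ doubled ⟩
              2 * good ≤⟨ *-monoˡ-≤ good (≤-trans (m≤m+n 2 31) (≤-trans (≤-reflexive (sym (*-identityʳ 33))) (*-monoʳ-≤ 33 0<K))) ⟩
              33 * K * good ∎
              where
              bad-small : 2 * bad ≤ q * N
              bad-small = begin
                2 * bad ≤⟨ *-monoʳ-≤ 2 concentration ⟩
                2 * (16 * (K * K) * (A * A) * (q * q * (q * q))) ≡⟨ cong (λ z → 2 * (16 * (K * K) * z * (q * q * (q * q)))) (2^j*2^j n) ⟩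
                2 * (16 * (K * K) * (4 * (4 * (4 * (4 * 4 ^ j)))) * (q * q * (q * q))) ≡⟨ e₁ 4 (K * K) (4 ^ j) (q * q * (q * q)) ⟩
                4 ^ j * (32 * (4 * 4 * (4 * 4)) * (K * K)) * (q * q * (q * q)) ≤⟨ *-monoˡ-≤ (q * q * (q * q)) (4^j≤ j (32 * (4 * 4 * (4 * 4)) * (K * K)) (bound (32 * (4 * 4 * (4 * 4))) (K * K) (≤-trans (≤-trans (≤-reflexive (sym (*-identityʳ (K * K)))) (*-monoʳ-≤ (K * K) 0<K)) (≤-trans L≤L² L²≤Y)))) ⟩
                q ^ j * q * (q * q * (q * q)) ≡⟨ e₂ q (q ^ j) ⟩
                q * (q * (q * (q * (q * q ^ j)))) ∎
                where
                e₁ : ∀ f k x Q → 2 * (16 * k * (f * (f * (f * (f * x)))) * Q) ≡ x * (32 * (f * f * (f * f)) * k) * Q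
                e₁ = ringℕ
                e₂ : ∀ q x → x * q * (q * q * (q * q)) ≡ q * (q * (q * (q * (q * x))))
                e₂ = ringℕ
              doubled : q * N + q * N ≤ 2 * good + q * N
              doubled = begin
                q * N + q * N ≡⟨ cong₂ _+_ (sym good+bad) (sym good+bad) ⟩
                good + bad + (good + bad) ≡⟨ e good bad ⟩
                2 * good + 2 * bad ≤⟨ +-monoʳ-≤ (2 * good) bad-small ⟩
                2 * good + q * N ∎
                where
                e : ∀ g b → g + b + (g + b) ≡ 2 * g + 2 * b
                e = ringℕ

        module Assemble (f : Pt (suc n) → 𝔽) (V : Pt (suc n) → Set) (V? : ∀ W → Dec (V W)) (h : Pt (suc n) → Pt n → 𝔽)
          (h-poly : ∀ W → V W → IsPoly n d (h W))
          (h-agree : ∀ W → V W → (2 * A + 1) * N ≤ A * (K * K) * agreeing (λ y → f (lift W y)) (h W))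
          (many : q * N ≤ 33 * K * ∑ᵖ (suc n) (λ W → I (V? W))) where

          private
            -- A share 1/(33 K) of the hyperplanes with agreement 2/K² each has total density 2/(33
            -- K³), and 17 is 33/2 rounded up. `G` is the inverse edge density given by
            -- `many-edges`.
            H = 17 * K³
            G = 2 * (H * H)

            dense : q * N * N ≤ H * ∑ᵖ (suc n) (λ W → I (V? W) * agreeing (λ y → f (lift W y)) (h W))
            dense = *-cancelˡ-≤ 2 (begin
              2 * (q * N * N) ≤⟨ *-monoʳ-≤ 2 (*-monoˡ-≤ N many) ⟩
              2 * (33 * K * good * N) ≡⟨ e₁ K good N ⟩
              33 * K * (good * (2 * N)) ≤⟨ *-monoʳ-≤ (33 * K) each ⟩
              33 * K * (K * K * S) ≤⟨ ≤-trans (m≤m+n _ (K * (K * K * S))) (≤-reflexive (e₂ K S)) ⟩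
              2 * (H * S) ∎)
              where
              good = ∑ᵖ (suc n) (λ W → I (V? W))
              S = ∑ᵖ (suc n) (λ W → I (V? W) * agreeing (λ y → f (lift W y)) (h W))
              e₁ : ∀ K g N → 2 * (33 * K * g * N) ≡ 33 * K * (g * (2 * N))
              e₁ = ringℕ
              e₂ : ∀ K S → 33 * K * (K * K * S) + K * (K * K * S) ≡ 2 * (17 * (K * K * K) * S)
              e₂ = ringℕ
              each : good * (2 * N) ≤ K * K * S
              each = begin
                good * (2 * N) ≡⟨ sym (∑-*ʳ (points (suc n)) (2 * N) _) ⟩
                ∑ᵖ (suc n) (λ W → I (V? W) * (2 * N)) ≤⟨ ∑-mono (points (suc n)) (λ W → I*-mono (V? W) (λ v → *-cancelˡ-≤ A (begin
                    A * (2 * N) ≡⟨ e₃ A N ⟩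
                    2 * A * N ≤⟨ *-monoˡ-≤ N (m≤m+n (2 * A) 1) ⟩
                    (2 * A + 1) * N ≤⟨ h-agree W v ⟩
                    A * (K * K) * agreeing (λ y → f (lift W y)) (h W) ≡⟨ *-assoc A (K * K) _ ⟩
                    A * (K * K * agreeing (λ y → f (lift W y)) (h W)) ∎))) ⟩
                ∑ᵖ (suc n) (λ W → I (V? W) * (K * K * agreeing (λ y → f (lift W y)) (h W))) ≡⟨ ∑-cong (points (suc n)) (λ W → comm₃ (I (V? W)) (K * K) _) ⟩
                ∑ᵖ (suc n) (λ W → K * K * (I (V? W) * agreeing (λ y → f (lift W y)) (h W))) ≡⟨ ∑-*ˡ (points (suc n)) (K * K) _ ⟩
                K * K * S ∎
                where
                e₃ : ∀ A N → A * (2 * N) ≡ 2 * A * N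
                e₃ = ringℕ
                comm₃ : ∀ x y z → x * (y * z) ≡ y * (x * z)
                comm₃ = ringℕ

            clique = large-clique (finitePt (suc n)) V (E V V? h h-poly) (E? V V? h h-poly) (λ {W} {W'} → E-sym V V? h h-poly {W} {W'}) proj₁
              (2 * (d * N)) G
              (*-mono-≤ {1} {2} (s≤s z≤n) (*-mono-≤ 0<d N>0))
              (*-mono-≤ {1} {2} (s≤s z≤n) (*-mono-≤ H>0 H>0))
              (defect V V? h h-poly)
              (subst (λ z → z * z ≤ G * ∑ᵖ (suc n) (λ W → ∑ᵖ (suc n) (λ W' → I (E? V V? h h-poly W W')))) (sym (length-points (suc n)))
                (many-edges V V? h h-poly f H dense N-large (≤-trans (≤-reflexive (e₁ 17 d K³)) (bound (8 * (17 * 17)) (K³ * K³ * d) L²d≤Y))))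
              (subst (24 * (G * G * (2 * (d * N))) ≤_) (sym (length-points (suc n))) (≤-trans (≤-reflexive (e₂ 17 K³ d N)) (*-monoˡ-≤ N (bound (192 * (17 * 17 * (17 * 17))) Y ≤-refl))))
              where
              H>0 : 0 < H
              H>0 = *-mono-≤ {1} {17} (s≤s z≤n) 1≤K³
              N-large : 4 * (H * H) ≤ N
              N-large = ≤-trans (≤-reflexive (e 17 K³)) (≤-trans (bound (4 * (17 * 17)) (K³ * K³) L²≤Y) q≤N)
                where
                e : ∀ h L → 4 * (h * L * (h * L)) ≡ 4 * (h * h) * (L * L)
                e = ringℕ
              e₁ : ∀ h d L → 8 * (d * (h * L * (h * L))) ≡ 8 * (h * h) * (L * L * d)
              e₁ = ringℕ
              e₂ : ∀ h L d N → 24 * (2 * (h * L * (h * L)) * (2 * (h * L * (h * L))) * (2 * (d * N))) ≡ 192 * (h * h * (h * h)) * (L * L * (L * L) * d) * N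
              e₂ = ringℕ

            Result = Σ (Pt (suc n) → 𝔽) λ Q → IsPoly (suc n) d Q × (2 * (2 * A) + 1) * (q * N) ≤ 2 * A * (K * K) * agreeing f Q

            from-clique : (Σ (Pt (suc n) → Set) λ C → Σ (∀ W → Dec (C W)) λ C? → (∀ W → C W → V W) × (∀ W W' → C W → C W' → E V V? h h-poly W W') ×
                           length (points (suc n)) ≤ 4 * G * ∑ᵖ (suc n) (λ W → I (C? W))) → Result
            from-clique (C , C? , C⊆V , complete , large) = finish (glue h C C? (λ W c → h-poly W (C⊆V W c)) (λ W W' c c' → proj₂ (proj₂ (complete W W' c c')))
                (4 * G) size (≤-trans (≤-reflexive (e₁ 17 K³ d)) (bound (128 * (17 * 17)) (K³ * K³ * d) L²d≤Y)))
              where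
              open Glue n′ d 0<d
              size : q * N ≤ 4 * G * ∑ᵖ (suc n) (λ W → I (C? W))
              size = subst (_≤ 4 * G * ∑ᵖ (suc n) (λ W → I (C? W))) (length-points (suc n)) large
              e₁ : ∀ h L d → 16 * (4 * (2 * (h * L * (h * L))) * d) ≡ 128 * (h * h) * (L * L * d)
              e₁ = ringℕ
              finish : (Σ (Pt (suc n) → 𝔽) λ R → IsPoly (suc n) d R × (∀ W → C W → ∀ y → R (lift W y) ≡ h W y)) → Result
              finish (R , R-poly , on-clique) = R , R-poly , decide ((2 * (2 * A) + 1) * (q * N) ℕ.≤? 2 * A * (K * K) * agreeing f R)
                where
                module S = Points (λ x → I (f x ≟ᶠ R x)) (λ x → I≤1 (f x ≟ᶠ R x))
                k = 2 * A * (K * K)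
                X : Pt (suc n) → ℕ
                X W = k * (q * S.in-plane W)
                μ = k * S.mass
                -- If the conclusion failed, every clique hyperplane would exceed the mean of `X` by
                -- `q N`. Chebyshev's inequality allows fewer such hyperplanes than the clique has,
                -- so its density does not enter the agreement obtained.
                decide : Dec ((2 * (2 * A) + 1) * (q * N) ≤ k * agreeing f R) → (2 * (2 * A) + 1) * (q * N) ≤ k * agreeing f R
                decide (yes p) = p
                decide (no ¬p) = contradiction (*-cancelʳ-≤ N (16 * G * (A * A) * (K * K * (K * K)) * q) (q * (q * N) * N) {{ℕ.>-nonZero (*-mono-≤ (*-mono-≤ q>0 qN>0) N>0)}} crowded) (<⇒≱ room)
                  where
                  -- In units of 1/K² a clique hyperplane has at least 2 + 1/A and the failing mean
                  -- less than 2 + 1/(2A); after scaling by `k`, the difference 1/(2A) is `q N`.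
                  far : ∀ W → C W → μ + q * N ≤ X W
                  far W c = begin
                    k * S.mass + q * N ≤⟨ +-monoˡ-≤ (q * N) (<⇒≤ (≰⇒> ¬p)) ⟩
                    (2 * (2 * A) + 1) * (q * N) + q * N ≡⟨ f₁ A q N ⟩
                    2 * q * ((2 * A + 1) * N) ≤⟨ *-monoʳ-≤ (2 * q) (h-agree W (C⊆V W c)) ⟩
                    2 * q * (A * (K * K) * agreeing (λ y → f (lift W y)) (h W)) ≡⟨ cong (λ z → 2 * q * (A * (K * K) * z)) (∑-cong (points n) (λ y → I-cong (_ ≟ᶠ _) (_ ≟ᶠ _) (λ e → trans e (sym (on-clique W c y))) (λ e → trans e (on-clique W c y)))) ⟩
                    2 * q * (A * (K * K) * S.in-plane W) ≡⟨ f₂ q A (K * K) (S.in-plane W) ⟩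
                    k * (q * S.in-plane W) ∎
                    where
                    f₁ : ∀ A q N → (2 * (2 * A) + 1) * (q * N) + q * N ≡ 2 * q * ((2 * A + 1) * N)
                    f₁ = ringℕ
                    f₂ : ∀ q A k S → 2 * q * (A * k * S) ≡ 2 * A * k * (q * S)
                    f₂ = ringℕ
                  ∑X : ∑ᵖ (suc n) X ≡ length (points (suc n)) * μ
                  ∑X = trans (∑-*ˡ (points (suc n)) k _) (trans (cong (k *_) (trans (∑-*ˡ (points (suc n)) q S.in-plane) (cong (q *_) S.mean)))
                    (trans (e k q N S.mass) (cong (_* μ) (sym (length-points (suc n))))))
                    where
                    e : ∀ k q N m → k * (q * (N * m)) ≡ q * N * (k * m)
                    e = ringℕ
                  squares : ∑ᵖ (suc n) (λ W → X W * X W) ≤ length (points (suc n)) * (μ * μ) + k * k * (q * q * (q * q) * (N * N))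
                  squares = begin
                    ∑ᵖ (suc n) (λ W → X W * X W) ≡⟨ ∑-cong (points (suc n)) (λ W → g₁ k q (S.in-plane W)) ⟩
                    ∑ᵖ (suc n) (λ W → k * k * (q * q * (S.in-plane W * S.in-plane W))) ≡⟨ trans (∑-*ˡ (points (suc n)) (k * k) _) (cong (k * k *_) (∑-*ˡ (points (suc n)) (q * q) _)) ⟩
                    k * k * (q * q * ∑ᵖ (suc n) (λ W → S.in-plane W * S.in-plane W)) ≤⟨ *-monoʳ-≤ (k * k) S.second ⟩
                    k * k * (q * N * (S.mass * S.mass) + q * q * (q * q) * (N * N)) ≡⟨ g₂ k (q * N) S.mass (q * q * (q * q) * (N * N)) ⟩
                    q * N * (μ * μ) + k * k * (q * q * (q * q) * (N * N)) ≡⟨ cong (λ z → z * (μ * μ) + k * k * (q * q * (q * q) * (N * N))) (sym (length-points (suc n))) ⟩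
                    length (points (suc n)) * (μ * μ) + k * k * (q * q * (q * q) * (N * N)) ∎
                    where
                    g₁ : ∀ k q I → k * (q * I) * (k * (q * I)) ≡ k * k * (q * q * (I * I))
                    g₁ = ringℕ
                    g₂ : ∀ k M m V → k * k * (M * (m * m) + V) ≡ M * (k * m * (k * m)) + k * k * V
                    g₂ = ringℕ
                  crowded : N * (q * (q * N) * N) ≤ 16 * G * (A * A) * (K * K * (K * K)) * q * (q * (q * N) * N)
                  crowded = *-cancelˡ-≤ q (begin
                    q * (N * (q * (q * N) * N)) ≡⟨ g₁ q N ⟩
                    q * N * (q * N * (q * N)) ≤⟨ *-monoˡ-≤ (q * N * (q * N)) size ⟩
                    4 * G * ∑ᵖ (suc n) (λ W → I (C? W)) * (q * N * (q * N)) ≡⟨ *-assoc (4 * G) _ _ ⟩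
                    4 * G * (∑ᵖ (suc n) (λ W → I (C? W)) * (q * N * (q * N))) ≤⟨ *-monoʳ-≤ (4 * G) (chebyshev (points (suc n)) X μ (q * N) _ C? (λ W c → inj₂ (far W c)) ∑X squares) ⟩
                    4 * G * (k * k * (q * q * (q * q) * (N * N))) ≡⟨ g₂ G A (K * K) q N ⟩
                    q * (16 * G * (A * A) * (K * K * (K * K)) * q * (q * (q * N) * N)) ∎)
                    where
                    g₁ : ∀ q N → q * (N * (q * (q * N) * N)) ≡ q * N * (q * N * (q * N))
                    g₁ = ringℕ
                    g₂ : ∀ G A L q N → 4 * G * (2 * A * L * (2 * A * L) * (q * q * (q * q) * (N * N))) ≡ q * (16 * G * (A * A) * (L * L) * q * (q * (q * N) * N))
                    g₂ = ringℕ
                  -- `G` brings K⁶ and `k²` brings K⁴. The factor `4 ^ n′` from `A²` is absorbed by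
                  -- as many powers of `q`.
                  room : 16 * G * (A * A) * (K * K * (K * K)) * q < N
                  room = begin-strict
                    16 * G * (A * A) * (K * K * (K * K)) * q ≡⟨ cong (λ z → 16 * G * z * (K * K * (K * K)) * q) (2^j*2^j n) ⟩
                    16 * G * (4 * (4 * 4 ^ n′)) * (K * K * (K * K)) * q ≡⟨ g₁ 17 K³ (4 ^ n′) (K * K) q ⟩
                    4 ^ n′ * (512 * (17 * 17) * (K³ * K³ * (K * K * (K * K)))) * q ≤⟨ *-monoˡ-≤ q (*-monoʳ-≤ (4 ^ n′) (*-monoʳ-≤ (512 * (17 * 17)) (*-monoʳ-≤ (K³ * K³) (*-mono-≤ K²≤ K²≤)))) ⟩
                    4 ^ n′ * (512 * (17 * 17) * (K³ * K³ * (K³ * K³))) * q <⟨ *-monoˡ-< q (*-mono-≤-< (^-monoˡ-≤ n′ 4≤q) below) ⟩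
                    q ^ n′ * q * q ≡⟨ g₂ (q ^ n′) q ⟩
                    q * (q * q ^ n′) ∎
                    where
                    K²≤ : K * K ≤ K³
                    K²≤ = ≤-trans (≤-reflexive (sym (*-identityʳ (K * K)))) (*-monoʳ-≤ (K * K) 0<K)
                    L⁴>0 : 0 < K³ * K³ * (K³ * K³)
                    L⁴>0 = *-mono-≤ (*-mono-≤ 1≤K³ 1≤K³) (*-mono-≤ 1≤K³ 1≤K³)
                    below : 512 * (17 * 17) * (K³ * K³ * (K³ * K³)) < q
                    below = ≤-trans (*-monoˡ-< (K³ * K³ * (K³ * K³)) {{ℕ.>-nonZero L⁴>0}} {512 * (17 * 17)} {suc (512 * (17 * 17))} ≤-refl)
                      (bound (suc (512 * (17 * 17))) (K³ * K³ * (K³ * K³)) (≤-trans (≤-reflexive (sym (*-identityʳ _))) (*-monoʳ-≤ (K³ * K³ * (K³ * K³)) 0<d)))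
                    *-mono-≤-< : ∀ {a b c e} → .{{NonZero b}} → a ≤ b → c < e → a * c < b * e
                    *-mono-≤-< {a} {b} {c} {e} a≤b c<e = ≤-<-trans (*-monoˡ-≤ c a≤b) (*-monoʳ-< b c<e)
                    instance q^n≢0 : NonZero (q ^ n′)
                    q^n≢0 = m^n≢0 q n′
                    g₁ : ∀ h L x M q → 16 * (2 * (h * L * (h * L))) * (4 * (4 * x)) * (M * M) * q ≡ x * (512 * (h * h) * (L * L * (M * M))) * q
                    g₁ = ringℕ
                    g₂ : ∀ x q → x * q * q ≡ q * (q * x)
                    g₂ = ringℕ

          result : Result
          result = from-clique clique

        step : Claim n → Claim (suc n)
        step claim f O hyp = Assemble.result f V V? h h-poly h-agree many-good
          where
          open Flagged f O hyp
          at-plane : ∀ W → V W → Σ (Pt n → 𝔽) λ Q → IsPoly n d Q × (2 * A + 1) * N ≤ A * (K * K) * agreeing (λ y → f (lift W y)) Q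
          at-plane W v = claim (λ y → f (lift W y)) (restrict O W) (≤-trans v (+-monoˡ-≤ (N * N) (*-monoʳ-≤ K (*-monoʳ-≤ A (in-plane≤passes W)))))
          choose : ∀ W → Dec (V W) → Pt n → 𝔽
          choose W (yes v) = proj₁ (at-plane W v)
          -- A default outside `V`; the statements about `h` assume `V W`.
          choose W (no _) = λ _ → 0ᶠ
          h : Pt (suc n) → Pt n → 𝔽
          h W = choose W (V? W)
          choose-poly : ∀ W (v? : Dec (V W)) → V W → IsPoly n d (choose W v?)
          choose-poly W (yes v) _ = proj₁ (proj₂ (at-plane W v))
          choose-poly W (no ¬v) v = contradiction v ¬v
          h-poly : ∀ W → V W → IsPoly n d (h W)
          h-poly W v = choose-poly W (V? W) v
          choose-agree : ∀ W (v? : Dec (V W)) → V W → (2 * A + 1) * N ≤ A * (K * K) * agreeing (λ y → f (lift W y)) (choose W v?)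
          choose-agree W (yes v) _ = proj₂ (proj₂ (at-plane W v))
          choose-agree W (no ¬v) v = contradiction v ¬v
          h-agree : ∀ W → V W → (2 * A + 1) * N ≤ A * (K * K) * agreeing (λ y → f (lift W y)) (h W)
          h-agree W v = choose-agree W (V? W) v

      all-dimensions : ∀ n′ → Claim (suc (suc n′))
      all-dimensions zero = plane
      all-dimensions (suc n′) = Step.step n′ (all-dimensions n′)

-- Degree zero, dimension one, and the test with integer parameters.

module Main (F : FiniteField) where
  open import Data.Nat using (_+_; _*_; _^_; _≤_; _<_)
  open import Data.Nat.Properties hiding (_≟_)
  open FiniteSums
  open FieldAlgebra F
  open Series F
  open Polynomials F
  open Core F
  open Dimension F

  poly-evalU : ∀ {k d} (cs : Vec 𝔽 (suc d)) {τ : Pt k → 𝔽} → IsPoly k 1 τ → IsPoly k d (λ x → evalU F cs (τ x))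
  poly-evalU {d = zero} (c ∷ []) {τ} p = poly-cong (λ x → sym (trans (cong (c +ᶠ_) (*ᶠ-zeroʳ (τ x))) (+ᶠ-identityʳ c))) (poly-const c)
  poly-evalU {d = suc d} (c ∷ cs) p = poly-+ (poly-const c) (poly-* p (poly-evalU cs p))

  nonzero-vectors : ℕ → ℕ
  nonzero-vectors m = ∑ᵖ m (λ u → I (¬? (u ≟ᵖ 0ᵥ)))

  nonzero-count : ∀ m → suc (nonzero-vectors m) ≡ q ^ m
  nonzero-count m = trans (cong (_+ nonzero-vectors m) (sym (Finite.∑-δ₁ (finitePt m) 0ᵥ)))
    (trans (sym (∑-+ (points m) _ _)) (trans (∑-cong (points m) (λ u → I-¬ (u ≟ᵖ 0ᵥ))) (∑ᵖ-one m)))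

  module _ {m d : ℕ} (f : Pt m → 𝔽) (O : Oracle m d) (K : ℕ) (hyp : 5 * (q ^ m * nonzero-vectors m) ≤ K * Test.passes f O) where
    private
      N = q ^ m
      T = Test.passes f O

    -- The test draws one of `N - 1` nonzero directions; completing the count to `N` costs `5 N`.
    hypothesis′ : 5 * (N * N) ≤ K * T + 5 * N
    hypothesis′ = begin
      5 * (N * N) ≡⟨ cong (λ z → 5 * (N * z)) (sym (nonzero-count m)) ⟩
      5 * (N * suc (nonzero-vectors m)) ≡⟨ e N (nonzero-vectors m) ⟩
      5 * (N * nonzero-vectors m) + 5 * N ≤⟨ +-monoˡ-≤ (5 * N) hyp ⟩
      K * T + 5 * N ∎
      where
      open ≤-Reasoning
      e : ∀ N z → 5 * (N * suc z) ≡ 5 * (N * z) + 5 * N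
      e = ringℕ

    enough : 5 < N → 4 * (N * N) < K * T
    enough 5<N = +-cancelʳ-< (5 * N) _ _ (begin-strict
      4 * (N * N) + 5 * N <⟨ +-monoʳ-< (4 * (N * N)) (*-monoˡ-< N {{ℕ.>-nonZero (≤-trans (s≤s z≤n) 5<N)}} 5<N) ⟩
      4 * (N * N) + N * N ≡⟨ e (N * N) ⟩
      5 * (N * N) ≤⟨ hypothesis′ ⟩
      K * T + 5 * N ∎)
      where
      open ≤-Reasoning
      e : ∀ x → 4 * x + x ≡ 5 * x
      e = ringℕ

  q≤q^ : ∀ m → q ≤ q ^ suc m
  q≤q^ m = ≤-trans (≤-reflexive (sym (*-identityʳ q))) (*-monoʳ-≤ q (ℕ.>-nonZero⁻¹ (q ^ m) {{m^n≢0 q m {{ℕ.>-nonZero q>0}}}}))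

  Conclusion : ∀ {m} d → (Pt m → 𝔽) → ℕ → Set
  Conclusion {m} d f K = Σ (Pt m → 𝔽) λ Q → IsPoly m d Q × 2 * q ^ m ≤ K * K * agreeing f Q

  -- For `d = 0` the condition relating `d` to `q` is empty, so small fields have to be handled. If
  -- `2 q ≤ K²`, the most frequent value of `f` has enough agreement. Otherwise `K ≥ 5` forces
  -- `2 K < q`, and the constant read off at one core point agrees along all its good lines.
  degree-zero : ∀ {m} → 0 < m → (f : Pt m → 𝔽) (O : Oracle m 0) (K : ℕ) → 5 ≤ K →
    5 * (q ^ m * nonzero-vectors m) ≤ K * Test.passes f O → Conclusion 0 f K
  degree-zero {m@(suc m′)} 0<m f O K 5≤K hyp with 2 * q ℕ.≤? K * K
  ... | yes small = popular (∑-≤⇒∃ elements {λ _ → N} {λ c → q * agreeing f (λ _ → c)} q>0 averaged)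
    where
    N = q ^ m
    averaged : ∑ᶠ (λ _ → N) ≤ ∑ᶠ (λ c → q * agreeing f (λ _ → c))
    averaged = ≤-reflexive (trans (∑-const elements N) (sym (trans (∑-*ˡ elements q _) (cong (q *_)
      (trans (∑-swap elements (points m) _) (trans (∑-cong (points m) (λ y → trans (∑-cong elements (λ c → I-cong (f y ≟ᶠ c) (c ≟ᶠ f y) sym sym)) (Finite.∑-δ₁ finite𝔽 (f y)))) (∑ᵖ-one m)))))))
    popular : (∃ λ c → _ × N ≤ q * agreeing f (λ _ → c)) → Conclusion 0 f K
    popular (c , _ , le) = (λ _ → c) , poly-const c , ≤-trans (*-monoʳ-≤ 2 le) (≤-trans (≤-reflexive (sym (*-assoc 2 q _))) (*-monoˡ-≤ (agreeing f (λ _ → c)) small))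
  ... | no large = from-core (line-core K (enough f O K hyp (<-≤-trans (≤-<-trans (≤-trans 5≤K (m≤m+n K (K + 0))) 2K<q) (q≤q^ m′))))
    where
    open Test f O
    2K<q : 2 * K < q
    2K<q = *-cancelˡ-< 2 _ _ (≤-<-trans (≤-trans (≤-reflexive (e K)) (≤-trans (*-monoˡ-≤ K {4} {5} (m≤m+n 4 1)) (*-monoˡ-≤ K 5≤K))) (≰⇒> large))
      where
      e : ∀ K → 2 * (2 * K) ≡ 4 * K
      e = ringℕ
    from-core : LineCore K → Conclusion 0 f K
    from-core C = Q , poly-const (f z) , ≤-trans (*-monoˡ-≤ (q ^ m) {2} {3} (m≤m+n 2 1)) (agreement f Q K z (U? z) (<⇒≤ 2K<q) (many-U z (proj₂ point))
        (λ u Uu → ≤-trans (many-t z u Uu) (*-monoʳ-≤ K (∑-mono elements (λ t → I-mono ((X (line z u t) Bool.≟ true) ×-dec (f (line z u t) ≟ᶠ val z u t)) (f (line z u t) ≟ᶠ f z)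
          (λ (_ , e) → trans e (trans (constant (P z u) t) (sym (proj₂ (U-agree z u Uu))))))))))
      where
      open LineCore C
      z = proj₁ point
      Q : Pt m → 𝔽
      Q _ = f z
      constant : (cs : Vec 𝔽 1) (t : 𝔽) → evalU F cs t ≡ evalU F cs 0ᶠ
      constant (c ∷ []) t = cong (c +ᶠ_) (trans (*ᶠ-zeroʳ t) (sym (*ᶠ-zeroʳ 0ᶠ)))

  -- A line is the whole space here. The polynomial of one good line, reparametrised by
  -- `(y - a) / b`, has agreement at least 2/K.
  dimension-one : ∀ {d} (f : Pt 1 → 𝔽) (O : Oracle 1 d) (K : ℕ) → 0 < K → 5 < q →
    5 * (q ^ 1 * nonzero-vectors 1) ≤ K * Test.passes f O → Conclusion d f K
  dimension-one {d} f O K 0<K 5<q hyp = from-core (line-core K (enough f O K hyp (≤-trans 5<q (q≤q^ 0))))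
    where
    open Test f O
    from-core : LineCore K → Conclusion d f K
    from-core C = on-line (∑-pos⇒∃ (points 1) some-direction)
      where
      open LineCore C
      z = proj₁ point
      some-direction : 0 < ∑ᵖ 1 (λ u → I (U? z u))
      some-direction = n≢0⇒n>0 λ e → <⇒≱ (*-mono-≤ {1} {2} (s≤s z≤n) (≤-trans q>0 (q≤q^ 0)))
        (≤-trans (many-U z (proj₂ point)) (≤-reflexive (trans (cong (K *_) e) (*-zeroʳ K))))
      on-line : (∃ λ u → _ × 0 < I (U? z u)) → Conclusion d f K
      on-line (u , _ , pos) = along z u (I-pos (U? z u) pos)
        where
        along : ∀ z u → U z u → Conclusion d f K
        along z@(a ∷ []) u@(b ∷ []) Uu = Q , poly-evalU (P z u) parameter-poly , (begin
          2 * q ^ 1 ≡⟨ cong (2 *_) (*-identityʳ q) ⟩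
          2 * q ≤⟨ many-t z u Uu ⟩
          K * ∑ᶠ (λ t → I ((X (line z u t) Bool.≟ true) ×-dec (f (line z u t) ≟ᶠ val z u t)))
            ≤⟨ *-monoʳ-≤ K (≤-trans (∑-mono elements (λ t → I-mono ((X (line z u t) Bool.≟ true) ×-dec (f (line z u t) ≟ᶠ val z u t)) (f (line z u t) ≟ᶠ Q (line z u t))
                 (λ (_ , e) → trans e (cong (val z u) (sym (parameter-line t))))))
                 (∑-injection≤ finite𝔽 (finitePt 1) (line z u) (line-injective z u u≢0) (λ y → I (f y ≟ᶠ Q y)))) ⟩
          K * agreeing f Q ≤⟨ *-monoˡ-≤ (agreeing f Q) (≤-trans (≤-reflexive (sym (*-identityʳ K))) (*-monoʳ-≤ K 0<K)) ⟩
          K * K * agreeing f Q ∎)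
          where
          open ≤-Reasoning
          u≢0 = proj₁ (U-agree z u Uu)
          b≢0 : ¬ (b ≡ 0ᶠ)
          b≢0 e = u≢0 (cong (_∷ []) e)
          parameter : Pt 1 → 𝔽
          parameter y = (b ⁻¹ᶠ) *ᶠ (lookup y zero +ᶠ (-ᶠ a))
          parameter-poly : IsPoly 1 1 parameter
          parameter-poly = poly-scale (b ⁻¹ᶠ) (poly-- (poly-var zero) (poly-const a))
          parameter-line : ∀ t → parameter (line z u t) ≡ t
          parameter-line t = trans (cancel (b ⁻¹ᶠ) a t b) (*-cancel-inverse′ t b≢0)
            where
            cancel : ∀ i a t b → i *ᶠ (a +ᶠ t *ᶠ b +ᶠ (-ᶠ a)) ≡ t *ᶠ b *ᶠ i
            cancel = solve 4 (λ i a t b → i :* (a :+ t :* b :+ (:- a)) := t :* b :* i) refl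
          Q : Pt 1 → 𝔽
          Q y = val z u (parameter y)

  module _ {m d : ℕ} (f : Pt m → 𝔽) (O : Oracle m d) where
    passes≤pairs : Test.passes f O ≤ q ^ m * nonzero-vectors m
    passes≤pairs = ∑ᵖ-≤const m (λ x → ∑-mono (points m) (λ u → I-mono (Test.agree? f O x u) (¬? (u ≟ᵖ 0ᵥ)) proj₁))

  pairs>0 : ∀ m → 0 < q ^ suc m * nonzero-vectors (suc m)
  pairs>0 m = *-mono-≤ (≤-trans q>0 (q≤q^ m)) (ℕ.s≤s⁻¹ (≤-trans (≤-trans q>1 (q≤q^ m)) (≤-reflexive (sym (nonzero-count (suc m))))))

  -- The number of passes cannot exceed the number of pairs.
  5≤K-of : ∀ {m d} (f : Pt (suc m) → 𝔽) (O : Oracle (suc m) d) K → 5 * (q ^ suc m * nonzero-vectors (suc m)) ≤ K * Test.passes f O → 5 ≤ K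
  5≤K-of {m} f O K hyp = *-cancelʳ-≤ 5 K (q ^ suc m * nonzero-vectors (suc m)) {{ℕ.>-nonZero (pairs>0 m)}} (≤-trans hyp (*-monoʳ-≤ K (passes≤pairs f O)))

  low-degree-test : ∀ {m d} → 0 < m → (f : Pt m → 𝔽) (O : Oracle m d) (K : ℕ) →
    K * K * K * (K * K * K) * (K * K * K * (K * K * K)) * d * 2 ^ 30 ≤ q →
    5 * (q ^ m * nonzero-vectors m) ≤ K * Test.passes f O → Conclusion d f K
  low-degree-test {suc m} {zero} 0<m f O K big hyp = degree-zero 0<m f O K (5≤K-of f O K hyp) hyp
  low-degree-test {suc m} {d@(suc _)} 0<m f O K big hyp = cases m f O hyp
    where
    5≤K : 5 ≤ K
    5≤K = 5≤K-of f O K hyp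
    0<K : 0 < K
    0<K = ≤-trans (s≤s z≤n) 5≤K
    10≤q : 10 ≤ q
    10≤q = ≤-trans (*-mono-≤ {1} {_} {10} {2 ^ 30} (*-mono-≤ (*-mono-≤ (*-mono-≤ c c) (*-mono-≤ c c)) (s≤s z≤n)) (≤ᵇ⇒≤ 10 (2 ^ 30) _)) big
      where
      c : 1 ≤ K * K * K
      c = *-mono-≤ (*-mono-≤ 0<K 0<K) 0<K
    cases : ∀ m (f : Pt (suc m) → 𝔽) (O : Oracle (suc m) d) → 5 * (q ^ suc m * nonzero-vectors (suc m)) ≤ K * Test.passes f O → Conclusion d f K
    cases zero f O hyp = dimension-one f O K 0<K (≤-trans (m≤m+n 6 4) 10≤q) hyp
    cases (suc m) f O hyp = finish (all-dimensions d K (s≤s z≤n) 0<K big m f O (begin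
        5 * (A * (N * N)) ≡⟨ e₁ A (N * N) ⟩
        A * (5 * (N * N)) ≤⟨ *-monoʳ-≤ A (hypothesis′ f O K hyp) ⟩
        A * (K * T + 5 * N) ≡⟨ e₂ A K T N ⟩
        K * (A * T) + 5 * A * N ≤⟨ +-monoʳ-≤ (K * (A * T)) (*-monoˡ-≤ N 5A≤N) ⟩
        K * (A * T) + N * N ∎))
      where
      open ≤-Reasoning
      n = suc (suc m)
      A = 2 ^ n
      N = q ^ n
      T = Test.passes f O
      e₁ : ∀ A x → 5 * (A * x) ≡ A * (5 * x)
      e₁ = ringℕ
      e₂ : ∀ A K T N → A * (K * T + 5 * N) ≡ K * (A * T) + 5 * A * N
      e₂ = ringℕ
      -- The `5 N` lost to the zero direction fits into the allowance `N² / A` of the claim.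
      5A≤N : 5 * A ≤ N
      5A≤N = ≤-trans (≤-reflexive (e₃ (2 ^ suc m))) (*-mono-≤ 10≤q (^-monoˡ-≤ (suc m) q>1))
        where
        e₃ : ∀ x → 5 * (2 * x) ≡ 10 * x
        e₃ = ringℕ
      finish : (Σ (Pt n → 𝔽) λ Q → IsPoly n d Q × (2 * A + 1) * N ≤ A * (K * K) * agreeing f Q) → Conclusion d f K
      finish (Q , p , le) = Q , p , *-cancelˡ-≤ A {{m^n≢0 2 n}} (begin
        A * (2 * N) ≡⟨ e₃ A N ⟩
        2 * A * N ≤⟨ *-monoˡ-≤ N (m≤m+n (2 * A) 1) ⟩
        (2 * A + 1) * N ≤⟨ le ⟩
        A * (K * K) * agreeing f Q ≡⟨ *-assoc A (K * K) _ ⟩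
        A * (K * K * agreeing f Q) ∎)
        where
        e₃ : ∀ A N → A * (2 * N) ≡ 2 * A * N
        e₃ = ringℕ

  to-oracle : ∀ {m d} → LinesOracle F m d → Oracle m d
  to-oracle O = record { P = P ; invariant = λ b u s t u≢0 →
      well-defined (line b u s) u b u u≢0 u≢0
        ((λ t → s +ᶠ t , line-line b u s t) , (λ t → t +ᶠ (-ᶠ s) , sym (trans (line-line b u s (t +ᶠ (-ᶠ s))) (cong (line b u) (back s t)))))
        t (s +ᶠ t) (line-line b u s t) }
    where
    open LinesOracle O
    back : ∀ s t → s +ᶠ (t +ᶠ (-ᶠ s)) ≡ t
    back = solve 2 (λ s t → s :+ (t :+ (:- s)) := t) refl

  passing-pairs : ∀ {m d} (f : Pt m → 𝔽) (O : LinesOracle F m d) →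
    count (λ p → FiniteField._≟_ F (f (proj₁ p)) (evalU F (LinesOracle.P O (proj₁ p) (proj₂ p)) 0ᶠ)) (pairs F m) ≡ Test.passes f (to-oracle O)
  passing-pairs {m} f O = trans (length-filter≡∑ _ (pairs F m)) (trans (∑-cartesianProduct (points m) _ _)
    (∑-cong (points m) (λ x → trans (∑-filter (λ u → ¬? (u ≟ᵖ 0ᵥ)) (points m) _)
      (∑-cong (points m) (λ u → sym (I-× (¬? (u ≟ᵖ 0ᵥ)) (f x ≟ᶠ evalU F (LinesOracle.P O x u) 0ᶠ)))))))

  length-pairs : ∀ m → length (pairs F m) ≡ q ^ m * nonzero-vectors m
  length-pairs m = trans (sym (trans (∑-const (pairs F m) 1) (*-identityʳ _))) (trans (∑-cartesianProduct (points m) _ _)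
    (trans (∑-cong (points m) (λ x → trans (∑-filter (λ u → ¬? (u ≟ᵖ 0ᵥ)) (points m) (λ _ → 1)) (∑-cong (points m) (λ u → *-identityʳ _)))) (∑ᵖ-const m _)))

-- From rational ε to integer parameters.

open FiniteSums
open FieldAlgebra
open Main
open Dimension
open Core

open import Data.Nat using (_≤_)
import Data.Nat.Properties as ℕ
open import Data.Nat.DivMod using (m/n*n≤m; m%n<n; m≡m%n+[m/n]*n)
open import Data.Integer as ℤ using (+_)
import Data.Integer.Properties as ℤ
open import Data.Rational using (ℚ; mkℚ; _<_; _*_; 0ℚ; 1ℚ; toℚᵘ)
import Data.Rational as ℚ
import Data.Rational.Properties as ℚ
open import Data.Rational.Unnormalised as ℚᵘ using (mkℚᵘ; *≤*; *<*; *≡*)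
import Data.Rational.Unnormalised.Properties as ℚᵘ

private
  frac-toℚᵘ : ∀ a b → toℚᵘ (frac a (suc b)) ℚᵘ.≃ mkℚᵘ (+ a) b
  frac-toℚᵘ a b = ℚ.toℚᵘ-fromℚᵘ (mkℚᵘ (+ a) b)

frac-≤⁻ : ∀ a b c d → frac a (suc b) ℚ.≤ frac c (suc d) → a ℕ.* suc d ℕ.≤ c ℕ.* suc b
frac-≤⁻ a b c d le with ℚᵘ.≤-respˡ-≃ (frac-toℚᵘ a b) (ℚᵘ.≤-respʳ-≃ (frac-toℚᵘ c d) (ℚ.toℚᵘ-mono-≤ le))
... | *≤* p = ℤ.drop‿+≤+ (subst₂ ℤ._≤_ (sym (ℤ.pos-* a (suc d))) (sym (ℤ.pos-* c (suc b))) p)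

frac-<⁻ : ∀ a b c d → frac a (suc b) < frac c (suc d) → a ℕ.* suc d ℕ.< c ℕ.* suc b
frac-<⁻ a b c d lt with ℚᵘ.<-respˡ-≃ (frac-toℚᵘ a b) (ℚᵘ.<-respʳ-≃ (frac-toℚᵘ c d) (ℚ.toℚᵘ-mono-< lt))
... | *<* p = ℤ.drop‿+<+ (subst₂ ℤ._<_ (sym (ℤ.pos-* a (suc d))) (sym (ℤ.pos-* c (suc b))) p)

frac-≤⁺ : ∀ a b c d → a ℕ.* suc d ℕ.≤ c ℕ.* suc b → frac a (suc b) ℚ.≤ frac c (suc d)
frac-≤⁺ a b c d le = ℚ.toℚᵘ-cancel-≤ (ℚᵘ.≤-respˡ-≃ (ℚᵘ.≃-sym (frac-toℚᵘ a b)) (ℚᵘ.≤-respʳ-≃ (ℚᵘ.≃-sym (frac-toℚᵘ c d))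
  (*≤* (subst₂ ℤ._≤_ (ℤ.pos-* a (suc d)) (ℤ.pos-* c (suc b)) (ℤ.+≤+ le)))))

frac-* : ∀ a b c d → frac a (suc b) * frac c (suc d) ≡ frac (a ℕ.* c) (suc b ℕ.* suc d)
frac-* a b c d = ℚ.toℚᵘ-injective (ℚᵘ.≃-trans (ℚ.toℚᵘ-homo-* (frac a (suc b)) (frac c (suc d)))
  (ℚᵘ.≃-trans (ℚᵘ.*-cong (frac-toℚᵘ a b) (frac-toℚᵘ c d))
    (ℚᵘ.≃-trans (*≡* (cong (ℤ._* + (suc b ℕ.* suc d)) (sym (ℤ.pos-* a c)))) (ℚᵘ.≃-sym (frac-toℚᵘ (a ℕ.* c) (d ℕ.+ b ℕ.* suc d))))))

frac-*′ : ∀ a b c d .{{_ : NonZero b}} .{{_ : NonZero d}} → frac a b * frac c d ≡ frac (a ℕ.* c) (b ℕ.* d)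
frac-*′ a (suc b) c (suc d) = frac-* a b c d

frac-^ : ∀ a b n .{{_ : NonZero b}} → frac a b ^ℚ n ≡ frac (a ℕ.^ n) (b ℕ.^ n)
frac-^ a b zero = refl
frac-^ a b (suc n) = trans (cong (frac a b *_) (frac-^ a b n)) (frac-*′ a b (a ℕ.^ n) (b ℕ.^ n) {{it}} {{ℕ.m^n≢0 b n}})
  where
  it : ∀ {A : Set} → {{A}} → A
  it {{x}} = x

frac-≤⁻′ : ∀ a b c d .{{_ : NonZero b}} .{{_ : NonZero d}} → frac a b ℚ.≤ frac c d → a ℕ.* d ℕ.≤ c ℕ.* b
frac-≤⁻′ a (suc b) c (suc d) = frac-≤⁻ a b c d

frac-<⁻′ : ∀ a b c d .{{_ : NonZero b}} .{{_ : NonZero d}} → frac a b < frac c d → a ℕ.* d ℕ.< c ℕ.* b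
frac-<⁻′ a (suc b) c (suc d) = frac-<⁻ a b c d

frac-≤⁺′ : ∀ a b c d .{{_ : NonZero b}} .{{_ : NonZero d}} → a ℕ.* d ℕ.≤ c ℕ.* b → frac a b ℚ.≤ frac c d
frac-≤⁺′ a (suc b) c (suc d) = frac-≤⁺ a b c d

as-frac : ∀ (x : ℚ) → 0ℚ < x → ∃ λ a → ∃ λ b → NonZero a × x ≡ frac a (suc b)
as-frac x@(mkℚ (+ suc a) b c) _ = suc a , b , _ , sym (ℚ.↥p/↧p≡p x)
as-frac x@(mkℚ (+ zero) b c) (ℚ.*<* lt) with ℤ.+<+ () ← lt
as-frac x@(mkℚ (ℤ.-[1+_] a) b c) (ℚ.*<* ())

private
  pow-* : ∀ x y n → (x ℕ.* y) ℕ.^ n ≡ x ℕ.^ n ℕ.* y ℕ.^ n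
  pow-* x y zero = refl
  pow-* x y (suc n) = trans (cong (x ℕ.* y ℕ.*_) (pow-* x y n)) (e x y (x ℕ.^ n) (y ℕ.^ n))
    where
    e : ∀ x y u v → x ℕ.* y ℕ.* (u ℕ.* v) ≡ x ℕ.* u ℕ.* (y ℕ.* v)
    e = ringℕ

  twelfth-power : ∀ K → K ℕ.* K ℕ.* K ℕ.* (K ℕ.* K ℕ.* K) ℕ.* (K ℕ.* K ℕ.* K ℕ.* (K ℕ.* K ℕ.* K)) ≡ K ℕ.^ 12
  twelfth-power K = e K
    where
    e : ∀ K → K ℕ.* K ℕ.* K ℕ.* (K ℕ.* K ℕ.* K) ℕ.* (K ℕ.* K ℕ.* K ℕ.* (K ℕ.* K ℕ.* K)) ≡
      K ℕ.* (K ℕ.* (K ℕ.* (K ℕ.* (K ℕ.* (K ℕ.* (K ℕ.* (K ℕ.* (K ℕ.* (K ℕ.* (K ℕ.* (K ℕ.* 1)))))))))))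
    e = ringℕ

-- For ε = a/b the integer `K = ⌊b / a⌋ + 1` satisfies 1 ≤ K ε ≤ 1 + ε.
ceiling : ∀ a b .{{_ : NonZero a}} → ∃ λ K → 0 ℕ.< K × b ℕ.≤ K ℕ.* a × K ℕ.* a ℕ.≤ a ℕ.+ b
ceiling a b = suc (b ℕ./ a) , s≤s z≤n ,
  ℕ.≤-trans (ℕ.≤-reflexive (m≡m%n+[m/n]*n b a)) (ℕ.+-monoˡ-≤ (b ℕ./ a ℕ.* a) (ℕ.<⇒≤ (m%n<n b a))) ,
  ℕ.+-monoʳ-≤ a (m/n*n≤m b a)

-- Since K ≤ 2/ε ≤ 2/ε₀, the hypothesis 4^n d/q ≤ ε₀^n gives K^n d 2^n ≤ q: one factor 2^n of 4^n is
-- spent on the bound for `K`, the other one is kept.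
field-large : ∀ n q d a b a₀ b₀ K .{{_ : NonZero a}} .{{_ : NonZero b₀}} → 0 ℕ.< K → K ℕ.* a ℕ.≤ 2 ℕ.* b → a₀ ℕ.* b ℕ.≤ a ℕ.* b₀ →
  4 ℕ.^ n ℕ.* d ℕ.* b₀ ℕ.^ n ℕ.≤ a₀ ℕ.^ n ℕ.* (1 ℕ.^ n ℕ.* q) → K ℕ.^ n ℕ.* d ℕ.* 2 ℕ.^ n ℕ.≤ q
field-large n q d a b a₀ b₀ K 0<K Ka≤2b order gap = ℕ.*-cancelˡ-≤ (a ℕ.^ n ℕ.* b₀ ℕ.^ n) {{ℕ.m*n≢0 (a ℕ.^ n) (b₀ ℕ.^ n) {{ℕ.m^n≢0 a n}} {{ℕ.m^n≢0 b₀ n}}}} (begin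
  a ℕ.^ n ℕ.* b₀ ℕ.^ n ℕ.* (K ℕ.^ n ℕ.* d ℕ.* 2 ℕ.^ n) ≡⟨ e₁ (a ℕ.^ n) (b₀ ℕ.^ n) (K ℕ.^ n) d (2 ℕ.^ n) ⟩
  K ℕ.^ n ℕ.* a ℕ.^ n ℕ.* (b₀ ℕ.^ n ℕ.* d ℕ.* 2 ℕ.^ n) ≤⟨ ℕ.*-monoˡ-≤ (b₀ ℕ.^ n ℕ.* d ℕ.* 2 ℕ.^ n) scaled ⟩
  2 ℕ.^ n ℕ.* b ℕ.^ n ℕ.* (b₀ ℕ.^ n ℕ.* d ℕ.* 2 ℕ.^ n) ≡⟨ e₂ (2 ℕ.^ n) (b ℕ.^ n) (b₀ ℕ.^ n) d ⟩
  2 ℕ.^ n ℕ.* 2 ℕ.^ n ℕ.* d ℕ.* b₀ ℕ.^ n ℕ.* b ℕ.^ n ≡⟨ cong (λ z → z ℕ.* d ℕ.* b₀ ℕ.^ n ℕ.* b ℕ.^ n) (sym (pow-* 2 2 n)) ⟩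
  4 ℕ.^ n ℕ.* d ℕ.* b₀ ℕ.^ n ℕ.* b ℕ.^ n ≤⟨ ℕ.*-monoˡ-≤ (b ℕ.^ n) gap ⟩
  a₀ ℕ.^ n ℕ.* (1 ℕ.^ n ℕ.* q) ℕ.* b ℕ.^ n ≡⟨ cong (λ z → a₀ ℕ.^ n ℕ.* (z ℕ.* q) ℕ.* b ℕ.^ n) (ℕ.^-zeroˡ n) ⟩
  a₀ ℕ.^ n ℕ.* (1 ℕ.* q) ℕ.* b ℕ.^ n ≡⟨ e₃ (a₀ ℕ.^ n) q (b ℕ.^ n) ⟩
  a₀ ℕ.^ n ℕ.* b ℕ.^ n ℕ.* q ≤⟨ ℕ.*-monoˡ-≤ q (subst₂ ℕ._≤_ (pow-* a₀ b n) (pow-* a b₀ n) (ℕ.^-monoˡ-≤ n order)) ⟩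
  a ℕ.^ n ℕ.* b₀ ℕ.^ n ℕ.* q ∎)
  where
  open ℕ.≤-Reasoning
  scaled : K ℕ.^ n ℕ.* a ℕ.^ n ℕ.≤ 2 ℕ.^ n ℕ.* b ℕ.^ n
  scaled = subst₂ ℕ._≤_ (pow-* K a n) (pow-* 2 b n) (ℕ.^-monoˡ-≤ n Ka≤2b)
  e₁ : ∀ x y k d t → x ℕ.* y ℕ.* (k ℕ.* d ℕ.* t) ≡ k ℕ.* x ℕ.* (y ℕ.* d ℕ.* t)
  e₁ = ringℕ
  e₂ : ∀ t b y d → t ℕ.* b ℕ.* (y ℕ.* d ℕ.* t) ≡ t ℕ.* t ℕ.* d ℕ.* y ℕ.* b
  e₂ = ringℕ
  e₃ : ∀ x q b → x ℕ.* (1 ℕ.* q) ℕ.* b ≡ x ℕ.* b ℕ.* q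
  e₃ = ringℕ

-- Translates to the requirement of the induction, whose factors `K ^ 12` and `2 ^ 30` are bounded
-- by `K ^ n` and `2 ^ n`.
field-large′ : ∀ n q d K → 30 ℕ.≤ n → 0 ℕ.< K → K ℕ.^ n ℕ.* d ℕ.* 2 ℕ.^ n ℕ.≤ q →
  K ℕ.* K ℕ.* K ℕ.* (K ℕ.* K ℕ.* K) ℕ.* (K ℕ.* K ℕ.* K ℕ.* (K ℕ.* K ℕ.* K)) ℕ.* d ℕ.* 2 ℕ.^ 30 ℕ.≤ q
field-large′ n q d K 30≤n 0<K le = ℕ.≤-trans (ℕ.*-mono-≤ (ℕ.*-monoˡ-≤ d (ℕ.≤-trans (ℕ.≤-reflexive (twelfth-power K))
  (ℕ.^-monoʳ-≤ K {{ℕ.>-nonZero 0<K}} (ℕ.≤-trans (ℕ.m≤m+n 12 18) 30≤n)))) (ℕ.^-monoʳ-≤ 2 30≤n)) le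

-- From 5 ε ≤ 1 follows K ε ≤ 1 + ε ≤ 6/5, hence 2/K² ≥ (50/36) ε². The factor 2 in the integer
-- conclusion pays for rounding 1/ε up.
agreement-large : ∀ a b K N M → 5 ℕ.* a ℕ.≤ b → K ℕ.* a ℕ.≤ a ℕ.+ b → 2 ℕ.* N ℕ.≤ K ℕ.* K ℕ.* M → a ℕ.* a ℕ.* N ℕ.≤ M ℕ.* (b ℕ.* b)
agreement-large a b K N M 5a≤b Ka≤a+b le = ℕ.*-cancelˡ-≤ 50 (begin
  50 ℕ.* (a ℕ.* a ℕ.* N) ≡⟨ e₁ a N ⟩
  25 ℕ.* (a ℕ.* a) ℕ.* (2 ℕ.* N) ≤⟨ ℕ.*-monoʳ-≤ (25 ℕ.* (a ℕ.* a)) le ⟩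
  25 ℕ.* (a ℕ.* a) ℕ.* (K ℕ.* K ℕ.* M) ≡⟨ e₂ a K M ⟩
  5 ℕ.* (K ℕ.* a) ℕ.* (5 ℕ.* (K ℕ.* a)) ℕ.* M ≤⟨ ℕ.*-monoˡ-≤ M (ℕ.*-mono-≤ 5Ka≤6b 5Ka≤6b) ⟩
  6 ℕ.* b ℕ.* (6 ℕ.* b) ℕ.* M ≤⟨ ℕ.≤-trans (ℕ.m≤m+n _ (14 ℕ.* (b ℕ.* b ℕ.* M))) (ℕ.≤-reflexive (e₃ b M)) ⟩
  50 ℕ.* (M ℕ.* (b ℕ.* b)) ∎)
  where
  open ℕ.≤-Reasoning
  e₁ : ∀ a N → 50 ℕ.* (a ℕ.* a ℕ.* N) ≡ 25 ℕ.* (a ℕ.* a) ℕ.* (2 ℕ.* N)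
  e₁ = ringℕ
  e₂ : ∀ a K M → 25 ℕ.* (a ℕ.* a) ℕ.* (K ℕ.* K ℕ.* M) ≡ 5 ℕ.* (K ℕ.* a) ℕ.* (5 ℕ.* (K ℕ.* a)) ℕ.* M
  e₂ = ringℕ
  e₃ : ∀ b M → 6 ℕ.* b ℕ.* (6 ℕ.* b) ℕ.* M ℕ.+ 14 ℕ.* (b ℕ.* b ℕ.* M) ≡ 50 ℕ.* (M ℕ.* (b ℕ.* b))
  e₃ = ringℕ
  5Ka≤6b : 5 ℕ.* (K ℕ.* a) ℕ.≤ 6 ℕ.* b
  5Ka≤6b = ℕ.≤-trans (ℕ.*-monoʳ-≤ 5 Ka≤a+b) (ℕ.≤-trans (ℕ.≤-reflexive (ℕ.*-distribˡ-+ 5 a b)) (ℕ.+-monoˡ-≤ (5 ℕ.* b) 5a≤b))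

module _ (F : FiniteField) (m d n : ℕ) (30≤n : 30 ℕ.≤ n) (0<m : 0 ℕ.< m) where
  private
    L = length (pairs F m)

    instance
      q≢0 : NonZero (FiniteField.size F)
      q≢0 = ℕ.>-nonZero (q>0 F)
      points≢0 : NonZero (length (allPoints F m))
      points≢0 = subst NonZero (sym (length-points F m)) (ℕ.m^n≢0 (FiniteField.size F) m)
      L≢0 : NonZero L
      L≢0 = subst NonZero (sym (length-pairs F m)) (pairs≢0 m 0<m)
        where
        pairs≢0 : ∀ m → 0 ℕ.< m → NonZero (FiniteField.size F ℕ.^ m ℕ.* nonzero-vectors F m)
        pairs≢0 (suc m) _ = ℕ.>-nonZero (pairs>0 F m)

  conclude : ∀ (a₀ b₀ a b : ℕ) .{{_ : NonZero a}} .{{_ : NonZero b₀}} .{{_ : NonZero b}} →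
    (frac 4 1 ^ℚ n) * frac d (FiniteField.size F) < frac a₀ b₀ ^ℚ n → frac a₀ b₀ ℚ.≤ frac a b →
    (f : Point F m → FiniteField.Carrier F) (O : LinesOracle F m d) → frac 5 1 * frac a b ℚ.≤ linesAgreement F f O →
    Σ (MPoly F m d) λ Q → (frac a b * frac a b) ℚ.≤ polyAgreement F f Q
  conclude a₀ b₀ a b gap order f O passing = from-ceiling (ceiling a b)
    where
    T = Test.passes F f (to-oracle F O)
    5aL≤Tb : 5 ℕ.* a ℕ.* L ℕ.≤ T ℕ.* (1 ℕ.* b)
    5aL≤Tb = frac-≤⁻′ (5 ℕ.* a) (1 ℕ.* b) T L {{ℕ.m*n≢0 1 b}} (subst₂ ℚ._≤_ (frac-*′ 5 1 a b) (cong (λ t → frac t L) (passing-pairs F f O)) passing)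
    T≤L : T ℕ.≤ L
    T≤L = subst (T ℕ.≤_) (sym (length-pairs F m)) (passes≤pairs F f (to-oracle F O))
    -- The acceptance probability is at most 1, so ε ≤ 1/5; this controls the rounding in `K`.
    5a≤b : 5 ℕ.* a ℕ.≤ b
    5a≤b = ℕ.*-cancelʳ-≤ (5 ℕ.* a) b L (ℕ.≤-trans 5aL≤Tb (ℕ.≤-trans (ℕ.*-monoˡ-≤ (1 ℕ.* b) T≤L) (ℕ.≤-reflexive (e L b))))
      where
      e : ∀ L b → L ℕ.* (1 ℕ.* b) ≡ b ℕ.* L
      e = ringℕ
    gapℕ : 4 ℕ.^ n ℕ.* d ℕ.* b₀ ℕ.^ n ℕ.≤ a₀ ℕ.^ n ℕ.* (1 ℕ.^ n ℕ.* FiniteField.size F)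
    gapℕ = ℕ.<⇒≤ (frac-<⁻′ (4 ℕ.^ n ℕ.* d) (1 ℕ.^ n ℕ.* FiniteField.size F) (a₀ ℕ.^ n) (b₀ ℕ.^ n) {{ℕ.m*n≢0 (1 ℕ.^ n) _ {{ℕ.m^n≢0 1 n}}}} {{ℕ.m^n≢0 b₀ n}}
      (subst₂ _<_ (trans (cong (_* frac d (FiniteField.size F)) (frac-^ 4 1 n)) (frac-*′ (4 ℕ.^ n) (1 ℕ.^ n) d (FiniteField.size F) {{ℕ.m^n≢0 1 n}})) (frac-^ a₀ b₀ n) gap))
    from-ceiling : (∃ λ K → 0 ℕ.< K × b ℕ.≤ K ℕ.* a × K ℕ.* a ℕ.≤ a ℕ.+ b) → Σ (MPoly F m d) λ Q → (frac a b * frac a b) ℚ.≤ polyAgreement F f Q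
    from-ceiling (K , 0<K , b≤Ka , Ka≤a+b) = finish (low-degree-test F 0<m f (to-oracle F O) K
        (field-large′ n _ d K 30≤n 0<K (field-large n _ d a b a₀ b₀ K 0<K (ℕ.≤-trans Ka≤a+b a+b≤2b) (frac-≤⁻′ a₀ b₀ a b order) gapℕ)) test)
      where
      open ℕ.≤-Reasoning
      a+b≤2b : a ℕ.+ b ℕ.≤ 2 ℕ.* b
      a+b≤2b = ℕ.+-mono-≤ (ℕ.≤-trans (ℕ.m≤m+n a (4 ℕ.* a)) 5a≤b) (ℕ.≤-reflexive (sym (ℕ.+-identityʳ b)))
      test : 5 ℕ.* (FiniteField.size F ℕ.^ m ℕ.* nonzero-vectors F m) ℕ.≤ K ℕ.* T
      test = ℕ.*-cancelˡ-≤ a (begin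
        a ℕ.* (5 ℕ.* (FiniteField.size F ℕ.^ m ℕ.* nonzero-vectors F m)) ≡⟨ cong (λ z → a ℕ.* (5 ℕ.* z)) (sym (length-pairs F m)) ⟩
        a ℕ.* (5 ℕ.* L) ≡⟨ e₁ a L ⟩
        5 ℕ.* a ℕ.* L ≤⟨ 5aL≤Tb ⟩
        T ℕ.* (1 ℕ.* b) ≤⟨ ℕ.*-monoʳ-≤ T (ℕ.≤-trans (ℕ.≤-reflexive (ℕ.*-identityˡ b)) b≤Ka) ⟩
        T ℕ.* (K ℕ.* a) ≡⟨ e₂ T K a ⟩
        a ℕ.* (K ℕ.* T) ∎)
        where
        e₁ : ∀ a L → a ℕ.* (5 ℕ.* L) ≡ 5 ℕ.* a ℕ.* L
        e₁ = ringℕ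
        e₂ : ∀ T K a → T ℕ.* (K ℕ.* a) ≡ a ℕ.* (K ℕ.* T)
        e₂ = ringℕ
      finish : Conclusion F d f K → Σ (MPoly F m d) λ Q → (frac a b * frac a b) ℚ.≤ polyAgreement F f Q
      finish (Q , (p , p≡Q) , le) = p , subst₂ ℚ._≤_ (sym (frac-*′ a b a b))
          (cong (λ z → frac z (length (allPoints F m))) (sym agreements))
          (frac-≤⁺′ (a ℕ.* a) (b ℕ.* b) (agreeing F f Q) (length (allPoints F m)) {{ℕ.m*n≢0 b b}}
            (subst (λ z → a ℕ.* a ℕ.* z ℕ.≤ agreeing F f Q ℕ.* (b ℕ.* b)) (sym (length-points F m)) (agreement-large a b K _ (agreeing F f Q) 5a≤b Ka≤a+b le)))
        where
        agreements : count (λ x → FiniteField._≟_ F (f x) (evalM F p x)) (allPoints F m) ≡ agreeing F f Q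
        agreements = trans (length-filter≡∑ _ (allPoints F m)) (∑-cong (allPoints F m) (λ x →
          I-cong (FiniteField._≟_ F (f x) (evalM F p x)) (FiniteField._≟_ F (f x) (Q x)) (λ e → trans e (p≡Q x)) (λ e → trans e (sym (p≡Q x)))))

  from-fractions : ∀ {ε₀ ε} → (∃ λ a → ∃ λ b → NonZero a × ε₀ ≡ frac a (suc b)) → (∃ λ a → ∃ λ b → NonZero a × ε ≡ frac a (suc b)) →
    (frac 4 1 ^ℚ n) * frac d (FiniteField.size F) < ε₀ ^ℚ n → ε₀ ℚ.≤ ε →
    (f : Point F m → FiniteField.Carrier F) (O : LinesOracle F m d) → frac 5 1 * ε ℚ.≤ linesAgreement F f O →
    Σ (MPoly F m d) λ Q → (ε * ε) ℚ.≤ polyAgreement F f Q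
  from-fractions (a₀ , b₀ , _ , refl) (a , b , a≢0 , refl) = conclude a₀ (suc b₀) a (suc b) {{a≢0}}

theorem5p6 :
  Σ ℚ λ c → (0ℚ < c) ×
    (∀ (ε₀ : ℚ) → 0ℚ < ε₀ → ε₀ < 1ℚ →
     ∀ (F : FiniteField) (m : ℕ) → 1 ≤ m → ∀ (d : ℕ) →
     -- ε₀ > c (d/q)^(1/48), equivalently ε₀^48 > c^48 · d/q
     (c ^ℚ 48) * frac d (FiniteField.size F) < ε₀ ^ℚ 48 →
     ∀ (ε : ℚ) → ε₀ Data.Rational.≤ ε →
     ∀ (f : Point F m → FiniteField.Carrier F) (O : LinesOracle F m d) →
     (frac 5 1 * ε) Data.Rational.≤ linesAgreement F f O →
     Σ (MPoly F m d) λ Q → (ε * ε) Data.Rational.≤ polyAgreement F f Q)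
-- The constant is 4 = 2 · 2: one factor 2 from K ≤ 2/ε, the other one raised to the power 48 to
-- supply `2 ^ 30`.
theorem5p6 = frac 4 1 , toWitness {a? = 0ℚ ℚ.<? frac 4 1} _ , go
  where
  go : ∀ (ε₀ : ℚ) → 0ℚ < ε₀ → ε₀ < 1ℚ → ∀ (F : FiniteField) (m : ℕ) → 1 ℕ.≤ m → ∀ (d : ℕ) →
    (frac 4 1 ^ℚ 48) * frac d (FiniteField.size F) < ε₀ ^ℚ 48 → ∀ (ε : ℚ) → ε₀ ℚ.≤ ε →
    ∀ (f : Point F m → FiniteField.Carrier F) (O : LinesOracle F m d) → (frac 5 1 * ε) ℚ.≤ linesAgreement F f O →
    Σ (MPoly F m d) λ Q → (ε * ε) ℚ.≤ polyAgreement F f Q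
  go ε₀ ε₀>0 _ F m 0<m d gap ε ε₀≤ε f O passing = from-fractions F m d 48 (ℕ.m≤m+n 30 18) 0<m
    (as-frac ε₀ ε₀>0) (as-frac ε (ℚ.<-≤-trans ε₀>0 ε₀≤ε)) gap ε₀≤ε f O passing
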